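{- Let $M(\mathit{odd})=\{(r^2+r)g(r^2): g\in\mathbb{Z}/2[t]\}\subset\mathbb{Z}/2[r]$ and let $K=\{f\in M(\mathit{odd}): U(f)=f\}$. Then $K=\{f\in\mathbb{Z}/2[r]: U_2f=0 \text{ and } U_3f=f\}$, i.e. $K$ consists of the mod $2$ modular forms of level $\Gamma_0(3)$ annihilated by $U_2$ and $U_3+I$. In particular, $T_p(K)\subseteq K$ for every prime $p>3$.
   Context: $\mathbb{Z}/2[[x]]$ is the formal power series ring over the field with two elements. Let $r=\sum_{n>0}(x^{n^2}+x^{2n^2}+x^{3n^2}+x^{6n^2})$, and $\mathbb{Z}/2[r]\subset\mathbb{Z}/2[[x]]$ the subring generated by $r$ (the space of mod $2$ modular forms of level $\Gamma_0(3)$; $r$ is transcendental over $\mathbb{Z}/2$). Let $F=r(r+1)^3$, $G=r^3(r+1)$. $\mathbb{Z}/2[r]$ is a free $\mathbb{Z}/2[G]$-module with basis $1,r,r^2,r^3$; let $U:\mathbb{Z}/2[r]\to\mathbb{Z}/2[r]$ be $U\big(\sum_{i=0}^3 g_i(G)r^i\big)=\sum_{i=0}^3 g_i(F)U(r^i)$ with $U(1)=1$, $U(r)=r$, $U(r^2)=r^2$, $U(r^3)=r^3+r^2+r$. Operators on $\mathbb{Z}/2[[x]]$: $U_2(\sum a_nx^n)=\sum a_{2n}x^n$, $U_3(\sum a_nx^n)=\sum a_{3n}x^n$, and for primes $p>3$, $T_p(\sum a_nx^n)=\sum a_{pn}x^n+\sum a_nx^{pn}$; these commute and map $\mathbb{Z}/2[r]$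 into itself. -}

module Defs where

open import Data.Bool using (Bool; true; false; _∧_; _xor_; if_then_else_)
open import Data.Nat using (ℕ; zero; suc; _*_; _∸_; _≡ᵇ_)
open import Data.List using (List; []; _∷_)
open import Data.Product using (Σ; _×_)
open import Relation.Binary.PropositionalEquality using (_≡_)

-- 𝔽₂ is Bool with _xor_ as addition and _∧_ as multiplication.

Series : Set
Series = ℕ → Bool

xsum : ℕ → (ℕ → Bool) → Bool
xsum zero    f = false
xsum (suc n) f = f n xor xsum n f

_*ₛ_ : Series → Series → Series
(a *ₛ b) n = xsum (suc n) (λ i → a i ∧ b (n ∸ i))

δ₀ : Series
δ₀ zero    = true
δ₀ (suc _) = false

-- r = Σ_{m>0} (x^{m²} + x^{2m²} + x^{3m²} + x^{6m²});
-- coefficient of x^n is the parity of the number of pairs (m ≥ 1, k ∈ {1,2,3,6})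
-- with k·m² = n  (only m ≤ n can contribute).
rS : Series
rS n = xsum n (λ j → let m = suc j in
         ((m * m ≡ᵇ n) xor (2 * m * m ≡ᵇ n)) xor ((3 * m * m ≡ᵇ n) xor (6 * m * m ≡ᵇ n)))

Poly : Set
Poly = List Bool

coeff : Poly → ℕ → Bool
coeff []      _       = false
coeff (a ∷ _) zero    = a
coeff (_ ∷ p) (suc n) = coeff p n

-- equality of polynomials (coefficientwise; trailing zeros irrelevant)
_≈ₚ_ : Poly → Poly → Set
p ≈ₚ q = ∀ n → coeff p n ≡ coeff q n

_+ₚ_ : Poly → Poly → Poly
[]      +ₚ q       = q
(a ∷ p) +ₚ []      = a ∷ p
(a ∷ p) +ₚ (b ∷ q) = (a xor b) ∷ (p +ₚ q)

_*ₚ_ : Poly → Poly → Poly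
[]      *ₚ q = []
(a ∷ p) *ₚ q = (if a then q else []) +ₚ (false ∷ (p *ₚ q))

_∘ₚ_ : Poly → Poly → Poly
[]      ∘ₚ h = []
(a ∷ p) ∘ₚ h = (a ∷ []) +ₚ (h *ₚ (p ∘ₚ h))

-- the variable (we write r for the generator of 𝔽₂[r], t for 𝔽₂[t])
X : Poly
X = false ∷ true ∷ []

𝟏 : Poly
𝟏 = true ∷ []

X² X³ : Poly
X² = X *ₚ X
X³ = X² *ₚ X

Fₚ Gₚ : Poly
Fₚ = X *ₚ ((X +ₚ 𝟏) *ₚ ((X +ₚ 𝟏) *ₚ (X +ₚ 𝟏)))
Gₚ = X³ *ₚ (X +ₚ 𝟏)

evalS : Poly → Series
evalS []      n = false
evalS (a ∷ p) n = (a ∧ δ₀ n) xor (rS *ₛ evalS p) n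

-- The operator U on 𝔽₂[r], given by its graph:
-- U f = h  iff  f = Σ_{i<4} g_i(G) r^i  and  h = Σ_{i<4} g_i(F) U(r^i),
-- with U(1)=1, U(r)=r, U(r²)=r², U(r³)=r³+r²+r.
-- (The decomposition exists and is unique since 𝔽₂[r] is free over 𝔽₂[G]
-- with basis 1,r,r²,r³, so this graph is that of a function.)

Ur³ : Poly
Ur³ = X³ +ₚ (X² +ₚ X)

UGraph : Poly → Poly → Set
UGraph f h = Σ Poly λ g₀ → Σ Poly λ g₁ → Σ Poly λ g₂ → Σ Poly λ g₃ →
  (f ≈ₚ ((g₀ ∘ₚ Gₚ) +ₚ (((g₁ ∘ₚ Gₚ) *ₚ X) +ₚ (((g₂ ∘ₚ Gₚ) *ₚ X²) +ₚ ((g₃ ∘ₚ Gₚ) *ₚ X³)))))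
  × (h ≈ₚ ((g₀ ∘ₚ Fₚ) +ₚ (((g₁ ∘ₚ Fₚ) *ₚ X) +ₚ (((g₂ ∘ₚ Fₚ) *ₚ X²) +ₚ ((g₃ ∘ₚ Fₚ) *ₚ Ur³)))))

Modd : Poly → Set
Modd f = Σ Poly λ g → f ≈ₚ ((X² +ₚ X) *ₚ (g ∘ₚ X²))

InK : Poly → Set
InK f = Modd f × UGraph f f

U₂ U₃ : Series → Series
U₂ a n = a (2 * n)
U₃ a n = a (3 * n)

-- T_p (Σ aₙ xⁿ) = Σ a_{pn} xⁿ + Σ aₙ x^{pn}
Tₚ : ℕ → Series → Series
Tₚ p a n = a (p * n) xor xsum (suc n) (λ m → (p * m ≡ᵇ n) ∧ a m)

{-# OPTIONS --safe #-}
-- With A = Σ_{n odd} x^{n²} one has r + r² = A + A(x³), an odd series, and A = F(r), hence A(x³) = r + r² + F(r) = G(r).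
-- So U is the restriction of U₃ to 𝔽₂[r], and M(odd) is the kernel of U₂ there.
-- As T_p commutes with U₂ and U₃, the theorem comes down to T_p(𝔽₂[r]) ⊆ 𝔽₂[r].
--
-- Put x = y^p and adjoin p-th and cube roots of unity ζ and ω to the coefficients. On the Tate curve 𝔾ₘ/q^ℤ, q = y^{4p},
-- consider 𝕏(u) = Σ_k 1/(v + v⁻¹) and 𝕎(u) = Σ_k 1/(1 + v + v⁻¹), where v = u q^k. Summing a rational identity over pairs
-- of indices gives 𝕏(P)𝕏(Q) = (𝕏(P+Q) + 𝕏(P−Q))(𝕏(P) + 𝕏(Q))². At the 4-torsion point P₄ = y^p the functions take the
-- values A and r, and for Q = ω one finds 𝕎 (𝕏 + 𝕏(Q)) = 𝕏 with 𝕏(Q) = (1 + r)⁴; at P₄ this is A = F(r).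
-- Multiplication by p is given by polynomials over 𝔽₂[r] in 𝕏, so the 𝕏(P), for the p² points P with pP = ±P₄, are the
-- roots of a monic polynomial over 𝔽₂[r], and sums of their powers lie in 𝔽₂[r] by Newton's identities.
-- Let ϱ(P) = Σ_{t<p} 𝕎((1+4t)P), which runs through r(x), r(x^p) and the r(ζ^a y). Then
-- Σ_P 𝕎(P) ϱ(P)^k = r^{k+1} + T_p(r^{k+1}) + r T_p(r^k), and ϱ is integral because F(ϱ(P)) = Σ_t 𝕏((1+4t)P).
-- This yields a single b ≠ 0 with b T_p(r^k) ∈ 𝔽₂[r] for all k; since T_p(f²) = T_p(f)², b can be cancelled by descent.
module Submission where

open import Data.Bool using (Bool; true; false; _∧_; _xor_; if_then_else_; not)
import Data.Bool.Properties as BoolP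
open import Data.Nat as ℕ using (ℕ; zero; suc; _∸_; _≤_; _<_; z≤n; s≤s; NonZero; _≡ᵇ_)
import Data.Nat.Properties as ℕP
import Data.Nat.Divisibility as ℕD
import Data.Nat.DivMod as ℕDM
open import Data.Nat.Primality using (Prime; prime?; euclidsLemma; prime⇒nonZero; prime⇒irreducible; ¬prime[1])
open import Data.Nat.Induction using (<-rec)
open import Data.Integer as ℤ using (ℤ; +_; -[1+_]; ∣_∣; _⊖_)
import Data.Integer.Properties as ℤP
import Data.Integer.DivMod as ℤDM
open import Data.List using ([]; _∷_; length)
open import Data.Product using (Σ; _×_; _,_; proj₁; proj₂)
open import Data.Sum using (_⊎_; inj₁; inj₂)
open import Data.Empty using (⊥; ⊥-elim)
open import Function using (_∘_)
open import Relation.Nullary using (¬_; Dec; yes; no; does)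
open import Relation.Nullary.Decidable using (toWitness; toWitnessFalse; dec-true; dec-false; _×-dec_)
open import Relation.Binary.PropositionalEquality as P using (_≡_)

-- The weight 𝕎(P) in the trace is forced by the characteristic. Apart from P₄, the p² points fall
-- into p + 1 families of p - 1 points on which ϱ is constant; since p - 1 is even, the bare sum of
-- ϱ(P)^k would lose everything but r^k. Over one family the weights add up to ϱ + r, which produces
-- the two terms T_p(r^{k+1}) and r T_p(r^k), hence a recursion in k. The price is a denominator, as
-- 𝕎(P) is not visibly integral over 𝔽₂[r]. It is the same for all k because only the single factor
-- 𝕎(P) carries it: the powers of ϱ stay in one finite extension with a common denominator. The
-- multipliers 1 + 4t preserve the exponent modulo 4 and sweep the coset of P under the subgroup
-- generated by 4P. The coefficient ring 𝔽₄[t]/(1 + t + ... + t^{p-1}) need not be a domain. Nonzero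
-- is therefore replaced by regular (not a zero divisor), and regularity of a value of 𝕏 is read off
-- from its leading coefficient or from a factorisation.

module CharacteristicTwo where
  open import Data.Maybe using (Maybe; just; nothing)
  open import Relation.Binary.Structures using (IsEquivalence)
  open import Relation.Binary.Bundles using (Setoid)
  open import Algebra.Bundles using (CommutativeRing; RawRing)
  import Algebra.Solver.Ring as RingSolver
  open import Algebra.Solver.Ring.AlmostCommutativeRing using (fromCommutativeRing; _-Raw-AlmostCommutative⟶_)
  import Relation.Binary.Reasoning.Setoid as SetoidReasoning

  -- Commutative 𝔽₂-algebras: identities, regular elements, finite sums.

  record F2Alg : Set₁ where
    infix 4 _≈_
    infixl 6 _+_
    infixl 7 _*_
    field
      Carrier : Set
      _≈_ : Carrier → Carrier → Set
      _+_ _*_ : Carrier → Carrier → Carrier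
      0# 1# : Carrier
      isEquivalence : IsEquivalence _≈_
      +-cong : ∀ {a b c d} → a ≈ b → c ≈ d → a + c ≈ b + d
      *-cong : ∀ {a b c d} → a ≈ b → c ≈ d → a * c ≈ b * d
      +-assoc : ∀ a b c → (a + b) + c ≈ a + (b + c)
      +-comm : ∀ a b → a + b ≈ b + a
      +-idˡ : ∀ a → 0# + a ≈ a
      double : ∀ a → a + a ≈ 0#
      *-assoc : ∀ a b c → (a * b) * c ≈ a * (b * c)
      *-comm : ∀ a b → a * b ≈ b * a
      *-idˡ : ∀ a → 1# * a ≈ a
      distribʳ : ∀ a b c → (b + c) * a ≈ b * a + c * a

    open IsEquivalence isEquivalence public
    setoid : Setoid _ _
    setoid = record { isEquivalence = isEquivalence }
    open SetoidReasoning setoid public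

  module Ring (K : F2Alg) where
    open F2Alg K public

    +-idʳ : ∀ a → a + 0# ≈ a
    +-idʳ a = trans (+-comm a 0#) (+-idˡ a)

    *-idʳ : ∀ a → a * 1# ≈ a
    *-idʳ a = trans (*-comm a 1#) (*-idˡ a)

    distribˡ : ∀ a b c → a * (b + c) ≈ a * b + a * c
    distribˡ a b c = trans (*-comm a (b + c)) (trans (distribʳ a b c) (+-cong (*-comm b a) (*-comm c a)))

    commutativeRing : CommutativeRing _ _
    commutativeRing = record
      { Carrier = Carrier ; _≈_ = _≈_ ; _+_ = _+_ ; _*_ = _*_ ; -_ = λ x → x ; 0# = 0# ; 1# = 1#
      ; isCommutativeRing = record
        { isRing = record
          { +-isAbelianGroup = record
            { isGroup = record
              { isMonoid = record
                { isSemigroup = record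
                  { isMagma = record { isEquivalence = isEquivalence ; ∙-cong = +-cong }
                  ; assoc = +-assoc }
                ; identity = +-idˡ , +-idʳ }
              ; inverse = double , double
              ; ⁻¹-cong = λ e → e }
            ; comm = +-comm }
          ; *-cong = *-cong
          ; *-assoc = *-assoc
          ; *-identity = *-idˡ , *-idʳ
          ; distrib = distribˡ , distribʳ }
        ; *-comm = *-comm } }

    open CommutativeRing commutativeRing public using (zeroˡ; zeroʳ)

    bit : Bool → Carrier
    bit true = 1#
    bit false = 0#

    bit-+ : ∀ a b → bit (a xor b) ≈ bit a + bit b
    bit-+ true true = sym (double 1#)
    bit-+ true false = sym (+-idʳ 1#)
    bit-+ false b = sym (+-idˡ _)

    bit-* : ∀ a b → bit (a ∧ b) ≈ bit a * bit b
    bit-* true b = sym (*-idˡ _)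
    bit-* false b = sym (zeroˡ _)

    private
      -- With 𝔽₂ itself as coefficient ring the solver cancels x + x, so identities that hold only
      -- in characteristic two are proved by normalisation.
      boolRing : RawRing _ _
      boolRing = record { Carrier = Bool ; _≈_ = _≡_ ; _+_ = _xor_ ; _*_ = _∧_ ; -_ = λ x → x ; 0# = false ; 1# = true }

      bitMorphism : boolRing -Raw-AlmostCommutative⟶ fromCommutativeRing commutativeRing
      bitMorphism = record
        { ⟦_⟧ = bit ; +-homo = bit-+ ; *-homo = bit-* ; -‿homo = λ _ → refl ; 0-homo = refl ; 1-homo = refl }

      bit≟ : ∀ a b → Maybe (bit a ≈ bit b)
      bit≟ true true = just refl
      bit≟ false false = just refl
      bit≟ _ _ = nothing

    open RingSolver boolRing (fromCommutativeRing commutativeRing) bitMorphism bit≟ public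
      using (solve; _:+_; _:*_; _:=_; con; Polynomial)

    I : ∀ {n} → Polynomial n
    I = con true

    O : ∀ {n} → Polynomial n
    O = con false

    sq : Carrier → Carrier
    sq a = a * a

    fourth : Carrier → Carrier
    fourth a = sq (sq a)

    infixr 8 _^_
    _^_ : Carrier → ℕ → Carrier
    a ^ zero = 1#
    a ^ suc n = a * a ^ n

    +-congˡ : ∀ {a b} c → a ≈ b → c + a ≈ c + b
    +-congˡ c e = +-cong refl e

    +-congʳ : ∀ {a b} c → a ≈ b → a + c ≈ b + c
    +-congʳ c e = +-cong e refl

    *-congˡ : ∀ {a b} c → a ≈ b → c * a ≈ c * b
    *-congˡ c e = *-cong refl e

    *-congʳ : ∀ {a b} c → a ≈ b → a * c ≈ b * c
    *-congʳ c e = *-cong e refl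

    ^-cong : ∀ {a b} n → a ≈ b → a ^ n ≈ b ^ n
    ^-cong zero e = refl
    ^-cong (suc n) e = *-cong e (^-cong n e)

    ^-+ : ∀ a m n → a ^ (m ℕ.+ n) ≈ a ^ m * a ^ n
    ^-+ a zero n = sym (*-idˡ _)
    ^-+ a (suc m) n = trans (*-congˡ a (^-+ a m n)) (sym (*-assoc _ _ _))

    ^-1 : ∀ n → 1# ^ n ≈ 1#
    ^-1 zero = refl
    ^-1 (suc n) = trans (*-idˡ _) (^-1 n)

    ^-* : ∀ a b n → (a * b) ^ n ≈ a ^ n * b ^ n
    ^-* a b zero = sym (*-idˡ _)
    ^-* a b (suc n) = trans (*-congˡ _ (^-* a b n))
      (solve 4 (λ a b c d → (a :* b) :* (c :* d) := (a :* c) :* (b :* d)) refl a b (a ^ n) (b ^ n))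

    ^-^ : ∀ a m n → a ^ (m ℕ.* n) ≈ (a ^ n) ^ m
    ^-^ a zero n = refl
    ^-^ a (suc m) n = trans (^-+ a n (m ℕ.* n)) (*-congˡ _ (^-^ a m n))

    +≈0⇒≈ : ∀ {a b} → a + b ≈ 0# → a ≈ b
    +≈0⇒≈ {a} {b} e = begin
      a             ≈⟨ solve 2 (λ a b → a := (a :+ b) :+ b) refl a b ⟩
      (a + b) + b   ≈⟨ +-congʳ b e ⟩
      0# + b        ≈⟨ +-idˡ b ⟩
      b ∎

    ≈⇒+≈0 : ∀ {a b} → a ≈ b → a + b ≈ 0#
    ≈⇒+≈0 {a} {b} e = trans (+-congʳ b e) (double b)

    -- Stands in for "nonzero" in rings that may have zero divisors; it is all that cancellation
    -- needs.
    Reg : Carrier → Set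
    Reg a = ∀ b → a * b ≈ 0# → b ≈ 0#

    reg-cong : ∀ {a b} → a ≈ b → Reg a → Reg b
    reg-cong e r c h = r c (trans (*-congʳ c e) h)

    reg-* : ∀ {a b} → Reg a → Reg b → Reg (a * b)
    reg-* ra rb c h = rb c (ra _ (trans (sym (*-assoc _ _ _)) h))

    -- The usual source of regular sums later on: such a sum is exhibited as a factor of a product
    -- already known to be regular.
    reg-factor : ∀ {a b} → Reg (a * b) → Reg a
    reg-factor {a} {b} r c h = r c (trans (solve 3 (λ a b c → (a :* b) :* c := b :* (a :* c)) refl a b c) (trans (*-congˡ b h) (zeroʳ b)))

    reg-factorʳ : ∀ {a b} → Reg (a * b) → Reg b
    reg-factorʳ {a} {b} r = reg-factor {b} {a} (reg-cong (*-comm a b) r)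

    reg-^ : ∀ {a} n → Reg a → Reg (a ^ n)
    reg-^ zero r c h = trans (sym (*-idˡ c)) h
    reg-^ (suc n) r = reg-* r (reg-^ n r)

    reg-1 : Reg 1#
    reg-1 c h = trans (sym (*-idˡ c)) h

    reg-unit : ∀ {a b} → a * b ≈ 1# → Reg a
    reg-unit e = reg-factor (reg-cong (sym e) reg-1)

    cancel : ∀ {a b c} → Reg a → a * b ≈ a * c → b ≈ c
    cancel {a} {b} {c} r e = +≈0⇒≈ (r (b + c) (trans (distribˡ a b c) (≈⇒+≈0 e)))

    inverse-unique : ∀ {a b s} → a * s ≈ 1# → b * s ≈ 1# → a ≈ b
    inverse-unique {a} {b} {s} e h = cancel (reg-unit (trans (*-comm s a) e)) (trans (*-comm s a) (trans e (trans (sym h) (*-comm b s))))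

    sum : ℕ → (ℕ → Carrier) → Carrier
    sum zero f = 0#
    sum (suc n) f = f n + sum n f

    sum-cong< : ∀ n {f g} → (∀ i → i ℕ.< n → f i ≈ g i) → sum n f ≈ sum n g
    sum-cong< zero e = refl
    sum-cong< (suc n) e = +-cong (e n ℕP.≤-refl) (sum-cong< n (λ i l → e i (ℕP.m≤n⇒m≤1+n l)))

    sum-cong : ∀ n {f g} → (∀ i → f i ≈ g i) → sum n f ≈ sum n g
    sum-cong n e = sum-cong< n (λ i _ → e i)

    sum-0 : ∀ n {f} → (∀ i → i ℕ.< n → f i ≈ 0#) → sum n f ≈ 0#
    sum-0 zero e = refl
    sum-0 (suc n) e = trans (sum-cong< (suc n) e) (zeros (suc n))
      where
        zeros : ∀ m → sum m (λ _ → 0#) ≈ 0#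
        zeros zero = refl
        zeros (suc m) = trans (+-idˡ _) (zeros m)

    sum-+ : ∀ n f g → sum n (λ i → f i + g i) ≈ sum n f + sum n g
    sum-+ zero f g = sym (+-idˡ _)
    sum-+ (suc n) f g = trans (+-congˡ _ (sum-+ n f g))
      (solve 4 (λ a b c d → (a :+ b) :+ (c :+ d) := (a :+ c) :+ (b :+ d)) refl (f n) (g n) (sum n f) (sum n g))

    sum-*ˡ : ∀ n c f → c * sum n f ≈ sum n (λ i → c * f i)
    sum-*ˡ zero c f = zeroʳ c
    sum-*ˡ (suc n) c f = trans (distribˡ _ _ _) (+-congˡ _ (sum-*ˡ n c f))

    sum-*ʳ : ∀ n c f → sum n f * c ≈ sum n (λ i → f i * c)
    sum-*ʳ n c f = trans (*-comm _ _) (trans (sum-*ˡ n c f) (sum-cong n (λ i → *-comm _ _)))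

    sum-swap : ∀ m n (f : ℕ → ℕ → Carrier) → sum m (λ i → sum n (f i)) ≈ sum n (λ j → sum m (λ i → f i j))
    sum-swap zero n f = sym (sum-0 n (λ _ _ → refl))
    sum-swap (suc m) n f = trans (+-congˡ _ (sum-swap m n f)) (sym (sum-+ n (f m) _))

    sum-front : ∀ n f → sum (suc n) f ≈ f 0 + sum n (λ i → f (suc i))
    sum-front zero f = refl
    sum-front (suc n) f = trans (+-congˡ _ (sum-front n f))
      (solve 3 (λ a b c → a :+ (b :+ c) := b :+ (a :+ c)) refl (f (suc n)) (f 0) _)

    sum-++ : ∀ m n f → sum (m ℕ.+ n) f ≈ sum m (λ i → f (i ℕ.+ n)) + sum n f
    sum-++ zero n f = sym (+-idˡ _)
    sum-++ (suc m) n f = trans (+-congˡ _ (sum-++ m n f)) (sym (+-assoc _ _ _))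

    sq-+ : ∀ a b → sq (a + b) ≈ sq a + sq b
    sq-+ = solve 2 (λ a b → (a :+ b) :* (a :+ b) := a :* a :+ b :* b) refl

    sq-* : ∀ a b → sq (a * b) ≈ sq a * sq b
    sq-* = solve 2 (λ a b → (a :* b) :* (a :* b) := (a :* a) :* (b :* b)) refl

    sq-cong : ∀ {a b} → a ≈ b → sq a ≈ sq b
    sq-cong e = *-cong e e

    sq-sum : ∀ n f → sq (sum n f) ≈ sum n (λ i → sq (f i))
    sq-sum zero f = zeroˡ _
    sq-sum (suc n) f = trans (sq-+ _ _) (+-congˡ _ (sq-sum n f))

    sum-block : ∀ m n f → sum (m ℕ.* n) f ≈ sum m (λ a → sum n (λ b → f (b ℕ.+ a ℕ.* n)))
    sum-block zero n f = refl
    sum-block (suc m) n f = trans (sum-++ n (m ℕ.* n) f) (+-congˡ _ (sum-block m n f))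

    only : ∀ n k {f} → k ℕ.< n → (∀ i → i ℕ.< n → ¬ (i ≡ k) → f i ≈ 0#) → sum n f ≈ f k
    only (suc n) k {f} l z with n ℕ.≟ k
    ... | yes P.refl = trans (+-congˡ _ (sum-0 n (λ i i<n → z i (ℕP.m≤n⇒m≤1+n i<n) (λ e → ℕP.<⇒≢ i<n e)))) (+-idʳ _)
    ... | no ne = trans (+-cong (z n (ℕP.≤-refl) ne) (only n k (ℕP.≤∧≢⇒< (ℕP.≤-pred l) (λ e → ne (P.sym e))) (λ i i<n → z i (ℕP.m≤n⇒m≤1+n i<n)))) (+-idˡ _)

-- Formal power series over an 𝔽₂-algebra.

module FormalSeries where
  open CharacteristicTwo

  module PowerSeries (K : F2Alg) where
    private
      open module K = Ring K using () renaming (Carrier to C)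
      open K

    -- The Cauchy product, computed by peeling off the constant term of f, so that the ring laws
    -- become structural inductions on the index; `conv-*ₛ` identifies it with the sum over i ≤ n.
    conv : (ℕ → C) → (ℕ → C) → ℕ → C
    conv f g zero = f 0 * g 0
    conv f g (suc n) = f 0 * g (suc n) + conv (f ∘ suc) g n

    conv-cong≤ : ∀ n {f f′ g g′} → (∀ i → i ≤ n → f i ≈ f′ i) → (∀ i → i ≤ n → g i ≈ g′ i) → conv f g n ≈ conv f′ g′ n
    conv-cong≤ zero e h = *-cong (e 0 z≤n) (h 0 z≤n)
    conv-cong≤ (suc n) e h = +-cong (*-cong (e 0 z≤n) (h (suc n) ℕP.≤-refl))
      (conv-cong≤ n (λ i l → e (suc i) (s≤s l)) (λ i l → h i (ℕP.m≤n⇒m≤1+n l)))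

    conv-right : ∀ n f g → conv f g (suc n) ≈ f (suc n) * g 0 + conv f (g ∘ suc) n
    conv-right zero f g = +-comm _ _
    conv-right (suc n) f g = trans (+-congˡ _ (conv-right n (f ∘ suc) g))
      (solve 3 (λ a b c → a :+ (b :+ c) := b :+ (a :+ c)) refl _ _ _)

    conv-comm : ∀ n f g → conv f g n ≈ conv g f n
    conv-comm zero f g = *-comm _ _
    conv-comm (suc n) f g = trans (+-cong (*-comm _ _) (conv-comm n (f ∘ suc) g)) (sym (conv-right n g f))

    -- The tail of `conv f g` is f₀ times the tail of g plus a product with the tail of f, a
    -- combination of exactly this shape; so this one statement carries the induction for
    -- associativity.
    conv-linear : ∀ n a u v h → conv (λ i → a * u i + v i) h n ≈ a * conv u h n + conv v h n
    conv-linear zero a u v h = solve 4 (λ a u v h → (a :* u :+ v) :* h := a :* (u :* h) :+ v :* h) refl a (u 0) (v 0) (h 0)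
    conv-linear (suc n) a u v h = trans (+-congˡ _ (conv-linear n a (u ∘ suc) (v ∘ suc) h))
      (solve 6 (λ a u v h x y → (a :* u :+ v) :* h :+ (a :* x :+ y) := a :* (u :* h :+ x) :+ (v :* h :+ y)) refl a (u 0) (v 0) (h (suc n)) _ _)

    conv-assoc : ∀ n f g h → conv (conv f g) h n ≈ conv f (conv g h) n
    conv-assoc zero f g h = *-assoc _ _ _
    conv-assoc (suc n) f g h = begin
      (f 0 * g 0) * h (suc n) + conv (λ i → f 0 * g (suc i) + conv (f ∘ suc) g i) h n
        ≈⟨ +-congˡ _ (conv-linear n (f 0) (g ∘ suc) (conv (f ∘ suc) g) h) ⟩
      (f 0 * g 0) * h (suc n) + (f 0 * conv (g ∘ suc) h n + conv (conv (f ∘ suc) g) h n)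
        ≈⟨ +-congˡ _ (+-congˡ _ (conv-assoc n (f ∘ suc) g h)) ⟩
      (f 0 * g 0) * h (suc n) + (f 0 * conv (g ∘ suc) h n + conv (f ∘ suc) (conv g h) n)
        ≈⟨ solve 5 (λ a b c d e → (a :* b) :* c :+ (a :* d :+ e) := a :* (b :* c :+ d) :+ e) refl (f 0) (g 0) (h (suc n)) _ _ ⟩
      f 0 * conv g h (suc n) + conv (f ∘ suc) (conv g h) n ∎

    const : C → ℕ → C
    const c zero = c
    const c (suc n) = 0#

    conv-0ˡ : ∀ n f g → (∀ i → f i ≈ 0#) → conv f g n ≈ 0#
    conv-0ˡ zero f g z = trans (*-congʳ _ (z 0)) (zeroˡ _)
    conv-0ˡ (suc n) f g z = trans (+-cong (trans (*-congʳ _ (z 0)) (zeroˡ _)) (conv-0ˡ n (f ∘ suc) g (z ∘ suc))) (+-idˡ _)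

    conv-const : ∀ n c f → conv (const c) f n ≈ c * f n
    conv-const zero c f = refl
    conv-const (suc n) c f = trans (+-congˡ _ (conv-0ˡ n _ f (λ _ → refl))) (+-idʳ _)

    series : F2Alg
    series = record
      { Carrier = ℕ → C
      ; _≈_ = λ f g → ∀ n → f n ≈ g n
      ; _+_ = λ f g n → f n + g n
      ; _*_ = conv
      ; 0# = λ _ → 0#
      ; 1# = const 1#
      ; isEquivalence = record { refl = λ _ → refl ; sym = λ e n → sym (e n) ; trans = λ e h n → trans (e n) (h n) }
      ; +-cong = λ e h n → +-cong (e n) (h n)
      ; *-cong = λ e h n → conv-cong≤ n (λ i _ → e i) (λ i _ → h i)
      ; +-assoc = λ f g h n → +-assoc _ _ _
      ; +-comm = λ f g n → +-comm _ _
      ; +-idˡ = λ f n → +-idˡ _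
      ; double = λ f n → double _
      ; *-assoc = λ f g h n → conv-assoc n f g h
      ; *-comm = λ f g n → conv-comm n f g
      ; *-idˡ = λ f n → trans (conv-const n 1# f) (*-idˡ _)
      ; distribʳ = λ h f g n → trans (conv-cong≤ n (λ i _ → +-congʳ (g i) (sym (*-idˡ (f i)))) (λ _ _ → refl)) (trans (conv-linear n 1# f g h) (+-congʳ _ (*-idˡ _)))
      }

  module Series (K : F2Alg) where
    private
      module K where
        open Ring K public
        open PowerSeries K public
    open PowerSeries K public using (conv; const; conv-const; conv-cong≤)
    open Ring (PowerSeries.series K) public

    shift : Carrier → Carrier
    shift f zero = K.0#
    shift f (suc n) = f n

    shift-* : ∀ f g → shift f * g ≈ shift (f * g)
    shift-* f g zero = K.zeroˡ _
    shift-* f g (suc n) = K.trans (K.+-congʳ _ (K.zeroˡ _)) (K.+-idˡ _)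

    head-tail : ∀ f → f ≈ const (f 0) + shift (f ∘ suc)
    head-tail f zero = K.sym (K.+-idʳ _)
    head-tail f (suc n) = K.sym (K.+-idˡ _)

    shiftBy : ℕ → Carrier → Carrier
    shiftBy zero f = f
    shiftBy (suc m) f = shift (shiftBy m f)

    shiftBy-+ : ∀ m f n → shiftBy m f (m ℕ.+ n) K.≈ f n
    shiftBy-+ zero f n = K.refl
    shiftBy-+ (suc m) f n = shiftBy-+ m f n

    shiftBy-< : ∀ m f n → n < m → shiftBy m f n K.≈ K.0#
    shiftBy-< (suc m) f zero l = K.refl
    shiftBy-< (suc m) f (suc n) (s≤s l) = shiftBy-< m f n l

    shift-cong : ∀ {f g} → f ≈ g → shift f ≈ shift g
    shift-cong e zero = K.refl
    shift-cong e (suc n) = e n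

    shiftBy-cong : ∀ m {f g} → f ≈ g → shiftBy m f ≈ shiftBy m g
    shiftBy-cong zero e = e
    shiftBy-cong (suc m) e = shift-cong (shiftBy-cong m e)

    shiftBy-* : ∀ m f g → shiftBy m f * g ≈ shiftBy m (f * g)
    shiftBy-* zero f g = refl
    shiftBy-* (suc m) f g = trans (shift-* _ g) (shift-cong (shiftBy-* m f g))

    infix 4 _≈[_]_
    -- Congruence modulo x^{n+1}. At each precision an infinite sum is a finite one, and identities
    -- between infinite sums are proved precision by precision.
    _≈[_]_ : Carrier → ℕ → Carrier → Set
    f ≈[ n ] g = ∀ i → i ≤ n → f i K.≈ g i

    ≈⇒≈[] : ∀ {f g} n → f ≈ g → f ≈[ n ] g
    ≈⇒≈[] n e i _ = e i

    ≈[]⇒≈ : ∀ {f g} → (∀ n → f ≈[ n ] g) → f ≈ g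
    ≈[]⇒≈ e n = e n n ℕP.≤-refl

    ≈[]-trans : ∀ {f g h n} → f ≈[ n ] g → g ≈[ n ] h → f ≈[ n ] h
    ≈[]-trans e e′ i l = K.trans (e i l) (e′ i l)

    ≈[]-sym : ∀ {f g n} → f ≈[ n ] g → g ≈[ n ] f
    ≈[]-sym e i l = K.sym (e i l)

    +-cong[] : ∀ {f f′ g g′} n → f ≈[ n ] f′ → g ≈[ n ] g′ → f + g ≈[ n ] f′ + g′
    +-cong[] n e h i l = K.+-cong (e i l) (h i l)

    *-cong[] : ∀ {f f′ g g′} n → f ≈[ n ] f′ → g ≈[ n ] g′ → f * g ≈[ n ] f′ * g′
    *-cong[] n e h i l = K.conv-cong≤ i (λ j m → e j (ℕP.≤-trans m l)) (λ j m → h j (ℕP.≤-trans m l))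

    sum-cong[] : ∀ n m {f g} → (∀ i → f i ≈[ n ] g i) → sum m f ≈[ n ] sum m g
    sum-cong[] n zero e i l = K.refl
    sum-cong[] n (suc m) e = +-cong[] n (e m) (sum-cong[] n m e)

    sum-at : ∀ m f n → sum m f n K.≈ K.sum m (λ i → f i n)
    sum-at zero f n = K.refl
    sum-at (suc m) f n = K.+-congˡ _ (sum-at m f n)

    -- If the coefficients of g below m vanish, coefficient m of f g is f₀ gₘ; regularity of f₀
    -- kills the coefficients of g one after the other.
    reg-0 : ∀ {f} → K.Reg (f 0) → Reg f
    reg-0 {f} r g e n = below (suc n) n ℕP.≤-refl
      where
        below : ∀ m i → i < m → g i K.≈ K.0#
        top : ∀ m → (∀ i → i < m → g i K.≈ K.0#) → f 0 K.* g m K.≈ conv f g m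
        top zero z = K.refl
        top (suc m) z = K.sym (K.trans (K.+-congˡ _ (K.trans (K.conv-comm m (f ∘ suc) g)
          (K.trans (conv-cong≤ m (λ i l → z i (s≤s l)) (λ _ _ → K.refl)) (K.conv-0ˡ m _ (f ∘ suc) (λ _ → K.refl))))) (K.+-idʳ _))
        below (suc m) i l with ℕP.m≤n⇒m<n∨m≡n (ℕP.≤-pred l)
        ... | inj₁ i<m = below m i i<m
        ... | inj₂ P.refl = r _ (K.trans (top m (below m)) (e m))

    reg-shiftBy : ∀ m {f} → Reg f → Reg (shiftBy m f)
    reg-shiftBy m {f} r g e = r g (λ n → K.trans (K.sym (shiftBy-+ m (f * g) n)) (K.trans (K.sym (shiftBy-* m f g (m ℕ.+ n))) (e (m ℕ.+ n))))

    Lead : ℕ → K.Carrier → Carrier → Set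
    Lead m c f = (∀ i → i < m → f i K.≈ K.0#) × f m K.≈ c

    unshift : ∀ m f → (∀ i → i < m → f i K.≈ K.0#) → f ≈ shiftBy m (λ n → f (m ℕ.+ n))
    unshift zero f z = refl
    unshift (suc m) f z zero = z 0 (s≤s z≤n)
    unshift (suc m) f z (suc n) = unshift m (f ∘ suc) (λ i l → z (suc i) (s≤s l)) n

    reg-lead : ∀ m {c f} → Lead m c f → K.Reg c → Reg f
    reg-lead m {c} {f} (z , e) r = reg-cong (sym (unshift m f z))
      (reg-shiftBy m (reg-0 (K.reg-cong (K.trans (K.sym e) (K.reflexive (P.cong f (P.sym (ℕP.+-identityʳ m))))) r)))

    lead-* : ∀ m n {c d f g} → Lead m c f → Lead n d g → Lead (m ℕ.+ n) (c K.* d) (f * g)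
    lead-* zero zero (z , e) (z′ , e′) = (λ i ()) , K.*-cong e e′
    lead-* zero (suc n) {g = g} (z , e) (z′ , e′) =
      (λ i l → K.trans (conv-cong≤ i (λ _ _ → K.refl) (λ j m → z′ j (ℕP.≤-trans (s≤s m) l))) (zeroʳ _ i)) ,
      K.trans (K.+-congˡ _ (K.trans (conv-cong≤ n (λ _ _ → K.refl) (λ j m → z′ j (s≤s m))) (zeroʳ _ n))) (K.trans (K.+-idʳ _) (K.*-cong e e′))
    lead-* (suc m) n {f = f} {g = g} (z , e) (z′ , e′) = zs , top
      where
        ih = lead-* m n {f = f ∘ suc} {g = g} ((λ i l → z (suc i) (s≤s l)) , e) (z′ , e′)
        zs : ∀ i → i < suc m ℕ.+ n → (f * g) i K.≈ K.0#
        zs zero l = K.trans (K.*-congʳ _ (z 0 (s≤s z≤n))) (K.zeroˡ _)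
        zs (suc i) (s≤s l) = K.trans (K.+-cong (K.trans (K.*-congʳ _ (z 0 (s≤s z≤n))) (K.zeroˡ _)) (proj₁ ih i l)) (K.+-idˡ _)
        top = K.trans (K.+-congʳ _ (K.trans (K.*-congʳ _ (z 0 (s≤s z≤n))) (K.zeroˡ _))) (K.trans (K.+-idˡ _) (proj₂ ih))

    const-cong : ∀ {a b} → a K.≈ b → const a ≈ const b
    const-cong e zero = e
    const-cong e (suc n) = K.refl

    const-+ : ∀ a b → const (a K.+ b) ≈ const a + const b
    const-+ a b zero = K.refl
    const-+ a b (suc n) = K.sym (K.+-idˡ _)

    const-* : ∀ a b → const (a K.* b) ≈ const a * const b
    const-* a b n = K.trans (h n) (K.sym (conv-const n a (const b)))
      where
        h : ∀ n → const (a K.* b) n K.≈ a K.* const b n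
        h zero = K.refl
        h (suc n) = K.sym (K.zeroʳ _)

-- Ring homomorphisms between series, substitutions, evaluation of polynomials.

module Homomorphisms where
  open import Defs
  open import Data.Nat.Divisibility using (_∣_; _∣?_; divides; ∣m∣n⇒∣m+n; ∣-refl)
  open CharacteristicTwo
  open FormalSeries

  record Hom (K L : F2Alg) : Set where
    private
      module K = Ring K
      module L = Ring L
    field
      fun : K.Carrier → L.Carrier
      fun-cong : ∀ {a b} → a K.≈ b → fun a L.≈ fun b
      fun-+ : ∀ a b → fun (a K.+ b) L.≈ fun a L.+ fun b
      fun-* : ∀ a b → fun (a K.* b) L.≈ fun a L.* fun b
      fun-1 : fun K.1# L.≈ L.1#

    fun-0 : fun K.0# L.≈ L.0#
    fun-0 = L.trans (fun-cong (K.sym (K.double K.0#))) (L.trans (fun-+ _ _) (L.double _))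

    fun-sum : ∀ n f → fun (K.sum n f) L.≈ L.sum n (fun ∘ f)
    fun-sum zero f = fun-0
    fun-sum (suc n) f = L.trans (fun-+ _ _) (L.+-congˡ _ (fun-sum n f))

    fun-^ : ∀ a n → fun (a K.^ n) L.≈ fun a L.^ n
    fun-^ a zero = fun-1
    fun-^ a (suc n) = L.trans (fun-* _ _) (L.*-congˡ _ (fun-^ a n))

    fun-bit : ∀ b → fun (K.bit b) L.≈ L.bit b
    fun-bit true = fun-1
    fun-bit false = fun-0

  _⊙_ : ∀ {K L M} → Hom L M → Hom K L → Hom K M
  _⊙_ {K} {L} {M} g f = record
    { fun = G.fun ∘ F.fun
    ; fun-cong = λ e → G.fun-cong (F.fun-cong e)
    ; fun-+ = λ a b → M.trans (G.fun-cong (F.fun-+ a b)) (G.fun-+ _ _)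
    ; fun-* = λ a b → M.trans (G.fun-cong (F.fun-* a b)) (G.fun-* _ _)
    ; fun-1 = M.trans (G.fun-cong F.fun-1) G.fun-1 }
    where
      module F = Hom f
      module G = Hom g
      module M = Ring M

  module _ (K L : F2Alg) (h : Hom K L) where
    private
      module L = Ring L
      module h = Hom h
      module PL = PowerSeries L
      module PK = PowerSeries K

    coeffwise : Hom (PowerSeries.series K) (PowerSeries.series L)
    coeffwise = record
      { fun = λ f n → h.fun (f n)
      ; fun-cong = λ e n → h.fun-cong (e n)
      ; fun-+ = λ f g n → h.fun-+ _ _
      ; fun-* = λ f g n → mul n f g
      ; fun-1 = one }
      where
        mul : ∀ n f g → h.fun (PK.conv f g n) L.≈ PL.conv (h.fun ∘ f) (h.fun ∘ g) n
        mul zero f g = h.fun-* _ _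
        mul (suc n) f g = L.trans (h.fun-+ _ _) (L.+-cong (h.fun-* _ _) (mul n (f ∘ suc) g))
        one : ∀ n → h.fun (PK.const _ n) L.≈ PL.const L.1# n
        one zero = h.fun-1
        one (suc n) = h.fun-0

  module _ (K : F2Alg) (z : F2Alg.Carrier K) where
    private
      module K = Ring K
      open PowerSeries K

    -- The substitution y ↦ z y. Summed over the p-th roots of unity z, it extracts the coefficients
    -- of index divisible by p.
    twist : Hom series series
    twist = record
      { fun = λ f n → f n K.* z K.^ n
      ; fun-cong = λ e n → K.*-congʳ _ (e n)
      ; fun-+ = λ f g n → K.distribʳ _ _ _
      ; fun-* = λ f g n → mul n f g
      ; fun-1 = one }
      where
        tw : (ℕ → K.Carrier) → ℕ → K.Carrier
        tw f n = f n K.* z K.^ n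
        mul : ∀ n f g → conv f g n K.* z K.^ n K.≈ conv (tw f) (tw g) n
        mul zero f g = K.solve 2 (λ a b → (a K.:* b) K.:* K.I K.:= (a K.:* K.I) K.:* (b K.:* K.I)) K.refl _ _
        mul (suc n) f g = begin
          (f 0 K.* g (suc n) K.+ conv (f ∘ suc) g n) K.* (z K.* z K.^ n)
            ≈⟨ K.solve 5 (λ a b c z w → (a K.:* b K.:+ c) K.:* (z K.:* w) K.:= (a K.:* K.I) K.:* (b K.:* (z K.:* w)) K.:+ (z K.:* (c K.:* w) K.:+ K.O)) K.refl _ _ _ _ _ ⟩
          tw f 0 K.* tw g (suc n) K.+ (z K.* (conv (f ∘ suc) g n K.* z K.^ n) K.+ K.0#)
            ≈⟨ K.+-congˡ _ (K.+-cong (K.*-congˡ z (mul n (f ∘ suc) g)) (K.sym (conv-0ˡ n _ (tw g) (λ _ → K.refl)))) ⟩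
          tw f 0 K.* tw g (suc n) K.+ (z K.* conv (tw (f ∘ suc)) (tw g) n K.+ conv (λ _ → K.0#) (tw g) n)
            ≈⟨ K.+-congˡ _ (K.sym (conv-linear n z (tw (f ∘ suc)) (λ _ → K.0#) (tw g))) ⟩
          tw f 0 K.* tw g (suc n) K.+ conv (λ i → z K.* tw (f ∘ suc) i K.+ K.0#) (tw g) n
            ≈⟨ K.+-congˡ _ (conv-cong≤ n (λ i _ → K.solve 3 (λ a z w → z K.:* (a K.:* w) K.:+ K.O K.:= a K.:* (z K.:* w)) K.refl _ _ _) (λ _ _ → K.refl)) ⟩
          tw f 0 K.* tw g (suc n) K.+ conv (tw f ∘ suc) (tw g) n ∎
          where open K using (begin_; _∎; step-≈-⟩)
        one : ∀ n → const K.1# n K.* z K.^ n K.≈ const K.1# n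
        one zero = K.*-idˡ _
        one (suc n) = K.zeroˡ _

  module Inflate (K : F2Alg) where
    private
      module K = Ring K
      open module S = Series K

    pick : ∀ {k n} → Carrier → Dec (k ∣ n) → K.Carrier
    pick f (yes (divides q _)) = f q
    pick f (no _) = K.0#

    -- The substitution x ↦ x^k; the quotient found when deciding k ∣ n is the index of the source
    -- coefficient.
    inflate : ℕ → Carrier → Carrier
    inflate k f n = pick f (k ∣? n)

    inflate-∣ : ∀ k .{{_ : NonZero k}} f q → inflate k f (q ℕ.* k) K.≈ f q
    inflate-∣ k f q with k ∣? (q ℕ.* k)
    ... | yes (divides q′ e) = K.reflexive (P.cong f (P.sym (ℕP.*-cancelʳ-≡ q q′ k e)))
    ... | no ne = ⊥-elim (ne (divides q P.refl))

    inflate-∤ : ∀ k f n → ¬ (k ∣ n) → inflate k f n K.≈ K.0#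
    inflate-∤ k f n ne with k ∣? n
    ... | yes d = ⊥-elim (ne d)
    ... | no _ = K.refl

    inflate-unique : ∀ k .{{_ : NonZero k}} f (g : Carrier) → (∀ q → g (q ℕ.* k) K.≈ f q) → (∀ n → ¬ (k ∣ n) → g n K.≈ K.0#) → inflate k f ≈ g
    inflate-unique k f g e z n with k ∣? n
    ... | yes (divides q P.refl) = K.sym (e q)
    ... | no ne = K.sym (z n ne)

    inflate-cong : ∀ k {f g} → f ≈ g → inflate k f ≈ inflate k g
    inflate-cong k e n with k ∣? n
    ... | yes (divides q _) = e q
    ... | no _ = K.refl

    inflate-+ : ∀ k f g → inflate k (f + g) ≈ inflate k f + inflate k g
    inflate-+ k f g n with k ∣? n
    ... | yes (divides q _) = K.refl
    ... | no _ = K.sym (K.double _)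

    inflate-scale : ∀ k c f → inflate k (const c * f) ≈ const c * inflate k f
    inflate-scale k c f n = K.trans (h n) (K.sym (conv-const n c (inflate k f)))
      where
        h : ∀ n → inflate k (const c * f) n K.≈ c K.* inflate k f n
        h n with k ∣? n
        ... | yes (divides q _) = conv-const q c f
        ... | no _ = K.sym (K.zeroʳ _)

    inflate-shift : ∀ k .{{_ : NonZero k}} f → inflate k (shift f) ≈ shiftBy k (inflate k f)
    inflate-shift k f = inflate-unique k (shift f) _ val off
      where
        val : ∀ q → shiftBy k (inflate k f) (q ℕ.* k) K.≈ shift f q
        val zero = shiftBy-< k _ 0 (ℕ.>-nonZero⁻¹ k)
        val (suc q) = K.trans (shiftBy-+ k (inflate k f) (q ℕ.* k)) (inflate-∣ k f q)
        off : ∀ n → ¬ (k ∣ n) → shiftBy k (inflate k f) n K.≈ K.0#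
        off n ne with ℕP.<-≤-connex n k
        ... | inj₁ n<k = shiftBy-< k _ n n<k
        ... | inj₂ k≤n = P.subst (λ m → shiftBy k (inflate k f) m K.≈ K.0#) (ℕP.m+[n∸m]≡n k≤n)
                  (K.trans (shiftBy-+ k _ (n ∸ k)) (inflate-∤ k f (n ∸ k)
                    (λ d → ne (P.subst (k ∣_) (ℕP.m+[n∸m]≡n k≤n) (∣m∣n⇒∣m+n ∣-refl d)))))

    shiftBy-≈[] : ∀ k .{{_ : NonZero k}} {f g} n → f ≈[ n ] g → shiftBy k f ≈[ suc n ] shiftBy k g
    shiftBy-≈[] (suc zero) n e zero l = K.refl
    shiftBy-≈[] (suc zero) n e (suc i) (s≤s l) = e i l
    shiftBy-≈[] (suc (suc k)) n e zero l = K.refl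
    shiftBy-≈[] (suc (suc k)) n e (suc i) (s≤s l) = shiftBy-≈[] (suc k) n e i (ℕP.m≤n⇒m≤1+n l)

    expand : ∀ f g → f * g ≈ const (f 0) * g + shift ((f ∘ suc) * g)
    expand f g zero = K.sym (K.+-idʳ _)
    expand f g (suc n) = K.+-congʳ _ (K.sym (conv-const (suc n) (f 0) g))

    -- Both sides obey the same recursion in f: f₀ times `inflate k g`, plus the k-fold shift of the
    -- same expression for the tail of f. As k > 0, each turn gains at least one coefficient of
    -- precision.
    inflate-* : ∀ k .{{_ : NonZero k}} f g → inflate k (f * g) ≈ inflate k f * inflate k g
    inflate-* k f g = ≈[]⇒≈ (λ n → upTo n f g)
      where
        left : ∀ f g → inflate k (f * g) ≈ const (f 0) * inflate k g + shiftBy k (inflate k ((f ∘ suc) * g))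
        left f g = trans (inflate-cong k (expand f g)) (trans (inflate-+ k _ _) (+-cong (inflate-scale k _ g) (inflate-shift k _)))
        one : ∀ c → inflate k (const c) ≈ const c
        one c = inflate-unique k (const c) (const c) (λ { zero → K.refl ; (suc q) → K.reflexive (nz k q) }) (λ { zero ne → ⊥-elim (ne (divides 0 P.refl)) ; (suc n) ne → K.refl })
          where
            nz : ∀ k .{{_ : NonZero k}} q → const c (k ℕ.+ q ℕ.* k) ≡ K.0#
            nz (suc k) q = P.refl
        right : ∀ f g → inflate k f * inflate k g ≈ const (f 0) * inflate k g + shiftBy k (inflate k (f ∘ suc) * inflate k g)
        right f g = begin
          inflate k f * inflate k g
            ≈⟨ *-congʳ _ (trans (inflate-cong k (head-tail f)) (trans (inflate-+ k _ _) (+-cong (one (f 0)) (inflate-shift k _)))) ⟩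
          (const (f 0) + shiftBy k (inflate k (f ∘ suc))) * inflate k g ≈⟨ distribʳ _ _ _ ⟩
          const (f 0) * inflate k g + shiftBy k (inflate k (f ∘ suc)) * inflate k g ≈⟨ +-congˡ _ (shiftBy-* k _ _) ⟩
          const (f 0) * inflate k g + shiftBy k (inflate k (f ∘ suc) * inflate k g) ∎
        upTo : ∀ n f g → inflate k (f * g) ≈[ n ] inflate k f * inflate k g
        upTo n f g = ≈[]-trans (≈⇒≈[] n (left f g)) (≈[]-trans (+-cong[] n (λ _ _ → K.refl) (step n)) (≈⇒≈[] n (sym (right f g))))
          where
            step : ∀ n → shiftBy k (inflate k ((f ∘ suc) * g)) ≈[ n ] shiftBy k (inflate k (f ∘ suc) * inflate k g)
            step zero i z≤n = K.trans (shiftBy-< k _ 0 (ℕ.>-nonZero⁻¹ k)) (K.sym (shiftBy-< k _ 0 (ℕ.>-nonZero⁻¹ k)))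
            step (suc n) = shiftBy-≈[] k n (upTo n (f ∘ suc) g)

    inflate-1 : ∀ k .{{_ : NonZero k}} → inflate k 1# ≈ 1#
    inflate-1 k = inflate-unique k 1# 1# (λ { zero → K.refl ; (suc q) → K.reflexive (nz k q) }) (λ { zero ne → ⊥-elim (ne (divides 0 P.refl)) ; (suc n) ne → K.refl })
      where
        nz : ∀ k .{{_ : NonZero k}} q → const K.1# (k ℕ.+ q ℕ.* k) ≡ K.0#
        nz (suc k) q = P.refl

    inflateHom : ∀ k .{{_ : NonZero k}} → Hom (PowerSeries.series K) (PowerSeries.series K)
    inflateHom k = record { fun = inflate k ; fun-cong = inflate-cong k ; fun-+ = inflate-+ k ; fun-* = inflate-* k ; fun-1 = inflate-1 k }

  boolAlg : F2Alg
  boolAlg = record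
    { Carrier = Bool ; _≈_ = _≡_ ; _+_ = _xor_ ; _*_ = _∧_ ; 0# = false ; 1# = true
    ; isEquivalence = P.isEquivalence
    ; +-cong = P.cong₂ _xor_ ; *-cong = P.cong₂ _∧_
    ; +-assoc = BoolP.xor-assoc ; +-comm = BoolP.xor-comm ; +-idˡ = λ _ → P.refl ; double = BoolP.xor-same
    ; *-assoc = BoolP.∧-assoc ; *-comm = BoolP.∧-comm ; *-idˡ = λ _ → P.refl
    ; distribʳ = λ a b c → BoolP.∧-distribʳ-xor a b c }

  bitHom : (K : F2Alg) → Hom boolAlg K
  bitHom K = record { fun = K.bit ; fun-cong = λ { P.refl → K.refl } ; fun-+ = K.bit-+ ; fun-* = K.bit-* ; fun-1 = K.refl }
    where module K = Ring K

  module Horner (K : F2Alg) where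
    open Ring K

    horner : Poly → Carrier → Carrier
    horner [] a = 0#
    horner (b ∷ f) a = bit b + a * horner f a

    horner-+ : ∀ f g a → horner (f +ₚ g) a ≈ horner f a + horner g a
    horner-+ [] g a = sym (+-idˡ _)
    horner-+ (b ∷ f) [] a = sym (+-idʳ _)
    horner-+ (b ∷ f) (c ∷ g) a = trans (+-cong (bit-+ b c) (*-congˡ a (horner-+ f g a)))
      (solve 5 (λ b c a f g → (b :+ c) :+ a :* (f :+ g) := (b :+ a :* f) :+ (c :+ a :* g)) refl _ _ _ _ _)

    horner-* : ∀ f g a → horner (f *ₚ g) a ≈ horner f a * horner g a
    horner-* [] g a = sym (zeroˡ _)
    horner-* (b ∷ f) g a = trans (horner-+ (if b then g else []) (false ∷ (f *ₚ g)) a)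
      (trans (+-cong (scale b) (+-congˡ _ (*-congˡ a (horner-* f g a))))
        (solve 4 (λ b a f g → b :* g :+ (O :+ a :* (f :* g)) := (b :+ a :* f) :* g) refl _ _ _ _))
      where
        scale : ∀ b → horner (if b then g else []) a ≈ bit b * horner g a
        scale true = sym (*-idˡ _)
        scale false = sym (zeroˡ _)

    horner-∘ : ∀ f h a → horner (f ∘ₚ h) a ≈ horner f (horner h a)
    horner-∘ [] h a = refl
    horner-∘ (b ∷ f) h a = trans (horner-+ (b ∷ []) (h *ₚ (f ∘ₚ h)) a)
      (+-cong (trans (+-congˡ _ (zeroʳ a)) (+-idʳ _)) (trans (horner-* h (f ∘ₚ h) a) (*-congˡ _ (horner-∘ f h a))))

    horner-cong : ∀ f {a b} → a ≈ b → horner f a ≈ horner f b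
    horner-cong [] e = refl
    horner-cong (b ∷ f) e = +-congˡ _ (*-cong e (horner-cong f e))

    horner-X : ∀ a → horner X a ≈ a
    horner-X = solve 1 (λ a → O :+ a :* (I :+ a :* O) := a) refl

    horner-𝟏 : ∀ a → horner 𝟏 a ≈ 1#
    horner-𝟏 = solve 1 (λ a → I :+ a :* O := I) refl

  module _ (K L : F2Alg) (h : Hom K L) where
    private
      module K = Ring K
      module L = Ring L
      module h = Hom h
      open Horner

    horner-fun : ∀ f a → h.fun (horner K f a) L.≈ horner L f (h.fun a)
    horner-fun [] a = h.fun-0
    horner-fun (b ∷ f) a = L.trans (h.fun-+ _ _) (L.+-cong (h.fun-bit b) (L.trans (h.fun-* _ _) (L.*-congˡ _ (horner-fun f a))))

-- Bilateral sums of series, indexed by the integers.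

module BilateralSums where
  open CharacteristicTwo
  open FormalSeries

  module BSum (K : F2Alg) where
    open Ring K

    abstract
      bsum : ℕ → (ℤ → Carrier) → Carrier
      bsum M t = sum (suc (M ℕ.+ M)) (λ i → t (i ⊖ M))

      top : ∀ M → suc (M ℕ.+ M) ⊖ M ≡ + suc M
      top M = P.trans (ℤP.⊖-≥ (ℕP.m≤n⇒m≤1+n (ℕP.m≤m+n M M))) (P.cong +_ (ℕP.m+n∸n≡m (suc M) M))

      bsum-extend : ∀ M t → bsum (suc M) t ≈ (t (+ suc M) + t -[1+ M ]) + bsum M t
      bsum-extend M t = begin
        sum (suc (suc M ℕ.+ suc M)) g ≈⟨ reflexive (P.cong (λ n → sum (suc (suc n)) g) (ℕP.+-suc M M)) ⟩
        g (suc (suc (M ℕ.+ M))) + sum (suc (suc (M ℕ.+ M))) g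
          ≈⟨ +-cong (reflexive (P.cong t (P.trans (ℤP.[1+m]⊖[1+n]≡m⊖n (suc (M ℕ.+ M)) M) (top M)))) (sum-front (suc (M ℕ.+ M)) g) ⟩
        t (+ suc M) + (t -[1+ M ] + sum (suc (M ℕ.+ M)) (λ i → t (suc i ⊖ suc M)))
          ≈⟨ +-congˡ _ (+-congˡ _ (sum-cong (suc (M ℕ.+ M)) (λ i → reflexive (P.cong t (ℤP.[1+m]⊖[1+n]≡m⊖n i M))))) ⟩
        t (+ suc M) + (t -[1+ M ] + bsum M t) ≈⟨ sym (+-assoc _ _ _) ⟩
        (t (+ suc M) + t -[1+ M ]) + bsum M t ∎
        where
            g : ℕ → Carrier
            g i = t (i ⊖ suc M)

      -- Moving the summand by one slides the window: one term enters on the right and one leaves on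
      -- the left. Both sit at the border, where `window` can discard them.
      bsum-suc : ∀ M t → bsum M (λ k → t (ℤ.suc k)) + t (0 ⊖ M) ≈ bsum M t + t (+ suc M)
      bsum-suc M t = begin
        sum (suc (M ℕ.+ M)) (λ i → t (ℤ.suc (i ⊖ M))) + t (0 ⊖ M)
          ≈⟨ +-congʳ _ (sum-cong (suc (M ℕ.+ M)) (λ i → reflexive (P.cong t (P.trans (ℤP.distribʳ-⊖-+-pos 1 i M) P.refl)))) ⟩
        sum (suc (M ℕ.+ M)) (λ i → t (suc i ⊖ M)) + t (0 ⊖ M) ≈⟨ +-comm _ _ ⟩
        t (0 ⊖ M) + sum (suc (M ℕ.+ M)) (λ i → t (suc i ⊖ M)) ≈⟨ sym (sum-front (suc (M ℕ.+ M)) (λ i → t (i ⊖ M))) ⟩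
        t (suc (M ℕ.+ M) ⊖ M) + bsum M t ≈⟨ +-congʳ _ (reflexive (P.cong t (top M))) ⟩
        t (+ suc M) + bsum M t ≈⟨ +-comm _ _ ⟩
        bsum M t + t (+ suc M) ∎

      bsum-cong : ∀ M {t s} → (∀ k → t k ≈ s k) → bsum M t ≈ bsum M s
      bsum-cong M e = sum-cong (suc (M ℕ.+ M)) (λ i → e (i ⊖ M))

      bsum-0 : ∀ t → bsum 0 t ≈ t (+ 0)
      bsum-0 t = +-idʳ _

      bsum-+ : ∀ M t s → bsum M (λ k → t k + s k) ≈ bsum M t + bsum M s
      bsum-+ M t s = sum-+ (suc (M ℕ.+ M)) _ _

      bsum-*ˡ : ∀ M c t → c * bsum M t ≈ bsum M (λ k → c * t k)
      bsum-*ˡ M c t = sum-*ˡ (suc (M ℕ.+ M)) c _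

      bsum-*ʳ : ∀ M c t → bsum M t * c ≈ bsum M (λ k → t k * c)
      bsum-*ʳ M c t = sum-*ʳ (suc (M ℕ.+ M)) c _

      bsum-swap : ∀ M N (f : ℤ → ℤ → Carrier) → bsum M (λ k → bsum N (f k)) ≈ bsum N (λ l → bsum M (λ k → f k l))
      bsum-swap M N f = sum-swap (suc (M ℕ.+ M)) (suc (N ℕ.+ N)) _

      bsum-sq : ∀ M t → sq (bsum M t) ≈ bsum M (λ k → sq (t k))
      bsum-sq M t = sq-sum (suc (M ℕ.+ M)) _

      bsum-sum : ∀ M n (f : ℕ → ℤ → Carrier) → sum n (λ j → bsum M (f j)) ≈ bsum M (λ k → sum n (λ j → f j k))
      bsum-sum M n f = sum-swap n (suc (M ℕ.+ M)) _

      bsum-as-sum : ∀ M t → bsum M t ≈ sum (suc (M ℕ.+ M)) (λ i → t (i ⊖ M))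
      bsum-as-sum M t = refl

    bsum-neg : ∀ M t → bsum M (λ k → t (ℤ.- k)) ≈ bsum M t
    bsum-neg zero t = trans (bsum-0 _) (sym (bsum-0 t))
    bsum-neg (suc M) t = trans (bsum-extend M (λ k → t (ℤ.- k))) (trans (+-cong (+-comm _ _) (bsum-neg M t)) (sym (bsum-extend M t)))

    bsum-pairs : ∀ M t → bsum M t ≈ t (+ 0) + sum M (λ i → t (+ suc i) + t -[1+ i ])
    bsum-pairs zero t = trans (bsum-0 t) (sym (+-idʳ _))
    bsum-pairs (suc M) t = trans (bsum-extend M t) (trans (+-congˡ _ (bsum-pairs M t))
      (solve 3 (λ a b c → a :+ (b :+ c) := b :+ (a :+ c)) refl _ _ _))

    bsum-even : ∀ M t → (∀ k → t (ℤ.suc (k ℤ.+ k)) ≈ 0#) → bsum (M ℕ.+ M) t ≈ bsum M (λ k → t (k ℤ.+ k))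
    bsum-even zero t z = trans (bsum-0 t) (sym (bsum-0 _))
    bsum-even (suc M) t z = begin
      bsum (suc (M ℕ.+ suc M)) t ≈⟨ reflexive (P.cong (λ n → bsum (suc n) t) (ℕP.+-suc M M)) ⟩
      bsum (suc (suc (M ℕ.+ M))) t ≈⟨ trans (bsum-extend (suc (M ℕ.+ M)) t) (+-congˡ _ (bsum-extend (M ℕ.+ M) t)) ⟩
      (t (+ suc (suc (M ℕ.+ M))) + t -[1+ suc (M ℕ.+ M) ]) + ((t (+ suc (M ℕ.+ M)) + t -[1+ M ℕ.+ M ]) + bsum (M ℕ.+ M) t)
        ≈⟨ +-cong (+-congʳ _ (reflexive (P.cong (λ n → t (+ suc n)) (P.sym (ℕP.+-suc M M)))))
             (trans (+-cong (trans (+-cong (z (+ M)) (trans (reflexive (P.cong t (neg M))) (z -[1+ M ]))) (+-idˡ _)) (bsum-even M t z)) (+-idˡ _)) ⟩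
      (t (+ suc M ℤ.+ + suc M) + t (-[1+ M ] ℤ.+ -[1+ M ])) + bsum M (λ k → t (k ℤ.+ k)) ≈⟨ sym (bsum-extend M (λ k → t (k ℤ.+ k))) ⟩
      bsum (suc M) (λ k → t (k ℤ.+ k)) ∎
      where
        neg : ∀ M → -[1+ M ℕ.+ M ] ≡ ℤ.suc (-[1+ M ] ℤ.+ -[1+ M ])
        neg M = P.refl

  module BilateralSeries (K : F2Alg) where
    private
      module K where
        open Ring K public
        open BSum K public
    open Series K
    open BSum (PowerSeries.series K)

    -- Divisibility of the k-th term by the |k|-th power of the variable makes the bilateral sum
    -- converge: coefficient n sees only |k| ≤ n, which is why `ΣZ` takes the window of radius n
    -- there.
    Good : (ℤ → Carrier) → Set
    Good t = ∀ k i → i < ∣ k ∣ → t k i K.≈ K.0#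

    ΣZ : (ℤ → Carrier) → Carrier
    ΣZ t n = bsum n t n

    bsum-cong[] : ∀ n M {t s} → (∀ k → t k ≈[ n ] s k) → bsum M t ≈[ n ] bsum M s
    bsum-cong[] n M {t} {s} e = ≈[]-trans (≈⇒≈[] n (bsum-as-sum M t)) (≈[]-trans (sum-cong[] n (suc (M ℕ.+ M)) (λ i → e (i ⊖ M))) (≈⇒≈[] n (sym (bsum-as-sum M s))))

    ΣZ-≈ : ∀ {t} → Good t → ∀ n M → n ≤ M → ΣZ t ≈[ n ] bsum M t
    ΣZ-≈ {t} g n M n≤M i i≤n = K.trans (grow (M ∸ i)) (K.reflexive (P.cong (λ m → bsum m t i) (ℕP.m∸n+n≡m (ℕP.≤-trans i≤n n≤M))))
      where
        grow : ∀ d → bsum i t i K.≈ bsum (d ℕ.+ i) t i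
        grow zero = K.refl
        grow (suc d) = K.trans (grow d) (K.sym (K.trans (bsum-extend (d ℕ.+ i) t i)
          (K.trans (K.+-congʳ _ (K.trans (K.+-cong (g _ i (s≤s (ℕP.m≤n+m i d))) (g _ i (s≤s (ℕP.m≤n+m i d)))) (K.+-idˡ _))) (K.+-idˡ _))))

    ΣZ-cong : ∀ {t s} → (∀ k → t k ≈ s k) → ΣZ t ≈ ΣZ s
    ΣZ-cong e n = bsum-cong n e n

    ΣZ-+ : ∀ t s → ΣZ (λ k → t k + s k) ≈ ΣZ t + ΣZ s
    ΣZ-+ t s n = bsum-+ n t s n

    ΣZ-sum : ∀ m (f : ℕ → ℤ → Carrier) → sum m (λ j → ΣZ (f j)) ≈ ΣZ (λ k → sum m (λ j → f j k))
    ΣZ-sum m f n = K.trans (sum-at m _ n) (K.trans (K.sym (sum-at m (λ j → bsum n (f j)) n)) (bsum-sum n m f n))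

    ΣZ-neg : ∀ t → ΣZ (λ k → t (ℤ.- k)) ≈ ΣZ t
    ΣZ-neg t n = bsum-neg n t n

    good-sq : ∀ {t} → Good t → Good (λ k → sq (t k))
    good-sq g k i l = K.trans (conv-cong≤ i (λ j m → g k j (ℕP.≤-trans (s≤s m) l)) (λ _ _ → K.refl)) (zeroˡ _ i)

    good-+ : ∀ {t s} → Good t → Good s → Good (λ k → t k + s k)
    good-+ g h k i l = K.trans (K.+-cong (g k i l) (h k i l)) (K.+-idˡ _)

    ΣZ-sq : ∀ {t} → Good t → sq (ΣZ t) ≈ ΣZ (λ k → sq (t k))
    ΣZ-sq {t} g = ≈[]⇒≈ (λ n → ≈[]-trans (*-cong[] n (ΣZ-≈ g n n ℕP.≤-refl) (ΣZ-≈ g n n ℕP.≤-refl))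
      (≈[]-trans (≈⇒≈[] n (bsum-sq n t)) (≈[]-sym (ΣZ-≈ (good-sq g) n n ℕP.≤-refl))))

    ΣZ-even : ∀ {t s} → Good t → Good s → (∀ k → t (ℤ.suc (k ℤ.+ k)) ≈ 0#) → (∀ k → t (k ℤ.+ k) ≈ s k) → ΣZ t ≈ ΣZ s
    ΣZ-even {t} {s} g h z e = ≈[]⇒≈ (λ n → ≈[]-trans (ΣZ-≈ g n (n ℕ.+ n) (ℕP.m≤m+n n n))
      (≈[]-trans (≈⇒≈[] n (trans (bsum-even n t z) (bsum-cong n e))) (≈[]-sym (ΣZ-≈ h n n ℕP.≤-refl))))

    private
      Van : ℕ → (ℤ → Carrier) → Set
      Van n t = ∀ k → n < ∣ k ∣ → t k ≈[ n ] 0#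

      drop2 : ∀ n {a b x y} → x ≈[ n ] 0# → y ≈[ n ] 0# → a + x ≈ b + y → a ≈[ n ] b
      drop2 n ex ey e i l = K.trans (K.sym (K.trans (K.+-congˡ _ (ex i l)) (K.+-idʳ _))) (K.trans (e i) (K.trans (K.+-congˡ _ (ey i l)) (K.+-idʳ _)))

      window⁺ : ∀ n M t → Van n t → ∀ c → c ℕ.+ n ≤ M → bsum M (λ l → t (+ c ℤ.+ l)) ≈[ n ] bsum M t
      window⁺ n M t v zero l = ≈⇒≈[] n (bsum-cong M (λ k → reflexive (P.cong t (ℤP.+-identityˡ k))))
      window⁺ n M t v (suc c) l = ≈[]-trans (≈⇒≈[] n (bsum-cong M (λ k → reflexive (P.cong t (assoc k)))))
        (≈[]-trans (drop2 n (v _ left) (v _ right) (bsum-suc M (λ k → t (+ c ℤ.+ k)))) (window⁺ n M t v c (ℕP.≤-trans (ℕP.n≤1+n _) l)))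
        where
          assoc : ∀ k → + suc c ℤ.+ k ≡ + c ℤ.+ ℤ.suc k
          assoc k = P.trans (P.cong (ℤ._+ k) (P.cong +_ (ℕP.+-comm 1 c))) (ℤP.+-assoc (+ c) (+ 1) k)
          c≤M : c ≤ M
          c≤M = ℕP.≤-trans (ℕP.m≤m+n c n) (ℕP.≤-trans (ℕP.n≤1+n _) l)
          left : n < ∣ + c ℤ.+ (0 ⊖ M) ∣
          left = P.subst (n <_) (P.sym (P.trans (P.cong ∣_∣ (ℤP.distribʳ-⊖-+-pos c 0 M)) (P.trans (P.cong (λ m → ∣ m ⊖ M ∣) (ℕP.+-identityʳ c)) (ℤP.∣⊖∣-≤ c≤M))))
            (ℕP.m+n≤o⇒m≤o∸n (suc n) (P.subst (_≤ M) (P.cong suc (ℕP.+-comm c n)) l))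
          right : n < ∣ + c ℤ.+ + suc M ∣
          right = ℕP.≤-trans (s≤s (ℕP.≤-trans (ℕP.m≤n+m n (suc c)) l)) (ℕP.m≤n+m (suc M) c)

    -- Translation invariance of bilateral sums. Modulo the (n+1)-st power of the variable only
    -- arguments of absolute value at most n count, and radius |c| + n contains all of them both
    -- before and after the translation.
    window : ∀ n M t → Van n t → ∀ c → ∣ c ∣ ℕ.+ n ≤ M → bsum M (λ l → t (c ℤ.+ l)) ≈[ n ] bsum M t
    window n M t v (+ c) l = window⁺ n M t v c l
    window n M t v -[1+ c ] l = ≈[]-trans (≈⇒≈[] n (trans (sym (bsum-neg M _)) (bsum-cong M (λ k → reflexive (P.cong t (P.sym (ℤP.neg-distrib-+ (+ suc c) k)))))))
      (≈[]-trans (window⁺ n M (λ k → t (ℤ.- k)) (λ k h → v _ (P.subst (n <_) (P.sym (ℤP.∣-i∣≡∣i∣ k)) h)) (suc c) l) (≈⇒≈[] n (bsum-neg M t)))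

    good-van : ∀ {t} → Good t → ∀ n → Van n t
    good-van g n k h i l = g k i (ℕP.≤-trans (s≤s l) h)

    private
      inner : ∀ {t s} → Good t → Good s → ∀ n (f : ℤ → ℤ → ℤ) →
              (∀ c → ∣ c ∣ ≤ n → bsum (n ℕ.+ n) (λ l → t (f c l)) ≈[ n ] bsum (n ℕ.+ n) t) →
              bsum (n ℕ.+ n) (λ k → bsum (n ℕ.+ n) (λ l → t (f k l) * s k)) ≈[ n ] ΣZ t * ΣZ s
      inner {t} {s} gt gs n f w = ≈[]-trans (bsum-cong[] n (n ℕ.+ n) step)
          (≈[]-trans (≈⇒≈[] n (sym (bsum-*ˡ (n ℕ.+ n) _ s))) (*-cong[] n (λ _ _ → K.refl) (≈[]-sym (ΣZ-≈ gs n _ (ℕP.m≤m+n n n)))))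
        where
          step : ∀ k → bsum (n ℕ.+ n) (λ l → t (f k l) * s k) ≈[ n ] ΣZ t * s k
          step k with ℕP.≤-<-connex ∣ k ∣ n
          ... | inj₁ k≤n = ≈[]-trans (≈⇒≈[] n (sym (bsum-*ʳ (n ℕ.+ n) (s k) _)))
                  (*-cong[] n (≈[]-trans (w k k≤n) (≈[]-sym (ΣZ-≈ gt n _ (ℕP.m≤m+n n n)))) (λ _ _ → K.refl))
          ... | inj₂ n<k = ≈[]-trans (≈⇒≈[] n (sym (bsum-*ʳ (n ℕ.+ n) (s k) _)))
                  (≈[]-trans (*-cong[] n (λ _ _ → K.refl) (good-van gs n k n<k))
                    (≈[]-trans (≈⇒≈[] n (trans (zeroʳ _) (sym (zeroʳ _)))) (*-cong[] n (λ _ _ → K.refl) (≈[]-sym (good-van gs n k n<k)))))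

    -- The termwise identity, summed over all k and l, splits into four double sums pairing `u₊` or
    -- `u₋` with one of the squares. For a fixed index in the square the inner sum is a translate
    -- (possibly reflected) of a full bilateral sum, so it factors out; in characteristic two the
    -- squares then add up to the square of the sum.
    bilinear : ∀ {u u′ u₊ u₋} → Good u → Good u′ → Good u₊ → Good u₋ →
               (∀ k l → u k * u′ l ≈ (u₊ (k ℤ.+ l) + u₋ (k ℤ.- l)) * (sq (u k) + sq (u′ l))) →
               ΣZ u * ΣZ u′ ≈ (ΣZ u₊ + ΣZ u₋) * sq (ΣZ u + ΣZ u′)
    bilinear {u} {u′} {u₊} {u₋} g g′ g₊ g₋ e = ≈[]⇒≈ at
      where
        at : ∀ n → ΣZ u * ΣZ u′ ≈[ n ] (ΣZ u₊ + ΣZ u₋) * sq (ΣZ u + ΣZ u′)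
        at n = ≈[]-trans (*-cong[] n (ΣZ-≈ g n M n≤M) (ΣZ-≈ g′ n M n≤M)) (≈[]-trans (≈⇒≈[] n expandAll)
            (≈[]-trans (+-cong[] n (+-cong[] n plus₁ minus₁) (+-cong[] n plus₂ minus₂)) (≈⇒≈[] n collect)))
          where
            -- Radius 2n leaves room for a translation by any |c| ≤ n; outer indices beyond n
            -- contribute nothing at this precision.
            M = n ℕ.+ n
            n≤M = ℕP.m≤m+n n n
            s = λ k → sq (u k)
            s′ = λ k → sq (u′ k)
            gs = good-sq g
            gs′ = good-sq g′
            expandAll : bsum M u * bsum M u′ ≈
              (bsum M (λ k → bsum M (λ l → u₊ (k ℤ.+ l) * s k)) + bsum M (λ k → bsum M (λ l → u₋ (k ℤ.- l) * s k))) +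
              (bsum M (λ l → bsum M (λ k → u₊ (l ℤ.+ k) * s′ l)) + bsum M (λ l → bsum M (λ k → u₋ (k ℤ.- l) * s′ l)))
            expandAll = begin
              bsum M u * bsum M u′ ≈⟨ bsum-*ʳ M _ u ⟩
              bsum M (λ k → u k * bsum M u′) ≈⟨ bsum-cong M (λ k → bsum-*ˡ M (u k) u′) ⟩
              bsum M (λ k → bsum M (λ l → u k * u′ l))
                ≈⟨ bsum-cong M (λ k → bsum-cong M (λ l → trans (e k l) (solve 4 (λ a b c d → (a :+ b) :* (c :+ d) := (a :* c :+ b :* c) :+ (a :* d :+ b :* d)) refl _ _ _ _))) ⟩
              bsum M (λ k → bsum M (λ l → (u₊ (k ℤ.+ l) * s k + u₋ (k ℤ.- l) * s k) + (u₊ (k ℤ.+ l) * s′ l + u₋ (k ℤ.- l) * s′ l)))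
                ≈⟨ bsum-cong M (λ k → trans (bsum-+ M _ _) (+-cong (bsum-+ M _ _) (bsum-+ M _ _))) ⟩
              bsum M (λ k → (bsum M (λ l → u₊ (k ℤ.+ l) * s k) + bsum M (λ l → u₋ (k ℤ.- l) * s k)) + (bsum M (λ l → u₊ (k ℤ.+ l) * s′ l) + bsum M (λ l → u₋ (k ℤ.- l) * s′ l)))
                ≈⟨ trans (bsum-+ M _ _) (+-cong (bsum-+ M _ _) (bsum-+ M _ _)) ⟩
              (bsum M (λ k → bsum M (λ l → u₊ (k ℤ.+ l) * s k)) + bsum M (λ k → bsum M (λ l → u₋ (k ℤ.- l) * s k))) +
              (bsum M (λ k → bsum M (λ l → u₊ (k ℤ.+ l) * s′ l)) + bsum M (λ k → bsum M (λ l → u₋ (k ℤ.- l) * s′ l)))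
                ≈⟨ +-congˡ _ (+-cong (trans (bsum-swap M M _) (bsum-cong M (λ l → bsum-cong M (λ k → *-congʳ _ (reflexive (P.cong u₊ (ℤP.+-comm k l))))))) (bsum-swap M M _)) ⟩
              _ ∎
            win : ∀ {t} → Good t → ∀ c → ∣ c ∣ ≤ n → bsum M (λ l → t (c ℤ.+ l)) ≈[ n ] bsum M t
            win gt c h = window n M _ (good-van gt n) c (ℕP.+-monoˡ-≤ n h)
            win⁻ : ∀ {t} → Good t → ∀ c → ∣ c ∣ ≤ n → bsum M (λ l → t (c ℤ.- l)) ≈[ n ] bsum M t
            win⁻ {t} gt c h = ≈[]-trans (≈⇒≈[] n (bsum-neg M (λ l → t (c ℤ.+ l)))) (win gt c h)
            winʳ : ∀ {t} → Good t → ∀ c → ∣ c ∣ ≤ n → bsum M (λ k → t (k ℤ.- c)) ≈[ n ] bsum M t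
            winʳ {t} gt c h = ≈[]-trans (≈⇒≈[] n (bsum-cong M (λ k → reflexive (P.cong t (ℤP.+-comm k (ℤ.- c)))))) (win gt (ℤ.- c) (P.subst (_≤ n) (P.sym (ℤP.∣-i∣≡∣i∣ c)) h))
            plus₁ = inner g₊ gs n (λ k l → k ℤ.+ l) (win g₊)
            minus₁ = inner g₋ gs n (λ k l → k ℤ.- l) (win⁻ g₋)
            plus₂ = inner g₊ gs′ n (λ k l → k ℤ.+ l) (win g₊)
            minus₂ = inner g₋ gs′ n (λ l k → k ℤ.- l) (winʳ g₋)
            collect : (ΣZ u₊ * ΣZ s + ΣZ u₋ * ΣZ s) + (ΣZ u₊ * ΣZ s′ + ΣZ u₋ * ΣZ s′) ≈ (ΣZ u₊ + ΣZ u₋) * sq (ΣZ u + ΣZ u′)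
            collect = trans (solve 4 (λ a b c d → (a :* c :+ b :* c) :+ (a :* d :+ b :* d) := (a :+ b) :* (c :+ d)) refl _ _ _ _)
              (*-congˡ _ (trans (+-cong (sym (ΣZ-sq g)) (sym (ΣZ-sq g′))) (sym (sq-+ _ _))))

-- The kernels of 𝕏 and 𝕎, and the addition identity for a single pair of terms.

module LambertSeries where
  open import Data.Integer.Divisibility.Signed as ℤD using (_∣?_)
  open CharacteristicTwo
  open FormalSeries
  open Homomorphisms
  open BilateralSums

  -- In characteristic two v/(1 + v²) is the sum of v^d over odd d, and v/(1 + v + v²) the sum over
  -- d prime to 3: `odd` and `non3` are the coefficients of 1/(v + v⁻¹) and 1/(1 + v + v⁻¹).
  odd : ℕ → Bool
  odd zero = false
  odd (suc n) = not (odd n)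

  non3 : ℕ → Bool
  non3 zero = false
  non3 (suc zero) = true
  non3 (suc (suc zero)) = true
  non3 (suc (suc (suc n))) = non3 n

  int : ∀ {m n} → m ≡ n → + m ≡ + n
  int P.refl = P.refl

  module Lambert (S : F2Alg) where
    private module S = Ring S
    open Series S
    open Inflate S
    open BilateralSeries S

    pows : (ℕ → Bool) → S.Carrier → Carrier
    pows c a d = S.bit (c d) S.* a S.^ d

    -- The kernel with coefficients c, expanded at v = a yⁿ.
    τ : (ℕ → Bool) → S.Carrier → ℕ → Carrier
    τ c a n = inflate n (pows c a)

    record Unit : Set where
      constructor unit
      field
        pos neg hyp : S.Carrier
        inv : pos S.* neg S.≈ S.1#

    open Unit public

    _⁻¹ : Unit → Unit
    unit a b c e ⁻¹ = unit b a c (S.trans (S.*-comm b a) e)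

    -- hyp stands for 1/(u + u⁻¹), the value at k = 0.
    Nontrivial : Unit → Set
    Nontrivial u = hyp u S.* (pos u S.+ neg u) S.≈ S.1#

    -- Both kernels are invariant under v ↦ v⁻¹, so for k < 0 the term at v = u y^k is expanded in
    -- v⁻¹. At k = 0 there is no expansion parameter, and the value z must be supplied.
    term : (ℕ → Bool) → S.Carrier → Unit → ℤ → Carrier
    term c z u (+ zero) = const z
    term c z u (+ suc n) = τ c (pos u) (suc n)
    term c z u -[1+ n ] = τ c (neg u) (suc n)

    term-flip : ∀ c z u k → term c z (u ⁻¹) (ℤ.- k) ≈ term c z u k
    term-flip c z u (+ zero) = refl
    term-flip c z u (+ suc n) = refl
    term-flip c z u -[1+ n ] = refl

    τ-good : ∀ c a n → c 0 ≡ false → ∀ i → i < n → τ c a n i S.≈ S.0#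
    τ-good c a n c0 i l with n ℕD.∣? i
    ... | no _ = S.refl
    ... | yes (ℕD.divides zero e) = S.trans (S.*-congʳ _ (S.reflexive (P.cong S.bit c0))) (S.zeroˡ _)
    ... | yes (ℕD.divides (suc q) P.refl) = ⊥-elim (ℕP.<⇒≱ l (ℕP.m≤m+n n (q ℕ.* n)))

    term-good : ∀ c z u → c 0 ≡ false → Good (term c z u)
    term-good c z u c0 (+ zero) i ()
    term-good c z u c0 (+ suc n) i l = τ-good c _ (suc n) c0 i l
    term-good c z u c0 -[1+ n ] i l = τ-good c _ (suc n) c0 i l

    φ : Unit → ℤ → Carrier
    φ u = term odd (hyp u) u

    mono : S.Carrier → ℕ → Carrier
    mono a n = shiftBy n (const a)

    inflate-mono : ∀ n .{{_ : NonZero n}} a → inflate n (mono a 1) ≈ mono a n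
    inflate-mono n a = trans (inflate-shift n (const a)) (shiftBy-cong n
      (trans (inflate-cong n (sym (*-idʳ _))) (trans (inflate-scale n a 1#) (trans (*-congˡ _ (inflate-1 n)) (*-idʳ _)))))

    mono-* : ∀ a b m n → mono a m * mono b n ≈ mono (a S.* b) (m ℕ.+ n)
    mono-* a b m n = trans (shiftBy-* m _ _) (trans (shiftBy-cong m (trans (*-comm _ _) (trans (shiftBy-* n _ _)
      (shiftBy-cong n (trans (sym (const-* b a)) (const-cong (S.*-comm b a))))))) (reflexive (shift-shift m n)))
      where
        shift-shift : ∀ {f} m n → shiftBy m (shiftBy n f) ≡ shiftBy (m ℕ.+ n) f
        shift-shift zero n = P.refl
        shift-shift (suc m) n = P.cong shift (shift-shift m n)

    mono-cong : ∀ {a b} n → a S.≈ b → mono a n ≈ mono b n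
    mono-cong n e = shiftBy-cong n (const-cong e)

    -- Says x = 1/(m + m⁻¹) without inverting m; the regular denominator makes x unique.
    IsΦ : Carrier → Carrier → Set
    IsΦ x m = x * (1# + sq m) ≈ m × Reg (1# + sq m)

    private
      tail-rec : ∀ a → pows odd a ≈ mono a 1 + sq (mono a 1) * pows odd a
      tail-rec a = begin
        pows odd a ≈⟨ pointwise ⟩
        mono a 1 + mono (a S.* a) 2 * pows odd a ≈⟨ +-congˡ _ (*-congʳ _ (sym (mono-* a a 1 1))) ⟩
        mono a 1 + sq (mono a 1) * pows odd a ∎
        where
          pointwise : pows odd a ≈ mono a 1 + mono (a S.* a) 2 * pows odd a
          pointwise n = S.trans (h n) (S.+-congˡ _ (S.sym (shiftBy-* 2 (const (a S.* a)) (pows odd a) n)))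
            where
              h : ∀ n → pows odd a n S.≈ mono a 1 n S.+ shiftBy 2 (const (a S.* a) * pows odd a) n
              h zero = S.solve 0 (S.O S.:* S.I S.:= S.O S.:+ S.O) S.refl
              h (suc zero) = S.solve 1 (λ a → S.I S.:* (a S.:* S.I) S.:= a S.:+ S.O) S.refl a
              h (suc (suc n)) = S.trans (S.trans (S.*-congʳ _ (S.reflexive (P.cong S.bit (BoolNot (odd n)))))
                (S.solve 3 (λ b a c → b S.:* (a S.:* (a S.:* c)) S.:= S.O S.:+ (a S.:* a) S.:* (b S.:* c)) S.refl (S.bit (odd n)) a (a S.^ n)))
                (S.+-cong (zeroAt n) (S.sym (conv-const n (a S.* a) (pows odd a))))
                where
                  BoolNot : ∀ b → not (not b) ≡ b
                  BoolNot true = P.refl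
                  BoolNot false = P.refl
                  zeroAt : ∀ n → S.0# S.≈ mono a 1 (suc (suc n))
                  zeroAt zero = S.refl
                  zeroAt (suc n) = S.refl

    reg-1+sq : ∀ a n → Reg (1# + sq (mono a (suc n)))
    reg-1+sq a n = reg-0 (S.reg-cong (S.sym (S.trans (S.+-congˡ _ (S.zeroˡ _)) (S.+-idʳ _))) S.reg-1)

    isΦ-τ : ∀ a n → IsΦ (τ odd a (suc n)) (mono a (suc n))
    isΦ-τ a n = e , reg-1+sq a n
      where
        x = τ odd a (suc n)
        m = mono a (suc n)
        r : x ≈ m + sq m * x
        r = trans (inflate-cong (suc n) (tail-rec a)) (trans (inflate-+ (suc n) _ _) (+-cong (inflate-mono (suc n) a)
          (trans (inflate-* (suc n) _ _) (*-congʳ _ (trans (inflate-* (suc n) _ _) (sq-cong (inflate-mono (suc n) a)))))))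
        e : x * (1# + sq m) ≈ m
        e = trans (solve 2 (λ x s → x :* (I :+ s) := x :+ s :* x) refl x (sq m)) (trans (+-congʳ _ r)
          (solve 2 (λ m y → (m :+ y) :+ y := m) refl m (sq m * x)))

    -- Here 1 + u² = u (u⁻¹ + u) is a unit of the coefficient ring, because `hyp u` inverts the
    -- second factor.
    isΦ-0 : ∀ u → Nontrivial u → IsΦ (const (hyp u)) (mono (pos u) 0)
    isΦ-0 (unit a b c i) nt = trans (trans (*-congˡ _ one+) (sym (const-* c (a S.* (b S.+ a))))) (const-cong v) ,
      reg-cong (sym one+) (reg-unit {const (a S.* (b S.+ a))} {const (b S.* c)} (trans (sym (const-* _ _)) (const-cong w)))
      where
        one+ : 1# + sq (const a) ≈ const (a S.* (b S.+ a))
        one+ = trans (+-cong (const-cong (S.sym i)) (sym (const-* a a))) (trans (sym (const-+ _ _)) (const-cong (S.sym (S.distribˡ a b a))))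
        v : c S.* (a S.* (b S.+ a)) S.≈ a
        v = S.trans (S.solve 3 (λ a b c → c S.:* (a S.:* (b S.:+ a)) S.:= (c S.:* (a S.:+ b)) S.:* a) S.refl a b c) (S.trans (S.*-congʳ a nt) (S.*-idˡ a))
        w : (a S.* (b S.+ a)) S.* (b S.* c) S.≈ S.1#
        w = S.trans (S.solve 3 (λ a b c → (a S.:* (b S.:+ a)) S.:* (b S.:* c) S.:= (a S.:* b) S.:* (c S.:* (a S.:+ b))) S.refl a b c)
              (S.trans (S.*-cong i nt) (S.*-idˡ _))

    isΦ : ∀ u n → (n ≡ 0 → Nontrivial u) → IsΦ (φ u (+ n)) (mono (pos u) n)
    isΦ u zero nt = isΦ-0 u (nt P.refl)
    isΦ u (suc n) _ = isΦ-τ (pos u) n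

    isΦ-cong : ∀ {x m m′} → m ≈ m′ → IsΦ x m → IsΦ x m′
    isΦ-cong e (h , r) = trans (*-congˡ _ (+-congˡ _ (sq-cong (sym e)))) (trans h e) , reg-cong (+-congˡ _ (sq-cong e)) r

    isΦ-unique : ∀ {x y m} → IsΦ x m → IsΦ y m → x ≈ y
    isΦ-unique {x} {y} {m} (e , r) (h , _) = cancel r (trans (*-comm _ x) (trans e (sym (trans (*-comm _ y) h))))

    -- With φ = 1/(u + u⁻¹) this is (uv + 1/uv)(u/v + v/u) = (u + 1/u)² + (v + 1/v)² and
    -- (uv + 1/uv) + (u/v + v/u) = (u + 1/u)(v + 1/v).
    φ-addition : ∀ {x₁ x₂ x₃ x₄ m w} → IsΦ x₁ (m * w) → IsΦ x₂ m → IsΦ x₃ (m * w * m) → IsΦ x₄ w →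
                 x₁ * x₂ ≈ (x₃ + x₄) * (sq x₁ + sq x₂)
    φ-addition {x₁} {x₂} {x₃} {x₄} {m} {w} (e₁ , r₁) (e₂ , r₂) (e₃ , r₃) (e₄ , r₄) =
      cancel (reg-* (reg-* (reg-* r₁ r₁) (reg-* r₂ r₂)) (reg-* r₃ r₄)) (begin
        ((d₁ * d₁) * (d₂ * d₂) * (d₃ * d₄)) * (x₁ * x₂)
          ≈⟨ solve 6 (λ d₁ d₂ d₃ d₄ x₁ x₂ → ((d₁ :* d₁) :* (d₂ :* d₂) :* (d₃ :* d₄)) :* (x₁ :* x₂) := ((x₁ :* d₁) :* (x₂ :* d₂)) :* ((d₁ :* d₂) :* (d₃ :* d₄))) refl d₁ d₂ d₃ d₄ x₁ x₂ ⟩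
        ((x₁ * d₁) * (x₂ * d₂)) * ((d₁ * d₂) * (d₃ * d₄)) ≈⟨ *-congʳ _ (*-cong e₁ e₂) ⟩
        ((m * w) * m) * ((d₁ * d₂) * (d₃ * d₄))
          ≈⟨ solve 2 (λ m w → ((m :* w) :* m) :* (((I :+ (m :* w) :* (m :* w)) :* (I :+ m :* m)) :* ((I :+ (m :* w :* m) :* (m :* w :* m)) :* (I :+ w :* w)))
               := ((m :* w :* m) :* (I :+ w :* w) :+ w :* (I :+ (m :* w :* m) :* (m :* w :* m))) :* (((m :* w) :* (I :+ m :* m)) :* ((m :* w) :* (I :+ m :* m)) :+ (m :* (I :+ (m :* w) :* (m :* w))) :* (m :* (I :+ (m :* w) :* (m :* w))))) refl m w ⟩
        ((m * w * m) * d₄ + w * d₃) * (sq ((m * w) * d₂) + sq (m * d₁))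
          ≈⟨ sym (*-cong (+-cong (*-congʳ d₄ e₃) (*-congʳ d₃ e₄)) (+-cong (sq-cong (*-congʳ d₂ e₁)) (sq-cong (*-congʳ d₁ e₂)))) ⟩
        (x₃ * d₃ * d₄ + x₄ * d₄ * d₃) * (sq (x₁ * d₁ * d₂) + sq (x₂ * d₂ * d₁))
          ≈⟨ rearr d₁ d₂ d₃ d₄ x₁ x₂ x₃ x₄ ⟩
        ((d₁ * d₁) * (d₂ * d₂) * (d₃ * d₄)) * ((x₃ + x₄) * (sq x₁ + sq x₂)) ∎)
      where
        d₁ = 1# + sq (m * w)
        d₂ = 1# + sq m
        d₃ = 1# + sq (m * w * m)
        d₄ = 1# + sq w
        rearr : ∀ d₁ d₂ d₃ d₄ x₁ x₂ x₃ x₄ → (x₃ * d₃ * d₄ + x₄ * d₄ * d₃) * (sq (x₁ * d₁ * d₂) + sq (x₂ * d₂ * d₁)) ≈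
                ((d₁ * d₁) * (d₂ * d₂) * (d₃ * d₄)) * ((x₃ + x₄) * (sq x₁ + sq x₂))
        rearr d₁ d₂ d₃ d₄ x₁ x₂ x₃ x₄ = begin
          (x₃ * d₃ * d₄ + x₄ * d₄ * d₃) * (sq (x₁ * d₁ * d₂) + sq (x₂ * d₂ * d₁))
            ≈⟨ *-cong (solve 4 (λ a b c d → a :* c :* d :+ b :* d :* c := (a :+ b) :* (c :* d)) refl x₃ x₄ d₃ d₄)
                 (solve 4 (λ a b c d → (a :* c :* d) :* (a :* c :* d) :+ (b :* d :* c) :* (b :* d :* c) := (a :* a :+ b :* b) :* ((c :* c) :* (d :* d))) refl x₁ x₂ d₁ d₂) ⟩
          ((x₃ + x₄) * (d₃ * d₄)) * ((sq x₁ + sq x₂) * ((d₁ * d₁) * (d₂ * d₂)))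
            ≈⟨ solve 4 (λ a b c d → (a :* b) :* (c :* d) := (d :* b) :* (a :* c)) refl _ _ _ _ ⟩
          ((d₁ * d₁) * (d₂ * d₂) * (d₃ * d₄)) * ((x₃ + x₄) * (sq x₁ + sq x₂)) ∎

    record Product (u v w₊ w₋ : Unit) : Set where
      field
        pos₊ : pos w₊ S.≈ pos u S.* pos v
        neg₊ : neg w₊ S.≈ neg u S.* neg v
        pos₋ : pos w₋ S.≈ pos u S.* neg v
        neg₋ : neg w₋ S.≈ neg u S.* pos v

    NT : Unit → ℤ → Set
    NT u k = k ≡ + 0 → Nontrivial u

    private
      flipNT : ∀ {u k} → NT u k → NT (u ⁻¹) (ℤ.- k)
      flipNT {unit a b c i} {+ zero} nt _ = S.trans (S.*-congˡ c (S.+-comm b a)) (nt P.refl)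

      Id : (x₁ x₂ x₃ x₄ : Carrier) → Set
      Id x₁ x₂ x₃ x₄ = x₁ * x₂ ≈ (x₃ + x₄) * (sq x₁ + sq x₂)

      id-cong : ∀ {a b c d a′ b′ c′ d′} → a ≈ a′ → b ≈ b′ → c ≈ c′ → d ≈ d′ → Id a b c d → Id a′ b′ c′ d′
      id-cong e₁ e₂ e₃ e₄ h = trans (*-cong (sym e₁) (sym e₂)) (trans h (*-cong (+-cong e₃ e₄) (+-cong (sq-cong e₁) (sq-cong e₂))))

      id-cong₂ : ∀ a b c d c′ d′ → c ≈ c′ → d ≈ d′ → Id a b c d → Id a b c′ d′
      id-cong₂ a b c d c′ d′ e₃ e₄ = id-cong {a} {b} {c} {d} {a} {b} {c′} {d′} refl refl e₃ e₄

      id-swap : ∀ {a b c d} → Id a b c d → Id a b d c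
      id-swap h = trans h (*-congʳ _ (+-comm _ _))

      id-comm : ∀ {a b c d} → Id a b c d → Id b a c d
      id-comm h = trans (*-comm _ _) (trans h (*-congˡ _ (+-comm _ _)))

      -- `φ-addition` wants its arguments in the form m w and m with nonnegative powers of y. The
      -- term of smaller exponent is therefore taken as m, and u and v exchange roles when m < n.
      nat : ∀ {u v w₊ w₋} → Product u v w₊ w₋ → ∀ m n → NT u (+ m) → NT v (+ n) → NT w₊ (+ (m ℕ.+ n)) → NT w₋ (m ⊖ n) →
            Id (φ u (+ m)) (φ v (+ n)) (φ w₊ (+ (m ℕ.+ n))) (φ w₋ (m ⊖ n))
      nat {u} {v} {w₊} {w₋} pr m n nu nv n₊ n₋ with ℕP.<-≤-connex m n
      ... | inj₂ n≤m = P.subst (λ k → Id (φ u (+ m)) (φ v (+ n)) (φ w₊ (+ (m ℕ.+ n))) (φ w₋ k)) (P.sym (ℤP.⊖-≥ n≤m))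
          (φ-addition (isΦ-cong e₁ (isΦ u m (nu ∘ int))) (isΦ v n (nv ∘ int)) (isΦ-cong e₃ (isΦ w₊ (m ℕ.+ n) (n₊ ∘ int)))
            (isΦ w₋ (m ∸ n) (λ h → n₋ (P.trans (ℤP.⊖-≥ n≤m) (int h)))))
        where
          open Product pr
          e₁ : mono (pos u) m ≈ mono (pos v) n * mono (pos w₋) (m ∸ n)
          e₁ = sym (trans (mono-* _ _ n (m ∸ n)) (trans (reflexive (P.cong (mono _) (ℕP.m+[n∸m]≡n n≤m))) (mono-cong m
            (S.trans (S.*-congˡ _ pos₋) (S.trans (S.solve 3 (λ a b c → b S.:* (a S.:* c) S.:= (b S.:* c) S.:* a) S.refl _ _ _) (S.trans (S.*-congʳ _ (inv v)) (S.*-idˡ _)))))))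
          e₃ : mono (pos w₊) (m ℕ.+ n) ≈ mono (pos v) n * mono (pos w₋) (m ∸ n) * mono (pos v) n
          e₃ = trans (mono-cong (m ℕ.+ n) pos₊) (trans (sym (mono-* _ _ m n)) (*-congʳ _ e₁))
      ... | inj₁ m<n = P.subst (λ k → Id (φ u (+ m)) (φ v (+ n)) (φ w₊ (+ (m ℕ.+ n))) (φ w₋ k)) (P.sym (ℤP.⊖-< m<n)) (id-comm
          (φ-addition (isΦ-cong e₁ (isΦ v n (nv ∘ int))) (isΦ u m (nu ∘ int)) (isΦ-cong e₃ (isΦ w₊ (m ℕ.+ n) (n₊ ∘ int)))
            (proj₁ Φ₄ , proj₂ Φ₄)))
        where
          open Product pr
          l≤ = ℕP.<⇒≤ m<n
          Φ₄ : IsΦ (φ w₋ (ℤ.- (+ (n ∸ m)))) (mono (neg w₋) (n ∸ m))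
          Φ₄ with n ∸ m | ℕP.m<n⇒0<n∸m m<n
          ... | suc d | _ = isΦ-τ (neg w₋) d
          e₁ : mono (pos v) n ≈ mono (pos u) m * mono (neg w₋) (n ∸ m)
          e₁ = sym (trans (mono-* _ _ m (n ∸ m)) (trans (reflexive (P.cong (mono _) (ℕP.m+[n∸m]≡n l≤))) (mono-cong n
            (S.trans (S.*-congˡ _ neg₋) (S.trans (S.sym (S.*-assoc _ _ _)) (S.trans (S.*-congʳ _ (inv u)) (S.*-idˡ _)))))))
          e₃ : mono (pos w₊) (m ℕ.+ n) ≈ mono (pos u) m * mono (neg w₋) (n ∸ m) * mono (pos u) m
          e₃ = trans (mono-cong (m ℕ.+ n) (S.trans pos₊ (S.*-comm _ _))) (trans (reflexive (P.cong (mono _) (ℕP.+-comm m n))) (trans (sym (mono-* _ _ n m)) (*-congʳ _ e₁)))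

      flipφ : ∀ u k → φ (u ⁻¹) (ℤ.- k) ≈ φ u k
      flipφ u = term-flip odd (hyp u) u

    φ-flip : ∀ u k → φ (u ⁻¹) (ℤ.- k) ≈ φ u k
    φ-flip = flipφ

    -- Negative exponents are removed by inverting u, v or both. Inverting v swaps `w₊` and `w₋`,
    -- inverting u swaps and inverts them, and inverting both inverts each.
    φ-identity : ∀ {u v w₊ w₋} → Product u v w₊ w₋ → ∀ k l → NT u k → NT v l → NT w₊ (k ℤ.+ l) → NT w₋ (k ℤ.- l) →
                 φ u k * φ v l ≈ (φ w₊ (k ℤ.+ l) + φ w₋ (k ℤ.- l)) * (sq (φ u k) + sq (φ v l))
    φ-identity {u} {v} {w₊} {w₋} pr (+ m) (+ n) nu nv n₊ n₋ =
      P.subst (λ k → Id (φ u (+ m)) (φ v (+ n)) (φ w₊ (+ (m ℕ.+ n))) (φ w₋ k)) (P.sym (ℤP.m-n≡m⊖n m n)) (nat pr m n nu nv n₊ (λ h → n₋ (P.trans (ℤP.m-n≡m⊖n m n) h)))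
    φ-identity {u} {v} {w₊} {w₋} pr (+ m) -[1+ n ] nu nv n₊ n₋ =
      id-swap (nat {v = v ⁻¹} (record { pos₊ = pos₋ ; neg₊ = neg₋ ; pos₋ = pos₊ ; neg₋ = neg₊ }) m (suc n) nu (λ ()) n₋ n₊)
      where open Product pr
    φ-identity {u} {v} {w₊} {w₋} pr -[1+ m ] (+ n) nu nv n₊ n₋ =
      id-swap {φ u -[1+ m ]} {φ v (+ n)} {φ (w₋) (-[1+ m ] ℤ.- + n)} {φ w₊ (-[1+ m ] ℤ.+ + n)} (id-cong₂ (φ u -[1+ m ]) (φ v (+ n)) (φ (w₋ ⁻¹) (+ (suc m ℕ.+ n))) (φ (w₊ ⁻¹) (suc m ⊖ n)) (φ w₋ (-[1+ m ] ℤ.- + n)) (φ w₊ (-[1+ m ] ℤ.+ + n)) (P.subst (λ k → φ (w₋ ⁻¹) k ≈ φ w₋ (-[1+ m ] ℤ.- + n)) k₋ (flipφ w₋ (-[1+ m ] ℤ.- + n)))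
                       (P.subst (λ k → φ (w₊ ⁻¹) k ≈ φ w₊ (-[1+ m ] ℤ.+ + n)) k₊ (flipφ w₊ (-[1+ m ] ℤ.+ + n)))
        (nat {u = u ⁻¹} {v = v} {w₊ = w₋ ⁻¹} {w₋ = w₊ ⁻¹} (record { pos₊ = neg₋ ; neg₊ = pos₋ ; pos₋ = neg₊ ; neg₋ = pos₊ }) (suc m) n (λ ()) nv
          (P.subst (NT (w₋ ⁻¹)) k₋ (flipNT {w₋} { -[1+ m ] ℤ.- + n} n₋)) (P.subst (NT (w₊ ⁻¹)) k₊ (flipNT {w₊} { -[1+ m ] ℤ.+ + n} n₊))))
      where
        open Product pr
        k₋ : ℤ.- (-[1+ m ] ℤ.- + n) ≡ + (suc m ℕ.+ n)
        k₋ = P.trans (ℤP.neg-distrib-+ -[1+ m ] (ℤ.- (+ n))) (P.cong (λ i → + suc m ℤ.+ i) (ℤP.neg-involutive (+ n)))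
        k₊ : ℤ.- (-[1+ m ] ℤ.+ + n) ≡ suc m ⊖ n
        k₊ = P.sym (ℤP.⊖-swap (suc m) n)
    φ-identity {u} {v} {w₊} {w₋} pr -[1+ m ] -[1+ n ] nu nv n₊ n₋ =
      id-cong₂ (φ u -[1+ m ]) (φ v -[1+ n ]) (φ (w₊ ⁻¹) (+ (suc m ℕ.+ suc n))) (φ (w₋ ⁻¹) (suc m ⊖ suc n)) (φ w₊ (-[1+ m ] ℤ.+ -[1+ n ])) (φ w₋ (-[1+ m ] ℤ.- -[1+ n ])) (P.subst (λ k → φ (w₊ ⁻¹) k ≈ φ w₊ (-[1+ m ] ℤ.+ -[1+ n ])) k₊ (flipφ w₊ (-[1+ m ] ℤ.+ -[1+ n ])))
                       (P.subst (λ k → φ (w₋ ⁻¹) k ≈ φ w₋ (-[1+ m ] ℤ.- -[1+ n ])) k₋ (flipφ w₋ (-[1+ m ] ℤ.- -[1+ n ])))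
        (nat {u = u ⁻¹} {v = v ⁻¹} {w₊ = w₊ ⁻¹} {w₋ = w₋ ⁻¹} (record { pos₊ = neg₊ ; neg₊ = pos₊ ; pos₋ = neg₋ ; neg₋ = pos₋ }) (suc m) (suc n) (λ ()) (λ ())
          (λ ()) (P.subst (NT (w₋ ⁻¹)) k₋ (flipNT {w₋} { -[1+ m ] ℤ.- -[1+ n ]} n₋)))
      where
        open Product pr
        k₊ : ℤ.- (-[1+ m ] ℤ.+ -[1+ n ]) ≡ + (suc m ℕ.+ suc n)
        k₊ = P.cong (λ d → + suc d) (P.sym (ℕP.+-suc m n))
        k₋ : ℤ.- (-[1+ m ] ℤ.- -[1+ n ]) ≡ suc m ⊖ suc n
        k₋ = P.sym (ℤP.⊖-swap (suc m) (suc n))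

-- Sums over residue classes of exponents and their addition formula.

module EisensteinSeries where
  open import Data.Integer.Divisibility.Signed as ℤD using (_∣_; _∣?_; divides; ∣m∣n⇒∣m+n; ∣m∣n⇒∣m-n; ∣m⇒∣-m; ∣⇒∣ᵤ)
  open import Data.Integer.Solver using (module +-*-Solver)
  open CharacteristicTwo
  open FormalSeries
  open Homomorphisms
  open BilateralSums
  open LambertSeries

  module ℤSolve = +-*-Solver

  small-multiple : ∀ L k → + L ∣ k → ∣ k ∣ < L → k ≡ + 0
  small-multiple L k d l with ∣ k ∣ in eq
  ... | zero = ℤP.∣i∣≡0⇒i≡0 eq
  ... | suc m = ⊥-elim (ℕP.<⇒≱ l (ℕD.∣⇒≤ (P.subst (L ℕD.∣_) eq (∣⇒∣ᵤ d))))

  parity : ∀ q → Σ ℤ λ m → q ≡ m ℤ.+ m ⊎ q ≡ m ℤ.+ m ℤ.+ + 1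
  parity (+ n) with even-odd n
    where
      even-odd : ∀ n → Σ ℕ λ m → n ≡ m ℕ.+ m ⊎ n ≡ m ℕ.+ m ℕ.+ 1
      even-odd zero = 0 , inj₁ P.refl
      even-odd (suc n) with even-odd n
      ... | m , inj₁ e = m , inj₂ (P.trans (P.cong suc e) (ℕP.+-comm 1 (m ℕ.+ m)))
      ... | m , inj₂ e = suc m , inj₁ (P.trans (P.cong suc (P.trans e (ℕP.+-comm (m ℕ.+ m) 1))) (P.cong suc (P.sym (ℕP.+-suc m m))))
  ... | m , inj₁ e = + m , inj₁ (int e)
  ... | m , inj₂ e = + m , inj₂ (int e)
  parity -[1+ n ] with parity (+ suc n)
  ... | m , inj₁ e = ℤ.- m , inj₁ (P.trans (P.cong ℤ.-_ e) (ℤP.neg-distrib-+ m m))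
  ... | m , inj₂ e = ℤ.- m ℤ.- + 1 , inj₂ (P.trans (P.cong ℤ.-_ e)
          (ℤSolve.solve 1 (λ m → ℤSolve.:- (m ℤSolve.:+ m ℤSolve.:+ ℤSolve.con (+ 1)) ℤSolve.:=
            ((ℤSolve.:- m) ℤSolve.:- ℤSolve.con (+ 1)) ℤSolve.:+ ((ℤSolve.:- m) ℤSolve.:- ℤSolve.con (+ 1)) ℤSolve.:+ ℤSolve.con (+ 1)) P.refl m))

  module Eisenstein (S : F2Alg) (H : ℕ) (H>0 : 0 < H) where
    module S = Ring S
    open Series S public
    open Inflate S public
    open BilateralSeries S public
    open Lambert S public
    open ℤSolve using () renaming (_:=_ to _≛_; solve to ℤsolve; _:+_ to _⊞_; _:-_ to _⊟_; _:*_ to _⊠_; :-_ to ⊟_; con to ℤcon)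

    L : ℕ
    L = H ℕ.+ H

    L≢0 : ¬ (+ L ∣ + H)
    L≢0 d = ℕP.<⇒≢ H>0 (P.sym (ℤP.+-injective (small-multiple L (+ H) d (P.subst (_< L) (ℕP.+-identityʳ H) (ℕP.+-monoʳ-< H H>0)))))

    record Pt : Set where
      constructor _at_
      field
        u : Unit
        e : ℤ

    open Pt public

    -- The condition that the point is not the origin of the Tate curve 𝔾ₘ/q^ℤ, q = y^L.
    NZ : Pt → Set
    NZ P = + L ∣ e P → Nontrivial (u P)

    restrict : ∀ {A : Set} → Dec A → Carrier → Carrier
    restrict (yes _) f = f
    restrict (no _) f = 0#

    -- The orbit of u y^e under q = y^L is indexed by the actual exponent k of y, with zeros off the
    -- class of e. Moving e by a period then changes nothing, and `Good` refers to the right |k|.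
    fam : (ℕ → Bool) → S.Carrier → Pt → ℤ → Carrier
    fam c z P k = restrict (+ L ∣? (k ℤ.- e P)) (term c z (u P) k)

    restrict-good : ∀ {A : Set} (d : Dec A) {f n} → (∀ i → i < n → f i S.≈ S.0#) → ∀ i → i < n → restrict d f i S.≈ S.0#
    restrict-good (yes _) g = g
    restrict-good (no _) g i l = S.refl

    fam-good : ∀ c z P → c 0 ≡ false → Good (fam c z P)
    fam-good c z P c0 k = restrict-good (+ L ∣? (k ℤ.- e P)) (term-good c z (u P) c0 k)

    X W : Pt → Carrier
    X P = ΣZ (fam odd (hyp (u P)) P)
    W P = ΣZ (fam non3 S.0# P)

    famX : Pt → ℤ → Carrier
    famX P = fam odd (hyp (u P)) P

    famX-good : ∀ P → Good (famX P)
    famX-good P = fam-good odd _ P P.refl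

    at-zero : ∀ P k → + L ∣ k ℤ.- e P → NZ P → NT (u P) k
    at-zero P k d nz k0 = nz (P.subst (+ L ∣_) (ℤP.neg-involutive (e P)) (∣m⇒∣-m (P.subst (+ L ∣_) (P.trans (P.cong (ℤ._- e P) k0) (ℤP.+-identityˡ _)) d)))

    -- The termwise identity survives the restriction to classes: if k and l lie in theirs, so do k
    -- + l and k - l; if exactly one does, neither k + l nor k - l does; if none does, both squares
    -- vanish.
    star : ∀ {P Q R₊ R₋} → Product (u P) (u Q) (u R₊) (u R₋) → e R₊ ≡ e P ℤ.+ e Q → e R₋ ≡ e P ℤ.- e Q →
           NZ P → NZ Q → NZ R₊ → NZ R₋ → X P * X Q ≈ (X R₊ + X R₋) * sq (X P + X Q)
    star {P} {Q} {R₊} {R₋} pr e₊ e₋ nP nQ n₊ n₋ = bilinear (famX-good P) (famX-good Q) (famX-good R₊) (famX-good R₋) termwise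
      where
        termwise : ∀ k l → famX P k * famX Q l ≈ (famX R₊ (k ℤ.+ l) + famX R₋ (k ℤ.- l)) * (sq (famX P k) + sq (famX Q l))
        termwise k l with + L ∣? (k ℤ.- e P) | + L ∣? (l ℤ.- e Q) | + L ∣? (k ℤ.+ l ℤ.- e R₊) | + L ∣? (k ℤ.- l ℤ.- e R₋)
        ... | yes d | yes d′ | yes d₊ | yes d₋ = φ-identity pr k l (at-zero P k d nP) (at-zero Q l d′ nQ) (at-zero R₊ (k ℤ.+ l) d₊ n₊) (at-zero R₋ (k ℤ.- l) d₋ n₋)
        ... | yes d | yes d′ | no n | _ = ⊥-elim (n (P.subst (+ L ∣_) (P.trans (ℤsolve 4 (λ k l a b → (k ⊟ a) ⊞ (l ⊟ b) ≛ k ⊞ l ⊟ (a ⊞ b)) P.refl k l (e P) (e Q)) (P.cong (λ x → k ℤ.+ l ℤ.- x) (P.sym e₊))) (∣m∣n⇒∣m+n d d′)))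
        ... | yes d | yes d′ | yes _ | no n = ⊥-elim (n (P.subst (+ L ∣_) (P.trans (ℤsolve 4 (λ k l a b → (k ⊟ a) ⊟ (l ⊟ b) ≛ k ⊟ l ⊟ (a ⊟ b)) P.refl k l (e P) (e Q)) (P.cong (λ x → k ℤ.- l ℤ.- x) (P.sym e₋))) (∣m∣n⇒∣m-n d d′)))
        ... | no n | yes d′ | yes d₊ | _ = ⊥-elim (n (P.subst (+ L ∣_) (P.trans (P.cong (λ x → (k ℤ.+ l ℤ.- x) ℤ.- (l ℤ.- e Q)) e₊) (ℤsolve 4 (λ k l a b → (k ⊞ l ⊟ (a ⊞ b)) ⊟ (l ⊟ b) ≛ k ⊟ a) P.refl k l (e P) (e Q))) (∣m∣n⇒∣m-n d₊ d′)))
        ... | no n | yes d′ | no _ | yes d₋ = ⊥-elim (n (P.subst (+ L ∣_) (P.trans (P.cong (λ x → (k ℤ.- l ℤ.- x) ℤ.+ (l ℤ.- e Q)) e₋) (ℤsolve 4 (λ k l a b → (k ⊟ l ⊟ (a ⊟ b)) ⊞ (l ⊟ b) ≛ k ⊟ a) P.refl k l (e P) (e Q))) (∣m∣n⇒∣m+n d₋ d′)))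
        ... | no _ | yes _ | no _ | no _ = trans (zeroˡ _) (sym (trans (*-congʳ _ (+-idˡ _)) (zeroˡ _)))
        ... | yes d | no n | yes d₊ | _ = ⊥-elim (n (P.subst (+ L ∣_) (P.trans (P.cong (λ x → (k ℤ.+ l ℤ.- x) ℤ.- (k ℤ.- e P)) e₊) (ℤsolve 4 (λ k l a b → (k ⊞ l ⊟ (a ⊞ b)) ⊟ (k ⊟ a) ≛ l ⊟ b) P.refl k l (e P) (e Q))) (∣m∣n⇒∣m-n d₊ d)))
        ... | yes d | no n | no _ | yes d₋ = ⊥-elim (n (P.subst (+ L ∣_) (P.trans (P.cong (λ x → (k ℤ.- e P) ℤ.- (k ℤ.- l ℤ.- x)) e₋) (ℤsolve 4 (λ k l a b → (k ⊟ a) ⊟ (k ⊟ l ⊟ (a ⊟ b)) ≛ l ⊟ b) P.refl k l (e P) (e Q))) (∣m∣n⇒∣m-n d d₋)))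
        ... | yes _ | no _ | no _ | no _ = trans (zeroʳ _) (sym (trans (*-congʳ _ (+-idˡ _)) (zeroˡ _)))
        ... | no _ | no _ | _ | _ = trans (zeroˡ _) (sym (trans (*-congˡ _ (trans (+-cong (zeroˡ _) (zeroˡ _)) (+-idˡ _))) (zeroʳ _)))

    -- The field `hyp` is left out: where it matters it is determined by the unit, by `hyp-unique`.
    record _≋_ (P Q : Pt) : Set where
      constructor same
      field
        pos≈ : pos (u P) S.≈ pos (u Q)
        neg≈ : neg (u P) S.≈ neg (u Q)
        e≡ : + L ∣ e P ℤ.- e Q

    pows-cong : ∀ c {a b} → a S.≈ b → pows c a ≈ pows c b
    pows-cong c e d = S.*-congˡ _ (S.^-cong d e)

    hyp-unique : ∀ u v → pos u S.≈ pos v → neg u S.≈ neg v → Nontrivial u → Nontrivial v → hyp u S.≈ hyp v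
    hyp-unique u v p n nu nv = S.inverse-unique (S.trans (S.*-congˡ _ (S.sym (S.+-cong p n))) nu) nv

    term-cong : ∀ c {z z′} u v k → pos u S.≈ pos v → neg u S.≈ neg v → (k ≡ + 0 → z S.≈ z′) → term c z u k ≈ term c z′ v k
    term-cong c u v (+ zero) p n h = const-cong (h P.refl)
    term-cong c u v (+ suc k) p n h = inflate-cong (suc k) (pows-cong c p)
    term-cong c u v -[1+ k ] p n h = inflate-cong (suc k) (pows-cong c n)

    fam-cong : ∀ c z z′ P Q → P ≋ Q → (∀ k → + L ∣ k ℤ.- e P → + L ∣ k ℤ.- e Q → k ≡ + 0 → z S.≈ z′) → ∀ k → fam c z P k ≈ fam c z′ Q k
    fam-cong c z z′ P Q (same p n d) h k with + L ∣? (k ℤ.- e P) | + L ∣? (k ℤ.- e Q)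
    ... | yes a | yes b = term-cong c (u P) (u Q) k p n (h k a b)
    ... | no _ | no _ = refl
    ... | yes a | no b = ⊥-elim (b (P.subst (+ L ∣_) (ℤsolve 3 (λ k a b → (k ⊟ a) ⊞ (a ⊟ b) ≛ k ⊟ b) P.refl k (e P) (e Q)) (∣m∣n⇒∣m+n a d)))
    ... | no a | yes b = ⊥-elim (a (P.subst (+ L ∣_) (ℤsolve 3 (λ k a b → (k ⊟ b) ⊟ (a ⊟ b) ≛ k ⊟ a) P.refl k (e P) (e Q)) (∣m∣n⇒∣m-n b d)))

    X-cong : ∀ {P Q} → P ≋ Q → NZ P → NZ Q → X P ≈ X Q
    X-cong {P} {Q} eq nP nQ = ΣZ-cong (fam-cong odd _ _ P Q eq (λ k a b k0 →
      hyp-unique (u P) (u Q) (_≋_.pos≈ eq) (_≋_.neg≈ eq) (at-zero P k a nP k0) (at-zero Q k b nQ k0)))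

    W-cong : ∀ {P Q} → P ≋ Q → W P ≈ W Q
    W-cong {P} {Q} eq = ΣZ-cong (fam-cong non3 _ _ P Q eq (λ _ _ _ _ → S.refl))

    -ₚ_ : Pt → Pt
    -ₚ (u at e) = (u ⁻¹) at (ℤ.- e)

    X-neg : ∀ P → X (-ₚ P) ≈ X P
    X-neg P = trans (sym (ΣZ-neg (famX (-ₚ P)))) (ΣZ-cong flip)
      where
        flip : ∀ k → famX (-ₚ P) (ℤ.- k) ≈ famX P k
        flip k with + L ∣? (ℤ.- k ℤ.- (ℤ.- e P)) | + L ∣? (k ℤ.- e P)
        ... | yes _ | yes _ = φ-flip (u P) k
        ... | no _ | no _ = refl
        ... | yes a | no b = ⊥-elim (b (P.subst (+ L ∣_) (ℤsolve 2 (λ k a → ⊟ (⊟ k ⊟ (⊟ a)) ≛ k ⊟ a) P.refl k (e P)) (∣m⇒∣-m a)))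
        ... | no a | yes b = ⊥-elim (a (P.subst (+ L ∣_) (ℤsolve 2 (λ k a → ⊟ (k ⊟ a) ≛ ⊟ k ⊟ (⊟ a)) P.refl k (e P)) (∣m⇒∣-m b)))

    bsum-vanish : ∀ m {t} i → (∀ k → ∣ k ∣ ≤ m → t k i S.≈ S.0#) → BSum.bsum (PowerSeries.series S) m t i S.≈ S.0#
    bsum-vanish zero {t} i z = S.trans (BSum.bsum-0 (PowerSeries.series S) t i) (z (+ 0) z≤n)
    bsum-vanish (suc m) {t} i z = S.trans (BSum.bsum-extend (PowerSeries.series S) m t i)
      (S.trans (S.+-cong (S.trans (S.+-cong (z (+ suc m) ℕP.≤-refl) (z -[1+ m ] ℕP.≤-refl)) (S.+-idˡ _)) (bsum-vanish m i (λ k l → z k (ℕP.m≤n⇒m≤1+n l)))) (S.+-idˡ _))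

    private
      sparse : ∀ c z v n k → n ℕ.+ n < L → ∣ k ∣ ≤ n → ¬ (k ≡ + n) → fam c z (v at (+ n)) k ≈ 0#
      sparse c z v n k 2n<L k≤n k≢n with + L ∣? (k ℤ.- + n)
      ... | no _ = refl
      ... | yes d = ⊥-elim (k≢n (ℤP.i-j≡0⇒i≡j k (+ n) (small-multiple L _ d
              (ℕP.≤-<-trans (ℤP.∣i-j∣≤∣i∣+∣j∣ k (+ n)) (ℕP.≤-<-trans (ℕP.+-monoˡ-≤ n k≤n) 2n<L)))))

      hit : ∀ c z v n → fam c z (v at (+ n)) (+ n) ≈ term c z v (+ n)
      hit c z v n with + L ∣? (+ n ℤ.- + n)
      ... | yes _ = refl
      ... | no ne = ⊥-elim (ne (P.subst (+ L ∣_) (P.sym (ℤP.+-inverseʳ (+ n))) (divides (+ 0) P.refl)))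

    -- For 2n < L the exponent n has the least absolute value in its class modulo L, so its term
    -- comes lowest. At n = L/2 the exponents n and -n tie, and the lowest terms may cancel.
    lead-Eis : ∀ c z v n → c 0 ≡ false → n ℕ.+ n < L → Lead n (term c z v (+ n) n) (ΣZ (fam c z (v at (+ n))))
    lead-Eis c z v zero c0 l = (λ i ()) , S.trans (BSum.bsum-0 (PowerSeries.series S) _ 0) (hit c z v 0 0)
    lead-Eis c z v (suc m) c0 l =
      (λ i i<n → bsum-vanish i i (λ k k≤i → sparse c z v (suc m) k l (ℕP.≤-trans k≤i (ℕP.<⇒≤ i<n))
         (λ h → ℕP.<⇒≱ i<n (P.subst (λ x → ∣ x ∣ ≤ i) h k≤i)) i)) ,
      S.trans (BSum.bsum-extend (PowerSeries.series S) m _ (suc m))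
        (S.trans (S.+-cong (S.trans (S.+-cong (hit c z v (suc m) (suc m)) (sparse c z v (suc m) -[1+ m ] l ℕP.≤-refl (λ ()) (suc m))) (S.+-idʳ _))
          (bsum-vanish m (suc m) (λ k k≤m → sparse c z v (suc m) k l (ℕP.m≤n⇒m≤1+n k≤m) (λ h → ℕP.<-irrefl P.refl (P.subst (λ x → ∣ x ∣ ≤ m) h k≤m)) (suc m)))) (S.+-idʳ _))

    τ-lead : ∀ c a n → τ c a (suc n) (suc n) S.≈ S.bit (c 1) S.* a
    τ-lead c a n = S.trans (S.reflexive (P.cong (τ c a (suc n)) (P.sym (ℕP.*-identityˡ (suc n)))))
      (S.trans (inflate-∣ (suc n) (pows c a) 1) (S.*-congˡ _ (S.*-idʳ a)))

    X-reg⁺ : ∀ v n → n ℕ.+ n < L → NZ (v at (+ n)) → Reg (X (v at (+ n)))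
    X-reg⁺ v zero l nz = reg-lead 0 (lead-Eis odd _ v 0 P.refl l) (S.reg-unit (nz (divides (+ 0) P.refl)))
    X-reg⁺ v (suc n) l nz = reg-lead (suc n) (lead-Eis odd _ v (suc n) P.refl l)
      (S.reg-cong (S.sym (S.trans (τ-lead odd (pos v) n) (S.*-idˡ _))) (S.reg-unit (inv v)))

    NZ-neg : ∀ {P} → NZ P → NZ (-ₚ P)
    NZ-neg {P} nz d = S.trans (S.*-congˡ _ (S.+-comm _ _)) (nz (P.subst (+ L ∣_) (ℤP.neg-involutive (e P)) (∣m⇒∣-m d)))

    X-reg-small : ∀ P → ∣ e P ∣ < H → NZ P → Reg (X P)
    X-reg-small (v at (+ n)) l nz = X-reg⁺ v n (ℕP.+-mono-< l l) nz
    X-reg-small P@(v at -[1+ n ]) l nz = reg-cong (X-neg P) (X-reg⁺ (v ⁻¹) (suc n) (ℕP.+-mono-< l l) (NZ-neg {P} nz))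

-- The Tate curve: translation by the 2-torsion point and duplication.

module TwoDivision where
  open import Data.Integer.Divisibility.Signed as ℤD using (_∣_; _∣?_; divides; ∣m∣n⇒∣m+n; ∣m∣n⇒∣m-n; ∣m⇒∣-m; ∣n⇒∣m*n)
  open import Relation.Binary.Definitions using (tri<; tri≈; tri>)
  open CharacteristicTwo
  open FormalSeries
  open BilateralSums
  open LambertSeries
  open EisensteinSeries

  -- N-th roots of unity indexed additively. `hyp i` inverts the sum of `root i` and its inverse,
  -- `half` is the inverse of 2 modulo N, and `omega` is the index of a primitive cube root of
  -- unity.
  record Cyclic (S : F2Alg) (N : ℕ) : Set where
    private module S = Ring S
    field
      root hyp : ℤ → S.Carrier
      root-+ : ∀ i j → root (i ℤ.+ j) S.≈ root i S.* root j
      root-per : ∀ i → + N ∣ i → root i S.≈ S.1#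
      root-nontrivial : ∀ i → ¬ (+ N ∣ i) → hyp i S.* (root i S.+ root (ℤ.- i)) S.≈ S.1#
      half : ℤ
      half-spec : + N ∣ half ℤ.+ half ℤ.- + 1
      omega : ℤ
      omega-order : + N ∣ omega ℤ.+ omega ℤ.+ omega
      omega-sum : root omega S.+ root (ℤ.- omega) S.≈ S.1#
      omega-nz : ¬ (+ N ∣ omega)

    root-inv : ∀ i → root i S.* root (ℤ.- i) S.≈ S.1#
    root-inv i = S.trans (S.sym (root-+ i (ℤ.- i))) (root-per _ (P.subst (+ N ∣_) (P.sym (ℤP.+-inverseʳ i)) (divides (+ 0) P.refl)))

    root-cong : ∀ i j → + N ∣ i ℤ.- j → root i S.≈ root j
    root-cong i j d = S.trans (S.reflexive (P.cong root (P.sym (ℤSolve.solve 2 (λ i j → (i ℤSolve.:- j) ℤSolve.:+ j ℤSolve.:= i) P.refl i j))))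
      (S.trans (root-+ _ _) (S.trans (S.*-congʳ _ (root-per _ d)) (S.*-idˡ _)))

  module TateCurve (S : F2Alg) (N p : ℕ) (p>0 : 0 < p) (cyc : Cyclic S N) where
    open Cyclic cyc using (root; root-+; root-per; root-nontrivial; root-inv; root-cong; half; half-spec; omega; omega-order; omega-sum; omega-nz)
    open Eisenstein S (p ℕ.+ p) (ℕP.≤-trans p>0 (ℕP.m≤m+n p p)) public
    open ℤSolve using () renaming (_:=_ to _≛_; solve to ℤsolve; _:+_ to _⊞_; _:-_ to _⊟_; _:*_ to _⊠_; :-_ to ⊟_; con to ℤcon)

    private
      H = + (p ℕ.+ p)
      LL = + (p ℕ.+ p ℕ.+ (p ℕ.+ p))

      dvd : ∀ {m a b} → a ≡ b → m ∣ a → m ∣ b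
      dvd P.refl d = d

      d0 : ∀ {m} → m ∣ + 0
      d0 = divides (+ 0) P.refl

    ⟨_⟩ : ℤ → Unit
    ⟨ i ⟩ = unit (root i) (root (ℤ.- i)) (Cyclic.hyp cyc i) (root-inv i)

    -- The point (i, e) is root i · y^e.
    𝕏 𝕎 : ℤ → ℤ → Carrier
    𝕏 i e = X (⟨ i ⟩ at e)
    𝕎 i e = W (⟨ i ⟩ at e)

    IsO : ℤ → ℤ → Set
    IsO i e = (+ N ∣ i) × (LL ∣ e)

    nz : ∀ {i e} → ¬ IsO i e → NZ (⟨ i ⟩ at e)
    nz {i} n d = root-nontrivial i (λ d′ → n (d′ , d))

    𝕏-cong : ∀ {i j e f} → + N ∣ i ℤ.- j → LL ∣ e ℤ.- f → ¬ IsO i e → 𝕏 i e ≈ 𝕏 j f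
    𝕏-cong {i} {j} {e} {f} d d′ n = X-cong (same (root-cong i j d) (root-cong _ _ (dvd (ℤsolve 2 (λ i j → ⊟ (i ⊟ j) ≛ ⊟ i ⊟ (⊟ j)) P.refl i j) (∣m⇒∣-m d))) d′)
      (nz n) (nz (λ { (h , h′) → n (dvd (ℤsolve 2 (λ i j → (i ⊟ j) ⊞ j ≛ i) P.refl i j) (∣m∣n⇒∣m+n d h) , dvd (ℤsolve 2 (λ i j → (i ⊟ j) ⊞ j ≛ i) P.refl e f) (∣m∣n⇒∣m+n d′ h′)) }))

    𝕎-cong : ∀ {i j e f} → + N ∣ i ℤ.- j → LL ∣ e ℤ.- f → 𝕎 i e ≈ 𝕎 j f
    𝕎-cong {i} {j} {e} {f} d d′ = W-cong (same (root-cong i j d) (root-cong _ _ (dvd (ℤsolve 2 (λ i j → ⊟ (i ⊟ j) ≛ ⊟ i ⊟ (⊟ j)) P.refl i j) (∣m⇒∣-m d))) d′)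

    𝕏-neg : ∀ i e → ¬ IsO i e → 𝕏 (ℤ.- i) (ℤ.- e) ≈ 𝕏 i e
    𝕏-neg i e n = trans (X-cong (same S.refl (S.reflexive (P.cong root (ℤP.neg-involutive i))) (dvd (P.sym (ℤP.+-inverseʳ (ℤ.- e))) d0))
        (nz (λ { (h , h′) → n (dvd (ℤP.neg-involutive i) (∣m⇒∣-m h) , dvd (ℤP.neg-involutive e) (∣m⇒∣-m h′)) }))
        (NZ-neg {⟨ i ⟩ at e} (nz n))) (X-neg (⟨ i ⟩ at e))

    𝕏-star : ∀ i e j f → ¬ IsO i e → ¬ IsO j f → ¬ IsO (i ℤ.+ j) (e ℤ.+ f) → ¬ IsO (i ℤ.- j) (e ℤ.- f) →
             𝕏 i e * 𝕏 j f ≈ (𝕏 (i ℤ.+ j) (e ℤ.+ f) + 𝕏 (i ℤ.- j) (e ℤ.- f)) * sq (𝕏 i e + 𝕏 j f)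
    𝕏-star i e j f n₁ n₂ n₃ n₄ = star (record
        { pos₊ = root-+ i j
        ; neg₊ = S.trans (S.reflexive (P.cong root (ℤP.neg-distrib-+ i j))) (root-+ _ _)
        ; pos₋ = root-+ i (ℤ.- j)
        ; neg₋ = S.trans (S.reflexive (P.cong root (ℤsolve 2 (λ i j → ⊟ (i ⊟ j) ≛ ⊟ i ⊞ j) P.refl i j))) (root-+ _ _) })
      P.refl P.refl (nz n₁) (nz n₂) (nz n₃) (nz n₄)

    double-∣ : ∀ i → + N ∣ i ℤ.+ i → + N ∣ i
    double-∣ i d = dvd (ℤsolve 2 (λ i h → h ⊠ (i ⊞ i) ⊟ i ⊠ (h ⊞ h ⊟ ℤcon (+ 1)) ≛ i) P.refl i half)
      (∣m∣n⇒∣m-n (∣n⇒∣m*n half d) (∣n⇒∣m*n i half-spec))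

    halve : ∀ e → LL ∣ e ℤ.+ e → (LL ∣ e) ⊎ (LL ∣ e ℤ.- H)
    halve e (divides q eq) with parity q
    ... | m , inj₁ qe = inj₁ (divides m (ℤP.*-cancelʳ-≡ e (m ℤ.* LL) (+ 2) (P.trans (ℤsolve 1 (λ e → e ⊠ ℤcon (+ 2) ≛ e ⊞ e) P.refl e)
          (P.trans eq (P.trans (P.cong (ℤ._* LL) qe) (ℤsolve 2 (λ m l → (m ⊞ m) ⊠ l ≛ m ⊠ l ⊠ ℤcon (+ 2)) P.refl m LL))))))
    ... | m , inj₂ qe = inj₂ (divides m (ℤP.*-cancelʳ-≡ (e ℤ.- H) (m ℤ.* LL) (+ 2)
          (P.trans (ℤsolve 2 (λ e h → (e ⊟ h) ⊠ ℤcon (+ 2) ≛ (e ⊞ e) ⊟ (h ⊞ h)) P.refl e H)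
            (P.trans (P.cong (ℤ._- (H ℤ.+ H)) (P.trans eq (P.cong (ℤ._* LL) qe)))
              (ℤsolve 2 (λ m h → ((m ⊞ m ⊞ ℤcon (+ 1)) ⊠ (h ⊞ h)) ⊟ (h ⊞ h) ≛ m ⊠ (h ⊞ h) ⊠ ℤcon (+ 2)) P.refl m H)))))

    H∤ : ¬ (LL ∣ H)
    H∤ = L≢0

    -- The nontrivial 2-torsion point is its own negative, so its terms cancel in pairs.
    𝕏-T₂ : 𝕏 (+ 0) H ≈ 0#
    𝕏-T₂ n = S.trans (BSum.bsum-pairs (PowerSeries.series S) n t n) (S.trans (S.+-cong (zero-term n) (S.trans (sum-at n _ n) (S.sum-0 n (λ i _ → S.trans (S.+-congˡ _ (S.sym (sym-t (suc i) n))) (S.double _))))) (S.+-idˡ _))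
      where
        t = famX (⟨ + 0 ⟩ at H)
        zero-term : t (+ 0) ≈ 0#
        zero-term with LL ∣? (+ 0 ℤ.- H)
        ... | yes d = ⊥-elim (H∤ (dvd (P.trans (P.cong ℤ.-_ (ℤP.+-identityˡ (ℤ.- H))) (ℤP.neg-involutive H)) (∣m⇒∣-m d)))
        ... | no _ = refl
        sym-t : ∀ n → t (+ n) ≈ t (ℤ.- (+ n))
        sym-t n with LL ∣? (+ n ℤ.- H) | LL ∣? (ℤ.- (+ n) ℤ.- H)
        ... | yes _ | yes _ = even n
          where
            even : ∀ n → φ ⟨ + 0 ⟩ (+ n) ≈ φ ⟨ + 0 ⟩ (ℤ.- (+ n))
            even zero = refl
            even (suc n) = refl
        ... | no _ | no _ = refl
        ... | yes a | no b = ⊥-elim (b (dvd (ℤsolve 2 (λ n h → ⊟ (n ⊟ h) ⊟ (h ⊞ h) ≛ ⊟ n ⊟ h) P.refl (+ n) H) (∣m∣n⇒∣m-n (∣m⇒∣-m a) ℤD.∣-refl)))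
        ... | no a | yes b = ⊥-elim (a (dvd (ℤsolve 2 (λ n h → ⊟ (⊟ n ⊟ h) ⊟ (h ⊞ h) ≛ n ⊟ h) P.refl (+ n) H) (∣m∣n⇒∣m-n (∣m⇒∣-m b) ℤD.∣-refl)))

    -- Frobenius: 1/(v² + v⁻²) is the square of 1/(v + v⁻¹).
    τ-double : ∀ a b n → b S.≈ a S.* a → τ odd b (suc n ℕ.+ suc n) ≈ sq (τ odd a (suc n))
    τ-double a b n e = isΦ-unique (isΦ-cong m²  (isΦ-τ b (n ℕ.+ suc n))) (sqΦ , reg-cong (+-congˡ _ (sq-cong m²)) (reg-1+sq b (n ℕ.+ suc n)))
      where
        m = mono a (suc n)
        x = τ odd a (suc n)
        m² : mono b (suc n ℕ.+ suc n) ≈ sq m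
        m² = trans (mono-cong (suc n ℕ.+ suc n) e) (sym (mono-* a a (suc n) (suc n)))
        sqΦ : sq x * (1# + sq (sq m)) ≈ sq m
        sqΦ = trans (solve 2 (λ x m → (x :* x) :* (I :+ (m :* m) :* (m :* m)) := (x :* (I :+ m :* m)) :* (x :* (I :+ m :* m))) refl x m) (sq-cong (proj₁ (isΦ-τ a n)))

    double-term : ∀ i k → NT ⟨ i ⟩ k → NT ⟨ i ℤ.+ i ⟩ k → φ ⟨ i ℤ.+ i ⟩ (k ℤ.+ k) ≈ sq (φ ⟨ i ⟩ k)
    double-term i (+ zero) n n′ = trans (const-cong (S.inverse-unique (n′ P.refl) (S.trans (S.*-congˡ _ (S.trans (S.+-cong (root-+ i i)
        (S.trans (S.reflexive (P.cong root (ℤP.neg-distrib-+ i i))) (root-+ _ _))) (S.sym (S.sq-+ _ _)))) (S.trans (S.sym (S.sq-* _ _)) (S.trans (S.sq-cong (n P.refl)) (S.*-idˡ _)))))) (const-* _ _)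
    double-term i (+ suc n) _ _ = τ-double (root i) (root (i ℤ.+ i)) n (root-+ i i)
    double-term i -[1+ n ] _ _ = trans (reflexive (P.cong (λ d → τ odd (root (ℤ.- (i ℤ.+ i))) (suc d)) (P.sym (ℕP.+-suc n n))))
      (τ-double (root (ℤ.- i)) (root (ℤ.- (i ℤ.+ i))) n (S.trans (S.reflexive (P.cong root (ℤP.neg-distrib-+ i i))) (root-+ _ _)))

    L∤odd : ∀ m → ¬ (LL ∣ m ℤ.+ m ℤ.+ + 1)
    L∤odd m (divides q eq) = even≢odd (q ℤ.* H ℤ.- m) (P.trans (ℤsolve 3 (λ q h m → (q ⊠ h ⊟ m) ⊞ (q ⊠ h ⊟ m) ≛ q ⊠ (h ⊞ h) ⊟ (m ⊞ m)) P.refl q H m)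
        (P.trans (P.cong (ℤ._- (m ℤ.+ m)) (P.sym eq)) (ℤsolve 1 (λ m → (m ⊞ m ⊞ ℤcon (+ 1)) ⊟ (m ⊞ m) ≛ ℤcon (+ 1)) P.refl m)))
      where
        even≢odd : ∀ k → ¬ (k ℤ.+ k ≡ + 1)
        even≢odd (+ zero) ()
        even≢odd (+ suc n) h with P.trans (P.sym (ℕP.+-suc n n)) (ℕP.suc-injective (ℤP.+-injective h))
        ... | ()
        even≢odd -[1+ n ] ()

    double-nz : ∀ {i e} → ¬ IsO (i ℤ.+ i) (e ℤ.+ e) → ¬ IsO i e
    double-nz n (h , h′) = n (∣m∣n⇒∣m+n h h , ∣m∣n⇒∣m+n h′ h′)

    double-nz′ : ∀ {i e} → ¬ IsO (i ℤ.+ i) (e ℤ.+ e) → ¬ IsO i (e ℤ.+ H)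
    double-nz′ {i} {e} n (h , h′) = n (∣m∣n⇒∣m+n h h , dvd (ℤsolve 2 (λ e h → (e ⊞ h) ⊞ (e ⊞ h) ⊟ (h ⊞ h) ≛ e ⊞ e) P.refl e H) (∣m∣n⇒∣m-n (∣m∣n⇒∣m+n h′ h′) ℤD.∣-refl))

    -- As L is even, the class of 2e consists of even exponents 2k, and 2k lies in it exactly when k
    -- is congruent to e or to e + L/2. Each term at 2k is the square of the term at k, and squares
    -- add.
    𝕏-double₁ : ∀ i e → ¬ IsO (i ℤ.+ i) (e ℤ.+ e) → 𝕏 (i ℤ.+ i) (e ℤ.+ e) ≈ sq (𝕏 i e + 𝕏 i (e ℤ.+ H))
    𝕏-double₁ i e n = trans (ΣZ-even (famX-good _) (good-sq good-s) odd-zero even-sq) (trans (sym (ΣZ-sq good-s)) (sq-cong (ΣZ-+ t₁ t₂)))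
      where
        D = ⟨ i ℤ.+ i ⟩ at (e ℤ.+ e)
        P₁ = ⟨ i ⟩ at e
        P₂ = ⟨ i ⟩ at (e ℤ.+ H)
        t₁ = famX P₁
        t₂ = famX P₂
        good-s : Good (λ k → t₁ k + t₂ k)
        good-s = good-+ (famX-good P₁) (famX-good P₂)
        odd-zero : ∀ k → famX D (ℤ.suc (k ℤ.+ k)) ≈ 0#
        odd-zero k with LL ∣? (ℤ.suc (k ℤ.+ k) ℤ.- (e ℤ.+ e))
        ... | no _ = refl
        ... | yes d = ⊥-elim (L∤odd (k ℤ.- e) (dvd (ℤsolve 2 (λ k e → (ℤcon (+ 1) ⊞ (k ⊞ k)) ⊟ (e ⊞ e) ≛ (k ⊟ e) ⊞ (k ⊟ e) ⊞ ℤcon (+ 1)) P.refl k e) d))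
        twice : ∀ k → (k ℤ.- e) ℤ.+ (k ℤ.- e) ≡ k ℤ.+ k ℤ.- (e ℤ.+ e)
        twice k = ℤsolve 2 (λ k e → (k ⊟ e) ⊞ (k ⊟ e) ≛ k ⊞ k ⊟ (e ⊞ e)) P.refl k e
        even-sq : ∀ k → famX D (k ℤ.+ k) ≈ sq (t₁ k + t₂ k)
        even-sq k with LL ∣? (k ℤ.+ k ℤ.- (e ℤ.+ e)) | LL ∣? (k ℤ.- e) | LL ∣? (k ℤ.- (e ℤ.+ H))
        ... | yes d | yes a | no _ = trans (double-term i k (at-zero P₁ k a (nz (double-nz {i} {e} n))) doubled) (sq-cong (sym (+-idʳ _)))
          where
            doubled : NT ⟨ i ℤ.+ i ⟩ k
            doubled k0 = at-zero D (k ℤ.+ k) d (nz n) (P.cong₂ ℤ._+_ k0 k0)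
        ... | yes d | no _ | yes b = trans (double-term i k (at-zero P₂ k b (nz (double-nz′ {i} {e} n))) doubled) (sq-cong (sym (+-idˡ _)))
          where
            doubled : NT ⟨ i ℤ.+ i ⟩ k
            doubled k0 = at-zero D (k ℤ.+ k) d (nz n) (P.cong₂ ℤ._+_ k0 k0)
        ... | no _ | no _ | no _ = sym (trans (sq-cong (+-idˡ _)) (zeroˡ _))
        ... | _ | yes a | yes b = ⊥-elim (H∤ (dvd (ℤsolve 3 (λ k e h → (k ⊟ e) ⊟ (k ⊟ (e ⊞ h)) ≛ h) P.refl k e H) (∣m∣n⇒∣m-n a b)))
        ... | no c | yes a | _ = ⊥-elim (c (dvd (twice k) (∣m∣n⇒∣m+n a a)))
        ... | no c | _ | yes b = ⊥-elim (c (dvd (ℤsolve 3 (λ k e h → (k ⊟ (e ⊞ h)) ⊞ (k ⊟ (e ⊞ h)) ⊞ (h ⊞ h) ≛ k ⊞ k ⊟ (e ⊞ e)) P.refl k e H) (∣m∣n⇒∣m+n (∣m∣n⇒∣m+n b b) ℤD.∣-refl)))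
        ... | yes d | no a | no b with halve (k ℤ.- e) (dvd (P.sym (twice k)) d)
        ...   | inj₁ h = ⊥-elim (a h)
        ...   | inj₂ h = ⊥-elim (b (dvd (ℤsolve 3 (λ k e h → (k ⊟ e) ⊟ h ≛ k ⊟ (e ⊞ h)) P.refl k e H) h))

    private
      instance
        L-nonZero : ℤ.NonZero LL
        L-nonZero = ℕ.>-nonZero {L} (ℕP.≤-trans p>0 (ℕP.≤-trans (ℕP.m≤m+n p p) (ℕP.m≤m+n (p ℕ.+ p) (p ℕ.+ p))))

    -- Only the class of 2p modulo 4p lacks a representative of absolute value below 2p; there 2p
    -- and -2p tie.
    near : ∀ e → ¬ (LL ∣ e ℤ.- H) → Σ ℤ λ f → (LL ∣ e ℤ.- f) × ∣ f ∣ < p ℕ.+ p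
    near e n with ℕP.<-cmp r (p ℕ.+ p)
      where
        r : ℕ
        r = e ℤDM.% LL
    ... | tri< r<H _ _ = + r , dvd (P.sym diff) (divides (e ℤDM./ LL) P.refl) , r<H
      where
        r = e ℤDM.% LL
        diff : e ℤ.- + r ≡ (e ℤDM./ LL) ℤ.* LL
        diff = P.trans (P.cong (ℤ._- + r) (ℤDM.a≡a%n+[a/n]*n e LL)) (ℤsolve 2 (λ r q → (r ⊞ q) ⊟ r ≛ q) P.refl (+ r) _)
    ... | tri≈ _ r≡H _ = ⊥-elim (n (divides (e ℤDM./ LL) (P.trans (P.cong (λ x → e ℤ.- + x) (P.sym r≡H))
              (P.trans (P.cong (λ x → x ℤ.- + r) (ℤDM.a≡a%n+[a/n]*n e LL)) (ℤsolve 2 (λ r q → (r ⊞ q) ⊟ r ≛ q) P.refl (+ r) _)))))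
      where
        r : ℕ
        r = e ℤDM.% LL
    ... | tri> _ _ H<r = + r ℤ.- LL , divides (e ℤDM./ LL ℤ.+ + 1) diff , small
      where
        r = e ℤDM.% LL
        diff : e ℤ.- (+ r ℤ.- LL) ≡ (e ℤDM./ LL ℤ.+ + 1) ℤ.* LL
        diff = P.trans (P.cong (ℤ._- (+ r ℤ.- LL)) (ℤDM.a≡a%n+[a/n]*n e LL)) (ℤsolve 3 (λ r q l → (r ⊞ q ⊠ l) ⊟ (r ⊟ l) ≛ (q ⊞ ℤcon (+ 1)) ⊠ l) P.refl (+ r) (e ℤDM./ LL) LL)
        r<L : r < L
        r<L = ℤDM.n%d<d e LL
        small : ∣ + r ℤ.- LL ∣ < p ℕ.+ p
        small = P.subst (_< p ℕ.+ p) (P.sym (P.trans (P.cong ∣_∣ (ℤP.[+m]-[+n]≡m⊖n r L)) (ℤP.∣⊖∣-< r<L)))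
          (ℕP.+-cancelˡ-< r _ _ (P.subst (_< r ℕ.+ (p ℕ.+ p)) (P.sym (ℕP.m+[n∸m]≡n (ℕP.<⇒≤ r<L))) (ℕP.+-monoˡ-< (p ℕ.+ p) H<r)))

    𝕏-reg-off : ∀ {i e} → ¬ IsO i e → ¬ (LL ∣ e ℤ.- H) → Reg (𝕏 i e)
    𝕏-reg-off {i} {e} n h with near e h
    ... | f , d , l = reg-cong (sym (𝕏-cong {i} {i} (dvd (P.sym (ℤP.+-inverseʳ i)) d0) d n)) (X-reg-small (⟨ i ⟩ at f) l
          (nz (λ { (x , y) → n (x , dvd (ℤsolve 2 (λ e f → (e ⊟ f) ⊞ f ≛ e) P.refl e f) (∣m∣n⇒∣m+n d y)) })))

    P₄ : ℤ
    P₄ = + p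

    A : Carrier
    A = 𝕏 (+ 0) P₄

    quarter : ∀ e → LL ∣ e ℤ.+ e ℤ.+ H → (LL ∣ e ℤ.+ P₄) ⊎ (LL ∣ e ℤ.- P₄)
    quarter e d with halve (e ℤ.+ P₄) (dvd (ℤsolve 2 (λ e p → e ⊞ e ⊞ (p ⊞ p) ≛ (e ⊞ p) ⊞ (e ⊞ p)) P.refl e P₄) d)
    ... | inj₁ h = inj₁ h
    ... | inj₂ h = inj₂ (dvd (ℤsolve 2 (λ e p → (e ⊞ p) ⊟ (p ⊞ p) ≛ e ⊟ p) P.refl e P₄) h)

    L∤P₄ : ¬ (LL ∣ P₄)
    L∤P₄ d = H∤ (∣m∣n⇒∣m+n d d)

    L∤-P₄ : ¬ (LL ∣ ℤ.- P₄)
    L∤-P₄ d = L∤P₄ (dvd (ℤP.neg-involutive P₄) (∣m⇒∣-m d))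

    A-reg : Reg A
    A-reg = 𝕏-reg-off (λ { (_ , d) → L∤P₄ d }) (λ d → L∤-P₄ (dvd (ℤsolve 1 (λ p → p ⊟ (p ⊞ p) ≛ ⊟ p) P.refl P₄) d))

    self : ∀ {m} i → m ∣ i ℤ.- i
    self i = dvd (P.sym (ℤP.+-inverseʳ i)) d0

    𝕏-near : ∀ {i e} f → + N ∣ i → LL ∣ e ℤ.- f → ¬ (LL ∣ f) → 𝕏 i e ≈ 𝕏 (+ 0) f
    𝕏-near {i} {e} f h d n = 𝕏-cong (dvd (P.sym (ℤP.+-identityʳ i)) h) d (λ { (_ , y) → n (dvd (ℤsolve 2 (λ e f → e ⊟ (e ⊟ f) ≛ f) P.refl e f) (∣m∣n⇒∣m-n y d)) })

    A-neg : 𝕏 (+ 0) (ℤ.- P₄) ≈ A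
    A-neg = 𝕏-neg (+ 0) P₄ (λ { (_ , d) → L∤P₄ d })

    -- The addition formula for S and S + T₂, whose difference is the 2-torsion point T₂, where 𝕏
    -- vanishes. Besides duplication it serves to make 𝕏(S) + 𝕏(S + T₂) regular, as a factor of a
    -- regular product.
    𝕏-split : ∀ i e → ¬ IsO i e → ¬ IsO i (e ℤ.+ H) → ¬ IsO (i ℤ.+ i) (e ℤ.+ e ℤ.+ H) →
              𝕏 i e * 𝕏 i (e ℤ.+ H) ≈ 𝕏 (i ℤ.+ i) (e ℤ.+ (e ℤ.+ H)) * sq (𝕏 i e + 𝕏 i (e ℤ.+ H))
    𝕏-split i e n n′ n″ = trans (𝕏-star i e i (e ℤ.+ H) n n′ (λ { (x , y) → n″ (x , dvd (P.sym (ℤP.+-assoc e e H)) y) }) (λ { (_ , y) → H∤ (dvd minus (∣m⇒∣-m y)) }))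
        (*-congʳ _ (trans (+-congˡ _ (trans (𝕏-cong {i ℤ.- i} {+ 0} {e ℤ.- (e ℤ.+ H)} {H} (dvd (P.sym (ℤP.+-identityʳ _)) (self i))
           (dvd (ℤsolve 2 (λ e h → ⊟ (h ⊞ h) ≛ (e ⊟ (e ⊞ h)) ⊟ h) P.refl e H) (∣m⇒∣-m ℤD.∣-refl)) (λ { (_ , y) → H∤ (dvd minus (∣m⇒∣-m y)) })) 𝕏-T₂)) (+-idʳ _)))
      where
        minus : ℤ.- (e ℤ.- (e ℤ.+ H)) ≡ H
        minus = ℤsolve 2 (λ e h → ⊟ (e ⊟ (e ⊞ h)) ≛ h) P.refl e H

    𝕏-split-reg : ∀ i e → ¬ IsO i e → ¬ IsO i (e ℤ.+ H) → ¬ IsO (i ℤ.+ i) (e ℤ.+ e ℤ.+ H) → Reg (𝕏 i e) → Reg (𝕏 i (e ℤ.+ H)) →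
                  Reg (𝕏 i e + 𝕏 i (e ℤ.+ H))
    𝕏-split-reg i e n n′ n″ ra rb = reg-factor (reg-factorʳ (reg-cong (𝕏-split i e n n′ n″) (reg-* ra rb)))

    -- The addition formulas for the pairs S, P₄ and S + T₂, -P₄ contain the same two values 𝕏(S ±
    -- P₄). Eliminating them leaves a (b + A)² = b (a + A)², that is (a + b)(a b + A²) = 0.
    antipode-generic : ∀ i e → ¬ IsO i e → ¬ IsO i (e ℤ.+ H) → Reg (𝕏 i e) → Reg (𝕏 i (e ℤ.+ H)) →
                       ¬ IsO i (e ℤ.+ P₄) → ¬ IsO i (e ℤ.- P₄) → 𝕏 i e * 𝕏 i (e ℤ.+ H) ≈ sq A
    antipode-generic i e n n′ ra rb n₊ n₋ = +≈0⇒≈ (𝕏-split-reg i e n n′ n″ ra rb _ vanish)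
      where
        a = 𝕏 i e
        b = 𝕏 i (e ℤ.+ H)
        x₊ = 𝕏 i (e ℤ.+ P₄)
        x₋ = 𝕏 i (e ℤ.- P₄)
        i+0 : + N ∣ (i ℤ.+ + 0) ℤ.- i
        i+0 = dvd (ℤsolve 1 (λ i → ℤcon (+ 0) ≛ (i ⊞ ℤcon (+ 0)) ⊟ i) P.refl i) d0
        i-0 : + N ∣ (i ℤ.- + 0) ℤ.- i
        i-0 = dvd (ℤsolve 1 (λ i → ℤcon (+ 0) ≛ (i ⊟ ℤcon (+ 0)) ⊟ i) P.refl i) d0
        via : ∀ {j f} g → + N ∣ j ℤ.- i → LL ∣ f ℤ.- g → ¬ IsO i g → ¬ IsO j f
        via {j} {f} g d d′ ng (x , y) = ng (dvd (ℤsolve 2 (λ j i → j ⊟ (j ⊟ i) ≛ i) P.refl j i) (∣m∣n⇒∣m-n x d) , dvd (ℤsolve 2 (λ j i → j ⊟ (j ⊟ i) ≛ i) P.refl f g) (∣m∣n⇒∣m-n y d′))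
        n″ : ¬ IsO (i ℤ.+ i) (e ℤ.+ e ℤ.+ H)
        n″ (x , y) with quarter e y
        ... | inj₁ d = n₊ (double-∣ i x , d)
        ... | inj₂ d = n₋ (double-∣ i x , d)
        first : a * A ≈ (x₊ + x₋) * sq (a + A)
        first = trans (𝕏-star i e (+ 0) P₄ n (λ { (_ , d) → L∤P₄ d }) (via (e ℤ.+ P₄) i+0 (self (e ℤ.+ P₄)) n₊) (via (e ℤ.- P₄) i-0 (self (e ℤ.- P₄)) n₋))
          (*-congʳ _ (+-cong (𝕏-cong {f = e ℤ.+ P₄} i+0 (self (e ℤ.+ P₄)) (via (e ℤ.+ P₄) i+0 (self (e ℤ.+ P₄)) n₊))
                             (𝕏-cong {f = e ℤ.- P₄} i-0 (self (e ℤ.- P₄)) (via (e ℤ.- P₄) i-0 (self (e ℤ.- P₄)) n₋))))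
        e₁ : LL ∣ ((e ℤ.+ H) ℤ.+ (ℤ.- P₄)) ℤ.- (e ℤ.+ P₄)
        e₁ = dvd (ℤsolve 2 (λ e p → ℤcon (+ 0) ≛ ((e ⊞ (p ⊞ p)) ⊞ (⊟ p)) ⊟ (e ⊞ p)) P.refl e P₄) d0
        e₂ : LL ∣ ((e ℤ.+ H) ℤ.- (ℤ.- P₄)) ℤ.- (e ℤ.- P₄)
        e₂ = dvd (ℤsolve 2 (λ e p → (p ⊞ p) ⊞ (p ⊞ p) ≛ ((e ⊞ (p ⊞ p)) ⊟ (⊟ p)) ⊟ (e ⊟ p)) P.refl e P₄) ℤD.∣-refl
        second : b * A ≈ (x₊ + x₋) * sq (b + A)
        second = begin
          b * A ≈⟨ *-congˡ b (sym A-neg) ⟩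
          b * 𝕏 (+ 0) (ℤ.- P₄) ≈⟨ 𝕏-star i (e ℤ.+ H) (+ 0) (ℤ.- P₄) n′ (λ { (_ , d) → L∤-P₄ d }) (via (e ℤ.+ P₄) i+0 e₁ n₊) (via (e ℤ.- P₄) i-0 e₂ n₋) ⟩
          _ ≈⟨ *-cong (+-cong (𝕏-cong i+0 e₁ (via (e ℤ.+ P₄) i+0 e₁ n₊)) (𝕏-cong i-0 e₂ (via (e ℤ.- P₄) i-0 e₂ n₋))) (sq-cong (+-congˡ b A-neg)) ⟩
          (x₊ + x₋) * sq (b + A) ∎
        cross : a * sq (b + A) ≈ b * sq (a + A)
        cross = cancel A-reg (begin
          A * (a * sq (b + A)) ≈⟨ solve 3 (λ a b A → A :* (a :* b) := (a :* A) :* b) refl a _ A ⟩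
          (a * A) * sq (b + A) ≈⟨ *-congʳ _ first ⟩
          ((x₊ + x₋) * sq (a + A)) * sq (b + A) ≈⟨ solve 3 (λ s x y → (s :* x) :* y := (s :* y) :* x) refl _ _ _ ⟩
          ((x₊ + x₋) * sq (b + A)) * sq (a + A) ≈⟨ *-congʳ _ (sym second) ⟩
          (b * A) * sq (a + A) ≈⟨ solve 3 (λ a b A → (a :* A) :* b := A :* (a :* b)) refl b _ A ⟩
          A * (b * sq (a + A)) ∎)
        vanish : (a + b) * (a * b + sq A) ≈ 0#
        vanish = trans (solve 3 (λ a b A → (a :+ b) :* (a :* b :+ A :* A) := a :* ((b :+ A) :* (b :+ A)) :+ b :* ((a :+ A) :* (a :+ A))) refl a b A) (≈⇒+≈0 cross)

    -- S and S + T₂ are both translates by ±P₄ of the same pair of points.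
    𝕏-antipode : ∀ i e → ¬ IsO i e → ¬ IsO i (e ℤ.+ H) → Reg (𝕏 i e) → Reg (𝕏 i (e ℤ.+ H)) → 𝕏 i e * 𝕏 i (e ℤ.+ H) ≈ sq A
    𝕏-antipode i e n n′ ra rb with + N ∣? i
    ... | yes h with LL ∣? (e ℤ.+ P₄) | LL ∣? (e ℤ.- P₄)
    ...   | yes d | _ = *-cong
        (trans (𝕏-near {i} {e} (ℤ.- P₄) h (dvd (P.cong (λ x → e ℤ.+ x) (P.sym (ℤP.neg-involutive P₄))) d) L∤-P₄) A-neg)
        (𝕏-near {i} {e ℤ.+ H} P₄ h (dvd (ℤsolve 2 (λ e p → e ⊞ p ≛ (e ⊞ (p ⊞ p)) ⊟ p) P.refl e P₄) d) L∤P₄)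
    ...   | no _ | yes d = *-cong
        (𝕏-near {i} {e} P₄ h d L∤P₄)
        (trans (𝕏-near {i} {e ℤ.+ H} (ℤ.- P₄) h (dvd (ℤsolve 2 (λ e p → (e ⊟ p) ⊞ ((p ⊞ p) ⊞ (p ⊞ p)) ≛ (e ⊞ (p ⊞ p)) ⊟ (⊟ p)) P.refl e P₄) (∣m∣n⇒∣m+n d ℤD.∣-refl)) L∤-P₄) A-neg)
    ...   | no x | no y = antipode-generic i e n n′ ra rb (λ { (_ , d) → x d }) (λ { (_ , d) → y d })
    𝕏-antipode i e n n′ ra rb | no h = antipode-generic i e n n′ ra rb (λ { (d , _) → h d }) (λ { (d , _) → h d })

    -- In the exponent class of T₂ the lowest terms tie and say nothing. Such a point is the double
    -- of one with root index i/2 and exponent p, where 𝕏 is known to be regular, and `𝕏-double₁`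
    -- with `𝕏-split-reg` carries this over.
    𝕏-reg : ∀ {i e} → ¬ IsO i e → ¬ IsO i (e ℤ.- H) → Reg (𝕏 i e)
    𝕏-reg {i} {e} n n′ with LL ∣? (e ℤ.- H)
    ... | no h = 𝕏-reg-off n h
    ... | yes h = reg-cong (sym twice) (reg-* r r)
      where
        N∤i : ¬ (+ N ∣ i)
        N∤i x = n′ (x , h)
        j = i ℤ.* half
        jj : + N ∣ i ℤ.- (j ℤ.+ j)
        jj = dvd (ℤsolve 2 (λ i h → ⊟ (i ⊠ (h ⊞ h ⊟ ℤcon (+ 1))) ≛ i ⊟ (i ⊠ h ⊞ i ⊠ h)) P.refl i half) (∣m⇒∣-m (∣n⇒∣m*n i half-spec))
        N∤jj : ¬ (+ N ∣ j ℤ.+ j)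
        N∤jj x = N∤i (dvd (ℤsolve 2 (λ i j → (i ⊟ j) ⊞ j ≛ i) P.refl i (j ℤ.+ j)) (∣m∣n⇒∣m+n jj x))
        N∤j : ¬ (+ N ∣ j)
        N∤j x = N∤jj (∣m∣n⇒∣m+n x x)
        twice : 𝕏 i e ≈ sq (𝕏 j P₄ + 𝕏 j (P₄ ℤ.+ H))
        twice = trans (𝕏-cong {i} {j ℤ.+ j} {e} {P₄ ℤ.+ P₄} jj h n) (𝕏-double₁ j P₄ (λ { (x , _) → N∤jj x }))
        r : Reg (𝕏 j P₄ + 𝕏 j (P₄ ℤ.+ H))
        r = 𝕏-split-reg j P₄ (λ { (x , _) → N∤j x }) (λ { (x , _) → N∤j x }) (λ { (x , _) → N∤jj x })
              (𝕏-reg-off (λ { (x , _) → N∤j x }) (λ d → L∤-P₄ (dvd (ℤsolve 1 (λ p → p ⊟ (p ⊞ p) ≛ ⊟ p) P.refl P₄) d)))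
              (𝕏-reg-off (λ { (x , _) → N∤j x }) (λ d → L∤P₄ (dvd (ℤsolve 1 (λ p → (p ⊞ (p ⊞ p)) ⊟ (p ⊞ p) ≛ p) P.refl P₄) d)))

    -- With a and b the values at S and S + T₂, the left side is (a + b)² a² = (a² + a b)², and a b
    -- = A².
    𝕏-double : ∀ i e → ¬ IsO (i ℤ.+ i) (e ℤ.+ e) → 𝕏 (i ℤ.+ i) (e ℤ.+ e) * sq (𝕏 i e) ≈ fourth (𝕏 i e) + fourth A
    𝕏-double i e n = begin
      𝕏 (i ℤ.+ i) (e ℤ.+ e) * sq a ≈⟨ *-congʳ _ (𝕏-double₁ i e n) ⟩
      sq (a + b) * sq a ≈⟨ solve 2 (λ a b → ((a :+ b) :* (a :+ b)) :* (a :* a) := (a :* a) :* (a :* a) :+ (a :* b) :* (a :* b)) refl a b ⟩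
      fourth a + sq (a * b) ≈⟨ +-congˡ _ (sq-cong (𝕏-antipode i e n₁ n₂ (𝕏-reg n₁ n₃) (𝕏-reg n₂ n₄))) ⟩
      fourth a + fourth A ∎
      where
        a = 𝕏 i e
        b = 𝕏 i (e ℤ.+ H)
        n₁ = double-nz {i} {e} n
        n₂ = double-nz′ {i} {e} n
        n₃ : ¬ IsO i (e ℤ.- H)
        n₃ (x , y) = n₂ (x , dvd (ℤsolve 2 (λ e h → (e ⊟ h) ⊞ (h ⊞ h) ≛ e ⊞ h) P.refl e H) (∣m∣n⇒∣m+n y ℤD.∣-refl))
        n₄ : ¬ IsO i (e ℤ.+ H ℤ.- H)
        n₄ (x , y) = n₁ (x , dvd (ℤsolve 2 (λ e h → e ⊞ h ⊟ h ≛ e) P.refl e H) y)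

    -- In the addition formula the left side is regular, hence so is every factor on the right.
    𝕏-reg-+ : ∀ {i e j f} → ¬ IsO i e → ¬ IsO i (e ℤ.- H) → ¬ IsO j f → ¬ IsO j (f ℤ.- H) →
              ¬ IsO (i ℤ.+ j) (e ℤ.+ f) → ¬ IsO (i ℤ.- j) (e ℤ.- f) → Reg (𝕏 i e + 𝕏 j f)
    𝕏-reg-+ {i} {e} {j} {f} n₁ n₂ n₃ n₄ n₅ n₆ = reg-factor (reg-factorʳ (reg-cong (𝕏-star i e j f n₁ n₃ n₅ n₆) (reg-* (𝕏-reg n₁ n₂) (𝕏-reg n₃ n₄))))

-- The function 𝕎, the value of 𝕏 at a 3-torsion point, and A in terms of r.

module LevelThreeLaw where
  open import Data.Integer.Divisibility.Signed as ℤD using (_∣_; _∣?_; divides; ∣m⇒∣-m)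
  open CharacteristicTwo
  open FormalSeries
  open Homomorphisms
  open BilateralSums
  open LambertSeries
  open EisensteinSeries
  open TwoDivision

  module LevelThree (S : F2Alg) (N p : ℕ) (p>0 : 0 < p) (cyc : Cyclic S N) where
    open Cyclic cyc using (root; root-+; root-nontrivial; root-inv; omega; omega-order; omega-sum; omega-nz)
    open TateCurve S N p p>0 cyc public
    open ℤSolve using () renaming (_:=_ to _≛_; solve to ℤsolve; _:+_ to _⊞_; _:-_ to _⊟_; _:*_ to _⊠_; :-_ to ⊟_; con to ℤcon)

    private
      LL = + (p ℕ.+ p ℕ.+ (p ℕ.+ p))

      rec3 : ∀ a → pows non3 a ≈ (mono a 1 + sq (mono a 1)) + (mono a 1 * sq (mono a 1)) * pows non3 a
      rec3 a = begin
        pows non3 a ≈⟨ pointwise ⟩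
        (mono a 1 + mono (a S.* a) 2) + mono (a S.* (a S.* a)) 3 * pows non3 a
          ≈⟨ +-cong (+-congˡ _ (sym (mono-* a a 1 1))) (*-congʳ _ (sym (trans (*-congˡ _ (mono-* a a 1 1)) (mono-* a _ 1 2)))) ⟩
        (mono a 1 + sq (mono a 1)) + (mono a 1 * sq (mono a 1)) * pows non3 a ∎
        where
          pointwise : pows non3 a ≈ (mono a 1 + mono (a S.* a) 2) + mono (a S.* (a S.* a)) 3 * pows non3 a
          pointwise n = S.trans (h n) (S.+-congˡ _ (S.sym (shiftBy-* 3 (const (a S.* (a S.* a))) (pows non3 a) n)))
            where
              h : ∀ n → pows non3 a n S.≈ (mono a 1 n S.+ mono (a S.* a) 2 n) S.+ shiftBy 3 (const (a S.* (a S.* a)) * pows non3 a) n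
              h zero = S.solve 0 (S.O S.:* S.I S.:= (S.O S.:+ S.O) S.:+ S.O) S.refl
              h (suc zero) = S.solve 1 (λ a → S.I S.:* (a S.:* S.I) S.:= (a S.:+ S.O) S.:+ S.O) S.refl a
              h (suc (suc zero)) = S.solve 1 (λ a → S.I S.:* (a S.:* (a S.:* S.I)) S.:= (S.O S.:+ (a S.:* a)) S.:+ S.O) S.refl a
              h (suc (suc (suc n))) = S.trans (S.solve 3 (λ b a c → b S.:* (a S.:* (a S.:* (a S.:* c))) S.:= (S.O S.:+ S.O) S.:+ (a S.:* (a S.:* a)) S.:* (b S.:* c)) S.refl (S.bit (non3 n)) a (a S.^ n))
                (S.+-congˡ _ (S.sym (conv-const n (a S.* (a S.* a)) (pows non3 a))))

    -- The coefficients of the kernel have period three, so x (1 + m³) = m + m²; the regular factor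
    -- 1 + m cancels.
    isΓ-τ : ∀ a n → let m = mono a (suc n) in τ non3 a (suc n) * (1# + m + sq m) ≈ m
    isΓ-τ a n = cancel r₁ (begin
        (1# + m) * (x * (1# + m + sq m)) ≈⟨ solve 2 (λ x m → (I :+ m) :* (x :* (I :+ m :+ m :* m)) := x :+ (m :* (m :* m)) :* x) refl x m ⟩
        x + (m * sq m) * x ≈⟨ +-congʳ _ r ⟩
        ((m + sq m) + (m * sq m) * x) + (m * sq m) * x ≈⟨ solve 2 (λ m y → ((m :+ m :* m) :+ y) :+ y := (I :+ m) :* m) refl m _ ⟩
        (1# + m) * m ∎)
      where
        x = τ non3 a (suc n)
        m = mono a (suc n)
        im = inflate-mono (suc n) a
        r : x ≈ (m + sq m) + (m * sq m) * x
        r = trans (inflate-cong (suc n) (rec3 a)) (trans (inflate-+ (suc n) _ _) (+-cong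
          (trans (inflate-+ (suc n) _ _) (+-cong im (trans (inflate-* (suc n) _ _) (sq-cong im))))
          (trans (inflate-* (suc n) _ _) (*-congʳ _ (trans (inflate-* (suc n) _ _) (*-cong im (trans (inflate-* (suc n) _ _) (sq-cong im))))))))
        r₁ : Reg (1# + m)
        r₁ = reg-0 (S.reg-cong (S.sym (S.+-idʳ _)) S.reg-1)

    -- 1/(ωu + 1/ωu) + 1/(ω⁻¹u + ω/u) = g + g² for g = 1/(1 + u + u⁻¹).
    three-torsion-term : ∀ {x₁ x₂ x m o o′} → o + o′ ≈ 1# → o * o′ ≈ 1# → IsΦ x₁ (m * o) → IsΦ x₂ (m * o′) → x * (1# + m + sq m) ≈ m →
                         x₁ + x₂ ≈ x + sq x
    three-torsion-term {x₁} {x₂} {x} {m} {o} {o′} s q (e₁ , r₁) (e₂ , r₂) e = cancel (reg-* r₁ r₂) (begin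
        (d₁ * d₂) * (x₁ + x₂) ≈⟨ solve 4 (λ a b c d → (a :* b) :* (c :+ d) := (c :* a) :* b :+ (d :* b) :* a) refl d₁ d₂ x₁ x₂ ⟩
        (x₁ * d₁) * d₂ + (x₂ * d₂) * d₁ ≈⟨ +-cong (*-congʳ d₂ e₁) (*-congʳ d₁ e₂) ⟩
        (m * o) * d₂ + (m * o′) * d₁
          ≈⟨ solve 3 (λ m o p → (m :* o) :* (I :+ (m :* p) :* (m :* p)) :+ (m :* p) :* (I :+ (m :* o) :* (m :* o)) := m :* (o :+ p) :+ (m :* (m :* m)) :* ((o :* p) :* (o :+ p))) refl m o o′ ⟩
        m * (o + o′) + (m * (m * m)) * ((o * o′) * (o + o′)) ≈⟨ +-cong (*-congˡ m s) (*-congˡ _ (*-cong q s)) ⟩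
        m * 1# + (m * (m * m)) * (1# * 1#) ≈⟨ solve 1 (λ m → m :* I :+ (m :* (m :* m)) :* (I :* I) := m :* (I :+ m :+ m :* m) :+ m :* m) refl m ⟩
        m * d + sq m ≈⟨ sym (+-cong (*-congʳ d e) (sq-cong e)) ⟩
        x * d * d + sq (x * d) ≈⟨ solve 2 (λ x d → x :* d :* d :+ (x :* d) :* (x :* d) := (d :* d) :* (x :+ x :* x)) refl x d ⟩
        (d * d) * (x + sq x) ≈⟨ *-congʳ _ (sym dd) ⟩
        (d₁ * d₂) * (x + sq x) ∎)
      where
        d = 1# + m + sq m
        d₁ = 1# + sq (m * o)
        d₂ = 1# + sq (m * o′)
        dd : d₁ * d₂ ≈ d * d
        dd = trans (solve 3 (λ m o p → (I :+ (m :* o) :* (m :* o)) :* (I :+ (m :* p) :* (m :* p)) := I :+ (m :* m) :* ((o :+ p) :* (o :+ p)) :+ ((m :* m) :* (m :* m)) :* ((o :* p) :* (o :* p))) refl m o o′)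
          (trans (+-cong (+-congˡ _ (*-congˡ _ (*-cong s s))) (*-congˡ _ (*-cong q q)))
            (solve 1 (λ m → I :+ (m :* m) :* (I :* I) :+ ((m :* m) :* (m :* m)) :* (I :* I) := (I :+ m :+ m :* m) :* (I :+ m :+ m :* m)) refl m))

    private
      ω ω′ : S.Carrier
      ω = root omega
      ω′ = root (ℤ.- omega)

      triple : ∀ a b b′ n → b S.≈ a S.* ω → b′ S.≈ a S.* ω′ → τ odd b (suc n) + τ odd b′ (suc n) ≈ τ non3 a (suc n) + sq (τ non3 a (suc n))
      triple a b b′ n e e′ = three-torsion-term {o = const ω} {o′ = const ω′}
          (trans (sym (const-+ ω ω′)) (const-cong omega-sum)) (trans (sym (const-* ω ω′)) (const-cong (root-inv omega)))
          (isΦ-cong (m* b ω e) (isΦ-τ b n)) (isΦ-cong (m* b′ ω′ e′) (isΦ-τ b′ n)) (isΓ-τ a n)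
        where
          m* : ∀ b o → b S.≈ a S.* o → mono b (suc n) ≈ mono a (suc n) * const o
          m* b o h = trans (mono-cong (suc n) h) (trans (reflexive (P.cong (mono (a S.* o)) (P.sym (ℕP.+-identityʳ (suc n))))) (sym (mono-* a o (suc n) 0)))

    famW : ℤ → ℤ → ℤ → Carrier
    famW i e = fam non3 S.0# (⟨ i ⟩ at e)

    famW-good : ∀ i e → Good (famW i e)
    famW-good i e = fam-good non3 S.0# (⟨ i ⟩ at e) P.refl

    -- `three-torsion-term` summed over the class of e, with the squares collected into one square.
    -- The class avoids 0, so every term has an expansion.
    𝕎-quadratic : ∀ i e → ¬ (LL ∣ e) → 𝕏 (i ℤ.+ omega) e + 𝕏 (i ℤ.- omega) e ≈ 𝕎 i e + sq (𝕎 i e)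
    𝕎-quadratic i e n = trans (sym (ΣZ-+ _ _)) (trans (ΣZ-cong termwise) (trans (ΣZ-+ _ _) (+-congˡ _ (sym (ΣZ-sq (famW-good i e))))))
      where
        termwise : ∀ k → famX (⟨ i ℤ.+ omega ⟩ at e) k + famX (⟨ i ℤ.- omega ⟩ at e) k ≈ famW i e k + sq (famW i e k)
        termwise k with LL ∣? (k ℤ.- e)
        ... | no _ = trans (+-idˡ _) (sym (trans (+-idˡ _) (zeroˡ _)))
        termwise (+ zero) | yes d = ⊥-elim (n (P.subst (LL ∣_) (P.trans (P.cong ℤ.-_ (ℤP.+-identityˡ (ℤ.- e))) (ℤP.neg-involutive e)) (∣m⇒∣-m d)))
        termwise (+ suc k) | yes d = triple (root i) _ _ k (root-+ _ _) (root-+ _ _)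
        termwise -[1+ k ] | yes d = trans (+-comm _ _) (triple (root (ℤ.- i)) _ _ k
          (S.trans (S.reflexive (P.cong root (ℤsolve 2 (λ i o → ⊟ (i ⊟ o) ≛ ⊟ i ⊞ o) P.refl i omega))) (root-+ _ _))
          (S.trans (S.reflexive (P.cong root (ℤP.neg-distrib-+ i omega))) (root-+ _ _)))

    XQ : Carrier
    XQ = 𝕏 omega (+ 0)

    0<L : 0 ℕ.+ 0 < L
    0<L = ℕP.≤-trans p>0 (ℕP.≤-trans (ℕP.m≤m+n p p) (ℕP.m≤m+n (p ℕ.+ p) (p ℕ.+ p)))

    XQ-0 : XQ 0 S.≈ S.1#
    XQ-0 = S.trans (proj₂ (lead-Eis odd _ ⟨ omega ⟩ 0 P.refl 0<L))
      (S.trans (S.sym (S.*-idʳ _)) (S.trans (S.*-congˡ _ (S.sym omega-sum)) (root-nontrivial omega omega-nz)))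

    private
      zero-const : ∀ c z i e → ¬ (LL ∣ e) → ΣZ (fam c z (⟨ i ⟩ at e)) 0 S.≈ S.0#
      zero-const c z i e n = bsum-vanish 0 0 at0
        where
          at0 : ∀ k → ∣ k ∣ ≤ 0 → fam c z (⟨ i ⟩ at e) k 0 S.≈ S.0#
          at0 (+ zero) _ with LL ∣? (+ 0 ℤ.- e)
          ... | no _ = S.refl
          ... | yes d = ⊥-elim (n (P.subst (LL ∣_) (P.trans (P.cong ℤ.-_ (ℤP.+-identityˡ (ℤ.- e))) (ℤP.neg-involutive e)) (∣m⇒∣-m d)))

    𝕏-0 : ∀ i e → ¬ (LL ∣ e) → 𝕏 i e 0 S.≈ S.0#
    𝕏-0 i e = zero-const odd _ i e

    𝕎-0 : ∀ i e → ¬ (LL ∣ e) → 𝕎 i e 0 S.≈ S.0#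
    𝕎-0 i e = zero-const non3 _ i e

    reg-unipotent : ∀ {f} → f 0 S.≈ S.1# → Reg f
    reg-unipotent h = reg-0 (S.reg-cong (S.sym h) S.reg-1)

    𝕏+XQ-reg : ∀ i e → ¬ (LL ∣ e) → Reg (𝕏 i e + XQ)
    𝕏+XQ-reg i e n = reg-unipotent (S.trans (S.+-cong (𝕏-0 i e n) XQ-0) (S.+-idˡ _))

    -- The quadratic equation for 𝕎 has the two roots 𝕏/(𝕏 + XQ) and XQ/(𝕏 + XQ); constant terms decide.
    𝕎-law : ∀ i e → ¬ (LL ∣ e) → 𝕎 i e * (𝕏 i e + XQ) ≈ 𝕏 i e
    𝕎-law i e n = +≈0⇒≈ (reg-unipotent const-1 _ product)
      where
        x = 𝕏 i e
        w = 𝕎 i e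
        const-1 : (w * (x + XQ) + XQ) 0 S.≈ S.1#
        const-1 = S.trans (S.+-cong (S.trans (S.*-congʳ _ (𝕎-0 i e n)) (S.zeroˡ _)) XQ-0) (S.+-idˡ _)
        far : ∀ {j} → ¬ IsO j e
        far (_ , d) = n d
        law : x * XQ ≈ (w + sq w) * sq (x + XQ)
        law = trans (𝕏-star i e omega (+ 0) far (λ { (d , _) → omega-nz d })
                (λ { (_ , d) → n (P.subst (LL ∣_) (ℤP.+-identityʳ e) d) }) (λ { (_ , d) → n (P.subst (LL ∣_) (ℤP.+-identityʳ e) d) }))
              (*-congʳ _ (trans (+-cong (reflexive (P.cong (𝕏 _) (ℤP.+-identityʳ e))) (reflexive (P.cong (𝕏 _) (ℤP.+-identityʳ e)))) (𝕎-quadratic i e n)))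
        product : (w * (x + XQ) + XQ) * (w * (x + XQ) + x) ≈ 0#
        product = trans (solve 3 (λ w x c → (w :* (x :+ c) :+ c) :* (w :* (x :+ c) :+ x) := (w :+ w :* w) :* ((x :+ c) :* (x :+ c)) :+ x :* c) refl w x XQ)
          (trans (+-congˡ _ law) (double _))

    r̂ : Carrier
    r̂ = 𝕎 (+ 0) P₄

    private
      P₄-law : r̂ * (A + XQ) ≈ A
      P₄-law = 𝕎-law (+ 0) P₄ L∤P₄

      1+r̂-reg : Reg (1# + r̂)
      1+r̂-reg = reg-unipotent (S.trans (S.+-congˡ _ (𝕎-0 (+ 0) P₄ L∤P₄)) (S.+-idʳ _))

      A-linear : A * (1# + r̂) ≈ r̂ * XQ
      A-linear = trans (solve 3 (λ a r c → a :* (I :+ r) := (r :* (a :+ c) :+ a) :+ r :* c) refl A r̂ XQ)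
        (trans (+-congʳ _ (≈⇒+≈0 P₄-law)) (+-idˡ _))

      XQ-reg : Reg XQ
      XQ-reg = reg-unipotent XQ-0

      -- Since 3Q = 0 and 𝕏 is even, 𝕏(2Q) = 𝕏(-Q) = 𝕏(Q), and duplication becomes an equation for
      -- 𝕏(Q).
      Q-double : XQ * sq XQ ≈ fourth XQ + fourth A
      Q-double = trans (*-congʳ _ (sym 2Q)) (𝕏-double omega (+ 0) n2)
        where
          n2 : ¬ IsO (omega ℤ.+ omega) (+ 0 ℤ.+ + 0)
          n2 (d , _) = omega-nz (double-∣ omega d)
          2Q : 𝕏 (omega ℤ.+ omega) (+ 0 ℤ.+ + 0) ≈ XQ
          2Q = trans (𝕏-cong {omega ℤ.+ omega} {ℤ.- omega} {+ 0} {+ 0}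
              (P.subst (+ N ∣_) (ℤsolve 1 (λ o → o ⊞ o ⊞ o ≛ (o ⊞ o) ⊟ (⊟ o)) P.refl omega) omega-order) (divides (+ 0) P.refl) n2)
            (𝕏-neg omega (+ 0) (λ { (d , _) → omega-nz d }))

    -- Eliminate A between c³ + c⁴ = A⁴, from duplication at Q, and A (1 + r) = r c, from `𝕎-law` at
    -- P₄. With (1 + r)⁴ + r⁴ = 1 this gives c³ ((1 + r)⁴ + c) = 0, and c is regular.
    XQ-value : XQ ≈ fourth (1# + r̂)
    XQ-value = sym (+≈0⇒≈ (reg-* XQ-reg (reg-* XQ-reg XQ-reg) _ (begin
        (c * sq c) * (fourth v + c) ≈⟨ solve 2 (λ c r → let u = I :+ r in (c :* (c :* c)) :* ((u :* u) :* (u :* u) :+ c)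
            := (c :* (c :* c) :+ (c :* c) :* (c :* c)) :* ((u :* u) :* (u :* u)) :+ ((r :* c) :* (r :* c)) :* ((r :* c) :* (r :* c))) refl c r̂ ⟩
        (c * sq c + fourth c) * fourth v + fourth (r̂ * c) ≈⟨ +-cong (*-congʳ _ A⁴) (sq-cong (sq-cong (sym A-linear))) ⟩
        fourth A * fourth v + fourth (A * v) ≈⟨ solve 2 (λ a u → ((a :* a) :* (a :* a)) :* ((u :* u) :* (u :* u)) :+ ((a :* u) :* (a :* u)) :* ((a :* u) :* (a :* u)) := O) refl A v ⟩
        0# ∎)))
      where
        c = XQ
        v = 1# + r̂
        A⁴ : c * sq c + fourth c ≈ fourth A
        A⁴ = trans (+-congʳ _ Q-double) (solve 2 (λ a b → (a :+ b) :+ a := b) refl _ _)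

    A-value : A ≈ r̂ * (1# + r̂) * sq (1# + r̂)
    A-value = cancel 1+r̂-reg (trans (*-comm _ A) (trans A-linear (trans (*-congˡ _ XQ-value)
      (solve 1 (λ r → let u = I :+ r in r :* ((u :* u) :* (u :* u)) := u :* (r :* u :* (u :* u))) refl r̂))))

-- Lambert series modulo 2: the expansions of r and A.

module DivisorSums where
  open import Defs
  open import Data.Bool using (T)
  open import Data.Nat.Divisibility using (_∣_; _∣?_; divides; ∣m∣n⇒∣m+n; ∣-refl; ∣⇒≤; m∣m*n)
  open import Data.Nat.Tactic.RingSolver using (solve-∀)
  open CharacteristicTwo
  open FormalSeries
  open Homomorphisms
  open LambertSeries using (odd; non3)

  module 𝔹 = Ring boolAlg
  module 𝔹S where
    open Series boolAlg public
    open Inflate boolAlg public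

  ≡ᵇ-true : ∀ {m n} → m ≡ n → (m ≡ᵇ n) ≡ true
  ≡ᵇ-true {m} P.refl = self m
    where
      self : ∀ m → (m ≡ᵇ m) ≡ true
      self zero = P.refl
      self (suc m) = self m

  ≡ᵇ-false : ∀ {m n} → ¬ (m ≡ n) → (m ≡ᵇ n) ≡ false
  ≡ᵇ-false {m} {n} ne with m ≡ᵇ n in eq
  ... | false = P.refl
  ... | true = ⊥-elim (ne (ℕP.≡ᵇ⇒≡ m n (P.subst T (P.sym eq) _)))

  xsum≡sum : ∀ n f → xsum n f ≡ 𝔹.sum n f
  xsum≡sum zero f = P.refl
  xsum≡sum (suc n) f = P.cong (f n xor_) (xsum≡sum n f)

  -- The pairs (i, j) and (j, i) cancel modulo 2. This is how counts of factorisations turn into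
  -- counts of squares.
  sum-symmetric : ∀ n (g : ℕ → ℕ → Bool) → (∀ i j → g i j ≡ g j i) → 𝔹.sum n (λ i → 𝔹.sum n (g i)) ≡ 𝔹.sum n (λ i → g i i)
  sum-symmetric zero g s = P.refl
  sum-symmetric (suc n) g s = P.trans (P.cong ((g n n xor 𝔹.sum n (g n)) xor_) (𝔹.sum-+ n (λ i → g i n) (λ i → 𝔹.sum n (g i))))
    (P.trans (P.cong₂ (λ a b → (g n n xor 𝔹.sum n (g n)) xor (a xor b)) (𝔹.sum-cong n (λ i → s i n)) (sum-symmetric n g s))
      (𝔹.solve 3 (λ a b c → (a 𝔹.:+ b) 𝔹.:+ (b 𝔹.:+ c) 𝔹.:= a 𝔹.:+ c) P.refl (g n n) (𝔹.sum n (g n)) _))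

  sum-multiples : ∀ k .{{_ : NonZero k}} n (f : ℕ → Bool) → (∀ m → n < m → f m ≡ false) →
                  𝔹.sum n (λ i → does (k ∣? suc i) ∧ f (suc i)) ≡ 𝔹.sum n (λ i → f (k ℕ.* suc i))
  sum-multiples k n f z = begin
    𝔹.sum n (λ i → does (k ∣? suc i) ∧ f (suc i)) ≡⟨ 𝔹.sum-cong< n (λ i l → P.cong (_∧ f (suc i)) (P.sym (count i l))) ⟩
    𝔹.sum n (λ i → 𝔹.sum n (λ j → k ℕ.* suc j ≡ᵇ suc i) ∧ f (suc i)) ≡⟨ 𝔹.sum-cong n (λ i → 𝔹.sum-*ʳ n (f (suc i)) _) ⟩
    𝔹.sum n (λ i → 𝔹.sum n (λ j → (k ℕ.* suc j ≡ᵇ suc i) ∧ f (suc i))) ≡⟨ 𝔹.sum-swap n n _ ⟩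
    𝔹.sum n (λ j → 𝔹.sum n (λ i → (k ℕ.* suc j ≡ᵇ suc i) ∧ f (suc i))) ≡⟨ 𝔹.sum-cong n pick-one ⟩
    𝔹.sum n (λ j → f (k ℕ.* suc j)) ∎
    where
      open P.≡-Reasoning
      k*≢0 : ∀ k .{{_ : NonZero k}} j → Σ ℕ λ m → k ℕ.* suc j ≡ suc m
      k*≢0 (suc k) j = _ , P.refl
      count : ∀ i → i < n → 𝔹.sum n (λ j → k ℕ.* suc j ≡ᵇ suc i) ≡ does (k ∣? suc i)
      count i l with k ∣? suc i
      ... | no ne = 𝔹.sum-0 n (λ j _ → ≡ᵇ-false (λ e → ne (divides (suc j) (P.trans (P.sym e) (ℕP.*-comm k (suc j))))))
      ... | yes (divides (suc q) e) = P.trans (𝔹.only n q (ℕP.≤-trans q≤ l) (λ j _ ne → ≡ᵇ-false (λ h → ne (ℕP.suc-injective (ℕP.*-cancelˡ-≡ (suc j) (suc q) k (P.trans h (P.trans e (ℕP.*-comm (suc q) k))))))))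
                       (≡ᵇ-true (P.trans (ℕP.*-comm k (suc q)) (P.sym e)))
        where
          q≤ : suc q ≤ suc i
          q≤ = P.subst (suc q ≤_) (P.sym e) (ℕP.m≤m*n (suc q) k)
      pick-one : ∀ j → 𝔹.sum n (λ i → (k ℕ.* suc j ≡ᵇ suc i) ∧ f (suc i)) ≡ f (k ℕ.* suc j)
      pick-one j with k*≢0 k j
      ... | m , e with ℕP.<-≤-connex m n
      ...   | inj₁ m<n = P.trans (𝔹.only n m m<n (λ i _ ne → P.cong (_∧ f (suc i)) (≡ᵇ-false (λ h → ne (ℕP.suc-injective (P.trans (P.sym h) e))))))
                          (P.trans (P.cong (_∧ f (suc m)) (≡ᵇ-true e)) (P.cong f (P.sym e)))
      ...   | inj₂ n≤m = P.trans (𝔹.sum-0 n (λ i l → P.cong (_∧ f (suc i)) (≡ᵇ-false (λ h → ℕP.<⇒≱ l (ℕP.≤-trans n≤m (ℕP.≤-reflexive (ℕP.suc-injective (P.trans (P.sym e) h))))))))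
                          (P.sym (P.trans (P.cong f e) (z (suc m) (s≤s n≤m))))

  odd-∣ : ∀ n → odd n ≡ true xor does (2 ∣? n)
  odd-∣ n with 2 ∣? n
  ... | yes d@(divides q P.refl) = P.trans (even q) (P.sym (P.cong not (dec-true (2 ∣? q ℕ.* 2) d)))
    where
      even : ∀ q → odd (q ℕ.* 2) ≡ false
      even zero = P.refl
      even (suc q) rewrite even q = P.refl
  ... | no ne = P.trans (other n ne) (P.sym (P.cong not (dec-false (2 ∣? n) ne)))
    where
      other : ∀ n → ¬ (2 ∣ n) → odd n ≡ true
      other zero ne = ⊥-elim (ne (divides 0 P.refl))
      other (suc zero) ne = P.refl
      other (suc (suc n)) ne rewrite other n (λ d → ne (∣m∣n⇒∣m+n ∣-refl d)) = P.refl

  non3-∣ : ∀ n → non3 n ≡ true xor does (3 ∣? n)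
  non3-∣ n with 3 ∣? n
  ... | yes d@(divides q P.refl) = P.trans (triple q) (P.sym (P.cong not (dec-true (3 ∣? q ℕ.* 3) d)))
    where
      triple : ∀ q → non3 (q ℕ.* 3) ≡ false
      triple zero = P.refl
      triple (suc q) = triple q
  ... | no ne = P.trans (other n ne) (P.sym (P.cong not (dec-false (3 ∣? n) ne)))
    where
      other : ∀ n → ¬ (3 ∣ n) → non3 n ≡ true
      other zero ne = ⊥-elim (ne (divides 0 P.refl))
      other (suc zero) ne = P.refl
      other (suc (suc zero)) ne = P.refl
      other (suc (suc (suc n))) ne = other n (λ d → ne (∣m∣n⇒∣m+n ∣-refl d))

  -- lam c is the Lambert series Σ_{m odd} Σ_d c(d) x^{md}.
  lam : (ℕ → Bool) → Series
  lam c n = 𝔹.sum n (λ i → odd (suc i) ∧ 𝔹S.inflate (suc i) c n)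

  inflate-count : ∀ m .{{_ : NonZero m}} c n → 0 < n → 𝔹S.inflate m c n ≡ 𝔹.sum n (λ j → (m ℕ.* suc j ≡ᵇ n) ∧ c (suc j))
  inflate-count m c n pos with m ∣? n
  ... | no ne = P.sym (𝔹.sum-0 n (λ j _ → P.cong (_∧ c (suc j)) (≡ᵇ-false (λ e → ne (divides (suc j) (P.trans (P.sym e) (ℕP.*-comm m (suc j))))))))
  ... | yes (divides zero e) = ⊥-elim (ℕP.<⇒≢ pos (P.sym e))
  ... | yes (divides (suc q) e) = P.sym (P.trans (𝔹.only n q (P.subst (suc q ≤_) (P.sym e) (ℕP.m≤m*n (suc q) m))
        (λ j _ ne → P.cong (_∧ c (suc j)) (≡ᵇ-false (λ h → ne (ℕP.suc-injective (ℕP.*-cancelˡ-≡ (suc j) (suc q) m (P.trans h (P.trans e (ℕP.*-comm (suc q) m)))))))))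
        (P.cong (_∧ c (suc q)) (≡ᵇ-true (P.trans (ℕP.*-comm m (suc q)) (P.sym e)))))

  -- Writing `odd` as 1 + [2 ∣ m] and `non3` as 1 + [3 ∣ d] makes the coefficient the parity of the
  -- number of pairs a, b with n equal to a b, 2 a b, 3 a b or 6 a b; by symmetry only a = b
  -- survives.
  rS-lam : ∀ n → rS n ≡ lam non3 n
  rS-lam zero = P.refl
  rS-lam n@(suc _) = P.sym (begin
    𝔹.sum n (λ i → odd (suc i) ∧ 𝔹S.inflate (suc i) non3 n)
      ≡⟨ 𝔹.sum-cong n (λ i → P.cong₂ _∧_ (odd-∣ (suc i)) (P.trans (inflate-count (suc i) non3 n (s≤s z≤n)) (inner (suc i)))) ⟩
    𝔹.sum n (λ i → (true xor does (2 ∣? suc i)) ∧ g (suc i))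
      ≡⟨ 𝔹.sum-cong n (λ i → 𝔹.solve 2 (λ a b → (𝔹.I 𝔹.:+ a) 𝔹.:* b 𝔹.:= b 𝔹.:+ a 𝔹.:* b) P.refl (does (2 ∣? suc i)) (g (suc i))) ⟩
    𝔹.sum n (λ i → g (suc i) xor (does (2 ∣? suc i) ∧ g (suc i))) ≡⟨ 𝔹.sum-+ n (λ i → g (suc i)) (λ i → does (2 ∣? suc i) ∧ g (suc i)) ⟩
    𝔹.sum n (λ i → g (suc i)) xor 𝔹.sum n (λ i → does (2 ∣? suc i) ∧ g (suc i)) ≡⟨ P.cong (𝔹.sum n (λ i → g (suc i)) xor_) (sum-multiples 2 n g big) ⟩
    𝔹.sum n (λ i → g (suc i)) xor 𝔹.sum n (λ i → g (2 ℕ.* suc i)) ≡⟨ P.cong₂ _xor_ (𝔹.sum-+ n (λ i → row (suc i)) (λ i → row₃ (suc i))) (𝔹.sum-+ n (λ i → row (2 ℕ.* suc i)) (λ i → row₃ (2 ℕ.* suc i))) ⟩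
    (pairs (λ a b → a ℕ.* b) xor pairs (λ a b → a ℕ.* (3 ℕ.* b))) xor (pairs (λ a b → 2 ℕ.* a ℕ.* b) xor pairs (λ a b → 2 ℕ.* a ℕ.* (3 ℕ.* b)))
      ≡⟨ P.cong₂ _xor_ (P.cong₂ _xor_ (diag (λ a b → a ℕ.* b) ℕP.*-comm) (P.trans (re (λ a b → a ℕ.* (3 ℕ.* b)) (λ a b → 3 ℕ.* a ℕ.* b) solve-∀) (diag (λ a b → 3 ℕ.* a ℕ.* b) solve-∀)))
                       (P.cong₂ _xor_ (diag (λ a b → 2 ℕ.* a ℕ.* b) solve-∀) (P.trans (re (λ a b → 2 ℕ.* a ℕ.* (3 ℕ.* b)) (λ a b → 6 ℕ.* a ℕ.* b) solve-∀) (diag (λ a b → 6 ℕ.* a ℕ.* b) solve-∀))) ⟩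
    (sq1 xor sq3) xor (sq2 xor sq6) ≡⟨ 𝔹.solve 4 (λ a b c d → (a 𝔹.:+ b) 𝔹.:+ (c 𝔹.:+ d) 𝔹.:= (a 𝔹.:+ c) 𝔹.:+ (b 𝔹.:+ d)) P.refl sq1 sq3 sq2 sq6 ⟩
    (sq1 xor sq2) xor (sq3 xor sq6) ≡⟨ P.sym (P.trans (xsum≡sum n (λ i → (s₁ i xor s₂ i) xor (s₃ i xor s₆ i))) (P.trans (𝔹.sum-+ n (λ i → s₁ i xor s₂ i) (λ i → s₃ i xor s₆ i)) (P.cong₂ _xor_ (𝔹.sum-+ n s₁ s₂) (𝔹.sum-+ n s₃ s₆)))) ⟩
    rS n ∎)
    where
      open P.≡-Reasoning
      pairs : (ℕ → ℕ → ℕ) → Bool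
      pairs h = 𝔹.sum n (λ i → 𝔹.sum n (λ j → h (suc i) (suc j) ≡ᵇ n))
      row row₃ g : ℕ → Bool
      row m = 𝔹.sum n (λ j → m ℕ.* suc j ≡ᵇ n)
      row₃ m = 𝔹.sum n (λ j → m ℕ.* (3 ℕ.* suc j) ≡ᵇ n)
      g m = row m xor row₃ m
      big : ∀ m → n < m → g m ≡ false
      big m l = P.cong₂ _xor_ (𝔹.sum-0 n (λ j _ → ≡ᵇ-false (λ e → ℕP.<⇒≱ l (P.subst (m ≤_) e (ℕP.m≤m*n m (suc j))))))
                              (𝔹.sum-0 n (λ j _ → ≡ᵇ-false (λ e → ℕP.<⇒≱ l (P.subst (m ≤_) e (ℕP.m≤m*n m (3 ℕ.* suc j))))))
      inner : ∀ m .{{_ : NonZero m}} → 𝔹.sum n (λ j → (m ℕ.* suc j ≡ᵇ n) ∧ non3 (suc j)) ≡ g m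
      inner m = P.trans (𝔹.sum-cong n (λ j → P.trans (P.cong ((m ℕ.* suc j ≡ᵇ n) ∧_) (non3-∣ (suc j)))
          (𝔹.solve 2 (λ a b → b 𝔹.:* (𝔹.I 𝔹.:+ a) 𝔹.:= b 𝔹.:+ a 𝔹.:* b) P.refl (does (3 ∣? suc j)) (m ℕ.* suc j ≡ᵇ n))))
        (P.trans (𝔹.sum-+ n (λ j → m ℕ.* suc j ≡ᵇ n) (λ j → does (3 ∣? suc j) ∧ (m ℕ.* suc j ≡ᵇ n))) (P.cong (𝔹.sum n (λ j → m ℕ.* suc j ≡ᵇ n) xor_) (sum-multiples 3 n (λ d → m ℕ.* d ≡ᵇ n)
          (λ d l → ≡ᵇ-false (λ e → ℕP.<⇒≱ l (P.subst (d ≤_) e (ℕP.m≤n*m d m)))))))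
      diag : ∀ h → (∀ a b → h a b ≡ h b a) → pairs h ≡ 𝔹.sum n (λ i → h (suc i) (suc i) ≡ᵇ n)
      diag h s = sum-symmetric n (λ i j → h (suc i) (suc j) ≡ᵇ n) (λ i j → P.cong (_≡ᵇ n) (s (suc i) (suc j)))
      re : ∀ h h′ → (∀ a b → h a b ≡ h′ a b) → pairs h ≡ pairs h′
      re h h′ e = 𝔹.sum-cong n (λ i → 𝔹.sum-cong n (λ j → P.cong (_≡ᵇ n) (e (suc i) (suc j))))
      s₁ s₂ s₃ s₆ : ℕ → Bool
      s₁ i = suc i ℕ.* suc i ≡ᵇ n
      s₂ i = 2 ℕ.* suc i ℕ.* suc i ≡ᵇ n
      s₃ i = 3 ℕ.* suc i ℕ.* suc i ≡ᵇ n
      s₆ i = 6 ℕ.* suc i ℕ.* suc i ≡ᵇ n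
      sq1 = 𝔹.sum n s₁
      sq2 = 𝔹.sum n s₂
      sq3 = 𝔹.sum n s₃
      sq6 = 𝔹.sum n s₆

  lam-extend : ∀ c N n → c 0 ≡ false → 0 < n → n ≤ N → 𝔹.sum N (λ i → odd (suc i) ∧ 𝔹S.inflate (suc i) c n) ≡ lam c n
  lam-extend c zero zero c0 pos l = P.refl
  lam-extend c zero (suc n) c0 pos ()
  lam-extend c (suc N) n c0 pos l with ℕP.m≤n⇒m<n∨m≡n l
  ... | inj₂ P.refl = P.refl
  ... | inj₁ (s≤s n≤N) = P.trans (P.cong₂ _xor_ (P.trans (P.cong (odd (suc N) ∧_) (𝔹S.inflate-∤ (suc N) c n (λ d → ℕP.<⇒≱ (s≤s n≤N) (∣⇒≤ {{ℕ.>-nonZero pos}} d)))) (𝔹.zeroʳ (odd (suc N)))) (lam-extend c N n c0 pos n≤N)) P.refl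

  inflate-inflate : ∀ m k .{{_ : NonZero m}} .{{_ : NonZero k}} c n → 𝔹S.inflate m (𝔹S.inflate k c) (k ℕ.* n) ≡ 𝔹S.inflate m c n
  inflate-inflate m k c n with m ∣? n
  ... | yes (divides q P.refl) = P.trans (P.cong (𝔹S.inflate m (𝔹S.inflate k c)) (P.trans (P.cong (k ℕ.*_) (ℕP.*-comm q m)) (P.trans (P.sym (ℕP.*-assoc k m q)) (P.trans (P.cong (ℕ._* q) (ℕP.*-comm k m)) (P.trans (ℕP.*-assoc m k q) (ℕP.*-comm m (k ℕ.* q)))))))
        (P.trans (𝔹S.inflate-∣ m (𝔹S.inflate k c) (k ℕ.* q)) (P.trans (P.cong (𝔹S.inflate k c) (ℕP.*-comm k q)) (𝔹S.inflate-∣ k c q)))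
  ... | no ne with m ∣? (k ℕ.* n)
  ...   | no _ = P.refl
  ...   | yes (divides q e) = 𝔹S.inflate-∤ k c q (λ { (divides s P.refl) → ne (divides s (ℕP.*-cancelˡ-≡ n (s ℕ.* m) k
              (P.trans e (P.trans (P.cong (ℕ._* m) (ℕP.*-comm s k)) (ℕP.*-assoc k s m))))) })

  lam-inflate : ∀ k .{{_ : NonZero k}} c → c 0 ≡ false → ∀ n → lam (𝔹S.inflate k c) n ≡ 𝔹S.inflate k (lam c) n
  lam-inflate k c c0 n with k ∣? n
  ... | yes (divides zero P.refl) = P.refl
  ... | yes (divides q@(suc _) P.refl) = P.trans (𝔹.sum-cong (q ℕ.* k) (λ i → P.cong (odd (suc i) ∧_)
          (P.trans (P.cong (𝔹S.inflate (suc i) (𝔹S.inflate k c)) (ℕP.*-comm q k)) (inflate-inflate (suc i) k c q))))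
        (lam-extend c (q ℕ.* k) q c0 (s≤s z≤n) (ℕP.m≤m*n q k))
  ... | no ne = 𝔹.sum-0 n (λ i _ → P.trans (P.cong (odd (suc i) ∧_) (vanish (suc i))) (𝔹.zeroʳ (odd (suc i))))
    where
      vanish : ∀ m .{{_ : NonZero m}} → 𝔹S.inflate m (𝔹S.inflate k c) n ≡ false
      vanish m with m ∣? n
      ... | no _ = P.refl
      ... | yes (divides q P.refl) = 𝔹S.inflate-∤ k c q (λ { (divides s P.refl) → ne (divides (s ℕ.* m) (P.trans (ℕP.*-assoc s k m) (P.trans (P.cong (s ℕ.*_) (ℕP.*-comm k m)) (P.sym (ℕP.*-assoc s m k))))) })

  lam-cong : ∀ {c d} → (∀ n → c n ≡ d n) → ∀ n → lam c n ≡ lam d n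
  lam-cong e n = 𝔹.sum-cong n (λ i → P.cong (odd (suc i) ∧_) (𝔹S.inflate-cong (suc i) e n))

  lam-+ : ∀ c d n → lam (λ i → c i xor d i) n ≡ lam c n xor lam d n
  lam-+ c d n = P.trans (𝔹.sum-cong n (λ i → P.trans (P.cong (odd (suc i) ∧_) (𝔹S.inflate-+ (suc i) c d n)) (𝔹.distribˡ (odd (suc i)) _ _))) (𝔹.sum-+ n _ _)

  -- Frobenius over 𝔽₂: squaring is the substitution x ↦ x². Both sides obey the same recursion on
  -- the tail of f.
  square-even : ∀ (f : Series) n → 𝔹S.sq f n ≡ 𝔹S.inflate 2 f n
  square-even f n = 𝔹S.≈[]⇒≈ (λ n → upTo n f) n
    where
      upTo : ∀ n f → 𝔹S.sq f 𝔹S.≈[ n ] 𝔹S.inflate 2 f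
      step : ∀ n f → 𝔹S.shiftBy 2 (𝔹S.sq (f ∘ suc)) 𝔹S.≈[ n ] 𝔹S.shiftBy 2 (𝔹S.inflate 2 (f ∘ suc))
      step zero f zero z≤n = P.refl
      step (suc n) f = 𝔹S.shiftBy-≈[] 2 n (upTo n (f ∘ suc))
      upTo n f = 𝔹S.≈[]-trans (𝔹S.≈⇒≈[] n left) (𝔹S.≈[]-trans (𝔹S.+-cong[] {𝔹S.const (f 0)} {𝔹S.const (f 0)} n (λ _ _ → P.refl) (step n f)) (𝔹S.≈⇒≈[] n (𝔹S.sym right)))
        where
          left : 𝔹S.sq f 𝔹S.≈ 𝔹S.const (f 0) 𝔹S.+ 𝔹S.shiftBy 2 (𝔹S.sq (f ∘ suc))
          left = 𝔹S.trans (𝔹S.sq-cong (𝔹S.head-tail f)) (𝔹S.trans (𝔹S.sq-+ (𝔹S.const (f 0)) (𝔹S.shift (f ∘ suc))) (𝔹S.+-cong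
            (𝔹S.trans (𝔹S.sym (𝔹S.const-* (f 0) (f 0))) (𝔹S.const-cong (BoolP.∧-idem (f 0))))
            (𝔹S.trans (𝔹S.shift-* (f ∘ suc) (𝔹S.shift (f ∘ suc))) (𝔹S.shift-cong (𝔹S.trans (𝔹S.*-comm (f ∘ suc) (𝔹S.shift (f ∘ suc))) (𝔹S.shift-* (f ∘ suc) (f ∘ suc)))))))
          right : 𝔹S.inflate 2 f 𝔹S.≈ 𝔹S.const (f 0) 𝔹S.+ 𝔹S.shiftBy 2 (𝔹S.inflate 2 (f ∘ suc))
          right = 𝔹S.trans (𝔹S.inflate-cong 2 (𝔹S.head-tail f)) (𝔹S.trans (𝔹S.inflate-+ 2 (𝔹S.const (f 0)) (𝔹S.shift (f ∘ suc))) (𝔹S.+-cong (inflate-const (f 0)) (𝔹S.inflate-shift 2 (f ∘ suc))))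
            where
              inflate-const : ∀ c → 𝔹S.inflate 2 (𝔹S.const c) 𝔹S.≈ 𝔹S.const c
              inflate-const c = 𝔹S.trans (𝔹S.inflate-cong 2 (𝔹S.sym (𝔹S.*-idʳ (𝔹S.const c)))) (𝔹S.trans (𝔹S.inflate-scale 2 c 𝔹S.1#)
                (𝔹S.trans (𝔹S.*-cong {𝔹S.const c} {𝔹S.const c} {𝔹S.inflate 2 𝔹S.1#} {𝔹S.1#} (λ _ → P.refl) (𝔹S.inflate-1 2)) (𝔹S.*-idʳ (𝔹S.const c))))

  -- Modulo 2 this is the sum of x^{n²} over odd n, the factorisations with two different factors
  -- cancelling in pairs.
  A₁ : Series
  A₁ = lam odd

  -- Both sides are the indicator of the d prime to 6.
  non3-odd : ∀ d → non3 d xor 𝔹S.inflate 2 non3 d ≡ odd d xor 𝔹S.inflate 3 odd d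
  non3-odd d = P.trans (P.cong₂ _xor_ (non3-∣ d) (two d)) (P.trans (by (does (2 ∣? d)) (does (3 ∣? d))) (P.sym (P.cong₂ _xor_ (odd-∣ d) (three d))))
    where
      by : ∀ a b → (true xor b) xor (a ∧ (true xor b)) ≡ (true xor a) xor (b ∧ (true xor a))
      by true true = P.refl
      by true false = P.refl
      by false true = P.refl
      by false false = P.refl
      two : ∀ d → 𝔹S.inflate 2 non3 d ≡ does (2 ∣? d) ∧ (true xor does (3 ∣? d))
      two d = P.trans (𝔹S.inflate-unique 2 non3 (λ n → does (2 ∣? n) ∧ non3 n) val (λ n ne → P.cong (_∧ non3 n) (dec-false (2 ∣? n) ne)) d) (P.cong (does (2 ∣? d) ∧_) (non3-∣ d))
        where
          twice : ∀ q → non3 (q ℕ.* 2) ≡ non3 q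
          twice zero = P.refl
          twice (suc zero) = P.refl
          twice (suc (suc zero)) = P.refl
          twice (suc (suc (suc q))) = twice q
          val : ∀ q → (does (2 ∣? q ℕ.* 2) ∧ non3 (q ℕ.* 2)) ≡ non3 q
          val q = P.trans (P.cong (_∧ non3 (q ℕ.* 2)) (dec-true (2 ∣? q ℕ.* 2) (divides q P.refl))) (twice q)
      three : ∀ d → 𝔹S.inflate 3 odd d ≡ does (3 ∣? d) ∧ (true xor does (2 ∣? d))
      three d = P.trans (𝔹S.inflate-unique 3 odd (λ n → does (3 ∣? n) ∧ odd n) val (λ n ne → P.cong (_∧ odd n) (dec-false (3 ∣? n) ne)) d) (P.cong (does (3 ∣? d) ∧_) (odd-∣ d))
        where
          thrice : ∀ q → odd (q ℕ.* 3) ≡ odd q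
          thrice zero = P.refl
          thrice (suc q) rewrite thrice q = P.cong not (BoolP.not-involutive (odd q))
          val : ∀ q → (does (3 ∣? q ℕ.* 3) ∧ odd (q ℕ.* 3)) ≡ odd q
          val q = P.trans (P.cong (_∧ odd (q ℕ.* 3)) (dec-true (3 ∣? q ℕ.* 3) (divides q P.refl))) (thrice q)

  r+r² : ∀ n → (rS 𝔹S.+ 𝔹S.sq rS) n ≡ (A₁ 𝔹S.+ 𝔹S.inflate 3 A₁) n
  r+r² n = P.trans (P.cong₂ _xor_ (rS-lam n) (P.trans (square-even rS n) (P.trans (𝔹S.inflate-cong 2 rS-lam n) (P.sym (lam-inflate 2 non3 P.refl n)))))
    (P.trans (P.sym (lam-+ non3 (𝔹S.inflate 2 non3) n)) (P.trans (lam-cong non3-odd n) (P.trans (lam-+ odd (𝔹S.inflate 3 odd) n) (P.cong (A₁ n xor_) (lam-inflate 3 odd P.refl n)))))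

  odd-* : ∀ m n → odd (m ℕ.* n) ≡ odd m ∧ odd n
  odd-* zero n = P.refl
  odd-* (suc m) n = P.trans (odd-+ n (m ℕ.* n)) (P.trans (P.cong (odd n xor_) (odd-* m n)) (by (odd m) (odd n)))
    where
      odd-+ : ∀ m n → odd (m ℕ.+ n) ≡ odd m xor odd n
      odd-+ zero n = P.refl
      odd-+ (suc m) n = P.trans (P.cong not (odd-+ m n)) (BoolP.not-distribˡ-xor (odd m) (odd n))
      by : ∀ a b → b xor (a ∧ b) ≡ not a ∧ b
      by true true = P.refl
      by true false = P.refl
      by false true = P.refl
      by false false = P.refl

  A₁-odd : ∀ n → odd n ≡ false → A₁ n ≡ false
  A₁-odd n e = 𝔹.sum-0 n (λ i _ → zero-term (suc i))
    where
      zero-term : ∀ m .{{_ : NonZero m}} → (odd m ∧ 𝔹S.inflate m odd n) ≡ false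
      zero-term m with m ∣? n
      ... | no _ = BoolP.∧-zeroʳ (odd m)
      ... | yes (divides q P.refl) = P.trans (BoolP.∧-comm (odd m) (odd q)) (P.trans (P.sym (odd-* q m)) e)

  D-odd : ∀ n → odd n ≡ false → (rS 𝔹S.+ 𝔹S.sq rS) n ≡ false
  D-odd n e = P.trans (r+r² n) (P.cong₂ _xor_ (A₁-odd n e) third)
    where
      third : 𝔹S.inflate 3 A₁ n ≡ false
      third with 3 ∣? n
      ... | no _ = P.refl
      ... | yes (divides q P.refl) = A₁-odd q (P.trans (P.sym (P.trans (odd-* q 3) (BoolP.∧-identityʳ (odd q)))) e)

  -- A divisor m of 3n that is prime to 3 has a quotient divisible by 3, where `non3` vanishes. So
  -- only the m = 3m′ contribute, and these give the divisors m′ of n.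
  U₃-r : ∀ n → rS (3 ℕ.* n) ≡ rS n
  U₃-r zero = P.refl
  U₃-r n@(suc _) = begin
    rS (3 ℕ.* n) ≡⟨ rS-lam (3 ℕ.* n) ⟩
    𝔹.sum (3 ℕ.* n) (λ i → g (suc i)) ≡⟨ 𝔹.sum-cong (3 ℕ.* n) (λ i → only3 (suc i)) ⟩
    𝔹.sum (3 ℕ.* n) (λ i → does (3 ∣? suc i) ∧ g (suc i)) ≡⟨ sum-multiples 3 (3 ℕ.* n) g (λ m l → P.trans (P.cong (odd m ∧_) (𝔹S.inflate-∤ m non3 (3 ℕ.* n) (λ d → ℕP.<⇒≱ l (∣⇒≤ d)))) (𝔹.zeroʳ (odd m))) ⟩
    𝔹.sum (3 ℕ.* n) (λ i → g (3 ℕ.* suc i)) ≡⟨ 𝔹.sum-cong (3 ℕ.* n) (λ i → descend (suc i)) ⟩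
    𝔹.sum (3 ℕ.* n) (λ i → odd (suc i) ∧ 𝔹S.inflate (suc i) non3 n) ≡⟨ lam-extend non3 (3 ℕ.* n) n P.refl (s≤s z≤n) (ℕP.m≤n*m n 3) ⟩
    lam non3 n ≡⟨ P.sym (rS-lam n) ⟩
    rS n ∎
    where
      open P.≡-Reasoning
      g : ℕ → Bool
      g m = odd m ∧ 𝔹S.inflate m non3 (3 ℕ.* n)
      only3 : ∀ m .{{_ : NonZero m}} → g m ≡ does (3 ∣? m) ∧ g m
      only3 m with 3 ∣? m
      ... | yes d = P.sym (P.cong (_∧ g m) (dec-true (3 ∣? m) d))
      ... | no ne = P.trans (P.trans (P.cong (odd m ∧_) none) (𝔹.zeroʳ (odd m))) (P.sym (P.cong (_∧ g m) (dec-false (3 ∣? m) ne)))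
        where
          three-prime : Prime 3
          three-prime = toWitness {a? = prime? 3} _
          none : 𝔹S.inflate m non3 (3 ℕ.* n) ≡ false
          none with m ∣? (3 ℕ.* n)
          ... | no _ = P.refl
          ... | yes (divides q e) with euclidsLemma q m three-prime (P.subst (3 ∣_) e (m∣m*n n))
          ...   | inj₁ d = P.trans (non3-∣ q) (P.cong not (dec-true (3 ∣? q) d))
          ...   | inj₂ d = ⊥-elim (ne d)
      descend : ∀ m .{{_ : NonZero m}} → g (3 ℕ.* m) ≡ odd m ∧ 𝔹S.inflate m non3 n
      descend m = P.cong₂ _∧_ (odd-* 3 m) same
        where
          same : 𝔹S.inflate (3 ℕ.* m) non3 (3 ℕ.* n) ≡ 𝔹S.inflate m non3 n
          same with m ∣? n
          ... | yes (divides q e) = P.trans (P.cong (𝔹S.inflate (3 ℕ.* m) non3) {3 ℕ.* n} {q ℕ.* (3 ℕ.* m)} (P.trans (P.cong (3 ℕ.*_) e) (lem q m))) (𝔹S.inflate-∣ (3 ℕ.* m) {{ℕP.m*n≢0 3 m}} non3 q)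
            where
              lem : ∀ q m → 3 ℕ.* (q ℕ.* m) ≡ q ℕ.* (3 ℕ.* m)
              lem = solve-∀
          ... | no ne = 𝔹S.inflate-∤ (3 ℕ.* m) non3 (3 ℕ.* n) (λ { (divides q e) → ne (divides q (ℕP.*-cancelˡ-≡ n (q ℕ.* m) 3 (P.trans e (lem q m)))) })
            where
              lem : ∀ q m → q ℕ.* (3 ℕ.* m) ≡ 3 ℕ.* (q ℕ.* m)
              lem = solve-∀

-- A ring with roots of unity of order 3p in characteristic two.

module RootsOfUnity where
  open import Data.Nat.Coprimality using (Coprime; coprime-Bézout)
  open import Data.Nat.GCD using (module Bézout)
  open import Data.Nat.Tactic.RingSolver using (solve-∀)
  open import Data.Integer.Divisibility.Signed as ℤD using (_∣_; _∣?_; divides; ∣m∣n⇒∣m+n; ∣m∣n⇒∣m-n; ∣⇒∣ᵤ; ∣ᵤ⇒∣)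
  open CharacteristicTwo
  open FormalSeries
  open Homomorphisms
  open LambertSeries using (int)
  open EisensteinSeries using (module ℤSolve)
  open TwoDivision using (Cyclic)
  open DivisorSums using (module 𝔹)

  module Units (K : F2Alg) where
    open Ring K

    IsUnit : Carrier → Set
    IsUnit a = Σ Carrier λ b → a * b ≈ 1#

    unit-cong : ∀ {a b} → a ≈ b → IsUnit a → IsUnit b
    unit-cong e (c , h) = c , trans (*-congʳ c (sym e)) h

    unit-factor : ∀ {a b} → IsUnit (a * b) → IsUnit a
    unit-factor {a} {b} (c , h) = b * c , trans (sym (*-assoc a b c)) h

    unit-* : ∀ {a b} → IsUnit a → IsUnit b → IsUnit (a * b)
    unit-* {a} {b} (c , h) (d , k) = c * d , trans (solve 4 (λ a b c d → (a :* b) :* (c :* d) := (a :* c) :* (b :* d)) refl a b c d) (trans (*-cong h k) (*-idˡ _))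

    geometric : ∀ z n → 1# + z ^ n ≈ (1# + z) * sum n (λ i → z ^ i)
    geometric z zero = trans (double 1#) (sym (zeroʳ _))
    geometric z (suc n) = begin
      1# + z * z ^ n ≈⟨ solve 2 (λ z w → I :+ z :* w := (I :+ z) :* w :+ (I :+ w)) refl z (z ^ n) ⟩
      (1# + z) * z ^ n + (1# + z ^ n) ≈⟨ +-congˡ _ (geometric z n) ⟩
      (1# + z) * z ^ n + (1# + z) * sum n (λ i → z ^ i) ≈⟨ sym (distribˡ _ _ _) ⟩
      (1# + z) * sum (suc n) (λ i → z ^ i) ∎

    unit-root : ∀ z n → IsUnit (1# + z ^ n) → IsUnit (1# + z)
    unit-root z n h = unit-factor (unit-cong (geometric z n) h)

    ^-mult : ∀ z n k → z ^ n ≈ 1# → z ^ (k ℕ.* n) ≈ 1#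
    ^-mult z n k e = trans (^-^ z k n) (trans (^-cong k e) (^-1 k))

    zpow : Carrier → Carrier → ℤ → Carrier
    zpow x y (+ n) = x ^ n
    zpow x y -[1+ n ] = y ^ suc n

    module _ {x y} (xy : x * y ≈ 1#) where
      zpow-⊖ : ∀ m n → zpow x y (m ⊖ n) ≈ x ^ m * y ^ n
      zpow-⊖ m zero = sym (*-idʳ _)
      zpow-⊖ zero (suc n) = sym (*-idˡ _)
      zpow-⊖ (suc m) (suc n) = begin
        zpow x y (suc m ⊖ suc n) ≈⟨ reflexive (P.cong (zpow x y) (ℤP.[1+m]⊖[1+n]≡m⊖n m n)) ⟩
        zpow x y (m ⊖ n) ≈⟨ zpow-⊖ m n ⟩
        x ^ m * y ^ n ≈⟨ sym (trans (*-congʳ _ xy) (*-idˡ _)) ⟩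
        (x * y) * (x ^ m * y ^ n) ≈⟨ solve 4 (λ a b c d → (a :* b) :* (c :* d) := (a :* c) :* (b :* d)) refl _ _ _ _ ⟩
        x ^ suc m * y ^ suc n ∎

      zpow-+ : ∀ i j → zpow x y (i ℤ.+ j) ≈ zpow x y i * zpow x y j
      zpow-+ (+ m) (+ n) = ^-+ x m n
      zpow-+ (+ m) -[1+ n ] = zpow-⊖ m (suc n)
      zpow-+ -[1+ m ] (+ n) = trans (zpow-⊖ n (suc m)) (*-comm _ _)
      zpow-+ -[1+ m ] -[1+ n ] = trans (reflexive (P.cong (λ k → y ^ suc k) (P.sym (ℕP.+-suc m n)))) (^-+ y (suc m) (suc n))

      zpow-per : ∀ n → x ^ n ≈ 1# → ∀ i → + n ∣ i → zpow x y i ≈ 1#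
      zpow-per n e i d with ∣⇒∣ᵤ d
      zpow-per n e (+ i) d | ℕD.divides q eq = trans (reflexive (P.cong (x ^_) eq)) (^-mult x n q e)
      zpow-per n e -[1+ i ] d | ℕD.divides q eq = trans (reflexive (P.cong (y ^_) eq)) (^-mult y n q y^n)
        where
          y^n : y ^ n ≈ 1#
          y^n = trans (sym (*-idˡ _)) (trans (*-congʳ _ (sym e)) (trans (sym (^-* x y n)) (trans (^-cong n xy) (^-1 n))))

  module Bounded (K : F2Alg) where
    private
      module K where
        open Ring K public
        open PowerSeries K public
    open Series K

    Deg≤ : ℕ → Carrier → Set
    Deg≤ n f = ∀ i → n < i → f i K.≈ K.0#

    deg-weaken : ∀ {m n f} → m ≤ n → Deg≤ m f → Deg≤ n f
    deg-weaken l d i h = d i (ℕP.≤-<-trans l h)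

    deg-+ : ∀ {n f g} → Deg≤ n f → Deg≤ n g → Deg≤ n (f + g)
    deg-+ d e i l = K.trans (K.+-cong (d i l) (e i l)) (K.+-idˡ _)

    deg-const : ∀ c → Deg≤ 0 (const c)
    deg-const c (suc i) l = K.refl

    deg-top : ∀ m n f g → Deg≤ m f → Deg≤ n g → (f * g) (m ℕ.+ n) K.≈ f m K.* g n × Deg≤ (m ℕ.+ n) (f * g)
    deg-top zero n f g d e = K.trans (low n) K.refl , λ i l → K.trans (low i) (K.trans (K.*-congˡ _ (e i l)) (K.zeroʳ _))
      where
        low : ∀ i → (f * g) i K.≈ f 0 K.* g i
        low zero = K.refl
        low (suc i) = K.trans (K.+-congˡ _ (K.conv-0ˡ i _ g (λ j → d (suc j) (s≤s z≤n)))) (K.+-idʳ _)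
    deg-top (suc m) n f g d e = K.trans (K.+-congʳ _ (K.trans (K.*-congˡ _ (e _ (s≤s (ℕP.m≤n+m n m)))) (K.zeroʳ _))) (K.trans (K.+-idˡ _) (proj₁ ih)) , bound
      where
        ih = deg-top m n (f ∘ suc) g (λ i l → d (suc i) (s≤s l)) e
        bound : Deg≤ (suc m ℕ.+ n) (f * g)
        bound (suc i) (s≤s l) = K.trans (K.+-cong (K.trans (K.*-congˡ _ (e (suc i) (ℕP.≤-trans (s≤s (ℕP.m≤n+m n m)) (ℕP.≤-trans l (ℕP.n≤1+n i))))) (K.zeroʳ _)) (proj₂ ih i l)) (K.+-idˡ _)

    deg-* : ∀ {m n f g} → Deg≤ m f → Deg≤ n g → Deg≤ (m ℕ.+ n) (f * g)
    deg-* {m} {n} {f} {g} d e = proj₂ (deg-top m n f g d e)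

    -- Series with a degree bound attached: the ring laws are inherited from series, and the bound
    -- is invisible to equality.
    polynomials : F2Alg
    polynomials = record
      { Carrier = Σ Carrier λ f → Σ ℕ λ n → Deg≤ n f
      ; _≈_ = λ f g → proj₁ f ≈ proj₁ g
      ; _+_ = λ { (f , m , d) (g , n , e) → f + g , m ℕ.+ n , deg-+ (deg-weaken (ℕP.m≤m+n m n) d) (deg-weaken (ℕP.m≤n+m n m) e) }
      ; _*_ = λ { (f , m , d) (g , n , e) → f * g , m ℕ.+ n , deg-* d e }
      ; 0# = 0# , 0 , (λ _ _ → K.refl)
      ; 1# = 1# , 0 , deg-const K.1#
      ; isEquivalence = record { refl = refl ; sym = sym ; trans = trans }
      ; +-cong = +-cong ; *-cong = *-cong
      ; +-assoc = λ _ _ _ → +-assoc _ _ _ ; +-comm = λ _ _ → +-comm _ _ ; +-idˡ = λ _ → +-idˡ _ ; double = λ _ → double _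
      ; *-assoc = λ f g h → *-assoc (proj₁ f) (proj₁ g) (proj₁ h) ; *-comm = λ f g → *-comm (proj₁ f) (proj₁ g) ; *-idˡ = λ f → *-idˡ (proj₁ f)
      ; distribʳ = λ f g h → distribʳ (proj₁ f) (proj₁ g) (proj₁ h) }

  module _ (K : F2Alg) (m : F2Alg.Carrier K) where
    open Ring K

    -- Congruence modulo m with the cofactor as witness; a + b is the difference of a and b in
    -- characteristic two.
    quotient : F2Alg
    quotient = record
      { Carrier = Carrier
      ; _≈_ = λ a b → Σ Carrier λ q → a + b ≈ q * m
      ; _+_ = _+_ ; _*_ = _*_ ; 0# = 0# ; 1# = 1#
      ; isEquivalence = record
        { refl = exact refl
        ; sym = λ { (q , e) → q , trans (+-comm _ _) e }
        ; trans = λ { {a} {b} {c} (q , e) (q′ , e′) → q + q′ , trans (solve 3 (λ a b c → a :+ c := (a :+ b) :+ (b :+ c)) refl a b c) (trans (+-cong e e′) (sym (distribʳ _ _ _))) } }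
      ; +-cong = λ { {a} {b} {c} {d} (q , e) (q′ , e′) → q + q′ , trans (solve 4 (λ a b c d → (a :+ c) :+ (b :+ d) := (a :+ b) :+ (c :+ d)) refl a b c d) (trans (+-cong e e′) (sym (distribʳ _ _ _))) }
      ; *-cong = λ { {a} {b} {c} {d} (q , e) (q′ , e′) → c * q + b * q′ ,
          trans (solve 4 (λ a b c d → a :* c :+ b :* d := c :* (a :+ b) :+ b :* (c :+ d)) refl a b c d)
            (trans (+-cong (*-congˡ c e) (*-congˡ b e′)) (solve 5 (λ c b q r m → c :* (q :* m) :+ b :* (r :* m) := (c :* q :+ b :* r) :* m) refl c b q q′ m)) }
      ; +-assoc = λ a b c → exact (+-assoc a b c) ; +-comm = λ a b → exact (+-comm a b) ; +-idˡ = λ a → exact (+-idˡ a) ; double = λ a → exact (double a)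
      ; *-assoc = λ a b c → exact (*-assoc a b c) ; *-comm = λ a b → exact (*-comm a b) ; *-idˡ = λ a → exact (*-idˡ a)
      ; distribʳ = λ a b c → exact (distribʳ a b c) }
      where
        exact : ∀ {a b} → a ≈ b → Σ Carrier λ q → a + b ≈ q * m
        exact e = 0# , trans (≈⇒+≈0 e) (sym (zeroˡ m))

  -- The pair (a , b) stands for a + b ω with ω² = 1 + ω.
  𝔽₄ : F2Alg
  𝔽₄ = record
    { Carrier = Bool × Bool ; _≈_ = _≡_
    ; _+_ = λ { (a , b) (c , d) → a xor c , b xor d }
    ; _*_ = λ { (a , b) (c , d) → (a ∧ c) xor (b ∧ d) , ((a ∧ d) xor (b ∧ c)) xor (b ∧ d) }
    ; 0# = false , false ; 1# = true , false
    ; isEquivalence = P.isEquivalence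
    ; +-cong = λ { P.refl P.refl → P.refl } ; *-cong = λ { P.refl P.refl → P.refl }
    ; +-assoc = λ { (a , b) (c , d) (e , f) → P.cong₂ _,_ (𝔹.+-assoc a c e) (𝔹.+-assoc b d f) }
    ; +-comm = λ { (a , b) (c , d) → P.cong₂ _,_ (𝔹.+-comm a c) (𝔹.+-comm b d) }
    ; +-idˡ = λ _ → P.refl
    ; double = λ { (a , b) → P.cong₂ _,_ (𝔹.double a) (𝔹.double b) }
    ; *-assoc = λ { (a , b) (c , d) (e , f) → P.cong₂ _,_
        (solve 6 (λ a b c d e f → (a :* c :+ b :* d) :* e :+ (a :* d :+ b :* c :+ b :* d) :* f := a :* (c :* e :+ d :* f) :+ b :* (c :* f :+ d :* e :+ d :* f)) P.refl a b c d e f)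
        (solve 6 (λ a b c d e f → (a :* c :+ b :* d) :* f :+ (a :* d :+ b :* c :+ b :* d) :* e :+ (a :* d :+ b :* c :+ b :* d) :* f := a :* (c :* f :+ d :* e :+ d :* f) :+ b :* (c :* e :+ d :* f) :+ b :* (c :* f :+ d :* e :+ d :* f)) P.refl a b c d e f) }
    ; *-comm = λ { (a , b) (c , d) → P.cong₂ _,_ (solve 4 (λ a b c d → a :* c :+ b :* d := c :* a :+ d :* b) P.refl a b c d)
        (solve 4 (λ a b c d → a :* d :+ b :* c :+ b :* d := c :* b :+ d :* a :+ d :* b) P.refl a b c d) }
    ; *-idˡ = λ { (a , b) → P.cong₂ _,_ (solve 1 (λ a → a :+ O := a) P.refl a) (solve 1 (λ b → b :+ O :+ O := b) P.refl b) }
    ; distribʳ = λ { (a , b) (c , d) (e , f) → P.cong₂ _,_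
        (solve 6 (λ a b c d e f → (c :+ e) :* a :+ (d :+ f) :* b := (c :* a :+ d :* b) :+ (e :* a :+ f :* b)) P.refl a b c d e f)
        (solve 6 (λ a b c d e f → (c :+ e) :* b :+ (d :+ f) :* a :+ (d :+ f) :* b := (c :* b :+ d :* a :+ d :* b) :+ (e :* b :+ f :* a :+ f :* b)) P.refl a b c d e f) } }
    where open 𝔹 using (solve; _:+_; _:*_; _:=_; O)

  coprime-to-prime : ∀ {p m} → Prime p → ¬ (p ℕD.∣ m) → Coprime m p
  coprime-to-prime pr ne (d∣m , d∣p) with prime⇒irreducible pr d∣p
  ... | inj₁ e = e
  ... | inj₂ P.refl = ⊥-elim (ne d∣m)

  invert-mod : ∀ {p m} → Prime p → ¬ (+ p ∣ m) → Σ ℤ λ k → + p ∣ k ℤ.* m ℤ.- + 1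
  invert-mod {p} {m} pr ne = signed m (bezout (coprime-Bézout (coprime-to-prime {p} {∣ m ∣} pr (λ d → ne (∣ᵤ⇒∣ d)))))
    where
      open ℤSolve using (solve; _:+_; _:-_; _:*_; :-_; con; _:=_)
      bezout : ∀ {m} → Bézout.Identity 1 m p → Σ ℤ λ k → + p ∣ k ℤ.* + m ℤ.- + 1
      bezout {m} (Bézout.+- x y eq) = + x , divides (+ y) (P.trans (P.cong (λ z → z ℤ.- + 1) (P.trans (P.sym (ℤP.pos-* x m)) (P.trans (int (P.sym eq)) (P.cong (λ z → + 1 ℤ.+ z) (ℤP.pos-* y p)))))
        (solve 1 (λ z → (con (+ 1) :+ z) :- con (+ 1) := z) P.refl (+ y ℤ.* + p)))
      bezout {m} (Bézout.-+ x y eq) = ℤ.- (+ x) , divides (ℤ.- (+ y)) (P.trans (solve 2 (λ x m → (:- x) :* m :- con (+ 1) := :- (con (+ 1) :+ x :* m)) P.refl (+ x) (+ m))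
        (P.trans (P.cong ℤ.-_ (P.trans (P.cong (λ z → + 1 ℤ.+ z) (P.sym (ℤP.pos-* x m))) (P.trans (int eq) (ℤP.pos-* y p)))) (ℤP.neg-distribˡ-* (+ y) (+ p))))
      signed : ∀ m → (Σ ℤ λ k → + p ∣ k ℤ.* + ∣ m ∣ ℤ.- + 1) → Σ ℤ λ k → + p ∣ k ℤ.* m ℤ.- + 1
      signed (+ m) r = r
      signed -[1+ m ] (k , d) = ℤ.- k , P.subst (λ z → + p ∣ z ℤ.- + 1) (solve 2 (λ k m → k :* m := (:- k) :* (:- m)) P.refl k (+ suc m)) d

  invert-mod-ℕ : ∀ {p m} → Prime p → ¬ (+ p ∣ m) → Σ ℕ λ k → + p ∣ + k ℤ.* m ℤ.- + 1
  invert-mod-ℕ {p} {m} pr ne with invert-mod {p} {m} pr ne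
  ... | k , d = k ℤDM.%ℕ p , P.subst (+ p ∣_) (solve 4 (λ k r q m → (k :* m :- con (+ 1)) :- (k :- r) :* m := r :* m :- con (+ 1)) P.refl k (+ (k ℤDM.%ℕ p)) (+ 0) m)
        (∣m∣n⇒∣m-n d (ℤD.∣m⇒∣m*n m (divides (k ℤDM./ℕ p) (P.trans (P.cong (λ z → z ℤ.- + (k ℤDM.%ℕ p)) (ℤDM.a≡a%ℕn+[a/ℕn]*n k p)) (solve 2 (λ r q → (r :+ q) :- r := q) P.refl (+ (k ℤDM.%ℕ p)) _)))))
    where
      open ℤSolve using (solve; _:+_; _:-_; _:*_; :-_; con; _:=_)
      instance
        nonZero : NonZero p
        nonZero = prime⇒nonZero pr

  prime-∣-* : ∀ {p} → Prime p → ∀ i j → + p ∣ i ℤ.* j → (+ p ∣ i) ⊎ (+ p ∣ j)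
  prime-∣-* pr i j d with euclidsLemma ∣ i ∣ ∣ j ∣ pr (P.subst (_ ℕD.∣_) (ℤP.abs-* i j) (∣⇒∣ᵤ d))
  ... | inj₁ h = inj₁ (∣ᵤ⇒∣ h)
  ... | inj₂ h = inj₂ (∣ᵤ⇒∣ h)

  three-prime : Prime 3
  three-prime = toWitness {a? = prime? 3} _

  -- Two demands beyond the group of roots: 1 + `root i` is invertible, so that geometric sums over
  -- p-th roots of unity vanish even with zero divisors around, and 1 ≠ 0, so that 𝔽₂ embeds.
  record RootSystem (N : ℕ) : Set₁ where
    field
      S : F2Alg
      cyclic : Cyclic S N
    open Cyclic cyclic public
    private module S = Ring S
    open Units S using (IsUnit)
    field
      one-minus-unit : ∀ i → ¬ (+ N ∣ i) → IsUnit (S.1# S.+ root i)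
      nontrivial : ¬ (S.1# S.≈ S.0#)

  module Cyclotomic (p h : ℕ) (p≡ : p ≡ suc (h ℕ.+ h)) (pr : Prime p) (3∤p : ¬ (3 ℕD.∣ p)) where
    private
      module F where
        open Series 𝔽₄ public
      module PF = Ring (Bounded.polynomials 𝔽₄)

      t : PF.Carrier
      t = F.shift F.1# , 1 , (λ { (suc (suc i)) l → P.refl ; (suc zero) (s≤s ()) })

      Φ : PF.Carrier
      Φ = PF.sum p (λ i → t PF.^ i)

    -- Dividing by the whole polynomial 1 + t + ... + t^{p-1} avoids factoring it over 𝔽₄, at the
    -- price of possible zero divisors.
    S : F2Alg
    S = quotient (Bounded.polynomials 𝔽₄) Φ

    private
      module S = Ring S
      open Units S

      project : Hom (Bounded.polynomials 𝔽₄) S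
      project = record { fun = λ f → f ; fun-cong = λ {a} {b} e → PF.0# , PF.trans {a PF.+ b} {PF.0#} {PF.0# PF.* Φ} (PF.≈⇒+≈0 {a} {b} e) (PF.sym {PF.0# PF.* Φ} {PF.0#} (PF.zeroˡ Φ))
        ; fun-+ = λ a b → S.refl {a PF.+ b} ; fun-* = λ a b → S.refl {a PF.* b} ; fun-1 = S.refl {S.1#} }

      t-pow : ∀ n → (∀ i → n < i → proj₁ (t PF.^ n) i ≡ (false , false)) × proj₁ (t PF.^ n) n ≡ (true , false)
      t-pow zero = (λ { (suc i) l → P.refl }) , P.refl
      t-pow (suc n) = (λ { (suc i) (s≤s l) → P.trans (F.trans (F.shift-* F.1# w) (F.shift-cong (F.*-idˡ w)) (suc i)) (proj₁ (t-pow n) i l) }) ,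
                      P.trans (F.trans (F.shift-* F.1# w) (F.shift-cong (F.*-idˡ w)) (suc n)) (proj₂ (t-pow n))
        where w = proj₁ (t PF.^ n)

      Φ-top : ∀ n → (∀ i → n ≤ i → proj₁ (PF.sum n (λ j → t PF.^ j)) i ≡ (false , false))
      Φ-top zero i l = P.refl
      Φ-top (suc n) i l = P.cong₂ (F2Alg._+_ 𝔽₄) (proj₁ (t-pow n) i l) (Φ-top n i (ℕP.≤-trans (ℕP.n≤1+n n) l))

      Φ-lead : proj₁ Φ (h ℕ.+ h) ≡ (true , false)
      Φ-lead = P.subst (λ n → proj₁ (PF.sum n (λ i → t PF.^ i)) (h ℕ.+ h) ≡ (true , false)) (P.sym p≡)
        (P.cong₂ (F2Alg._+_ 𝔽₄) (proj₂ (t-pow (h ℕ.+ h))) (Φ-top (h ℕ.+ h) (h ℕ.+ h) ℕP.≤-refl))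

      positive : ∀ k → p ≡ suc (k ℕ.+ k) → 0 < k
      positive (suc k) e = s≤s z≤n
      positive zero e = ⊥-elim (one-not-prime (P.subst Prime e pr))
        where
          one-not-prime : ¬ Prime 1
          one-not-prime ()

      h>0 : 0 < h
      h>0 = positive h p≡

    -- If 1 = q Φ, the coefficient of q at a degree bound N equals the coefficient of 1 in degree N
    -- + p - 1 > 0, hence vanishes. Lowering the bound step by step leaves q = 0, which contradicts
    -- the constant term.
    nontrivial : ¬ (S.1# S.≈ S.0#)
    nontrivial (q , e) = descend (suc (proj₁ (proj₂ q))) (proj₂ (proj₂ q))
      where
        coeff-0 : ∀ n → 0 < n → (proj₁ q F.* proj₁ Φ) n ≡ (false , false)
        coeff-0 (suc n) l = P.sym (e (suc n))
        descend : ∀ N → (∀ i → N ≤ i → proj₁ q i ≡ (false , false)) → ⊥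
        descend zero z with P.trans (e 0) (P.cong (λ x → F2Alg._*_ 𝔽₄ x (proj₁ Φ 0)) (z 0 z≤n))
        ... | ()
        descend (suc N) z = descend N lower
          where
            top : (proj₁ q F.* proj₁ Φ) (N ℕ.+ (h ℕ.+ h)) ≡ F2Alg._*_ 𝔽₄ (proj₁ q N) (proj₁ Φ (h ℕ.+ h))
            top = proj₁ (Bounded.deg-top 𝔽₄ N (h ℕ.+ h) (proj₁ q) (proj₁ Φ) z (λ i l → Φ-top p i (P.subst (_≤ i) (P.sym p≡) l)))
            qN : proj₁ q N ≡ (false , false)
            qN = P.trans (P.sym (Ring.*-idʳ 𝔽₄ (proj₁ q N))) (P.trans (P.cong (F2Alg._*_ 𝔽₄ (proj₁ q N)) (P.sym Φ-lead))
                   (P.trans (P.sym top) (coeff-0 _ (ℕP.≤-trans h>0 (ℕP.≤-trans (ℕP.m≤m+n h h) (ℕP.m≤n+m (h ℕ.+ h) N))))))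
            lower : ∀ i → N ≤ i → proj₁ q i ≡ (false , false)
            lower i l with ℕP.m≤n⇒m<n∨m≡n l
            ... | inj₁ N<i = z i N<i
            ... | inj₂ P.refl = qN

    ζ ω : S.Carrier
    ζ = t
    ω = F.const (false , true) , 0 , Bounded.deg-const 𝔽₄ (false , true)

    abstract
      Φ≈0 : S.sum p (λ i → ζ S.^ i) S.≈ S.0#
      Φ≈0 = S.trans {S.sum p (λ i → ζ S.^ i)} {Φ} {S.0#}
        (S.trans {S.sum p (λ i → ζ S.^ i)} {S.sum p (λ i → t PF.^ i)} {Φ} (S.sum-cong p {λ i → ζ S.^ i} {λ i → t PF.^ i} (λ i → S.sym {t PF.^ i} {ζ S.^ i} (Hom.fun-^ project t i))) (S.sym {Φ} {S.sum p (λ i → t PF.^ i)} (Hom.fun-sum project p (λ i → t PF.^ i))))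
        (PF.1# , PF.trans {Φ PF.+ PF.0#} {Φ} {PF.1# PF.* Φ} (PF.+-idʳ Φ) (PF.sym {PF.1# PF.* Φ} {Φ} (PF.*-idˡ Φ)))

      ω-eq : ω S.* ω S.≈ S.1# S.+ ω
      ω-eq = Hom.fun-cong project {ω PF.* ω} {PF.1# PF.+ ω} (λ n → P.trans (P.sym (F.const-* (false , true) (false , true) n)) (F.const-+ (true , false) (false , true) n))

  module FromRoot (S : F2Alg) (nontrivial′ : ¬ (Ring._≈_ S (Ring.1# S) (Ring.0# S))) (p h : ℕ) (p≡ : p ≡ suc (h ℕ.+ h)) (pr : Prime p) (3∤p : ¬ (3 ℕD.∣ p))
    (ζ ω : F2Alg.Carrier S) (Φ≈0 : Ring._≈_ S (Ring.sum S p (λ i → Ring._^_ S ζ i)) (Ring.0# S))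
    (ω-eq : Ring._≈_ S (Ring._*_ S ω ω) (Ring._+_ S (Ring.1# S) ω)) where
    private
      open module S = Ring S
      open Units S
      open ℤSolve using () renaming (solve to ℤsolve; _:+_ to _⊞_; _:-_ to _⊟_; _:*_ to _⊠_; :-_ to ⊟_; con to ℤcon; _:=_ to _≛_)

      ζ^p : ζ ^ p ≈ 1#
      ζ^p = sym (+≈0⇒≈ (trans (geometric ζ p) (trans (*-congˡ _ Φ≈0) (zeroʳ _))))

      -- Pairing consecutive powers in the vanishing sum of p = 2h + 1 terms gives 1 + (1 + ζ) q =
      -- 0, so q is the inverse.
      unit-1+ζ : IsUnit (1# + ζ)
      unit-1+ζ = sum-odd h .proj₁ , trans (solve 2 (λ a b → a := (I :+ a) :+ I) refl _ ζ)
          (trans (+-congʳ 1# (sym (sum-odd h .proj₂))) (trans (+-congʳ 1# (trans (reflexive (P.cong (λ n → sum n (λ i → ζ ^ i)) (P.sym p≡))) Φ≈0)) (+-idˡ _)))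
        where
          sum-odd : ∀ k → Σ Carrier λ q → sum (suc (k ℕ.+ k)) (λ i → ζ ^ i) ≈ 1# + (1# + ζ) * q
          sum-odd zero = 0# , solve 1 (λ z → I :+ O := I :+ (I :+ z) :* O) refl ζ
          sum-odd (suc k) with sum-odd k
          ... | q , e = ζ ^ suc (k ℕ.+ k) + q , (begin
            sum (suc (suc k ℕ.+ suc k)) (λ i → ζ ^ i) ≈⟨ reflexive (P.cong (λ n → sum (suc (suc n)) (λ i → ζ ^ i)) (ℕP.+-suc k k)) ⟩
            ζ * ζ ^ suc (k ℕ.+ k) + (ζ ^ suc (k ℕ.+ k) + sum (suc (k ℕ.+ k)) (λ i → ζ ^ i)) ≈⟨ +-congˡ _ (+-congˡ _ e) ⟩
            ζ * ζ ^ suc (k ℕ.+ k) + (ζ ^ suc (k ℕ.+ k) + (1# + (1# + ζ) * q))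
              ≈⟨ solve 3 (λ z w q → z :* w :+ (w :+ (I :+ (I :+ z) :* q)) := I :+ (I :+ z) :* (w :+ q)) refl ζ (ζ ^ suc (k ℕ.+ k)) q ⟩
            1# + (1# + ζ) * (ζ ^ suc (k ℕ.+ k) + q) ∎)

      ζ′ ω′ : Carrier
      ζ′ = ζ ^ (h ℕ.+ h)
      ω′ = 1# + ω

      ζζ′ : ζ * ζ′ ≈ 1#
      ζζ′ = trans (reflexive (P.cong (ζ ^_) (P.sym p≡))) ζ^p

      ωω′ : ω * ω′ ≈ 1#
      ωω′ = trans (solve 1 (λ o → o :* (I :+ o) := o :+ o :* o) refl ω) (trans (+-congˡ ω ω-eq) (solve 1 (λ o → o :+ (I :+ o) := I) refl ω))

      ω³ : ω ^ 3 ≈ 1#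
      ω³ = trans (solve 1 (λ o → o :* (o :* (o :* I)) := o :* (o :* o)) refl ω) (trans (*-congˡ ω ω-eq) ωω′)

      zζ zω : ℤ → Carrier
      zζ = zpow ζ ζ′
      zω = zpow ω ω′

    -- One index serves for both kinds of roots, with period 3p: multiples of 3 give powers of ζ
    -- alone, multiples of p powers of ω alone. Hence the factor 3 in the indices of p-torsion
    -- points.
    root : ℤ → Carrier
    root i = zζ i * zω i

    private
      zζ-per : ∀ i → + p ∣ i → zζ i ≈ 1#
      zζ-per = zpow-per ζζ′ p ζ^p

      zω-per : ∀ i → + 3 ∣ i → zω i ≈ 1#
      zω-per = zpow-per ωω′ 3 ω³

      N = 3 ℕ.* p

      p∣N : + p ∣ + N
      p∣N = divides (+ 3) (ℤP.pos-* 3 p)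

      3∣N : + 3 ∣ + N
      3∣N = divides (+ p) (P.trans (ℤP.pos-* 3 p) (ℤP.*-comm (+ 3) (+ p)))

      root-+ : ∀ i j → root (i ℤ.+ j) ≈ root i * root j
      root-+ i j = trans (*-cong (zpow-+ ζζ′ i j) (zpow-+ ωω′ i j)) (solve 4 (λ a b c d → (a :* b) :* (c :* d) := (a :* c) :* (b :* d)) refl _ _ _ _)

      root-per : ∀ i → + N ∣ i → root i ≈ 1#
      root-per i d = trans (*-cong (zζ-per i (ℤD.∣-trans p∣N d)) (zω-per i (ℤD.∣-trans 3∣N d))) (*-idˡ _)

      power : ∀ {x y} (xy : x * y ≈ 1#) k i → zpow x y (+ k ℤ.* i) ≈ zpow x y i ^ k
      power {x} {y} xy zero i = reflexive (P.cong (zpow x y) (ℤP.*-zeroˡ i))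
      power {x} {y} xy (suc k) i = trans (reflexive (P.cong (zpow x y) (ℤP.suc-* (+ k) i))) (trans (zpow-+ xy i (+ k ℤ.* i)) (*-congˡ _ (power xy k i)))

      -- If k inverts i modulo the order then z^{ik} is the generator, and 1 + z^i divides 1 + (z^i)^k.
      unit-z : ∀ {x y} (xy : x * y ≈ 1#) q → Prime q → x ^ q ≈ 1# → IsUnit (1# + x) → ∀ i → ¬ (+ q ∣ i) → IsUnit (1# + zpow x y i)
      unit-z {x} {y} xy q qp e un i ne = go (invert-mod-ℕ {q} {i} qp ne)
        where
          go : (Σ ℕ λ k → + q ∣ + k ℤ.* i ℤ.- + 1) → IsUnit (1# + zpow x y i)
          go (k , d) = unit-root (zpow x y i) k (unit-cong (+-congˡ 1# (sym pow)) un)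
            where
              m : ℤ
              m = + k ℤ.* i
              split : m ≡ (m ℤ.- + 1) ℤ.+ + 1
              split = P.sym (P.trans (ℤP.+-assoc m (ℤ.- (+ 1)) (+ 1)) (ℤP.+-identityʳ m))
              pow : zpow x y i ^ k ≈ x
              pow = begin
                zpow x y i ^ k ≈⟨ sym (power xy k i) ⟩
                zpow x y m ≈⟨ reflexive (P.cong (zpow x y) split) ⟩
                zpow x y ((m ℤ.- + 1) ℤ.+ + 1) ≈⟨ zpow-+ xy (m ℤ.- + 1) (+ 1) ⟩
                zpow x y (m ℤ.- + 1) * zpow x y (+ 1) ≈⟨ *-cong (zpow-per xy q e (m ℤ.- + 1) d) (*-idʳ x) ⟩
                1# * x ≈⟨ *-idˡ x ⟩
                x ∎

      both : ∀ i → + p ∣ i → + 3 ∣ i → + N ∣ i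
      both i (divides m P.refl) d with prime-∣-* three-prime m (+ p) d
      ... | inj₂ h = ⊥-elim (3∤p (∣⇒∣ᵤ h))
      ... | inj₁ (divides n P.refl) = divides n (P.trans (ℤP.*-assoc n (+ 3) (+ p)) (P.cong (n ℤ.*_) (P.sym (ℤP.pos-* 3 p))))

      -- If p does not divide i, cubing removes the ω-part, and 1 + z divides 1 + z³. Otherwise only
      -- the ω-part is left, and 3 does not divide i.
      one-minus-unit : ∀ i → ¬ (+ N ∣ i) → IsUnit (1# + root i)
      one-minus-unit i ne with + p ∣? i
      ... | no p∤i = unit-root (root i) 3 (unit-cong (+-congˡ 1# (sym cube)) (unit-z ζζ′ p pr ζ^p unit-1+ζ (+ 3 ℤ.* i) p∤3i))
        where
          cube : root i ^ 3 ≈ zζ (+ 3 ℤ.* i)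
          cube = trans (^-* _ _ 3) (trans (*-cong (sym (power ζζ′ 3 i)) (trans (sym (power ωω′ 3 i)) (zω-per _ (divides i (ℤP.*-comm (+ 3) i))))) (*-idʳ _))
          p∤3i : ¬ (+ p ∣ + 3 ℤ.* i)
          p∤3i d with prime-∣-* pr (+ 3) i d
          ... | inj₂ h′ = p∤i h′
          ... | inj₁ h′ with prime⇒irreducible three-prime (∣⇒∣ᵤ h′)
          ...   | inj₁ P.refl = one-not-prime pr
            where
              one-not-prime : ¬ Prime 1
              one-not-prime ()
          ...   | inj₂ P.refl = 3∤p ℕD.∣-refl
      ... | yes p∣i = unit-cong (+-congˡ 1# (sym (trans (*-congʳ _ (zζ-per i p∣i)) (*-idˡ _))))
          (unit-z ωω′ 3 three-prime ω³ (ω , trans (*-comm _ ω) ωω′) i (λ d → ne (both i p∣i d)))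

      inverse-pair : ∀ i → root i * root (ℤ.- i) ≈ 1#
      inverse-pair i = trans (sym (root-+ i (ℤ.- i))) (root-per _ (P.subst (+ N ∣_) (P.sym (ℤP.+-inverseʳ i)) (divides (+ 0) P.refl)))

      -- In characteristic two z + z⁻¹ = z⁻¹ (1 + z)².
      unit-sum : ∀ i → ¬ (+ N ∣ i) → IsUnit (root i + root (ℤ.- i))
      unit-sum i ne = unit-cong eq (unit-* (root i , trans (*-comm _ _) (inverse-pair i)) (unit-* (one-minus-unit i ne) (one-minus-unit i ne)))
        where
          eq : root (ℤ.- i) * ((1# + root i) * (1# + root i)) ≈ root i + root (ℤ.- i)
          eq = trans (solve 2 (λ a b → b :* ((I :+ a) :* (I :+ a)) := b :+ (a :* b) :* a) refl (root i) (root (ℤ.- i)))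
            (trans (+-congˡ _ (trans (*-congʳ _ (inverse-pair i)) (*-idˡ _))) (+-comm _ _))

      hyp : ℤ → Carrier
      hyp i with + N ∣? i
      ... | yes _ = 0#
      ... | no ne = proj₁ (unit-sum i ne)

      hyp-spec : ∀ i → ¬ (+ N ∣ i) → hyp i * (root i + root (ℤ.- i)) ≈ 1#
      hyp-spec i ne with + N ∣? i
      ... | yes d = ⊥-elim (ne d)
      ... | no ne′ = trans (*-comm _ _) (proj₂ (unit-sum i ne′))

      residue : ∀ n → ¬ (3 ℕD.∣ n) → ω ^ n ≈ ω ⊎ ω ^ n ≈ ω′
      residue zero ne = ⊥-elim (ne (ℕD.divides 0 P.refl))
      residue (suc zero) ne = inj₁ (*-idʳ ω)
      residue (suc (suc zero)) ne = inj₂ (trans (*-congˡ ω (*-idʳ ω)) ω-eq)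
      residue (suc (suc (suc n))) ne with residue n (λ d → ne (ℕD.∣m∣n⇒∣m+n ℕD.∣-refl d))
      ... | inj₁ e = inj₁ (trans (trans (^-+ ω 3 n) (trans (*-congʳ _ ω³) (*-idˡ _))) e)
      ... | inj₂ e = inj₂ (trans (trans (^-+ ω 3 n) (trans (*-congʳ _ ω³) (*-idˡ _))) e)

      root-p : root (+ p) ≈ ω ^ p
      root-p = trans (*-congʳ _ ζ^p) (*-idˡ _)

      -- According to p modulo 3, ω^p is ω or 1 + ω; its inverse is the other of the two, and they
      -- add up to 1.
      omega-sum : root (+ p) + root (ℤ.- (+ p)) ≈ 1#
      omega-sum with residue p 3∤p
      ... | inj₁ e = trans (+-cong (trans root-p e) (inverse-unique {s = ω} (trans (*-comm _ ω) (trans (*-congʳ _ (sym (trans root-p e))) (inverse-pair (+ p)))) (trans (*-comm _ _) ωω′)))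
              (solve 1 (λ o → o :+ (I :+ o) := I) refl ω)
      ... | inj₂ e = trans (+-cong (trans root-p e) (inverse-unique {s = ω′} (trans (*-comm _ ω′) (trans (*-congʳ _ (sym (trans root-p e))) (inverse-pair (+ p)))) ωω′))
              (solve 1 (λ o → (I :+ o) :+ o := I) refl ω)

      p>0 : 0 < p
      p>0 = P.subst (0 <_) (P.sym p≡) (s≤s z≤n)

    rootSystem : RootSystem N
    rootSystem = record
      { S = S
      ; cyclic = record
        { root = root ; hyp = hyp ; root-+ = root-+ ; root-per = root-per ; root-nontrivial = hyp-spec
        -- Twice 3h + 2 is 3 (2h + 1) + 1 = N + 1.
        ; half = + (3 ℕ.* h ℕ.+ 2)
        ; half-spec = divides (+ 1) (P.trans (half-eq h) (P.trans (int (P.cong (3 ℕ.*_) (P.sym p≡))) (P.sym (ℤP.*-identityˡ (+ N)))))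
        ; omega = + p
        ; omega-order = divides (+ 1) (P.trans (int (lem p)) (P.sym (ℤP.*-identityˡ (+ N))))
        ; omega-sum = omega-sum
        ; omega-nz = λ d → ℕP.<⇒≱ (small p p>0) (ℕD.∣⇒≤ {{ℕ.>-nonZero p>0}} (∣⇒∣ᵤ d)) }
      ; one-minus-unit = one-minus-unit
      ; nontrivial = nontrivial′ }
      where
        half-eq : ∀ h → + (3 ℕ.* h ℕ.+ 2) ℤ.+ + (3 ℕ.* h ℕ.+ 2) ℤ.- + 1 ≡ + (3 ℕ.* suc (h ℕ.+ h))
        half-eq h = P.trans (P.cong (λ z → + z ℤ.- + 1) (lem₂ h)) P.refl
          where
            lem₂ : ∀ h → (3 ℕ.* h ℕ.+ 2) ℕ.+ (3 ℕ.* h ℕ.+ 2) ≡ suc (3 ℕ.* suc (h ℕ.+ h))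
            lem₂ = solve-∀
        lem : ∀ p → p ℕ.+ p ℕ.+ p ≡ 3 ℕ.* p
        lem = solve-∀
        small : ∀ p → 0 < p → p < 3 ℕ.* p
        small p l = ℕP.m<m+n p (ℕP.≤-trans l (ℕP.m≤m+n p _))

  rootSystem : ∀ p h → p ≡ suc (h ℕ.+ h) → Prime p → ¬ (3 ℕD.∣ p) → RootSystem (3 ℕ.* p)
  rootSystem p h p≡ pr 3∤p = FromRoot.rootSystem C.S C.nontrivial p h p≡ pr 3∤p C.ζ C.ω C.Φ≈0 C.ω-eq
    where
      module C = Cyclotomic p h p≡ pr 3∤p

-- Series in x as series in y, x = y^p, and the values at P₄.

module Embedding where
  open import Defs
  open import Data.Integer.Divisibility.Signed as ℤD using (_∣_; _∣?_; divides; ∣m∣n⇒∣m+n; ∣m∣n⇒∣m-n; ∣m⇒∣-m; ∣⇒∣ᵤ; ∣ᵤ⇒∣; ∣n⇒∣m*n)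
  open CharacteristicTwo
  open FormalSeries
  open Homomorphisms
  open BilateralSums
  open LambertSeries
  open EisensteinSeries
  open TwoDivision
  open LevelThreeLaw
  open DivisorSums
  open RootsOfUnity

  module Level (p h : ℕ) (p≡ : p ≡ suc (h ℕ.+ h)) (pr : Prime p) (3∤p : ¬ (3 ℕD.∣ p)) (rs : RootSystem (3 ℕ.* p)) where
    open RootSystem rs public using (one-minus-unit; nontrivial; root; root-+; root-per; root-cong; half; omega)
    module RS = RootSystem rs

    N : ℕ
    N = 3 ℕ.* p

    p>0 : 0 < p
    p>0 = P.subst (0 <_) (P.sym p≡) (s≤s z≤n)

    instance
      p-nonZero : NonZero p
      p-nonZero = ℕ.>-nonZero p>0

    open LevelThree RS.S N p p>0 RS.cyclic public
    open ℤSolve using () renaming (_:=_ to _≛_; solve to ℤsolve; _:+_ to _⊞_; _:-_ to _⊟_; _:*_ to _⊠_; :-_ to ⊟_; con to ℤcon)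

    private
      LL = + (p ℕ.+ p ℕ.+ (p ℕ.+ p))

      dvd : ∀ {m a b} → a ≡ b → m ∣ a → m ∣ b
      dvd P.refl d = d

    p-odd : + p ≡ + h ℤ.+ + h ℤ.+ + 1
    p-odd = int (P.trans p≡ (ℕP.+-comm 1 (h ℕ.+ h)))

    LL-4p : LL ≡ + 4 ℤ.* + p
    LL-4p = ℤsolve 1 (λ p → (p ⊞ p) ⊞ (p ⊞ p) ≛ ℤcon (+ 4) ⊠ p) P.refl (+ p)

    split-L : ∀ x → LL ∣ x → (+ 4 ∣ x) × (+ p ∣ x)
    split-L x (divides q P.refl) = divides (q ℤ.* + p) (P.trans (P.cong (q ℤ.*_) LL-4p) (ℤsolve 2 (λ q p → q ⊠ (ℤcon (+ 4) ⊠ p) ≛ q ⊠ p ⊠ ℤcon (+ 4)) P.refl q (+ p))) ,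
      divides (q ℤ.* + 4) (P.trans (P.cong (q ℤ.*_) LL-4p) (ℤsolve 2 (λ q p → q ⊠ (ℤcon (+ 4) ⊠ p) ≛ q ⊠ ℤcon (+ 4) ⊠ p) P.refl q (+ p)))

    join-L : ∀ x → + 4 ∣ x → + p ∣ x → LL ∣ x
    join-L x d (divides y P.refl) with four
      where
        four : + 4 ∣ y
        -- Since p² = 4h(h + 1) + 1, y is p (p y) minus a multiple of 4.
        four = dvd (P.trans (P.cong (λ z → z ℤ.* (y ℤ.* z) ℤ.- + 4 ℤ.* ((+ h ℤ.* (+ h ℤ.+ + 1)) ℤ.* y)) p-odd)
            (ℤsolve 2 (λ h y → (h ⊞ h ⊞ ℤcon (+ 1)) ⊠ (y ⊠ (h ⊞ h ⊞ ℤcon (+ 1))) ⊟ ℤcon (+ 4) ⊠ ((h ⊠ (h ⊞ ℤcon (+ 1))) ⊠ y) ≛ y) P.refl (+ h) y))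
          (∣m∣n⇒∣m-n (∣n⇒∣m*n (+ p) d) (divides ((+ h ℤ.* (+ h ℤ.+ + 1)) ℤ.* y) (ℤP.*-comm (+ 4) _)))
    ... | divides z P.refl = divides z (P.trans (ℤP.*-assoc z (+ 4) (+ p)) (P.cong (z ℤ.*_) (P.sym LL-4p)))

    2∤odd : ∀ m → ¬ (+ 2 ∣ m ℤ.+ m ℤ.+ + 1)
    2∤odd m d = 2∤1 (dvd (ℤsolve 1 (λ m → (m ⊞ m ⊞ ℤcon (+ 1)) ⊟ m ⊠ ℤcon (+ 2) ≛ ℤcon (+ 1)) P.refl m) (∣m∣n⇒∣m-n d (divides m P.refl)))
      where
        2∤1 : ¬ (+ 2 ∣ + 1)
        2∤1 d with ℕD.∣⇒≤ (∣⇒∣ᵤ d)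
        ... | s≤s ()

    4-to-2 : ∀ x → + 4 ∣ x ℤ.+ x → + 2 ∣ x
    4-to-2 x (divides q e) = divides q (ℤP.*-cancelʳ-≡ x (q ℤ.* + 2) (+ 2) (P.trans (ℤsolve 1 (λ x → x ⊠ ℤcon (+ 2) ≛ x ⊞ x) P.refl x) (P.trans e (ℤsolve 1 (λ q → q ⊠ ℤcon (+ 4) ≛ q ⊠ ℤcon (+ 2) ⊠ ℤcon (+ 2)) P.refl q))))

    2-to-4 : ∀ x → + 2 ∣ x → + 4 ∣ x ℤ.+ x
    2-to-4 x (divides q P.refl) = divides q (ℤsolve 1 (λ q → q ⊠ ℤcon (+ 2) ⊞ q ⊠ ℤcon (+ 2) ≛ q ⊠ ℤcon (+ 4)) P.refl q)

    -- For odd m exactly one of m and -m is congruent to p modulo 4, for even m neither. Pairing k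
    -- with -k thus turns a sum over one class modulo 4 into a sum over the positive odd numbers.
    data Signs (m : ℕ) : Set where
      plus : odd m ≡ true → + 4 ∣ + m ℤ.- + p → ¬ (+ 4 ∣ ℤ.- (+ m) ℤ.- + p) → Signs m
      minus : odd m ≡ true → ¬ (+ 4 ∣ + m ℤ.- + p) → + 4 ∣ ℤ.- (+ m) ℤ.- + p → Signs m
      neither : odd m ≡ false → ¬ (+ 4 ∣ + m ℤ.- + p) → ¬ (+ 4 ∣ ℤ.- (+ m) ℤ.- + p) → Signs m

    odd-form : ∀ m → (odd m ≡ true × Σ ℤ λ a → + m ≡ a ℤ.+ a ℤ.+ + 1) ⊎ (odd m ≡ false × Σ ℤ λ a → + m ≡ a ℤ.+ a)
    odd-form zero = inj₂ (P.refl , + 0 , P.refl)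
    odd-form (suc m) with odd-form m
    ... | inj₁ (o , a , e) = inj₂ (P.cong not o , a ℤ.+ + 1 , P.trans (P.cong (λ z → + 1 ℤ.+ z) e) (ℤsolve 1 (λ a → ℤcon (+ 1) ⊞ (a ⊞ a ⊞ ℤcon (+ 1)) ≛ (a ⊞ ℤcon (+ 1)) ⊞ (a ⊞ ℤcon (+ 1))) P.refl a))
    ... | inj₂ (o , a , e) = inj₁ (P.cong not o , a , P.trans (P.cong (λ z → + 1 ℤ.+ z) e) (ℤP.+-comm (+ 1) (a ℤ.+ a)))

    signs : ∀ m → Signs m
    signs m with odd-form m
    ... | inj₂ (o , a , e) = neither o
        (λ d → 2∤odd (a ℤ.- + h ℤ.- + 1) (dvd (P.trans (P.cong₂ ℤ._-_ e p-odd) (ℤsolve 2 (λ a h → (a ⊞ a) ⊟ (h ⊞ h ⊞ ℤcon (+ 1)) ≛ (a ⊟ h ⊟ ℤcon (+ 1)) ⊞ (a ⊟ h ⊟ ℤcon (+ 1)) ⊞ ℤcon (+ 1)) P.refl a (+ h))) (two d)))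
        (λ d → 2∤odd (ℤ.- a ℤ.- + h ℤ.- + 1) (dvd (P.trans (P.cong₂ (λ x y → ℤ.- x ℤ.- y) e p-odd) (ℤsolve 2 (λ a h → ⊟ (a ⊞ a) ⊟ (h ⊞ h ⊞ ℤcon (+ 1)) ≛ (⊟ a ⊟ h ⊟ ℤcon (+ 1)) ⊞ (⊟ a ⊟ h ⊟ ℤcon (+ 1)) ⊞ ℤcon (+ 1)) P.refl a (+ h))) (two d)))
      where
        two : ∀ {x} → + 4 ∣ x → + 2 ∣ x
        two = ℤD.∣-trans (divides (+ 2) P.refl)
    ... | inj₁ (o , a , e) with parity (a ℤ.- + h)
    ...   | y , inj₁ q = plus o (dvd (P.sym m-p) (2-to-4 _ (divides y (P.trans q (ℤsolve 1 (λ y → y ⊞ y ≛ y ⊠ ℤcon (+ 2)) P.refl y)))))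
            (λ d → 2∤odd (ℤ.- y ℤ.- + h ℤ.- + 1) (dvd (P.trans (P.cong (λ z → ℤ.- z ℤ.- (+ h ℤ.+ + h ℤ.+ + 1)) q) (ℤsolve 2 (λ y h → ⊟ (y ⊞ y) ⊟ (h ⊞ h ⊞ ℤcon (+ 1)) ≛ (⊟ y ⊟ h ⊟ ℤcon (+ 1)) ⊞ (⊟ y ⊟ h ⊟ ℤcon (+ 1)) ⊞ ℤcon (+ 1)) P.refl y (+ h))) (4-to-2 _ (dvd -m-p d))))
      where
        m-p : + m ℤ.- + p ≡ (a ℤ.- + h) ℤ.+ (a ℤ.- + h)
        m-p = P.trans (P.cong₂ ℤ._-_ e p-odd) (ℤsolve 2 (λ a h → (a ⊞ a ⊞ ℤcon (+ 1)) ⊟ (h ⊞ h ⊞ ℤcon (+ 1)) ≛ (a ⊟ h) ⊞ (a ⊟ h)) P.refl a (+ h))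
        x = ℤ.- (a ℤ.- + h) ℤ.- (+ h ℤ.+ + h ℤ.+ + 1)
        -m-p : ℤ.- (+ m) ℤ.- + p ≡ x ℤ.+ x
        -m-p = P.trans (P.cong₂ (λ x y → ℤ.- x ℤ.- y) e p-odd) (ℤsolve 2 (λ a h → ⊟ (a ⊞ a ⊞ ℤcon (+ 1)) ⊟ (h ⊞ h ⊞ ℤcon (+ 1)) ≛ (⊟ (a ⊟ h) ⊟ (h ⊞ h ⊞ ℤcon (+ 1))) ⊞ (⊟ (a ⊟ h) ⊟ (h ⊞ h ⊞ ℤcon (+ 1)))) P.refl a (+ h))
    ...   | y , inj₂ q = minus o (λ d → 2∤odd y (dvd q (4-to-2 _ (dvd m-p d))))
            (dvd (P.sym -m-p) (2-to-4 x (divides (ℤ.- y ℤ.- + h ℤ.- + 1) (P.trans (P.cong (λ z → ℤ.- z ℤ.- (+ h ℤ.+ + h ℤ.+ + 1)) q) (ℤsolve 2 (λ y h → ⊟ (y ⊞ y ⊞ ℤcon (+ 1)) ⊟ (h ⊞ h ⊞ ℤcon (+ 1)) ≛ (⊟ y ⊟ h ⊟ ℤcon (+ 1)) ⊠ ℤcon (+ 2)) P.refl y (+ h))))))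
      where
        m-p : + m ℤ.- + p ≡ (a ℤ.- + h) ℤ.+ (a ℤ.- + h)
        m-p = P.trans (P.cong₂ ℤ._-_ e p-odd) (ℤsolve 2 (λ a h → (a ⊞ a ⊞ ℤcon (+ 1)) ⊟ (h ⊞ h ⊞ ℤcon (+ 1)) ≛ (a ⊟ h) ⊞ (a ⊟ h)) P.refl a (+ h))
        x = ℤ.- (a ℤ.- + h) ℤ.- (+ h ℤ.+ + h ℤ.+ + 1)
        -m-p : ℤ.- (+ m) ℤ.- + p ≡ x ℤ.+ x
        -m-p = P.trans (P.cong₂ (λ x y → ℤ.- x ℤ.- y) e p-odd) (ℤsolve 2 (λ a h → ⊟ (a ⊞ a ⊞ ℤcon (+ 1)) ⊟ (h ⊞ h ⊞ ℤcon (+ 1)) ≛ (⊟ (a ⊟ h) ⊟ (h ⊞ h ⊞ ℤcon (+ 1))) ⊞ (⊟ (a ⊟ h) ⊟ (h ⊞ h ⊞ ℤcon (+ 1)))) P.refl a (+ h))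

    coeffs : Hom (PowerSeries.series boolAlg) (PowerSeries.series RS.S)
    coeffs = coeffwise boolAlg RS.S (bitHom RS.S)

    -- Series over S are series in y, and x = y^p.
    embed : Hom (PowerSeries.series boolAlg) (PowerSeries.series RS.S)
    embed = inflateHom p ⊙ coeffs

    E : Series → Carrier
    E = Hom.fun embed

    bit-injective : ∀ a b → S.bit a S.≈ S.bit b → a ≡ b
    bit-injective true true e = P.refl
    bit-injective false false e = P.refl
    bit-injective true false e = ⊥-elim (nontrivial e)
    bit-injective false true e = ⊥-elim (nontrivial (S.sym e))

    E-injective : ∀ {f g} → E f ≈ E g → ∀ n → f n ≡ g n
    E-injective {f} {g} e n = bit-injective (f n) (g n) (S.trans (S.sym (inflate-∣ p _ n)) (S.trans (e (n ℕ.* p)) (inflate-∣ p _ n)))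

    expandΣ : ∀ t n → t (+ 0) n S.≈ S.0# → ΣZ t n S.≈ S.sum n (λ i → t (+ suc i) n S.+ t -[1+ i ] n)
    expandΣ t n z = S.trans (BSum.bsum-pairs (PowerSeries.series RS.S) n t n) (S.trans (S.+-congʳ _ z) (S.trans (S.+-idˡ _) (sum-at n _ n)))

    restrict-yes : ∀ {A : Set} (d : Dec A) f → A → restrict d f ≈ f
    restrict-yes (yes _) f a = refl
    restrict-yes (no n) f a = ⊥-elim (n a)

    restrict-no : ∀ {A : Set} (d : Dec A) f → ¬ A → restrict d f ≈ 0#
    restrict-no (yes a) f n = ⊥-elim (n a)
    restrict-no (no _) f n = refl

    τ-bit : ∀ c a m n → a S.≈ S.1# → τ c a m n S.≈ S.bit (𝔹S.inflate m c n)
    τ-bit c a m n e with m ℕD.∣? n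
    ... | yes (ℕD.divides q _) = S.trans (S.*-congˡ _ (S.trans (S.^-cong q e) (S.^-1 q))) (S.*-idʳ _)
    ... | no _ = S.refl

    off-zero : ∀ e → ¬ (LL ∣ e) → ¬ (LL ∣ + 0 ℤ.- e)
    off-zero e n d = n (dvd (P.trans (P.cong ℤ.-_ (ℤP.+-identityˡ (ℤ.- e))) (ℤP.neg-involutive e)) (∣m⇒∣-m d))

    odd-p : odd p ≡ true
    odd-p = P.trans (P.cong odd p≡) (P.cong not (lem h))
      where
        lem : ∀ h → odd (h ℕ.+ h) ≡ false
        lem zero = P.refl
        lem (suc h) = P.trans (P.cong (not ∘ odd) (ℕP.+-suc h h)) (P.trans (BoolP.not-involutive _) (lem h))

    private
      χ-sum : ∀ c z m n → 0 < m → let t = fam c z (⟨ + 0 ⟩ at P₄) in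
              (t (+ m) n S.+ t (ℤ.- (+ m)) n) S.≈ S.bit (does (p ℕD.∣? m) ∧ (odd m ∧ 𝔹S.inflate m c n))
      χ-sum c z m@(suc m′) n _ = go (p ℕD.∣? m) (signs m)
        where
        go : Dec (p ℕD.∣ m) → Signs m → (fam c z (⟨ + 0 ⟩ at P₄) (+ m) n S.+ fam c z (⟨ + 0 ⟩ at P₄) (ℤ.- (+ m)) n) S.≈ S.bit (does (p ℕD.∣? m) ∧ (odd m ∧ 𝔹S.inflate m c n))
        go (no ne) _ = S.trans (S.+-cong (restrict-no (LL ∣? (+ m ℤ.- P₄)) _ (λ d → ne (bad d) ) n) (restrict-no (LL ∣? (ℤ.- (+ m) ℤ.- P₄)) _ (λ d → ne (bad′ d)) n))
            (S.trans (S.+-idˡ _) (S.reflexive (P.cong S.bit (P.sym (P.cong (_∧ (odd m ∧ 𝔹S.inflate m c n)) (dec-false (p ℕD.∣? m) ne))))))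
          where
            bad : LL ∣ + m ℤ.- + p → p ℕD.∣ m
            bad d = ∣⇒∣ᵤ (dvd (ℤsolve 2 (λ m p → (m ⊟ p) ⊞ p ≛ m) P.refl (+ m) (+ p)) (∣m∣n⇒∣m+n (proj₂ (split-L _ d)) ℤD.∣-refl))
            bad′ : LL ∣ ℤ.- (+ m) ℤ.- + p → p ℕD.∣ m
            bad′ d = ∣⇒∣ᵤ (dvd (ℤsolve 2 (λ m p → ⊟ ((⊟ m ⊟ p) ⊞ p) ≛ m) P.refl (+ m) (+ p)) (∣m⇒∣-m (∣m∣n⇒∣m+n (proj₂ (split-L _ d)) ℤD.∣-refl)))
        go (yes d) (plus o a b) = S.trans (S.+-cong (S.trans (restrict-yes (LL ∣? (+ m ℤ.- P₄)) _ (join-L _ a (∣m∣n⇒∣m-n (∣ᵤ⇒∣ {+ p} {+ m} d) ℤD.∣-refl)) n) (τ-bit c _ m n (root-per (+ 0) (divides (+ 0) P.refl))))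
                                      (restrict-no (LL ∣? (ℤ.- (+ m) ℤ.- P₄)) _ (λ l → b (proj₁ (split-L _ l))) n))
            (S.trans (S.+-idʳ _) (S.reflexive (P.cong S.bit (P.sym (P.cong₂ (λ x y → x ∧ (y ∧ 𝔹S.inflate m c n)) (dec-true (p ℕD.∣? m) d) o)))))
        go (yes d) (minus o a b) = S.trans (S.+-cong (restrict-no (LL ∣? (+ m ℤ.- P₄)) _ (λ l → a (proj₁ (split-L _ l))) n)
                                      (S.trans (restrict-yes (LL ∣? (ℤ.- (+ m) ℤ.- P₄)) _ (join-L _ b (∣m∣n⇒∣m-n (∣m⇒∣-m (∣ᵤ⇒∣ {+ p} {+ m} d)) ℤD.∣-refl)) n) (τ-bit c _ m n (root-per (+ 0) (divides (+ 0) P.refl)))))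
            (S.trans (S.+-idˡ _) (S.reflexive (P.cong S.bit (P.sym (P.cong₂ (λ x y → x ∧ (y ∧ 𝔹S.inflate m c n)) (dec-true (p ℕD.∣? m) d) o)))))
        go (yes d) (neither o a b) = S.trans (S.+-cong (restrict-no (LL ∣? (+ m ℤ.- P₄)) _ (λ l → a (proj₁ (split-L _ l))) n) (restrict-no (LL ∣? (ℤ.- (+ m) ℤ.- P₄)) _ (λ l → b (proj₁ (split-L _ l))) n))
            (S.trans (S.+-idˡ _) (S.reflexive (P.cong S.bit (P.sym (P.cong₂ (λ x y → x ∧ (y ∧ 𝔹S.inflate m c n)) (dec-true (p ℕD.∣? m) d) o)))))

    sum-bit : ∀ n f → S.sum n (λ i → S.bit (f i)) S.≈ S.bit (𝔹.sum n f)
    sum-bit n f = S.sym (Hom.fun-sum (bitHom RS.S) n f)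

    -- The class of p modulo 4p contains exactly one of m and -m for each odd multiple m of p, and
    -- nothing else. At root index 0 the two signs give the same term, so what remains is the
    -- Lambert series in y^p.
    Eis-P₄ : ∀ c z → c 0 ≡ false → ΣZ (fam c z (⟨ + 0 ⟩ at P₄)) ≈ E (lam c)
    Eis-P₄ c z c0 n = S.trans (expandΣ (fam c z (⟨ + 0 ⟩ at P₄)) n (restrict-no (LL ∣? (+ 0 ℤ.- P₄)) _ (off-zero P₄ L∤P₄) n))
      (S.trans (S.sum-cong n (λ i → χ-sum c z (suc i) n (s≤s z≤n))) (S.trans (sum-bit n _) (S.trans (S.reflexive (P.cong S.bit total)) embedded)))
      where
        g : ℕ → Bool
        g m = odd m ∧ 𝔹S.inflate m c n
        total : 𝔹.sum n (λ i → does (p ℕD.∣? suc i) ∧ g (suc i)) ≡ 𝔹S.inflate p (lam c) n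
        total with ℕP.m≤n⇒m<n∨m≡n (z≤n {n})
        ... | inj₂ P.refl = P.sym (P.trans (𝔹S.inflate-∣ p (lam c) 0) P.refl)
        ... | inj₁ n>0 = P.trans (sum-multiples p n g (λ m l → P.trans (P.cong (odd m ∧_) (𝔹S.inflate-∤ m c n (λ d → ℕP.<⇒≱ l (ℕD.∣⇒≤ {{ℕ.>-nonZero n>0}} d)))) (𝔹.zeroʳ (odd m)))) (by (p ℕD.∣? n))
          where
            by : Dec (p ℕD.∣ n) → 𝔹.sum n (λ i → g (p ℕ.* suc i)) ≡ 𝔹S.inflate p (lam c) n
            by (no ne) = P.trans (𝔹.sum-0 n (λ i _ → P.trans (P.cong (odd (p ℕ.* suc i) ∧_) (𝔹S.inflate-∤ (p ℕ.* suc i) c n (λ d → ne (ℕD.∣-trans (ℕD.m∣m*n (suc i)) d)))) (𝔹.zeroʳ (odd (p ℕ.* suc i))))) (P.sym (𝔹S.inflate-∤ p (lam c) n ne))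
            by (yes (ℕD.divides q e)) = P.trans (𝔹.sum-cong n (λ i → P.cong₂ _∧_ (P.trans (odd-* p (suc i)) (P.cong (_∧ odd (suc i)) odd-p)) (cancelled (suc i))))
                (P.trans (lam-extend c n q c0 q>0 (P.subst (q ≤_) (P.sym e) (ℕP.m≤m*n q p))) (P.sym (P.trans (P.cong (𝔹S.inflate p (lam c)) e) (𝔹S.inflate-∣ p (lam c) q))))
              where
                positive : ∀ q → n ≡ q ℕ.* p → 0 < q
                positive (suc _) _ = s≤s z≤n
                positive zero e = ⊥-elim (ℕP.<⇒≢ n>0 (P.sym e))
                q>0 : 0 < q
                q>0 = positive q e
                cancelled : ∀ m .{{_ : NonZero m}} → 𝔹S.inflate (p ℕ.* m) c n ≡ 𝔹S.inflate m c q
                cancelled m with m ℕD.∣? q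
                ... | yes (ℕD.divides s P.refl) = P.trans (P.cong (𝔹S.inflate (p ℕ.* m) c) (P.trans e (P.trans (ℕP.*-assoc s m p) (P.cong (s ℕ.*_) (ℕP.*-comm m p))))) (𝔹S.inflate-∣ (p ℕ.* m) {{ℕP.m*n≢0 p m}} c s)
                ... | no ne = 𝔹S.inflate-∤ (p ℕ.* m) c n (λ { (ℕD.divides s e′) → ne (ℕD.divides s (ℕP.*-cancelʳ-≡ q (s ℕ.* m) p (P.trans (P.sym e) (P.trans e′ (P.trans (P.cong (s ℕ.*_) (ℕP.*-comm p m)) (P.sym (ℕP.*-assoc s m p))))))) })
        embedded : S.bit (𝔹S.inflate p (lam c) n) S.≈ E (lam c) n
        embedded with p ℕD.∣? n
        ... | yes (ℕD.divides q _) = S.refl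
        ... | no _ = S.refl

    r̂-embed : r̂ ≈ E rS
    r̂-embed = trans (Eis-P₄ non3 _ P.refl) (Hom.fun-cong embed (λ n → P.sym (rS-lam n)))

    A-embed : A ≈ E A₁
    A-embed = Eis-P₄ odd _ P.refl

    -- `A-value` holds between series in y over `S`; it descends to 𝔽₂[[x]] because `E` is an
    -- injective ring homomorphism.
    A₁-value : A₁ 𝔹S.≈ rS 𝔹S.* (𝔹S.1# 𝔹S.+ rS) 𝔹S.* 𝔹S.sq (𝔹S.1# 𝔹S.+ rS)
    A₁-value = E-injective (trans (sym A-embed) (trans A-value (trans (*-cong (*-cong r̂-embed one+) (sq-cong one+))
        (sym (trans (E.fun-* _ _) (*-cong (E.fun-* _ _) (E.fun-* _ _)))))))
      where
        module E = Hom embed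
        one+ : 1# + r̂ ≈ E (𝔹S.1# 𝔹S.+ rS)
        one+ = trans (+-cong (sym E.fun-1) r̂-embed) (sym (E.fun-+ 𝔹S.1# rS))

-- The operators U₂ and U₃ on 𝔽₂[r], and the removal of denominators.

module OddForms where
  open import Defs
  open CharacteristicTwo
  open FormalSeries
  open Homomorphisms
  open LambertSeries using (odd)
  open DivisorSums
  open RootsOfUnity
  open Embedding

  private
    SB = PowerSeries.series boolAlg

  open 𝔹S
  open Horner SB

  conv-*ₛ : ∀ n (a b : Series) → (a *ₛ b) n ≡ conv a b n
  conv-*ₛ n a b = P.trans (xsum≡sum (suc n) (λ i → a i ∧ b (n ∸ i))) (go n a)
    where
      go : ∀ n (a : Series) → 𝔹.sum (suc n) (λ i → a i ∧ b (n ∸ i)) ≡ conv a b n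
      go zero a = BoolP.xor-identityʳ _
      go (suc n) a = P.trans (𝔹.sum-front (suc n) (λ i → a i ∧ b (suc n ∸ i))) (P.cong ((a 0 ∧ b (suc n)) xor_) (go n (a ∘ suc)))

  ev : Poly → Series
  ev f = horner f rS

  evalS-horner : ∀ f → evalS f ≈ ev f
  evalS-horner [] n = P.refl
  evalS-horner (a ∷ f) n = P.cong₂ _xor_ (bit-δ a n) (P.trans (conv-*ₛ n rS (evalS f)) (conv-cong≤ n {rS} {rS} (λ _ _ → P.refl) (λ i _ → evalS-horner f i)))
    where
      bit-δ : ∀ a n → (a ∧ δ₀ n) ≡ bit a n
      bit-δ true zero = P.refl
      bit-δ true (suc n) = P.refl
      bit-δ false n = P.refl

  -- The identity does not mention p; the smallest prime above 3 supplies the roots of unity for its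
  -- proof.
  A₁-law : A₁ ≈ rS * (1# + rS) * sq (1# + rS)
  A₁-law = Level.A₁-value 5 2 P.refl prime-5 3∤5 (rootSystem 5 2 P.refl prime-5 3∤5)
    where
      prime-5 : Prime 5
      prime-5 = toWitness {a? = prime? 5} _
      3∤5 : ¬ (3 ℕD.∣ 5)
      3∤5 = toWitnessFalse {a? = 3 ℕD.∣? 5} _

  r-lead : Lead 1 true rS
  r-lead = (λ { zero _ → P.refl ; (suc i) (s≤s ()) }) , P.refl

  -- As r = x + ..., the lowest coefficient of f becomes the leading coefficient of f(r). This
  -- decides whether f(r) = 0, shows that r is transcendental, and makes every nonzero polynomial in
  -- r regular.
  data Zero? (f : Poly) : Set where
    is-zero : (∀ n → coeff f n ≡ false) → ev f ≈ 0# → Zero? f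
    has-lead : (m : ℕ) → Lead m true (ev f) → Zero? f

  zero? : ∀ f → Zero? f
  zero? [] = is-zero (λ _ → P.refl) (λ _ → P.refl)
  zero? (true ∷ f) = has-lead 0 ((λ i ()) , P.refl)
  zero? (false ∷ f) with zero? f
  ... | is-zero z e = is-zero (λ { zero → P.refl ; (suc n) → z n }) (trans (+-idˡ (rS * ev f)) (trans (*-congˡ {ev f} {0#} rS e) (zeroʳ rS)))
  ... | has-lead m l = has-lead (suc m) (lead-* 1 m {true} {true} {rS} {ev f} r-lead l)

  lead-nonzero : ∀ {m f} → Lead m true f → ¬ (f ≈ 0#)
  lead-nonzero {m} (_ , e) z with P.trans (P.sym e) (z m)
  ... | ()

  coeff-zero : ∀ f → ev f ≈ 0# → ∀ n → coeff f n ≡ false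
  coeff-zero f e with zero? f
  ... | is-zero z _ = z
  ... | has-lead m l = ⊥-elim (lead-nonzero {m} {ev f} l e)

  coeff-+ : ∀ f g n → coeff (f +ₚ g) n ≡ coeff f n xor coeff g n
  coeff-+ [] g n = P.refl
  coeff-+ (a ∷ f) [] n = P.sym (BoolP.xor-identityʳ _)
  coeff-+ (a ∷ f) (b ∷ g) zero = P.refl
  coeff-+ (a ∷ f) (b ∷ g) (suc n) = coeff-+ f g n

  ev-injective : ∀ f g → ev f ≈ ev g → f ≈ₚ g
  ev-injective f g e n = 𝔹.+≈0⇒≈ (P.trans (P.sym (coeff-+ f g n)) (coeff-zero (f +ₚ g) (trans (horner-+ f g rS) (≈⇒+≈0 {ev f} {ev g} e)) n))

  ev-cong : ∀ f g → f ≈ₚ g → ev f ≈ ev g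
  ev-cong f g e = +≈0⇒≈ {ev f} {ev g} (trans (sym (horner-+ f g rS)) (go (f +ₚ g) (λ n → P.trans (coeff-+ f g n) (𝔹.≈⇒+≈0 (e n)))))
    where
      go : ∀ h → (∀ n → coeff h n ≡ false) → ev h ≈ 0#
      go [] z n = P.refl
      go (b ∷ h) z = trans (+-cong {bit b} {0#} (λ n → P.cong (λ c → bit c n) (z 0)) (trans (*-congˡ {ev h} {0#} rS (go h (z ∘ suc))) (zeroʳ rS))) (+-idˡ 0#)

  U : ℕ → Series → Series
  U m a n = a (m ℕ.* n)

  U-+ : ∀ m a b → U m (a + b) ≈ U m a + U m b
  U-+ m a b n = P.refl

  -- Projection formula: `U m` is linear over the series in x^m. For m = 2 these are the squares,
  -- for m = 3 they include G(r).
  U-inflate : ∀ m .{{_ : NonZero m}} (a b : Series) → U m (a * inflate m b) ≈ U m a * b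
  U-inflate m a b n = P.trans (go n b) (conv-comm n b (U m a))
    where
      open PowerSeries boolAlg using (conv-comm)
      expand-right : ∀ b → a * inflate m b ≈ const (b 0) * a + shiftBy m (a * inflate m (b ∘ suc))
      expand-right b = trans (*-comm a (inflate m b)) (trans (*-congʳ {inflate m b} {const (b 0) + shiftBy m (inflate m (b ∘ suc))} a
          (trans (inflate-cong m (head-tail b)) (trans (inflate-+ m (const (b 0)) (shift (b ∘ suc))) (+-cong {inflate m (const (b 0))} {const (b 0)} (inflate-const (b 0)) (inflate-shift m (b ∘ suc))))))
        (trans (distribʳ a (const (b 0)) (shiftBy m (inflate m (b ∘ suc)))) (+-congˡ (const (b 0) * a) (trans (shiftBy-* m (inflate m (b ∘ suc)) a) (shiftBy-cong m (*-comm (inflate m (b ∘ suc)) a))))))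
        where
          inflate-const : ∀ c → inflate m (const c) ≈ const c
          inflate-const c = trans (inflate-cong m (sym (*-idʳ (const c)))) (trans (inflate-scale m c 1#)
            (trans (*-congˡ {inflate m 1#} {1#} (const c) (inflate-1 m)) (*-idʳ (const c))))
      go : ∀ n b → (a * inflate m b) (m ℕ.* n) ≡ conv b (U m a) n
      go zero b = P.trans (expand-right b (m ℕ.* 0)) (P.trans (P.cong₂ _xor_ (conv-const (m ℕ.* 0) (b 0) a)
        (P.trans (P.cong (shiftBy m (a * inflate m (b ∘ suc))) (ℕP.*-zeroʳ m)) (shiftBy-< m (a * inflate m (b ∘ suc)) 0 (ℕ.>-nonZero⁻¹ m)))) (BoolP.xor-identityʳ _))
      go (suc n) b = P.trans (expand-right b (m ℕ.* suc n)) (P.cong₂ _xor_ (conv-const (m ℕ.* suc n) (b 0) a)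
        (P.trans (P.cong (shiftBy m (a * inflate m (b ∘ suc))) (ℕP.*-suc m n)) (P.trans (shiftBy-+ m (a * inflate m (b ∘ suc)) (m ℕ.* n)) (go n (b ∘ suc)))))

  U-pure : ∀ m .{{_ : NonZero m}} b → U m (inflate m b) ≈ b
  U-pure m b = trans (λ n → P.sym (P.trans (*-idˡ (inflate m b) (m ℕ.* n)) P.refl)) (trans (U-inflate m 1# b) (trans (*-congʳ {U m 1#} {1#} b (U-1 m)) (*-idˡ b)))
    where
      U-1 : ∀ m .{{_ : NonZero m}} → U m 1# ≈ 1#
      U-1 m zero = P.cong (const true) (ℕP.*-zeroʳ m)
      U-1 (suc m) (suc n) = P.refl

  square : ∀ a → a * a ≈ inflate 2 a
  square = square-even

  -- All its exponents are odd, so U₂ kills D b² and returns a from a².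
  D : Series
  D = rS + sq rS

  U₂-D : U 2 D ≈ 0#
  U₂-D n = D-odd (2 ℕ.* n) (P.trans (odd-* 2 n) P.refl)

  D-reg : Reg D
  D-reg = reg-lead 1 {true} {D} ((λ { zero _ → P.refl ; (suc i) (s≤s ()) }) , P.refl) 𝔹.reg-1

  U₂-D* : ∀ b → U 2 (D * sq b) ≈ 0#
  U₂-D* b = trans (λ n → *-congˡ {sq b} {inflate 2 b} D (square b) (2 ℕ.* n)) (trans (U-inflate 2 D b) (trans (*-congʳ {U 2 D} {0#} b U₂-D) (zeroˡ b)))

  U₂-sq : ∀ b → U 2 (sq b) ≈ b
  U₂-sq b = trans (λ n → square b (2 ℕ.* n)) (U-pure 2 b)

  ev-∘X² : ∀ g → ev (g ∘ₚ X²) ≈ sq (ev g)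
  ev-∘X² g = trans (horner-∘ g X² rS) (trans (horner-cong g {horner X² rS} {inflate 2 rS} (trans (horner-* X X rS) (trans (*-cong {horner X rS} {rS} {horner X rS} {rS} (horner-X rS) (horner-X rS)) (square rS))))
    (trans (sym (horner-fun SB SB (inflateHom 2) g rS)) (sym (square (ev g)))))

  ev-X : ev X ≈ rS
  ev-X = horner-X rS

  ev-X² : ev X² ≈ sq rS
  ev-X² = trans (horner-* X X rS) (*-cong {ev X} {rS} {ev X} {rS} ev-X ev-X)

  ev-X³ : ev X³ ≈ sq rS * rS
  ev-X³ = trans (horner-* X² X rS) (*-cong {ev X²} {sq rS} {ev X} {rS} ev-X² ev-X)

  Modd⇒U₂ : ∀ f → Modd f → U 2 (ev f) ≈ 0#
  Modd⇒U₂ f (g , e) = trans (λ n → form (2 ℕ.* n)) (U₂-D* (ev g))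
    where
      form : ev f ≈ D * sq (ev g)
      form = trans (ev-cong f ((X² +ₚ X) *ₚ (g ∘ₚ X²)) e) (trans (horner-* (X² +ₚ X) (g ∘ₚ X²) rS)
        (*-cong {ev (X² +ₚ X)} {D} {ev (g ∘ₚ X²)} {sq (ev g)} (trans (horner-+ X² X rS) (trans (+-cong {ev X²} {sq rS} {ev X} {rS} ev-X² ev-X) (+-comm (sq rS) rS))) (ev-∘X² g)))

  split : Poly → Poly × Poly
  split [] = [] , []
  split (a ∷ f) = a ∷ proj₂ (split f) , proj₁ (split f)

  evens odds : Poly → Poly
  evens f = proj₁ (split f)
  odds f = proj₂ (split f)

  split-ev : ∀ f → ev f ≈ sq (ev (evens f)) + rS * sq (ev (odds f))
  split-ev [] = trans (sym (zeroˡ 0#)) (trans (sym (+-idʳ (0# * 0#))) (+-congˡ (0# * 0#) (sym (trans (*-congˡ {0# * 0#} {0#} rS (zeroˡ 0#)) (zeroʳ rS)))))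
  split-ev (a ∷ f) = trans (+-congˡ (bit a) (*-congˡ {ev f} rS (split-ev f)))
      (trans (solve 4 (λ a r e o → a :+ r :* (e :* e :+ r :* (o :* o)) := (a :+ (r :* o) :* (r :* o)) :+ r :* (e :* e)) refl (bit a) rS (ev (evens f)) (ev (odds f)))
        (+-congʳ (rS * sq (ev (evens f))) (trans (+-congʳ (sq (rS * ev (odds f))) (bit-sq a)) (sym (sq-+ (bit a) (rS * ev (odds f)))))))
    where
      bit-sq : ∀ a → bit a ≈ sq (bit a)
      bit-sq true = sym (*-idˡ 1#)
      bit-sq false = sym (zeroˡ 0#)

  -- Putting r = r² + D into e² + r o² separates what U₂ keeps, a square, from what it kills, D
  -- times a square.
  decompose : ∀ f → ev f ≈ sq (ev (evens f) + rS * ev (odds f)) + D * sq (ev (odds f))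
  decompose f = trans (split-ev f) (solve 3 (λ r e o → e :* e :+ r :* (o :* o) := (e :+ r :* o) :* (e :+ r :* o) :+ (r :+ r :* r) :* (o :* o)) refl rS (ev (evens f)) (ev (odds f)))

  U₂⇒Modd : ∀ f → U 2 (ev f) ≈ 0# → Modd f
  U₂⇒Modd f z = o , ev-injective f ((X² +ₚ X) *ₚ (o ∘ₚ X²)) (trans (decompose f) (trans (+-congʳ (D * sq (ev o)) (trans (sq-cong {a} {0#} a≈0) (zeroˡ 0#))) (trans (+-idˡ (D * sq (ev o)))
      (sym (trans (horner-* (X² +ₚ X) (o ∘ₚ X²) rS)
        (*-cong {ev (X² +ₚ X)} {D} {ev (o ∘ₚ X²)} {sq (ev o)} (trans (horner-+ X² X rS) (trans (+-cong {ev X²} {sq rS} {ev X} {rS} ev-X² ev-X) (+-comm (sq rS) rS))) (ev-∘X² o)))))))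
    where
      o = odds f
      a = ev (evens f) + rS * ev o
      a≈0 : a ≈ 0#
      a≈0 = trans (sym (U₂-sq a)) (trans (sym (+-idʳ (U 2 (sq a)))) (trans (+-congˡ (U 2 (sq a)) (sym (U₂-D* (ev o)))) (trans (λ n → P.sym (decompose f (2 ℕ.* n))) z)))

  Fv Gv : Series
  Fv = ev Fₚ
  Gv = ev Gₚ

  ev-X+1 : ev (X +ₚ 𝟏) ≈ 1# + rS
  ev-X+1 = trans (horner-+ X 𝟏 rS) (trans (+-cong {ev X} {rS} {ev 𝟏} {1#} ev-X (horner-𝟏 rS)) (+-comm rS 1#))

  F-form : Fv ≈ rS * ((1# + rS) * ((1# + rS) * (1# + rS)))
  F-form = trans (horner-* X ((X +ₚ 𝟏) *ₚ ((X +ₚ 𝟏) *ₚ (X +ₚ 𝟏))) rS) (*-cong {ev X} {rS} {ev ((X +ₚ 𝟏) *ₚ ((X +ₚ 𝟏) *ₚ (X +ₚ 𝟏)))} ev-X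
    (trans (horner-* (X +ₚ 𝟏) ((X +ₚ 𝟏) *ₚ (X +ₚ 𝟏)) rS) (*-cong {ev (X +ₚ 𝟏)} {1# + rS} {ev ((X +ₚ 𝟏) *ₚ (X +ₚ 𝟏))} ev-X+1
      (trans (horner-* (X +ₚ 𝟏) (X +ₚ 𝟏) rS) (*-cong {ev (X +ₚ 𝟏)} {1# + rS} {ev (X +ₚ 𝟏)} {1# + rS} ev-X+1 ev-X+1)))))

  G-form : Gv ≈ (sq rS * rS) * (1# + rS)
  G-form = trans (horner-* X³ (X +ₚ 𝟏) rS) (*-cong {ev X³} {sq rS * rS} {ev (X +ₚ 𝟏)} {1# + rS} ev-X³ ev-X+1)

  G-inflate : Gv ≈ inflate 3 Fv
  G-inflate = +≈0⇒≈ {Gv} {inflate 3 Fv} (begin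
      Gv + inflate 3 Fv ≈⟨ +-cong {Gv} {(sq rS * rS) * (1# + rS)} {inflate 3 Fv} {inflate 3 A₁} G-form (inflate-cong 3 (trans F-form (trans
          (solve 1 (λ r → r :* ((I :+ r) :* ((I :+ r) :* (I :+ r))) := r :* (I :+ r) :* ((I :+ r) :* (I :+ r))) refl rS) (sym A₁-law)))) ⟩
      (sq rS * rS) * (1# + rS) + inflate 3 A₁ ≈⟨ solve 3 (λ g a b → g :+ b := (a :+ b) :+ (a :+ g)) refl ((sq rS * rS) * (1# + rS)) A₁ (inflate 3 A₁) ⟩
      (A₁ + inflate 3 A₁) + (A₁ + (sq rS * rS) * (1# + rS)) ≈⟨ +-cong {A₁ + inflate 3 A₁} {rS + sq rS} {A₁ + (sq rS * rS) * (1# + rS)} (λ n → P.sym (r+r² n)) (+-congʳ ((sq rS * rS) * (1# + rS)) A₁-law) ⟩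
      (rS + sq rS) + (rS * (1# + rS) * sq (1# + rS) + (sq rS * rS) * (1# + rS))
        ≈⟨ solve 1 (λ r → (r :+ r :* r) :+ (r :* (I :+ r) :* ((I :+ r) :* (I :+ r)) :+ ((r :* r) :* r) :* (I :+ r)) := O) refl rS ⟩
      0# ∎)

  U₃-rS : U 3 rS ≈ rS
  U₃-rS = U₃-r

  U-sq : ∀ m a → odd m ≡ true → U m (sq a) ≈ sq (U m a)
  U-sq m a o n = P.trans (square a (m ℕ.* n)) (P.trans (commute (2 ℕD.∣? n)) (P.sym (square (U m a) n)))
    where
      2∣ : ∀ {k} → odd k ≡ false → 2 ℕD.∣ k
      2∣ {k} e = go (2 ℕD.∣? k)
        where
          go : Dec (2 ℕD.∣ k) → 2 ℕD.∣ k
          go (yes d) = d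
          go (no ne) with P.trans (P.sym e) (P.trans (odd-∣ k) (P.cong not (dec-false (2 ℕD.∣? k) ne)))
          ... | ()
      odd-of : ∀ {k} → ¬ (2 ℕD.∣ k) → odd k ≡ true
      odd-of {k} ne with odd k in eq
      ... | true = P.refl
      ... | false = ⊥-elim (ne (2∣ eq))
      even-of : ∀ {k} → 2 ℕD.∣ k → odd k ≡ false
      even-of (ℕD.divides q P.refl) = P.trans (odd-* q 2) (BoolP.∧-zeroʳ (odd q))
      commute : Dec (2 ℕD.∣ n) → inflate 2 a (m ℕ.* n) ≡ inflate 2 (U m a) n
      commute (yes (ℕD.divides q P.refl)) = P.trans (P.cong (inflate 2 a) (P.sym (ℕP.*-assoc m q 2))) (P.trans (inflate-∣ 2 a (m ℕ.* q)) (P.sym (inflate-∣ 2 (U m a) q)))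
      commute (no ne) = P.trans (inflate-∤ 2 a (m ℕ.* n) (λ d → absurd (even-of d))) (P.sym (inflate-∤ 2 (U m a) n ne))
        where
          absurd : ¬ (odd (m ℕ.* n) ≡ false)
          absurd e with P.trans (P.sym e) (P.trans (odd-* m n) (P.cong₂ _∧_ o (odd-of ne)))
          ... | ()

  U₃-r² : U 3 (sq rS) ≈ sq rS
  U₃-r² = trans (U-sq 3 rS P.refl) (sq-cong {U 3 rS} {rS} U₃-rS)

  -- r⁴ = G(r) + r³ and U₃ G(r) = F(r).
  U₃-r³ : U 3 (sq rS * rS) ≈ ev Ur³
  U₃-r³ = begin
      U 3 (sq rS * rS) ≈⟨ (λ n → solve 1 (λ r → (r :* r) :* r := (r :* r) :* (r :* r) :+ (r :* r) :* r :* (I :+ r)) refl rS (3 ℕ.* n)) ⟩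
      U 3 (sq (sq rS)) + U 3 (sq rS * rS * (1# + rS)) ≈⟨ +-cong {U 3 (sq (sq rS))} {sq (sq rS)} {U 3 (sq rS * rS * (1# + rS))} {Fv}
          (trans (U-sq 3 (sq rS) P.refl) (sq-cong {U 3 (sq rS)} {sq rS} U₃-r²)) (trans (λ n → P.trans (P.sym (G-form (3 ℕ.* n))) (G-inflate (3 ℕ.* n))) (U-pure 3 Fv)) ⟩
      sq (sq rS) + Fv ≈⟨ +-congˡ (sq (sq rS)) F-form ⟩
      sq (sq rS) + rS * ((1# + rS) * ((1# + rS) * (1# + rS)))
        ≈⟨ solve 1 (λ r → (r :* r) :* (r :* r) :+ r :* ((I :+ r) :* ((I :+ r) :* (I :+ r))) := (r :* r) :* r :+ (r :* r :+ r)) refl rS ⟩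
      sq rS * rS + (sq rS + rS) ≈⟨ sym (trans (horner-+ X³ (X² +ₚ X) rS) (+-cong {ev X³} {sq rS * rS} {ev (X² +ₚ X)} {sq rS + rS} ev-X³ (trans (horner-+ X² X rS) (+-cong {ev X²} {sq rS} {ev X} {rS} ev-X² ev-X)))) ⟩
      ev Ur³ ∎

  combine : Poly → (Poly → Poly → Poly → Poly → Poly → Poly)
  combine u b g₀ g₁ g₂ g₃ = (g₀ ∘ₚ b) +ₚ (((g₁ ∘ₚ b) *ₚ X) +ₚ (((g₂ ∘ₚ b) *ₚ X²) +ₚ ((g₃ ∘ₚ b) *ₚ u)))

  ev-combine : ∀ u b g₀ g₁ g₂ g₃ → ev (combine u b g₀ g₁ g₂ g₃) ≈
    horner g₀ (ev b) + (horner g₁ (ev b) * rS + (horner g₂ (ev b) * sq rS + horner g₃ (ev b) * ev u))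
  ev-combine u b g₀ g₁ g₂ g₃ = trans (horner-+ (g₀ ∘ₚ b) _ rS) (+-cong {ev (g₀ ∘ₚ b)} {horner g₀ (ev b)} (horner-∘ g₀ b rS)
    (trans (horner-+ ((g₁ ∘ₚ b) *ₚ X) _ rS) (+-cong {ev ((g₁ ∘ₚ b) *ₚ X)} {horner g₁ (ev b) * rS} (mul g₁ X rS ev-X)
      (trans (horner-+ ((g₂ ∘ₚ b) *ₚ X²) _ rS) (+-cong {ev ((g₂ ∘ₚ b) *ₚ X²)} {horner g₂ (ev b) * sq rS} (mul g₂ X² (sq rS) ev-X²) (mul g₃ u (ev u) (λ _ → P.refl)))))))
    where
      mul : ∀ g v w → ev v ≈ w → ev ((g ∘ₚ b) *ₚ v) ≈ horner g (ev b) * w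
      mul g v w e = trans (horner-* (g ∘ₚ b) v rS) (*-cong {ev (g ∘ₚ b)} {horner g (ev b)} {ev v} {w} (horner-∘ g b rS) e)

  -- U₃ is linear over series in x³ and G(r) is F(r) at x³, so a coefficient g(G) comes out as g(F).
  -- It remains to compare U₃ and U on the basis 1, r, r², r³.
  UGraph⇒U₃ : ∀ f h → UGraph f h → ev h ≈ U 3 (ev f)
  UGraph⇒U₃ f h (g₀ , g₁ , g₂ , g₃ , ef , eh) = begin
      ev h ≈⟨ trans (ev-cong h (combine Ur³ Fₚ g₀ g₁ g₂ g₃) eh) (ev-combine Ur³ Fₚ g₀ g₁ g₂ g₃) ⟩
      horner g₀ Fv + (horner g₁ Fv * rS + (horner g₂ Fv * sq rS + horner g₃ Fv * ev Ur³))
        ≈⟨ sym (+-cong {U 3 (horner g₀ Gv)} {horner g₀ Fv} (trans (λ n → lift g₀ (3 ℕ.* n)) (U-pure 3 (horner g₀ Fv)))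
            (+-cong {U 3 (horner g₁ Gv * rS)} {horner g₁ Fv * rS} (part g₁ rS rS U₃-rS)
              (+-cong {U 3 (horner g₂ Gv * sq rS)} {horner g₂ Fv * sq rS} (part g₂ (sq rS) (sq rS) U₃-r²)
                (part g₃ (ev X³) (ev Ur³) (trans (λ n → ev-X³ (3 ℕ.* n)) U₃-r³))))) ⟩
      U 3 (horner g₀ Gv + (horner g₁ Gv * rS + (horner g₂ Gv * sq rS + horner g₃ Gv * ev X³)))
        ≈⟨ (λ n → P.sym (P.trans (ev-cong f (combine X³ Gₚ g₀ g₁ g₂ g₃) ef (3 ℕ.* n)) (ev-combine X³ Gₚ g₀ g₁ g₂ g₃ (3 ℕ.* n)))) ⟩
      U 3 (ev f) ∎
    where
      lift : ∀ g → horner g Gv ≈ inflate 3 (horner g Fv)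
      lift g = trans (horner-cong g {Gv} {inflate 3 Fv} G-inflate) (sym (horner-fun SB SB (inflateHom 3) g Fv))
      part : ∀ g b c → U 3 b ≈ c → U 3 (horner g Gv * b) ≈ horner g Fv * c
      part g b c e = trans (λ n → trans (*-congʳ {horner g Gv} {inflate 3 (horner g Fv)} b (lift g)) (*-comm (inflate 3 (horner g Fv)) b) (3 ℕ.* n))
        (trans (U-inflate 3 b (horner g Fv)) (trans (*-congʳ {U 3 b} {c} (horner g Fv) e) (*-comm c (horner g Fv))))

  -- Division by the monic quartic G − G(r), using r⁴ = G + r³.
  base-G : ∀ f → Σ Poly λ g₀ → Σ Poly λ g₁ → Σ Poly λ g₂ → Σ Poly λ g₃ → f ≈ₚ combine X³ Gₚ g₀ g₁ g₂ g₃
  base-G [] = [] , [] , [] , [] , ev-injective [] (combine X³ Gₚ [] [] [] []) (λ _ → P.refl)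
  base-G (a ∷ f) with base-G f
  ... | g₀ , g₁ , g₂ , g₃ , e = (a ∷ g₃) , g₀ , g₁ , (g₂ +ₚ g₃) , ev-injective (a ∷ f) (combine X³ Gₚ (a ∷ g₃) g₀ g₁ (g₂ +ₚ g₃)) (begin
      bit a + rS * ev f ≈⟨ +-congˡ (bit a) (*-congˡ {ev f} rS (trans (ev-cong f (combine X³ Gₚ g₀ g₁ g₂ g₃) e) (trans (ev-combine X³ Gₚ g₀ g₁ g₂ g₃) (cube g₀ g₁ g₂ g₃)))) ⟩
      bit a + rS * (h g₀ + (h g₁ * rS + (h g₂ * sq rS + h g₃ * (sq rS * rS))))
        ≈⟨ solve 6 (λ a r x y z w → a :+ r :* (x :+ (y :* r :+ (z :* (r :* r) :+ w :* ((r :* r) :* r)))) := (a :+ ((r :* r) :* r) :* (I :+ r) :* w) :+ (x :* r :+ (y :* (r :* r) :+ (z :+ w) :* ((r :* r) :* r))))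
             refl (bit a) rS (h g₀) (h g₁) (h g₂) (h g₃) ⟩
      (bit a + (sq rS * rS) * (1# + rS) * h g₃) + (h g₀ * rS + (h g₁ * sq rS + (h g₂ + h g₃) * (sq rS * rS)))
        ≈⟨ +-cong {bit a + (sq rS * rS) * (1# + rS) * h g₃} {bit a + Gv * h g₃} (+-congˡ (bit a) (*-congʳ {(sq rS * rS) * (1# + rS)} {Gv} (h g₃) (sym G-form)))
            (+-congˡ (h g₀ * rS) (+-congˡ (h g₁ * sq rS) (*-congʳ {h g₂ + h g₃} {h (g₂ +ₚ g₃)} (sq rS * rS) (sym (horner-+ g₂ g₃ Gv))))) ⟩
      h (a ∷ g₃) + (h g₀ * rS + (h g₁ * sq rS + h (g₂ +ₚ g₃) * (sq rS * rS))) ≈⟨ sym (trans (ev-combine X³ Gₚ (a ∷ g₃) g₀ g₁ (g₂ +ₚ g₃)) (cube (a ∷ g₃) g₀ g₁ (g₂ +ₚ g₃))) ⟩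
      ev (combine X³ Gₚ (a ∷ g₃) g₀ g₁ (g₂ +ₚ g₃)) ∎)
    where
      h : Poly → Series
      h g = horner g Gv
      cube : ∀ g₀ g₁ g₂ g₃ → h g₀ + (h g₁ * rS + (h g₂ * sq rS + h g₃ * ev X³)) ≈ h g₀ + (h g₁ * rS + (h g₂ * sq rS + h g₃ * (sq rS * rS)))
      cube g₀ g₁ g₂ g₃ = +-congˡ (h g₀) (+-congˡ (h g₁ * rS) (+-congˡ (h g₂ * sq rS) (*-congˡ {ev X³} {sq rS * rS} (h g₃) ev-X³)))

  U₃⇒UGraph : ∀ f → U 3 (ev f) ≈ ev f → UGraph f f
  U₃⇒UGraph f e with base-G f
  ... | g₀ , g₁ , g₂ , g₃ , ef = g₀ , g₁ , g₂ , g₃ , ef , ev-injective f k (sym (trans (UGraph⇒U₃ f k (g₀ , g₁ , g₂ , g₃ , ef , (λ _ → P.refl))) e))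
    where
      k = combine Ur³ Fₚ g₀ g₁ g₂ g₃

  K⇒ : ∀ f → InK f → (∀ n → U₂ (evalS f) n ≡ false) × (∀ n → U₃ (evalS f) n ≡ evalS f n)
  K⇒ f (m , u) = (λ n → P.trans (evalS-horner f (2 ℕ.* n)) (Modd⇒U₂ f m n)) ,
    (λ n → P.trans (evalS-horner f (3 ℕ.* n)) (P.trans (P.sym (UGraph⇒U₃ f f u n)) (P.sym (evalS-horner f n))))

  K⇐ : ∀ f → (∀ n → U₂ (evalS f) n ≡ false) → (∀ n → U₃ (evalS f) n ≡ evalS f n) → InK f
  K⇐ f e₂ e₃ = U₂⇒Modd f (λ n → P.trans (P.sym (evalS-horner f (2 ℕ.* n))) (e₂ n)) ,
    U₃⇒UGraph f (λ n → P.trans (P.sym (evalS-horner f (3 ℕ.* n))) (P.trans (e₃ n) (evalS-horner f n)))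

  InR : Series → Set
  InR a = Σ Poly λ f → ev f ≈ a

  iterate-sq : ℕ → Series → Series
  iterate-sq zero S = S
  iterate-sq (suc j) S = sq (iterate-sq j S)

  private
    -- 1 and r are independent over the squares of series: after r = r² + D, U₂ isolates the square
    -- part, and D is regular.
    frobenius-unique : ∀ a b c d → sq a + rS * sq b ≈ sq c + rS * sq d → (a ≈ c) × (b ≈ d)
    frobenius-unique a b c d e = +≈0⇒≈ {a} {c} (trans (sym (trans (+-congˡ (a + c) (trans (*-congˡ {b + d} {0#} rS v0) (zeroʳ rS))) (+-idʳ (a + c)))) u0) , +≈0⇒≈ {b} {d} v0
      where
        w = (a + c) + rS * (b + d)
        form : sq w + D * sq (b + d) ≈ 0#
        form = trans (solve 5 (λ r a b c d → ((a :+ c) :+ r :* (b :+ d)) :* ((a :+ c) :+ r :* (b :+ d)) :+ (r :+ r :* r) :* ((b :+ d) :* (b :+ d)) := (a :* a :+ r :* (b :* b)) :+ (c :* c :+ r :* (d :* d))) refl rS a b c d) (≈⇒+≈0 {sq a + rS * sq b} {sq c + rS * sq d} e)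
        u0 : w ≈ 0#
        u0 = trans (sym (U₂-sq w)) (trans (sym (+-idʳ (U 2 (sq w)))) (trans (+-congˡ (U 2 (sq w)) (sym (U₂-D* (b + d)))) (λ n → form (2 ℕ.* n))))
        v0 : (b + d) ≈ 0#
        v0 = trans (sym (U₂-sq (b + d))) (λ n → D-reg (sq (b + d)) (trans (sym (trans (+-congʳ (D * sq (b + d)) (trans (sq-cong {w} {0#} u0) (zeroˡ 0#))) (+-idˡ (D * sq (b + d))))) form) (2 ℕ.* n))

    lengths : ∀ f → length (evens f) ≤ length f × length (odds f) ≤ length f × (∀ n → length f ≡ suc (suc n) → length (evens f) ≤ suc n × length (odds f) ≤ suc n)
    lengths [] = z≤n , z≤n , (λ n ())
    lengths (a ∷ []) = s≤s z≤n , z≤n , (λ n ())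
    lengths (a ∷ b ∷ f) with lengths f
    ... | e , o , _ = s≤s (ℕP.≤-trans e (ℕP.n≤1+n _)) , s≤s (ℕP.≤-trans o (ℕP.n≤1+n _)) , (λ { n P.refl → s≤s e , s≤s o })

    halves : ∀ b S → InR (ev b * sq S) → InR (ev (evens b) * S) × InR (ev (odds b) * S)
    halves b S (a , e) = (evens a , proj₁ q) , (odds a , proj₂ q)
      where
        q : (ev (evens a) ≈ ev (evens b) * S) × (ev (odds a) ≈ ev (odds b) * S)
        q = frobenius-unique (ev (evens a)) (ev (odds a)) (ev (evens b) * S) (ev (odds b) * S)
              (trans (sym (split-ev a)) (trans e (trans (*-congʳ {ev b} (sq S) (split-ev b))
                (solve 4 (λ r e o s → (e :* e :+ r :* (o :* o)) :* (s :* s) := (e :* s) :* (e :* s) :+ r :* ((o :* s) :* (o :* s))) refl rS (ev (evens b)) (ev (odds b)) S))))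

    ev-zero-split : ∀ b → ev (evens b) ≈ 0# → ev (odds b) ≈ 0# → ev b ≈ 0#
    ev-zero-split b ez oz = trans (split-ev b) (trans (+-cong {sq (ev (evens b))} {0#} {rS * sq (ev (odds b))} {0#} (trans (sq-cong {ev (evens b)} {0#} ez) (zeroˡ 0#))
      (trans (*-congˡ {sq (ev (odds b))} {0#} rS (trans (sq-cong {ev (odds b)} {0#} oz) (zeroˡ 0#))) (zeroʳ rS))) (+-idˡ 0#))

  -- A common denominator b of all S^{2^j}: write b = e² + r o². Then e S and o S are again polynomials,
  -- for every Frobenius twist, so a denominator of half the degree exists.
  bounded-denominator : ∀ n b S → length b ≤ n → ¬ (ev b ≈ 0#) → (∀ j → InR (ev b * iterate-sq j S)) → InR S
  bounded-denominator n [] S l nz h = ⊥-elim (nz (λ _ → P.refl))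
  bounded-denominator n (true ∷ []) S l nz h = proj₁ (h 0) , trans (proj₂ (h 0)) (trans (*-congʳ {ev (true ∷ [])} {1#} S (trans (+-congˡ 1# (zeroʳ rS)) (+-idʳ 1#))) (*-idˡ S))
  bounded-denominator n (false ∷ []) S l nz h = ⊥-elim (nz (trans (+-idˡ (rS * 0#)) (zeroʳ rS)))
  bounded-denominator (suc n) b@(_ ∷ _ ∷ f) S (s≤s l) nz h = by (zero? (evens b))
    where
      shorter : length (evens b) ≤ suc (length f) × length (odds b) ≤ suc (length f)
      shorter = proj₂ (proj₂ (lengths b)) (length f) P.refl
      by : Zero? (evens b) → InR S
      by (has-lead m ld) = bounded-denominator n (evens b) S (ℕP.≤-trans (proj₁ shorter) l) (lead-nonzero {m} {ev (evens b)} ld) (λ j → proj₁ (halves b (iterate-sq j S) (h (suc j))))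
      by (is-zero _ ez) = bounded-denominator n (odds b) S (ℕP.≤-trans (proj₂ shorter) l) (λ oz → nz (ev-zero-split b ez oz)) (λ j → proj₂ (halves b (iterate-sq j S) (h (suc j))))

-- Subrings, adjunction of an integral element, Newton's identities.

module NewtonSums where
  open CharacteristicTwo
  open FormalSeries
  open LambertSeries using (odd)

  record IsSubring (K : F2Alg) (B : F2Alg.Carrier K → Set) : Set where
    private module K = Ring K
    field
      resp : ∀ {a b} → a K.≈ b → B a → B b
      one : B K.1#
      add : ∀ {a b} → B a → B b → B (a K.+ b)
      mul : ∀ {a b} → B a → B b → B (a K.* b)

    nil : B K.0#
    nil = resp (K.double K.1#) (add one one)

    sums : ∀ n {f} → (∀ i → i < n → B (f i)) → B (K.sum n f)
    sums zero h = nil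
    sums (suc n) h = add (h n ℕP.≤-refl) (sums n (λ i l → h i (ℕP.m≤n⇒m≤1+n l)))

    pow : ∀ {a} n → B a → B (a K.^ n)
    pow zero h = one
    pow (suc n) h = mul h (pow n h)

    bits : ∀ b → B (K.bit b)
    bits true = one
    bits false = nil

  -- B[ψ] as the B-span of 1, ..., ψ^m; the monic relation rewrites ψ^{m+1}, which closes the span
  -- under multiplication by ψ.
  module Adjoin (K : F2Alg) (B : F2Alg.Carrier K → Set) (sub : IsSubring K B) (ψ : F2Alg.Carrier K) (m : ℕ) (o : ℕ → F2Alg.Carrier K)
                (o∈ : ∀ k → B (o k)) (monic : Ring._≈_ K (Ring._^_ K ψ (suc m)) (Ring.sum K (suc m) (λ k → Ring._*_ K (o k) (Ring._^_ K ψ k)))) where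
    open Ring K
    open IsSubring sub

    lin : (ℕ → Carrier) → Carrier
    lin v = sum (suc m) (λ k → v k * ψ ^ k)

    Adj : Carrier → Set
    Adj φ = Σ (ℕ → Carrier) λ v → (∀ k → B (v k)) × (φ ≈ lin v)

    private
      adj-resp : ∀ {a b} → a ≈ b → Adj a → Adj b
      adj-resp e (v , h , q) = v , h , trans (sym e) q

    adj-base : ∀ {b} → B b → Adj b
    adj-base {b} h = v , v∈ , sym (trans (sum-front m (λ k → v k * ψ ^ k)) (trans (+-cong (*-idʳ b) (sum-0 m (λ i _ → zeroˡ _))) (+-idʳ b)))
      where
        v : ℕ → Carrier
        v zero = b
        v (suc _) = 0#
        v∈ : ∀ k → B (v k)
        v∈ zero = h
        v∈ (suc _) = nil

    private
      adj-add : ∀ {a b} → Adj a → Adj b → Adj (a + b)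
      adj-add (v , h , e) (w , k , q) = (λ i → v i + w i) , (λ i → add (h i) (k i)) ,
        trans (+-cong e q) (trans (sym (sum-+ (suc m) _ _)) (sum-cong (suc m) (λ i → sym (distribʳ _ _ _))))

      adj-scale : ∀ {b a} → B b → Adj a → Adj (b * a)
      adj-scale {b} hb (v , h , e) = (λ i → b * v i) , (λ i → mul hb (h i)) ,
        trans (*-congˡ b e) (trans (sum-*ˡ (suc m) b _) (sum-cong (suc m) (λ i → sym (*-assoc _ _ _))))

    adj-ψ* : ∀ {a} → Adj a → Adj (ψ * a)
    adj-ψ* {a} (v , h , e) = w , w∈ , (begin
        ψ * a ≈⟨ *-congˡ ψ e ⟩
        ψ * lin v ≈⟨ sum-*ˡ (suc m) ψ _ ⟩
        sum (suc m) (λ k → ψ * (v k * ψ ^ k)) ≈⟨ sum-cong (suc m) (λ k → solve 3 (λ a b c → a :* (b :* c) := b :* (a :* c)) refl ψ (v k) (ψ ^ k)) ⟩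
        v m * ψ ^ suc m + sum m (λ k → v k * ψ ^ suc k) ≈⟨ +-cong (trans (*-congˡ (v m) monic) (sum-*ˡ (suc m) (v m) _)) (sym (trans (sum-front m (λ k → up k * ψ ^ k)) (trans (+-congʳ _ (zeroˡ _)) (+-idˡ _)))) ⟩
        sum (suc m) (λ k → v m * (o k * ψ ^ k)) + sum (suc m) (λ k → up k * ψ ^ k) ≈⟨ sym (sum-+ (suc m) _ _) ⟩
        sum (suc m) (λ k → v m * (o k * ψ ^ k) + up k * ψ ^ k)
          ≈⟨ sum-cong (suc m) (λ k → solve 4 (λ a b c d → a :* (b :* c) :+ d :* c := (d :+ a :* b) :* c) refl (v m) (o k) (ψ ^ k) (up k)) ⟩
        lin w ∎)
      where
        up : ℕ → Carrier
        up zero = 0#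
        up (suc k) = v k
        w : ℕ → Carrier
        w k = up k + v m * o k
        up∈ : ∀ k → B (up k)
        up∈ zero = nil
        up∈ (suc k) = h k
        w∈ : ∀ k → B (w k)
        w∈ k = add (up∈ k) (mul (h m) (o∈ k))

    private
      adj-ψ^* : ∀ k {a} → Adj a → Adj (ψ ^ k * a)
      adj-ψ^* zero h = adj-resp (sym (*-idˡ _)) h
      adj-ψ^* (suc k) h = adj-resp (sym (*-assoc _ _ _)) (adj-ψ* (adj-ψ^* k h))

      adj-sum : ∀ n {f} → (∀ i → Adj (f i)) → Adj (sum n f)
      adj-sum zero h = adj-base nil
      adj-sum (suc n) h = adj-add (h n) (adj-sum n h)

      adj-mul : ∀ {a b} → Adj a → Adj b → Adj (a * b)
      adj-mul {a} {b} (v , h , e) hb = adj-resp (sym (trans (*-congʳ b e) (trans (sum-*ʳ (suc m) b _) (sum-cong (suc m) (λ i → *-assoc _ _ _)))))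
        (adj-sum (suc m) (λ i → adj-scale (h i) (adj-ψ^* i hb)))

    adj-subring : IsSubring K Adj
    adj-subring = record { resp = adj-resp ; one = adj-base one ; add = adj-add ; mul = adj-mul }

    adj-ψ : Adj ψ
    adj-ψ = adj-resp (*-idʳ ψ) (adj-ψ* (adj-base one))

  module Eval (K : F2Alg) where
    open Ring K
    open PowerSeries K using (conv; conv-0ˡ)

    evalP : ℕ → (ℕ → Carrier) → Carrier → Carrier
    evalP zero f α = 0#
    evalP (suc n) f α = f 0 + α * evalP n (f ∘ suc) α

    Supp : ℕ → (ℕ → Carrier) → Set
    Supp n f = ∀ i → n ≤ i → f i ≈ 0#

    evalP-cong : ∀ n {f g α} → (∀ i → i < n → f i ≈ g i) → evalP n f α ≈ evalP n g α
    evalP-cong zero e = refl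
    evalP-cong (suc n) {α = α} e = +-cong (e 0 (s≤s z≤n)) (*-congˡ α (evalP-cong n (λ i l → e (suc i) (s≤s l))))

    evalP-0 : ∀ n {f} α → (∀ i → i < n → f i ≈ 0#) → evalP n f α ≈ 0#
    evalP-0 zero α z = refl
    evalP-0 (suc n) α z = trans (+-cong (z 0 (s≤s z≤n)) (trans (*-congˡ α (evalP-0 n α (λ i l → z (suc i) (s≤s l)))) (zeroʳ α))) (+-idˡ 0#)

    evalP-+ : ∀ n f g α → evalP n (λ i → f i + g i) α ≈ evalP n f α + evalP n g α
    evalP-+ zero f g α = sym (+-idˡ 0#)
    evalP-+ (suc n) f g α = trans (+-congˡ _ (*-congˡ α (evalP-+ n (f ∘ suc) (g ∘ suc) α)))
      (solve 5 (λ a b c x y → (a :+ b) :+ c :* (x :+ y) := (a :+ c :* x) :+ (b :+ c :* y)) refl (f 0) (g 0) α _ _)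

    evalP-scale : ∀ n c f α → evalP n (λ i → c * f i) α ≈ c * evalP n f α
    evalP-scale zero c f α = sym (zeroʳ c)
    evalP-scale (suc n) c f α = trans (+-congˡ _ (*-congˡ α (evalP-scale n c (f ∘ suc) α)))
      (solve 4 (λ c a x y → c :* a :+ x :* (c :* y) := c :* (a :+ x :* y)) refl c (f 0) α _)

    evalP-sum : ∀ n m (f : ℕ → ℕ → Carrier) α → evalP n (λ l → sum m (λ j → f j l)) α ≈ sum m (λ j → evalP n (f j) α)
    evalP-sum n zero f α = evalP-0 n α (λ _ _ → refl)
    evalP-sum n (suc m) f α = trans (evalP-+ n (f m) (λ l → sum m (λ j → f j l)) α) (+-congˡ _ (evalP-sum n m f α))

    evalP-as-sum : ∀ n f α → evalP n f α ≈ sum n (λ l → f l * α ^ l)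
    evalP-as-sum zero f α = refl
    evalP-as-sum (suc n) f α = trans (+-cong (sym (*-idʳ _)) (trans (*-congˡ α (evalP-as-sum n (f ∘ suc) α)) (trans (sum-*ˡ n α _)
      (sum-cong n (λ l → solve 3 (λ a b c → a :* (b :* c) := b :* (a :* c)) refl α (f (suc l)) (α ^ l)))))) (sym (sum-front n (λ l → f l * α ^ l)))

    evalP-extend : ∀ d n {f} α → Supp n f → evalP (n ℕ.+ d) f α ≈ evalP n f α
    evalP-extend d zero α z = evalP-0 d α (λ i _ → z i z≤n)
    evalP-extend d (suc n) α z = +-congˡ _ (*-congˡ α (evalP-extend d n α (λ i l → z (suc i) (s≤s l))))

    evalP-* : ∀ n m f g α → Supp n f → Supp m g → evalP (n ℕ.+ m) (conv f g) α ≈ evalP n f α * evalP m g α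
    evalP-* zero m f g α zf zg = trans (evalP-0 m α (λ i _ → conv-0ˡ i f g (λ j → zf j z≤n))) (sym (zeroˡ _))
    evalP-* (suc n) m f g α zf zg = begin
      f 0 * g 0 + α * evalP (n ℕ.+ m) (λ i → f 0 * g (suc i) + conv (f ∘ suc) g i) α
        ≈⟨ +-congˡ _ (*-congˡ α (trans (evalP-+ (n ℕ.+ m) (λ i → f 0 * g (suc i)) (conv (f ∘ suc) g) α)
             (+-cong (evalP-scale (n ℕ.+ m) (f 0) (g ∘ suc) α) (evalP-* n m (f ∘ suc) g α (λ i l → zf (suc i) (s≤s l)) zg)))) ⟩
      f 0 * g 0 + α * (f 0 * evalP (n ℕ.+ m) (g ∘ suc) α + evalP n (f ∘ suc) α * evalP m g α)
        ≈⟨ solve 6 (λ a b c x y z → a :* b :+ c :* (a :* x :+ y :* z) := a :* (b :+ c :* x) :+ c :* y :* z) refl (f 0) (g 0) α _ _ _ ⟩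
      f 0 * evalP (suc (n ℕ.+ m)) g α + α * evalP n (f ∘ suc) α * evalP m g α
        ≈⟨ +-congʳ _ (*-congˡ (f 0) (trans (reflexive (P.cong (λ k → evalP k g α) (ℕP.+-comm (suc n) m))) (evalP-extend (suc n) m α zg))) ⟩
      f 0 * evalP m g α + α * evalP n (f ∘ suc) α * evalP m g α ≈⟨ sym (distribʳ _ _ _) ⟩
      (f 0 + α * evalP n (f ∘ suc) α) * evalP m g α ∎

    -- Synthetic division: the coefficients of (f(T) - f(α))/(T - α).
    quo : ℕ → (ℕ → Carrier) → Carrier → ℕ → Carrier
    quo zero f α j = 0#
    quo (suc n) f α zero = evalP n (f ∘ suc) α
    quo (suc n) f α (suc j) = quo n (f ∘ suc) α j

    quo-eval : ∀ n f α β → evalP (suc n) f β + evalP (suc n) f α ≈ (β + α) * evalP n (quo (suc n) f α) β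
    quo-eval zero f α β = solve 3 (λ a x y → (a :+ x :* O) :+ (a :+ y :* O) := (x :+ y) :* O) refl (f 0) β α
    quo-eval (suc n) f α β = begin
      (f 0 + β * eβ) + (f 0 + α * eα) ≈⟨ solve 5 (λ a x y b c → (a :+ x :* b) :+ (a :+ y :* c) := (x :+ y) :* c :+ x :* (b :+ c)) refl (f 0) β α eβ eα ⟩
      (β + α) * eα + β * (eβ + eα) ≈⟨ +-congˡ _ (*-congˡ β (quo-eval n (f ∘ suc) α β)) ⟩
      (β + α) * eα + β * ((β + α) * evalP n (quo (suc n) (f ∘ suc) α) β) ≈⟨ solve 4 (λ s a x b → s :* a :+ x :* (s :* b) := s :* (a :+ x :* b)) refl (β + α) eα β _ ⟩
      (β + α) * (eα + β * evalP n (quo (suc n) (f ∘ suc) α) β) ∎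
      where
        eβ = evalP (suc n) (f ∘ suc) β
        eα = evalP (suc n) (f ∘ suc) α

    quo-supp : ∀ n f α → Supp n (quo (suc n) f α)
    quo-supp zero f α zero l = refl
    quo-supp zero f α (suc i) l = refl
    quo-supp (suc n) f α (suc i) (s≤s l) = quo-supp n (f ∘ suc) α i l

    quo-zero : ∀ n f α → Supp n f → (∀ j → quo n f α j ≈ 0#) → evalP n f α ≈ 0# → ∀ j → f j ≈ 0#
    quo-zero zero f α s z e j = s j z≤n
    quo-zero (suc n) f α s z e zero = trans (sym (trans (+-congˡ _ (trans (*-congˡ α (z 0)) (zeroʳ α))) (+-idʳ _))) e
    quo-zero (suc n) f α s z e (suc j) = quo-zero n (f ∘ suc) α (λ i l → s (suc i) (s≤s l)) (λ i → z (suc i)) (z 0) j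

    -- The roots are divided out one at a time; regularity of their differences replaces the absence
    -- of zero divisors in the usual bound on the number of roots.
    vanish : ∀ n f (α : ℕ → Carrier) → Supp n f → (∀ i → i < n → evalP n f (α i) ≈ 0#) → (∀ i j → i < j → j < n → Reg (α i + α j)) → ∀ j → f j ≈ 0#
    vanish zero f α s z r j = s j z≤n
    vanish (suc n) f α s z r = quo-zero (suc n) f (α n) s
      (vanish n (quo (suc n) f (α n)) α (quo-supp n f (α n))
        (λ i l → r i n l ℕP.≤-refl _ (trans (sym (quo-eval n f (α n) (α i))) (trans (+-cong (z i (ℕP.m≤n⇒m≤1+n l)) (z n ℕP.≤-refl)) (+-idˡ 0#))))
        (λ i j l l′ → r i j l (ℕP.m≤n⇒m≤1+n l′)))
      (z n ℕP.≤-refl)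

    -- The formal derivative; the factor k + 1 matters only modulo 2.
    ∂ : (ℕ → Carrier) → ℕ → Carrier
    ∂ f k = bit (odd (suc k)) * f (suc k)

    quo-derivative : ∀ n f α → evalP n (quo (suc n) f α) α ≈ evalP n (∂ f) α
    quo-derivative zero f α = refl
    quo-derivative (suc n) f α = begin
      evalP (suc n) (f ∘ suc) α + α * evalP n (quo (suc n) (f ∘ suc) α) α ≈⟨ +-congˡ _ (*-congˡ α (quo-derivative n (f ∘ suc) α)) ⟩
      evalP (suc n) (f ∘ suc) α + α * evalP n (∂ (f ∘ suc)) α ≈⟨ +-congˡ _ (sym (trans (+-congʳ _ (zeroˡ (f 1))) (+-idˡ _))) ⟩
      evalP (suc n) (f ∘ suc) α + evalP (suc n) (λ k → bit (odd k) * f (suc k)) α ≈⟨ sym (evalP-+ (suc n) (f ∘ suc) (λ k → bit (odd k) * f (suc k)) α) ⟩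
      evalP (suc n) (λ k → f (suc k) + bit (odd k) * f (suc k)) α ≈⟨ evalP-cong (suc n) {g = ∂ f} (λ k _ → flip (odd k) (f (suc k))) ⟩
      evalP (suc n) (∂ f) α ∎
      where
        flip : ∀ b x → x + bit b * x ≈ bit (not b) * x
        flip true x = solve 1 (λ x → x :+ I :* x := O :* x) refl x
        flip false x = solve 1 (λ x → x :+ O :* x := I :* x) refl x

    quo-coeff : ∀ k j f α → quo (suc (k ℕ.+ suc j)) f α j ≈ evalP (suc k) (λ l → f (suc j ℕ.+ l)) α
    quo-coeff k zero f α = reflexive (P.cong (λ n → evalP n (f ∘ suc) α) (ℕP.+-comm k 1))
    quo-coeff k (suc j) f α = trans (reflexive (P.cong (λ n → quo n (f ∘ suc) α j) (ℕP.+-suc k (suc j)))) (quo-coeff k j (f ∘ suc) α)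

    -- Ψ′ = Σᵢ Ψ/(T − αᵢ), compared coefficientwise, gives Newton's identities.
    module Newton (R : Carrier → Set) (sub : IsSubring K R) (n : ℕ) (ψ : ℕ → Carrier) (ψ∈ : ∀ k → R (ψ k)) (ψ-lead : ψ n ≈ 1#)
                  (α : ℕ → Carrier) (root : ∀ i → i < n → evalP (suc n) ψ (α i) ≈ 0#) (distinct : ∀ i j → i < j → j < n → Reg (α i + α j)) where
      open IsSubring sub

      reduce : ∀ i → i < n → α i ^ n ≈ sum n (λ l → ψ l * α i ^ l)
      reduce i l = +≈0⇒≈ (trans (+-congʳ _ (sym (trans (*-congʳ _ ψ-lead) (*-idˡ _)))) (trans (sym (evalP-as-sum (suc n) ψ (α i))) (root i l)))

      private
        p : ℕ → Carrier
        p k = sum n (λ i → α i ^ k)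

        diag-sum : ∀ j → j < n → sum n (λ i → evalP n (quo (suc n) ψ (α i)) (α j)) ≈ evalP n (∂ ψ) (α j)
        diag-sum j l = trans (only n j l (λ i i<n i≢j → off i i<n i≢j)) (quo-derivative n ψ (α j))
          where
            off : ∀ i → i < n → ¬ (i ≡ j) → evalP n (quo (suc n) ψ (α i)) (α j) ≈ 0#
            off i i<n i≢j = reg-either (ℕP.<-cmp i j) _ (trans (sym (quo-eval n ψ (α i) (α j))) (trans (+-cong (root j l) (root i i<n)) (+-idˡ 0#)))
              where
                open import Relation.Binary.Definitions using (Tri; tri<; tri≈; tri>)
                reg-either : Tri (i < j) (i ≡ j) (j < i) → Reg (α j + α i)
                reg-either (tri< i<j _ _) = reg-cong (+-comm _ _) (distinct i j i<j l)
                reg-either (tri≈ _ e _) = ⊥-elim (i≢j e)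
                reg-either (tri> _ _ j<i) = distinct j i j<i i<n

        -- Cut off at n because `vanish` asks for support below n, while entries of ψ beyond n are
        -- unconstrained.
        ∂ψ : ℕ → Carrier
        ∂ψ j with j ℕ.<? n
        ... | yes _ = ∂ ψ j
        ... | no _ = 0#
        ∂ψ-< : ∀ j → j < n → ∂ψ j ≈ ∂ ψ j
        ∂ψ-< j l with j ℕ.<? n
        ... | yes _ = refl
        ... | no h = ⊥-elim (h l)
        ∂ψ-supp : Supp n ∂ψ
        ∂ψ-supp j l with j ℕ.<? n
        ... | yes h = ⊥-elim (ℕP.<⇒≱ h l)
        ... | no _ = refl
        quotients : ∀ j → sum n (λ i → quo (suc n) ψ (α i) j) + ∂ψ j ≈ 0#
        quotients = vanish n (λ j → sum n (λ i → quo (suc n) ψ (α i) j) + ∂ψ j) α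
          (λ j l → trans (+-cong (sum-0 n (λ i _ → quo-supp n ψ (α i) j l)) (∂ψ-supp j l)) (+-idˡ 0#))
          (λ j l → trans (evalP-+ n _ ∂ψ (α j)) (≈⇒+≈0 (trans (evalP-sum n n (λ i → quo (suc n) ψ (α i)) (α j)) (trans (diag-sum j l) (evalP-cong n (λ k k<n → sym (∂ψ-< k k<n)))))))
          distinct

        -- Coefficient j = n - 1 - k of the summed quotients is `p k` plus an R-combination of
        -- earlier power sums, and it equals a coefficient of Ψ′. The sum `p k` occurs with
        -- coefficient one, so nothing has to be divided by k.
        small : ∀ k j → n ≡ k ℕ.+ suc j → (∀ l → l < k → R (p l)) → R (p k)
        small k j e ih = resp split (add (resp (sym (+≈0⇒≈ (quotients j))) (resp (sym (∂ψ-< j j<n)) (mul (bits (odd (suc j))) (ψ∈ (suc j))))) (sums k (λ l l<k → mul (ψ∈ (suc j ℕ.+ l)) (ih l l<k))))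
          where
            j<n : j < n
            j<n = P.subst (j <_) (P.sym e) (ℕP.m≤n+m (suc j) k)
            term : ∀ i → quo (suc n) ψ (α i) j ≈ α i ^ k + sum k (λ l → ψ (suc j ℕ.+ l) * α i ^ l)
            term i = trans (reflexive (P.cong (λ m → quo (suc m) ψ (α i) j) e)) (trans (quo-coeff k j ψ (α i)) (trans (evalP-as-sum (suc k) _ (α i))
              (+-congʳ _ (trans (*-congʳ _ (trans (reflexive (P.cong ψ (P.trans (ℕP.+-comm (suc j) k) (P.sym e)))) ψ-lead)) (*-idˡ _)))))
            split : sum n (λ i → quo (suc n) ψ (α i) j) + sum k (λ l → ψ (suc j ℕ.+ l) * p l) ≈ p k
            split = begin
              sum n (λ i → quo (suc n) ψ (α i) j) + rest ≈⟨ +-congʳ _ (trans (sum-cong n term) (sum-+ n (λ i → α i ^ k) _)) ⟩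
              (p k + sum n (λ i → sum k (λ l → ψ (suc j ℕ.+ l) * α i ^ l))) + rest
                ≈⟨ +-congʳ _ (+-congˡ _ (trans (sum-swap n k _) (sum-cong k (λ l → sym (sum-*ˡ n _ _))))) ⟩
              (p k + rest) + rest ≈⟨ solve 2 (λ a b → (a :+ b) :+ b := a) refl (p k) rest ⟩
              p k ∎
              where
                rest = sum k (λ l → ψ (suc j ℕ.+ l) * p l)

        -- From n on, multiplying the monic equation by α^d gives a linear recurrence for the power
        -- sums.
        large : ∀ k d → k ≡ d ℕ.+ n → (∀ l → l < k → R (p l)) → R (p k)
        large k d e ih = resp (sym shape) (sums n (λ l l<n → mul (ψ∈ l) (ih (d ℕ.+ l) (P.subst (d ℕ.+ l <_) (P.sym e) (ℕP.+-monoʳ-< d l<n)))))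
          where
            shape : p k ≈ sum n (λ l → ψ l * p (d ℕ.+ l))
            shape = begin
              sum n (λ i → α i ^ k) ≈⟨ sum-cong< n (λ i l → trans (reflexive (P.cong (α i ^_) e)) (trans (^-+ (α i) d n) (trans (*-congˡ _ (reduce i l)) (trans (sum-*ˡ n _ _)
                   (sum-cong n (λ l → trans (solve 3 (λ a b c → a :* (b :* c) := b :* (a :* c)) refl (α i ^ d) (ψ l) (α i ^ l)) (*-congˡ _ (sym (^-+ (α i) d l))))))))) ⟩
              sum n (λ i → sum n (λ l → ψ l * α i ^ (d ℕ.+ l))) ≈⟨ trans (sum-swap n n _) (sum-cong n (λ l → sym (sum-*ˡ n _ _))) ⟩
              sum n (λ l → ψ l * p (d ℕ.+ l)) ∎

      power-sum : ∀ k → R (sum n (λ i → α i ^ k))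
      power-sum = <-rec _ (λ k ih → step k (λ l h → ih h))
        where
          step : ∀ k → (∀ l → l < k → R (p l)) → R (p k)
          step k ih with ℕP.<-≤-connex k n
          ... | inj₁ k<n = small k (n ∸ suc k) (P.sym (P.trans (ℕP.+-suc k (n ∸ suc k)) (ℕP.m+[n∸m]≡n k<n))) ih
          ... | inj₂ n≤k = large k (k ∸ n) (P.sym (ℕP.m∸n+n≡m n≤k)) ih

-- Denominators and traces over the roots of Ψ.

module BoundedTraces where
  open CharacteristicTwo
  open NewtonSums

  -- The product ring Kⁿ. The family of roots is a single element α of it, so that R[α] is an
  -- ordinary subring even without a field to hold the roots apart.
  functions : F2Alg → ℕ → F2Alg
  functions K n = record
    { Carrier = ℕ → Carrier
    ; _≈_ = λ f g → ∀ i → i < n → f i ≈ g i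
    ; _+_ = λ f g i → f i + g i ; _*_ = λ f g i → f i * g i
    ; 0# = λ _ → 0# ; 1# = λ _ → 1#
    ; isEquivalence = record { refl = λ _ _ → refl ; sym = λ e i l → sym (e i l) ; trans = λ e h i l → trans (e i l) (h i l) }
    ; +-cong = λ e h i l → +-cong (e i l) (h i l) ; *-cong = λ e h i l → *-cong (e i l) (h i l)
    ; +-assoc = λ _ _ _ _ _ → +-assoc _ _ _ ; +-comm = λ _ _ _ _ → +-comm _ _ ; +-idˡ = λ _ _ _ → +-idˡ _ ; double = λ _ _ _ → double _
    ; *-assoc = λ _ _ _ _ _ → *-assoc _ _ _ ; *-comm = λ _ _ _ _ → *-comm _ _ ; *-idˡ = λ _ _ _ → *-idˡ _
    ; distribʳ = λ _ _ _ _ _ → distribʳ _ _ _ }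
    where open Ring K

  module Dependence (K : F2Alg) (R : F2Alg.Carrier K → Set) (sub : IsSubring K R)
                    (dec : ∀ {a} → R a → (Ring._≈_ K a (Ring.0# K)) ⊎ Ring.Reg K a) where
    open Ring K
    open IsSubring sub

    private
      first-nonzero : ∀ n (f : ℕ → Carrier) → (∀ i → R (f i)) → (∀ i → i < n → f i ≈ 0#) ⊎ (Σ ℕ λ k → (k < n) × Reg (f k) × (∀ i → i < k → f i ≈ 0#))
      first-nonzero zero f h = inj₁ (λ i ())
      first-nonzero (suc n) f h = go (first-nonzero n f h) (dec (h n))
        where
          go : (∀ i → i < n → f i ≈ 0#) ⊎ (Σ ℕ λ k → (k < n) × Reg (f k) × (∀ i → i < k → f i ≈ 0#)) → (f n ≈ 0#) ⊎ Reg (f n) → _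
          go (inj₂ (k , l , r , z)) _ = inj₂ (k , ℕP.m≤n⇒m≤1+n l , r , z)
          go (inj₁ z) (inj₂ r) = inj₂ (n , ℕP.≤-refl , r , z)
          go (inj₁ z) (inj₁ e) = inj₁ (λ i l → below i (ℕP.m≤n⇒m<n∨m≡n (ℕP.≤-pred l)))
            where
              below : ∀ i → (i < n) ⊎ (i ≡ n) → f i ≈ 0#
              below i (inj₁ l) = z i l
              below i (inj₂ P.refl) = e

      extend : ℕ → (ℕ → Carrier) → Carrier → ℕ → Carrier
      extend m c x i with i ℕ.<? m
      ... | yes _ = c i
      ... | no _ = x

      extend-< : ∀ m c x i → i < m → extend m c x i ≈ c i
      extend-< m c x i l with i ℕ.<? m
      ... | yes _ = refl
      ... | no h = ⊥-elim (h l)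

      extend-top : ∀ m c x → extend m c x m ≈ x
      extend-top m c x with m ℕ.<? m
      ... | yes l = ⊥-elim (ℕP.<-irrefl P.refl l)
      ... | no _ = refl

      extend-R : ∀ m c x → (∀ i → R (c i)) → R x → ∀ i → R (extend m c x i)
      extend-R m c x h hx i with i ℕ.<? m
      ... | yes _ = h i
      ... | no _ = hx

    Relation : ℕ → (ℕ → ℕ → Carrier) → Set
    Relation n v = Σ (ℕ → Carrier) λ c → (∀ i → R (c i)) × (Σ ℕ λ k → (k < suc n) × Reg (c k)) × (∀ j → j < n → sum (suc n) (λ i → c i * v i j) ≈ 0#)

    -- One step of Gaussian elimination: the pivot is sought in the last vector, and the last coordinate moves into the pivot's slot.
    dependence : ∀ n (v : ℕ → ℕ → Carrier) → (∀ i j → R (v i j)) → Relation n v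
    dependence zero v v∈ = (λ _ → 1#) , (λ _ → one) , (0 , s≤s z≤n , λ x e → trans (sym (*-idˡ x)) e) , λ j ()
    dependence (suc n) v v∈ = pivot (first-nonzero (suc n) (v (suc n)) (v∈ (suc n)))
      where
        pivot : _ → Relation (suc n) v
        pivot (inj₁ z) = c , extend-R (suc n) _ _ (λ _ → nil) one , (suc n , ℕP.≤-refl , reg-cong (sym (extend-top (suc n) _ _)) (λ x e → trans (sym (*-idˡ x)) e)) ,
          λ j l → trans (+-cong (trans (*-congˡ _ (z j l)) (zeroʳ _)) (sum-0 (suc n) (λ i h → trans (*-congʳ _ (extend-< (suc n) _ _ i h)) (zeroˡ _)))) (+-idˡ 0#)
          where
            c = extend (suc n) (λ _ → 0#) 1#
        pivot (inj₂ (j₀ , j₀< , π-reg , _)) = finish (dependence n (λ i j → red i (slot j)) (λ i j → add (mul (v∈ _ _) (v∈ _ _)) (mul (v∈ _ _) (v∈ _ _))))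
          where
            π = v (suc n) j₀
            red : ℕ → ℕ → Carrier
            red i j = π * v i j + v i j₀ * v (suc n) j
            slot : ℕ → ℕ
            slot j with j ℕ.≟ j₀
            ... | yes _ = n
            ... | no _ = j
            slot-≢ : ∀ j → ¬ (j ≡ j₀) → slot j ≡ j
            slot-≢ j ne with j ℕ.≟ j₀
            ... | yes e = ⊥-elim (ne e)
            ... | no _ = P.refl
            slot-≡ : slot j₀ ≡ n
            slot-≡ with j₀ ℕ.≟ j₀
            ... | yes _ = P.refl
            ... | no ne = ⊥-elim (ne P.refl)
            finish : Relation n (λ i j → red i (slot j)) → Relation (suc n) v
            finish (c , c∈ , (k , k< , k-reg) , rel) = c′ , extend-R (suc n) _ _ (λ i → mul (v∈ _ _) (c∈ i)) last∈ ,
              (k , ℕP.m≤n⇒m≤1+n k< , reg-cong (sym (extend-< (suc n) _ _ k k<)) (reg-* π-reg k-reg)) ,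
              λ j l → trans (same j) (vanishes j l (j ℕ.≟ j₀) (ℕP.m≤n⇒m<n∨m≡n (ℕP.≤-pred l)))
              where
                -- The coefficient of the last vector: it cancels column j₀ and turns every other
                -- column into the relation between the reduced vectors.
                last = sum (suc n) (λ i → c i * v i j₀)
                last∈ : R last
                last∈ = sums (suc n) (λ i _ → mul (c∈ i) (v∈ _ _))
                c′ = extend (suc n) (λ i → π * c i) last
                same : ∀ j → sum (suc (suc n)) (λ i → c′ i * v i j) ≈ sum (suc n) (λ i → c i * red i j)
                same j = trans (+-cong (trans (*-congʳ _ (extend-top (suc n) _ _)) (sum-*ʳ (suc n) (v (suc n) j) _)) (sum-cong< (suc n) (λ i l → *-congʳ _ (extend-< (suc n) _ _ i l))))
                  (trans (sym (sum-+ (suc n) _ _)) (sum-cong (suc n) (λ i → solve 5 (λ c a b x p → (c :* a) :* x :+ (p :* c) :* b := c :* (p :* b :+ a :* x)) refl (c i) (v i j₀) (v i j) (v (suc n) j) π)))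
                vanishes : ∀ j → j < suc n → Dec (j ≡ j₀) → (j < n) ⊎ (j ≡ n) → sum (suc n) (λ i → c i * red i j) ≈ 0#
                vanishes j l (yes P.refl) _ = sum-0 (suc n) (λ i _ → trans (*-congˡ _ (solve 2 (λ a b → a :* b :+ b :* a := O) refl π (v i j))) (zeroʳ _))
                vanishes j l (no ne) (inj₁ j<n) = trans (sum-cong (suc n) (λ i → reflexive (P.cong (λ z → c i * red i z) (P.sym (slot-≢ j ne))))) (rel j j<n)
                vanishes j l (no ne) (inj₂ P.refl) = trans (sum-cong (suc n) (λ i → reflexive (P.cong (λ z → c i * red i z) (P.sym slot-≡))))
                  (rel j₀ (ℕP.≤∧≢⇒< (ℕP.≤-pred j₀<) (λ e → ne (P.sym e))))

    -- Isolating the first nonzero coefficient, of index k, prepares the cancellation of δ^k in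
    -- `powers-divide`.
    lowest : ∀ n v → Relation n v → Σ (ℕ → Carrier) λ c → (∀ i → R (c i)) × (Σ ℕ λ k → (k < suc n) × Reg (c k) × (∀ i → i < k → c i ≈ 0#)) × (∀ j → j < n → sum (suc n) (λ i → c i * v i j) ≈ 0#)
    lowest n v (c , c∈ , (k , k< , k-reg) , rel) = go (first-nonzero (suc n) c c∈)
      where
        go : _ → _
        go (inj₂ s) = c , c∈ , s , rel
        -- If all coefficients vanish although one is regular, the ring is trivial and every claim
        -- of regularity holds.
        go (inj₁ z) = c , c∈ , (0 , s≤s z≤n , (λ x _ → trivial x) , λ i ()) , rel
          where
            trivial : ∀ x → x ≈ 0#
            trivial x = k-reg x (trans (*-congʳ _ (z k k<)) (zeroˡ x))

  -- R[α] inside the functions on the roots of Ψ; every element of R[α] regular at all roots divides a regular constant.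
  module Trace (K : F2Alg) (R : F2Alg.Carrier K → Set) (sub : IsSubring K R)
               (dec : ∀ {a} → R a → (Ring._≈_ K a (Ring.0# K)) ⊎ Ring.Reg K a)
               (m : ℕ) (ψ : ℕ → F2Alg.Carrier K) (ψ∈ : ∀ k → R (ψ k)) (ψ-lead : Ring._≈_ K (ψ (suc m)) (Ring.1# K))
               (α : ℕ → F2Alg.Carrier K) (root : ∀ i → i < suc m → Ring._≈_ K (Eval.evalP K (suc (suc m)) ψ (α i)) (Ring.0# K))
               (distinct : ∀ i j → i < j → j < suc m → Ring.Reg K (Ring._+_ K (α i) (α j))) where
    private
      n = suc m
    open Ring K
    open Eval K using (evalP; evalP-as-sum; module Newton)
    open Newton R sub n ψ ψ∈ ψ-lead α root distinct
    open Dependence K R sub dec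
    private
      module F = Ring (functions K n)
      module R = IsSubring sub

    Λⁿ = functions K n

    Constant : F.Carrier → Set
    Constant φ = Σ Carrier λ a → R a × (φ F.≈ (λ _ → a))

    constants : IsSubring Λⁿ Constant
    constants = record
      { resp = λ { e (a , h , q) → a , h , F.trans (F.sym e) q }
      ; one = 1# , R.one , F.refl
      ; add = λ { (a , h , e) (b , k , q) → a + b , R.add h k , F.+-cong e q }
      ; mul = λ { (a , h , e) (b , k , q) → a * b , R.mul h k , F.*-cong e q } }

    F-^ : ∀ φ k i → (φ F.^ k) i ≈ φ i ^ k
    F-^ φ zero i = refl
    F-^ φ (suc k) i = *-congˡ _ (F-^ φ k i)

    F-sum : ∀ k f i → F.sum k f i ≈ sum k (λ j → f j i)
    F-sum zero f i = refl
    F-sum (suc k) f i = +-congˡ _ (F-sum k f i)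

    private
      α-monic : α F.^ suc m F.≈ F.sum (suc m) (λ k → (λ _ → ψ k) F.* α F.^ k)
      α-monic i l = trans (F-^ α (suc m) i) (trans (reduce i l) (trans (sum-cong n (λ k → *-congˡ _ (sym (F-^ α k i)))) (sym (F-sum n (λ k → (λ _ → ψ k) F.* α F.^ k) i))))

    open Adjoin Λⁿ Constant constants α m (λ k _ → ψ k) (λ k → ψ k , ψ∈ k , F.refl) α-monic public
      using () renaming (Adj to Span; adj-base to span-constant; adj-subring to span; adj-ψ to span-α)
    private
      module Sp = IsSubring span

    trace : ∀ φ → Span φ → R (sum n φ)
    trace φ (v , v∈ , e) = R.resp (sym value) (R.sums n (λ k _ → R.mul (proj₁ (proj₂ (v∈ k))) (power-sum k)))
      where
        c : ℕ → Carrier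
        c k = proj₁ (v∈ k)
        value : sum n φ ≈ sum n (λ k → c k * sum n (λ i → α i ^ k))
        value = begin
          sum n φ ≈⟨ sum-cong< n (λ i l → trans (e i l) (trans (F-sum n (λ k → v k F.* α F.^ k) i) (sum-cong n (λ k → *-cong (proj₂ (proj₂ (v∈ k)) i l) (F-^ α k i))))) ⟩
          sum n (λ i → sum n (λ k → c k * α i ^ k)) ≈⟨ sum-swap n n _ ⟩
          sum n (λ k → sum n (λ i → c k * α i ^ k)) ≈⟨ sum-cong n (λ k → sym (sum-*ˡ n (c k) _)) ⟩
          sum n (λ k → c k * sum n (λ i → α i ^ k)) ∎

    Regular : F.Carrier → Set
    Regular δ = ∀ i → i < n → Reg (δ i)

    Divides-constant : F.Carrier → Set
    Divides-constant δ = Σ Carrier λ b → R b × Reg b × (Σ F.Carrier λ χ → Span χ × (χ F.* δ F.≈ (λ _ → b)))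

    -- The n + 1 powers 1, ..., δⁿ lie in the R-span of the n powers of α, so they satisfy a
    -- relation over R. Cancelling the lowest power δ^k leaves c_k as a multiple of δ.
    powers-divide : ∀ δ → (∀ k → Span (δ F.^ k)) → Regular δ → Divides-constant δ
    powers-divide δ pw r = go (lowest n v (dependence n v v∈))
      where
        v : ℕ → ℕ → Carrier
        v k j = proj₁ (proj₁ (proj₂ (pw k)) j)
        v∈ : ∀ k j → R (v k j)
        v∈ k j = proj₁ (proj₂ (proj₁ (proj₂ (pw k)) j))
        power : ∀ k i → i < n → δ i ^ k ≈ sum n (λ j → v k j * α i ^ j)
        power k i l = trans (sym (F-^ δ k i)) (trans (proj₂ (proj₂ (pw k)) i l)
          (trans (F-sum n (λ j → proj₁ (pw k) j F.* α F.^ j) i) (sum-cong n (λ j → *-cong (proj₂ (proj₂ (proj₁ (proj₂ (pw k)) j)) i l) (F-^ α j i)))))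
        go : Σ (ℕ → Carrier) (λ c → (∀ i → R (c i)) × (Σ ℕ λ k → (k < suc n) × Reg (c k) × (∀ i → i < k → c i ≈ 0#)) × (∀ j → j < n → sum (suc n) (λ i → c i * v i j) ≈ 0#)) → Divides-constant δ
        go (c , c∈ , (k , k< , k-reg , below) , rel) = c k , c∈ k , k-reg , χ , χ∈ , λ i l → sym (+≈0⇒≈ (trans (+-congˡ _ (*-comm _ _)) (cut i l)))
          where
            d = n ∸ k
            d-eq : k ℕ.+ d ≡ n
            d-eq = ℕP.m+[n∸m]≡n (ℕP.≤-pred k<)
            χ : F.Carrier
            χ i = sum d (λ j → c (k ℕ.+ suc j) * δ i ^ j)
            χ∈ : Span χ
            χ∈ = Sp.resp (λ i l → trans (F-sum d _ i) (sum-cong d (λ j → *-congˡ _ (F-^ δ j i))))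
              (Sp.sums d {λ j → (λ _ → c (k ℕ.+ suc j)) F.* δ F.^ j} (λ j _ → Sp.mul (span-constant (c (k ℕ.+ suc j) , c∈ _ , F.refl)) (pw j)))
            relation : ∀ i → i < n → sum (suc n) (λ l → c l * δ i ^ l) ≈ 0#
            relation i l = begin
              sum (suc n) (λ k → c k * δ i ^ k) ≈⟨ sum-cong (suc n) (λ k → trans (*-congˡ _ (power k i l)) (sum-*ˡ n (c k) _)) ⟩
              sum (suc n) (λ k → sum n (λ j → c k * (v k j * α i ^ j))) ≈⟨ sum-swap (suc n) n _ ⟩
              sum n (λ j → sum (suc n) (λ k → c k * (v k j * α i ^ j))) ≈⟨ sum-cong n (λ j → trans (sum-cong (suc n) (λ k → sym (*-assoc _ _ _))) (sym (sum-*ʳ (suc n) _ _))) ⟩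
              sum n (λ j → sum (suc n) (λ k → c k * v k j) * α i ^ j) ≈⟨ sum-0 n (λ j j< → trans (*-congʳ _ (rel j j<)) (zeroˡ _)) ⟩
              0# ∎
            cut : ∀ i → i < n → c k + δ i * χ i ≈ 0#
            cut i l = reg-^ k (r i l) _ (begin
              δ i ^ k * (c k + δ i * χ i) ≈⟨ distribˡ _ _ _ ⟩
              δ i ^ k * c k + δ i ^ k * (δ i * χ i) ≈⟨ +-cong (*-comm _ _) (trans (*-congˡ _ (sum-*ˡ d (δ i) _)) (trans (sum-*ˡ d _ _)
                  (sum-cong d (λ j → trans (solve 4 (λ a b c d → a :* (b :* (c :* d)) := c :* (a :* (b :* d))) refl (δ i ^ k) (δ i) (c (k ℕ.+ suc j)) (δ i ^ j)) (*-congˡ _ (sym (^-+ (δ i) k (suc j)))))))) ⟩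
              c k * δ i ^ k + sum d (λ j → term i (k ℕ.+ suc j)) ≈⟨ +-congˡ _ (sum-cong d (λ j → reflexive (P.cong (term i) (P.trans (ℕP.+-suc k j) (ℕP.+-comm (suc k) j))))) ⟩
              term i k + sum d (λ j → term i (j ℕ.+ suc k)) ≈⟨ +-congʳ _ (sym (trans (+-congˡ _ (sum-0 k (λ j j< → trans (*-congʳ _ (below j j<)) (zeroˡ _)))) (+-idʳ _))) ⟩
              sum (suc k) (term i) + sum d (λ j → term i (j ℕ.+ suc k)) ≈⟨ trans (+-comm _ _) (sym (sum-++ d (suc k) (term i))) ⟩
              sum (d ℕ.+ suc k) (term i) ≈⟨ reflexive (P.cong (λ z → sum z (term i)) (P.trans (ℕP.+-comm d (suc k)) (P.cong suc d-eq))) ⟩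
              sum (suc n) (term i) ≈⟨ relation i l ⟩
              0# ∎)
              where
                term : ℕ → ℕ → Carrier
                term i l = c l * δ i ^ l

    divides-constant : ∀ δ → Span δ → Regular δ → Divides-constant δ
    divides-constant δ h = powers-divide δ (λ k → Sp.pow k h)

    -- In R[α] up to a constant denominator. The values 𝕏(mP) and 𝕎(mP) are of this kind, being
    -- fractions in 𝕏(P).
    Definable : F.Carrier → Set
    Definable φ = Σ Carrier λ b → R b × Reg b × Span ((λ _ → b) F.* φ)

    -- Since δ divides a regular constant b, the quotient η/δ can be written with denominator b.
    fraction : ∀ φ δ η → Span δ → Regular δ → Span η → δ F.* φ F.≈ η → Definable φ
    fraction φ δ η hδ r hη e = go (divides-constant δ hδ r)
      where
        go : _ → Definable φ
        go (b , b∈ , b-reg , χ , χ∈ , q) = b , b∈ , b-reg ,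
          Sp.resp (F.trans (F.*-congˡ χ (F.sym e)) (F.trans (F.sym (F.*-assoc χ δ φ)) (F.*-congʳ φ q))) (Sp.mul χ∈ hη)

    definable-+ : ∀ {φ φ′} → Definable φ → Definable φ′ → Definable (φ F.+ φ′)
    definable-+ {φ} {φ′} (b , b∈ , r , h) (c , c∈ , s , k) = b * c , R.mul b∈ c∈ , reg-* r s ,
      Sp.resp (λ i _ → solve 4 (λ b c x y → c :* (b :* x) :+ b :* (c :* y) := (b :* c) :* (x :+ y)) refl b c (φ i) (φ′ i))
        (Sp.add (Sp.mul (span-constant (c , c∈ , F.refl)) h) (Sp.mul (span-constant (b , b∈ , F.refl)) k))

    definable-sum : ∀ k {f} → (∀ j → j < k → Definable (f j)) → Definable (F.sum k f)
    definable-sum zero h = 1# , R.one , (λ x e → trans (sym (*-idˡ x)) e) , Sp.resp (λ _ _ → sym (zeroʳ _)) Sp.nil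
    definable-sum (suc k) h = definable-+ (h k ℕP.≤-refl) (definable-sum k (λ j l → h j (ℕP.m≤n⇒m≤1+n l)))

    -- A subring all of whose elements share one denominator. `Definable` alone would allow the
    -- denominator of ϱ^k to grow with k.
    record Order : Set₁ where
      field
        Mem : F.Carrier → Set
        sub-Mem : IsSubring Λⁿ Mem
        constant : ∀ {a} → R a → Mem (λ _ → a)
        den : Carrier
        den∈ : R den
        den-reg : Reg den
        clear : ∀ {φ} → Mem φ → Span ((λ _ → den) F.* φ)

    base-order : Order
    base-order = record { Mem = Constant ; sub-Mem = constants ; constant = λ h → _ , h , F.refl ; den = 1# ; den∈ = R.one
      ; den-reg = λ x e → trans (sym (*-idˡ x)) e ; clear = λ h → Sp.mul Sp.one (span-constant h) }

    record Extension (𝒪 : Order) (φ : F.Carrier) : Set₁ where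
      field
        order : Order
        include : ∀ {x} → Order.Mem 𝒪 x → Order.Mem order x
        element : Order.Mem order φ

    -- An element satisfying a monic equation of degree k + 1 brings in only its powers up to k, and
    -- d^k clears them all: d^k φ^j = d^{k-j} (d φ)^j.
    extend-order : ∀ (𝒪 : Order) φ → Definable φ → ∀ k (o : ℕ → F.Carrier) → (∀ j → Order.Mem 𝒪 (o j)) → φ F.^ suc k F.≈ F.sum (suc k) (λ j → o j F.* φ F.^ j) → Extension 𝒪 φ
    extend-order 𝒪 φ (d , d∈ , d-reg , dφ∈) k o o∈ monic = record
      { order = record { Mem = Ad.Adj ; sub-Mem = Ad.adj-subring ; constant = λ h → Ad.adj-base (constant h) ; den = den * d ^ k ; den∈ = R.mul den∈ (R.pow k d∈)
          ; den-reg = reg-* den-reg (reg-^ k d-reg) ; clear = clear′ }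
      ; include = Ad.adj-base ; element = Ad.adj-ψ }
      where
        open Order 𝒪
        module Ad = Adjoin Λⁿ Mem sub-Mem φ k o o∈ monic
        D : F.Carrier
        D _ = d
        D∈ : Span D
        D∈ = span-constant (d , d∈ , F.refl)
        N : F.Carrier
        N _ = den
        D-^ : D F.^ k F.≈ (λ _ → d ^ k)
        D-^ i _ = F-^ D k i
        split : ∀ j → j < suc k → D F.^ k F.* φ F.^ j F.≈ D F.^ (k ∸ j) F.* (D F.* φ) F.^ j
        split j l = F.trans (F.*-congʳ (φ F.^ j) (F.trans (F.reflexive (P.cong (D F.^_) (P.sym (ℕP.m∸n+n≡m (ℕP.≤-pred l))))) (F.^-+ D (k ∸ j) j)))
          (F.trans (F.*-assoc (D F.^ (k ∸ j)) (D F.^ j) (φ F.^ j)) (F.*-congˡ (D F.^ (k ∸ j)) (F.sym (F.^-* D φ j))))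
        clear′ : ∀ {x} → Ad.Adj x → Span ((λ _ → den * d ^ k) F.* x)
        clear′ {x} (v , v∈ , e) = Sp.resp shape (Sp.sums (suc k) {λ j → (N F.* v j) F.* (D F.^ (k ∸ j) F.* (D F.* φ) F.^ j)} (λ j l → Sp.mul (clear (v∈ j)) (Sp.mul (Sp.pow (k ∸ j) D∈) (Sp.pow j dφ∈))))
          where
            shape : F.sum (suc k) (λ j → (N F.* v j) F.* (D F.^ (k ∸ j) F.* (D F.* φ) F.^ j)) F.≈ (λ _ → den * d ^ k) F.* x
            shape = F.trans (F.sum-cong< (suc k) (λ j l → F.trans (F.*-congˡ (N F.* v j) (F.sym (split j l)))
                      (λ i _ → solve 4 (λ a b c d → (a :* b) :* (c :* d) := (a :* c) :* (b :* d)) refl den (v j i) ((D F.^ k) i) ((φ F.^ j) i))))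
              (F.trans (F.sym (F.sum-*ˡ (suc k) (N F.* D F.^ k) (λ j → v j F.* φ F.^ j)))
                (F.*-cong {N F.* D F.^ k} (F.*-congˡ N D-^) (F.sym e)))

    -- The denominator of `w` is paid once, and `den` serves every power of ϱ; the trace of what
    -- remains lies in R.
    bounded-traces : ∀ w ϱ (𝒪 : Order) → Order.Mem 𝒪 ϱ → Definable w → Σ Carrier λ b → R b × Reg b × (∀ k → R (b * sum n (λ i → w i * ϱ i ^ k)))
    bounded-traces w ϱ 𝒪 ϱ∈ (d , d∈ , d-reg , dw∈) = d * den , R.mul d∈ den∈ , reg-* d-reg den-reg , λ k →
      R.resp (sym (sum-*ˡ n (d * den) (λ i → w i * ϱ i ^ k))) (trace _ (Sp.resp
        (λ i _ → trans (*-congˡ _ (*-congˡ _ (F-^ ϱ k i))) (solve 4 (λ a b c d → (a :* b) :* (c :* d) := (a :* c) :* (b :* d)) refl d (w i) den (ϱ i ^ k)))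
        (Sp.mul dw∈ (clear (IsSubring.pow sub-Mem k ϱ∈)))))
      where open Order 𝒪

    conjugate-integral : ∀ φ → (∀ i → i < n → evalP (suc n) ψ (φ i) ≈ 0#) → φ F.^ suc m F.≈ F.sum (suc m) (λ k → (λ _ → ψ k) F.* φ F.^ k)
    conjugate-integral φ z i l = trans (F-^ φ (suc m) i) (trans (+≈0⇒≈ {φ i ^ suc m} {sum (suc m) (λ k → ψ k * φ i ^ k)}
        (trans (+-congʳ _ (sym (trans (*-congʳ _ ψ-lead) (*-idˡ _)))) (trans (sym (evalP-as-sum (suc n) ψ (φ i))) (z i l))))
        (trans (sum-cong (suc m) (λ k → *-congˡ _ (sym (F-^ φ k i)))) (sym (F-sum (suc m) (λ k → (λ _ → ψ k) F.* φ F.^ k) i))))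

    module Conjugates (x : ℕ → F.Carrier) (x-def : ∀ t → Definable (x t)) (x-root : ∀ t i → i < n → evalP (suc n) ψ (x t i) ≈ 0#) where

      Tower : ℕ → Set₁
      Tower s = Σ Order λ 𝒪 → ∀ t → t < s → Order.Mem 𝒪 (x t)

      -- Every x t is a root of the same Ψ, so it stays integral over whatever has been adjoined
      -- before, and it is `Definable`.
      tower : ∀ s → Tower s
      tower zero = base-order , λ t ()
      tower (suc s) = Extension.order y , λ t l → choose t (ℕP.m≤n⇒m<n∨m≡n (ℕP.≤-pred l))
        where
          𝒪 = proj₁ (tower s)
          y : Extension 𝒪 (x s)
          y = extend-order 𝒪 (x s) (x-def s) m (λ k _ → ψ k) (λ k → Order.constant 𝒪 (ψ∈ k)) (conjugate-integral (x s) (x-root s))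
          choose : ∀ t → (t < s) ⊎ (t ≡ s) → Order.Mem (Extension.order y) (x t)
          choose t (inj₁ l) = Extension.include y (proj₂ (tower s) t l)
          choose t (inj₂ P.refl) = Extension.element y

      -- In characteristic two r (1 + r)³ = r + r² + r³ + r⁴. The hypothesis is thus the monic
      -- equation ϱ⁴ = ϱ³ + ϱ² + ϱ + Y over the tower, with Y the sum of the adjoined elements; of
      -- `w` only a denominator is required.
      quartic-traces : ∀ s ϱ w → Definable ϱ → Definable w → (∀ i → i < n → sum s (λ t → x t i) ≈ ϱ i * (1# + ϱ i) * sq (1# + ϱ i)) →
                       Σ Carrier λ b → R b × Reg b × (∀ k → R (b * sum n (λ i → w i * ϱ i ^ k)))
      quartic-traces s ϱ w ϱ-def w-def law = bounded-traces w ϱ (Extension.order top) (Extension.element top) w-def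
        where
          𝒪 = proj₁ (tower s)
          Y : F.Carrier
          Y = F.sum s x
          o : ℕ → F.Carrier
          o zero = Y
          o (suc _) = F.1#
          o∈ : ∀ j → Order.Mem 𝒪 (o j)
          o∈ zero = IsSubring.sums (Order.sub-Mem 𝒪) s (proj₂ (tower s))
          o∈ (suc _) = IsSubring.one (Order.sub-Mem 𝒪)
          quartic : ϱ F.^ 4 F.≈ F.sum 4 (λ j → o j F.* ϱ F.^ j)
          quartic i l = trans (solve 2 (λ y r → r :* (r :* (r :* (r :* I))) := (r :* (I :+ r) :* ((I :+ r) :* (I :+ r)) :+ y) :+ (I :* (r :* (r :* (r :* I))) :+ (I :* (r :* (r :* I)) :+ (I :* (r :* I) :+ (y :* I :+ O))))) refl (Y i) (ϱ i))
            (trans (+-congʳ _ (≈⇒+≈0 (sym (trans (F-sum s x i) (law i l))))) (+-idˡ _))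
          top : Extension 𝒪 ϱ
          top = extend-order 𝒪 ϱ ϱ-def 3 o o∈ quartic

-- Multiplication by m as a rational function of the 𝕏-coordinate.

module MultiplicationPolynomials where
  open import Data.Nat.Solver using (module +-*-Solver)
  open import Data.Integer.Divisibility.Signed as ℤD using (_∣_; _∣?_; divides; ∣m∣n⇒∣m+n; ∣m∣n⇒∣m-n; ∣m⇒∣-m; ∣n⇒∣m*n)
  open CharacteristicTwo
  open FormalSeries
  open Homomorphisms
  open LambertSeries using (odd)
  open EisensteinSeries using (module ℤSolve)
  open TwoDivision
  open RootsOfUnity using (module Bounded)
  open NewtonSums

  module Evaluation (K : F2Alg) where
    private
      module K = Ring K
      module E = Eval K
    open Ring K using (Carrier)
    open Bounded K
    private
      module S = Series K
      module Q = Ring polynomials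

    value : Carrier → Q.Carrier → Carrier
    value α (f , n , _) = E.evalP (suc n) f α

    private
      up : ∀ α n k f → Deg≤ n f → E.evalP (suc (n ℕ.+ k)) f α K.≈ E.evalP (suc n) f α
      up α n k f d = E.evalP-extend k (suc n) α d

    evaluation : Carrier → Hom polynomials K
    evaluation α = record
      { fun = value α
      ; fun-cong = λ { {f , m , d} {g , n , d′} e → K.trans (K.sym (up α m n f d)) (K.trans (E.evalP-cong (suc (m ℕ.+ n)) (λ i _ → e i))
          (K.trans (K.reflexive (P.cong (λ k → E.evalP (suc k) g α) (ℕP.+-comm m n))) (up α n m g d′))) }
      ; fun-+ = λ { (f , m , d) (g , n , d′) → K.trans (E.evalP-+ (suc (m ℕ.+ n)) f g α) (K.+-cong (up α m n f d)
          (K.trans (K.reflexive (P.cong (λ k → E.evalP (suc k) g α) (ℕP.+-comm m n))) (up α n m g d′))) }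
      ; fun-* = λ { (f , m , d) (g , n , d′) → K.trans (K.trans (K.sym (E.evalP-extend 1 (suc (m ℕ.+ n)) α (deg-* {m} {n} {f} {g} d d′)))
          (K.reflexive (P.cong (λ k → E.evalP k (f S.* g) α) (P.cong suc (P.trans (ℕP.+-assoc m n 1) (P.cong (m ℕ.+_) (ℕP.+-comm n 1)))))))
          (E.evalP-* (suc m) (suc n) f g α d d′) }
      ; fun-1 = K.trans (K.+-congˡ _ (K.zeroʳ α)) (K.+-idʳ _) }

  module CoefficientsIn (K : F2Alg) (R : F2Alg.Carrier K → Set) (sub : IsSubring K R) where
    private
      module S = Series K
    open Ring K
    open IsSubring sub

    conv∈ : ∀ n f g → (∀ k → R (f k)) → (∀ k → R (g k)) → R (S.conv f g n)
    conv∈ zero f g hf hg = mul (hf 0) (hg 0)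
    conv∈ (suc n) f g hf hg = add (mul (hf 0) (hg (suc n))) (conv∈ n (f ∘ suc) g (hf ∘ suc) hg)

    -- Monic (c = 1) or merely bounded (c = 0) polynomials of degree n.
    record Top (n : ℕ) (c : Carrier) (f : S.Carrier) : Set where
      field
        bound : Bounded.Deg≤ K n f
        top : f n ≈ c
        coeffs∈ : ∀ k → R (f k)

    open Top public
    open Bounded K using (deg-top; deg-+)

    infixl 7 _⊗_
    infixl 6 _⊕_

    _⊗_ : ∀ {m n c d f g} → Top m c f → Top n d g → Top (m ℕ.+ n) (c * d) (f S.* g)
    _⊗_ {m} {n} {f = f} {g = g} s t = record
      { bound = proj₂ (deg-top m n f g (bound s) (bound t))
      ; top = trans (proj₁ (deg-top m n f g (bound s) (bound t))) (*-cong (top s) (top t))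
      ; coeffs∈ = λ k → conv∈ k f g (coeffs∈ s) (coeffs∈ t) }

    _⊕_ : ∀ {n c d f g} → Top n c f → Top n d g → Top n (c + d) (f S.+ g)
    s ⊕ t = record { bound = deg-+ (bound s) (bound t) ; top = +-cong (top s) (top t) ; coeffs∈ = λ k → add (coeffs∈ s k) (coeffs∈ t k) }

    raise : ∀ {m n c f} → Top m c f → m < n → Top n 0# f
    raise {m} {n} s l = record { bound = λ i h → bound s i (ℕP.<-trans l h) ; top = bound s n l ; coeffs∈ = coeffs∈ s }

    recast : ∀ {m n c d f} → m ≡ n → c ≈ d → Top m c f → Top n d f
    recast P.refl e s = record { bound = bound s ; top = trans (top s) e ; coeffs∈ = coeffs∈ s }

  module Ladder (S : F2Alg) (N p : ℕ) (p>0 : 0 < p) (cyc : Cyclic S N)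
                (R : F2Alg.Carrier (PowerSeries.series S) → Set) (sub : IsSubring (PowerSeries.series S) R) (A∈ : R (TateCurve.A S N p p>0 cyc)) where
    open TateCurve S N p p>0 cyc
    open +-*-Solver using () renaming (_:=_ to _≜_; solve to ℕsolve; _:+_ to _⊹_; _:*_ to _⊛_; con to Nc)
    open ℤSolve using () renaming (_:=_ to _≛_; solve to ℤsolve; _:+_ to _⊞_; _:-_ to _⊟_; _:*_ to _⊠_; :-_ to ⊟_; con to ℤcon)

    private
      Λ = PowerSeries.series S
      module R = IsSubring sub
    open Bounded Λ using (polynomials; Deg≤; deg-const)
    open Evaluation Λ
    open CoefficientsIn Λ R sub

    private
      module Q = Ring polynomials
      H = + (p ℕ.+ p)
      LL = + (p ℕ.+ p ℕ.+ (p ℕ.+ p))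

      dvd : ∀ {m a b} → a ≡ b → m ∣ a → m ∣ b
      dvd P.refl d = d

      2∣H : + 2 ∣ H
      2∣H = divides (+ p) (ℤsolve 1 (λ p → p ⊞ p ≛ p ⊠ ℤcon (+ 2)) P.refl (+ p))

      2∣LL : + 2 ∣ LL
      2∣LL = ∣m∣n⇒∣m+n 2∣H 2∣H

    -- Both the period 4p and the exponent 2p of T₂ are even, so points of odd exponent avoid the
    -- origin and T₂. Their odd multiples do so too; only even multiples can become exceptional.
    Odd : ℤ → Set
    Odd e = ¬ (+ 2 ∣ e)

    odd⇒≢O : ∀ {i e} → Odd e → ¬ IsO i e
    odd⇒≢O o (_ , d) = o (ℤD.∣-trans 2∣LL d)

    odd⇒≢T : ∀ {i e} → Odd e → ¬ IsO i (e ℤ.- H)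
    odd⇒≢T {e = e} o (_ , d) = o (dvd (ℤsolve 2 (λ e h → (e ⊟ h) ⊞ h ≛ e) P.refl e H) (∣m∣n⇒∣m+n (ℤD.∣-trans 2∣LL d) 2∣H))

    odd-+ : ∀ {e f} → Odd e → + 2 ∣ f → Odd (e ℤ.+ f)
    odd-+ {e} {f} o d h = o (dvd (ℤsolve 2 (λ e f → e ⊞ f ⊟ f ≛ e) P.refl e f) (∣m∣n⇒∣m-n h d))

    odd-- : ∀ {e f} → Odd e → + 2 ∣ f → Odd (e ℤ.- f)
    odd-- {e} {f} o d h = o (dvd (ℤsolve 2 (λ e f → (e ⊟ f) ⊞ f ≛ e) P.refl e f) (∣m∣n⇒∣m+n h d))

    O? : ∀ i e → Dec (IsO i e)
    O? i e = (+ N ∣? i) ×-dec (LL ∣? e)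

    𝕏-T : ∀ {i e} → IsO i (e ℤ.- H) → ¬ IsO i e → 𝕏 i e ≈ 0#
    𝕏-T {i} {e} (a , b) n = trans (𝕏-cong {i} {+ 0} {e} {H} (dvd (P.sym (ℤP.+-identityʳ i)) a) b n) 𝕏-T₂

    -- (x : y) are projective coordinates of 𝕏 at (i, e), with (1 : 0) at the origin.
    record Kummer (i e : ℤ) (x y : Carrier) : Set where
      field
        origin : IsO i e → (y ≈ 0#) × Reg x
        affine : ¬ IsO i e → (x ≈ 𝕏 i e * y) × Reg y

    open Kummer public

    kummer-cong : ∀ {i e x y x′ y′} → x ≈ x′ → y ≈ y′ → Kummer i e x y → Kummer i e x′ y′
    kummer-cong ex ey k = record
      { origin = λ o → trans (sym ey) (proj₁ (origin k o)) , reg-cong ex (proj₂ (origin k o))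
      ; affine = λ n → trans (sym ex) (trans (proj₁ (affine k n)) (*-congˡ _ ey)) , reg-cong ey (proj₂ (affine k n)) }

    -- The duplication formula made homogeneous. It remains valid at the origin, where y = 0, and at
    -- T₂, where x = 0 and the image is the origin (A⁴ y⁴ : 0).
    kummer-double : ∀ {i e x y} → Kummer i e x y → Kummer (i ℤ.+ i) (e ℤ.+ e) (fourth x + fourth (A * y)) (sq x * sq y)
    kummer-double {i} {e} {x} {y} k = record { origin = λ o → at-origin o (O? i e) ; affine = λ n → at-affine n (affine k (double-nz {i} {e} n)) }
      where
        at-origin : IsO (i ℤ.+ i) (e ℤ.+ e) → Dec (IsO i e) → (sq x * sq y ≈ 0#) × Reg (fourth x + fourth (A * y))
        at-origin o (yes h) = go (origin k h)
          where
            go : (y ≈ 0#) × Reg x → _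
            go (z , r) = trans (*-congˡ _ (trans (*-congʳ _ z) (zeroˡ _))) (zeroʳ _) ,
              reg-cong (sym (trans (+-congˡ _ (trans (sq-cong (trans (sq-cong (trans (*-congˡ A z) (zeroʳ A))) (zeroˡ _))) (zeroˡ _))) (+-idʳ _))) (reg-* (reg-* r r) (reg-* r r))
        at-origin (a , b) (no h) = go (affine k h)
          where
            N∣i = double-∣ i a
            isT : IsO i (e ℤ.- H)
            isT = N∣i , half-period b (λ d → h (N∣i , d))
              where
                half-period : LL ∣ e ℤ.+ e → ¬ (LL ∣ e) → LL ∣ e ℤ.- H
                half-period (divides q eq) n = choose (EisensteinSeries.parity q)
                  where
                    e≡ : e ≡ q ℤ.* H
                    e≡ = ℤP.*-cancelʳ-≡ e (q ℤ.* H) (+ 2) (P.trans (ℤsolve 1 (λ e → e ⊠ ℤcon (+ 2) ≛ e ⊞ e) P.refl e) (P.trans eq (ℤsolve 2 (λ q h → q ⊠ (h ⊞ h) ≛ q ⊠ h ⊠ ℤcon (+ 2)) P.refl q H)))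
                    choose : (Σ ℤ λ m → q ≡ m ℤ.+ m ⊎ q ≡ m ℤ.+ m ℤ.+ + 1) → LL ∣ e ℤ.- H
                    choose (m , inj₁ z) = ⊥-elim (n (divides m (P.trans e≡ (P.trans (P.cong (ℤ._* H) z) (ℤsolve 2 (λ m h → (m ⊞ m) ⊠ h ≛ m ⊠ (h ⊞ h)) P.refl m H)))))
                    choose (m , inj₂ z) = divides m (P.trans (P.cong (ℤ._- H) (P.trans e≡ (P.cong (ℤ._* H) z))) (ℤsolve 2 (λ m h → (m ⊞ m ⊞ ℤcon (+ 1)) ⊠ h ⊟ h ≛ m ⊠ (h ⊞ h)) P.refl m H))
            go : (x ≈ 𝕏 i e * y) × Reg y → _
            go (q , r) = trans (*-congʳ _ (trans (*-congʳ _ x0) (zeroˡ _))) (zeroˡ _) ,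
              reg-cong (sym (trans (+-congʳ _ (trans (sq-cong (trans (*-congʳ _ x0) (zeroˡ _))) (zeroˡ _))) (+-idˡ _))) (reg-* (reg-* Ay Ay) (reg-* Ay Ay))
              where
                x0 : x ≈ 0#
                x0 = trans q (trans (*-congʳ _ (𝕏-T isT h)) (zeroˡ _))
                Ay = reg-* A-reg r
        at-affine : ¬ IsO (i ℤ.+ i) (e ℤ.+ e) → (x ≈ 𝕏 i e * y) × Reg y → _
        at-affine n (q , r) = (begin
            fourth x + fourth (A * y) ≈⟨ +-congʳ _ (sq-cong (sq-cong q)) ⟩
            fourth (t * y) + fourth (A * y)
              ≈⟨ solve 3 (λ t y a → ((t :* y) :* (t :* y)) :* ((t :* y) :* (t :* y)) :+ ((a :* y) :* (a :* y)) :* ((a :* y) :* (a :* y))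
                    := ((t :* t) :* (t :* t) :+ (a :* a) :* (a :* a)) :* ((y :* y) :* (y :* y))) refl t y A ⟩
            (fourth t + fourth A) * fourth y ≈⟨ *-congʳ _ (sym (𝕏-double i e n)) ⟩
            (𝕏 (i ℤ.+ i) (e ℤ.+ e) * sq t) * fourth y ≈⟨ solve 3 (λ d t y → (d :* (t :* t)) :* ((y :* y) :* (y :* y)) := d :* (((t :* y) :* (t :* y)) :* (y :* y))) refl _ t y ⟩
            𝕏 (i ℤ.+ i) (e ℤ.+ e) * (sq (t * y) * sq y) ≈⟨ *-congˡ _ (*-congʳ _ (sq-cong (sym q))) ⟩
            𝕏 (i ℤ.+ i) (e ℤ.+ e) * (sq x * sq y) ∎) , reg-* (reg-* rx rx) (reg-* r r)
          where
            t = 𝕏 i e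
            rx : Reg x
            rx = reg-cong (sym q) (reg-* (𝕏-reg (double-nz {i} {e} n)
              (λ { (a , b) → double-nz′ {i} {e} n (a , dvd (ℤsolve 2 (λ e h → (e ⊟ h) ⊞ (h ⊞ h) ≛ e ⊞ h) P.refl e H) (∣m∣n⇒∣m+n b ℤD.∣-refl)) })) r)

    mix : Carrier → Carrier → Carrier → Carrier → Carrier
    mix x y x′ y′ = sq (x * y′ + x′ * y)

    -- Differential addition: given α = 𝕏(P - Q), the addition formula yields 𝕏(P + Q) as α plus
    -- 𝕏(P)𝕏(Q)/(𝕏(P) + 𝕏(Q))². With P of odd and Q of even exponent, P ± Q are never the origin; if
    -- Q itself is, the formula returns α.
    kummer-add : ∀ {i e j f x y x′ y′ α} → Odd e → + 2 ∣ f → Kummer i e x y → Kummer j f x′ y′ → 𝕏 (i ℤ.- j) (e ℤ.- f) ≈ α →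
                 Kummer (i ℤ.+ j) (e ℤ.+ f) (α * mix x y x′ y′ + (x * x′) * (y * y′)) (mix x y x′ y′)
    kummer-add {i} {e} {j} {f} {x} {y} {x′} {y′} {α} o ev k k′ diff = record
      { origin = λ z → ⊥-elim (odd⇒≢O (odd-+ {e} o ev) z)
      ; affine = λ _ → go (O? j f) (affine k (odd⇒≢O {i} {e} o)) }
      where
        s = 𝕏 i e
        n₊ = odd⇒≢O {i ℤ.+ j} {e ℤ.+ f} (odd-+ {e} o ev)
        n₋ = odd⇒≢O {i ℤ.- j} {e ℤ.- f} (odd-- {e} o ev)
        Goal = (α * mix x y x′ y′ + (x * x′) * (y * y′) ≈ 𝕏 (i ℤ.+ j) (e ℤ.+ f) * mix x y x′ y′) × Reg (mix x y x′ y′)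
        go : Dec (IsO j f) → (x ≈ s * y) × Reg y → Goal
        go (yes z) (q , r) = with-origin (origin k′ z)
          where
            with-origin : (y′ ≈ 0#) × Reg x′ → Goal
            with-origin (y0 , rx) = trans (+-congˡ _ (trans (*-congˡ _ (trans (*-congˡ y y0) (zeroʳ y))) (zeroʳ _))) (trans (+-idʳ _) (*-congʳ _ (trans (sym diff)
                (𝕏-cong (dvd (ℤsolve 2 (λ i j → ⊟ (j ⊞ j) ≛ (i ⊟ j) ⊟ (i ⊞ j)) P.refl i j) (∣m⇒∣-m (∣m∣n⇒∣m+n (proj₁ z) (proj₁ z))))
                        (dvd (ℤsolve 2 (λ i j → ⊟ (j ⊞ j) ≛ (i ⊟ j) ⊟ (i ⊞ j)) P.refl e f) (∣m⇒∣-m (∣m∣n⇒∣m+n (proj₂ z) (proj₂ z)))) n₋)))) ,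
              reg-cong (sq-cong (sym (trans (+-congʳ _ (trans (*-congˡ x y0) (zeroʳ x))) (+-idˡ _)))) (reg-* (reg-* rx r) (reg-* rx r))
        go (no z) (q , r) = with-affine (affine k′ z)
          where
            t = 𝕏 j f
            reg-sum : Dec (IsO j (f ℤ.- H)) → Reg (s + t)
            reg-sum (yes isT) = reg-cong (sym (trans (+-congˡ s (𝕏-T isT z)) (+-idʳ s))) (𝕏-reg (odd⇒≢O {i} {e} o) (odd⇒≢T {i} {e} o))
            reg-sum (no h) = 𝕏-reg-+ (odd⇒≢O {i} {e} o) (odd⇒≢T {i} {e} o) z h n₊ n₋
            with-affine : (x′ ≈ t * y′) × Reg y′ → Goal
            with-affine (q′ , r′) = (begin
                α * mix x y x′ y′ + (x * x′) * (y * y′) ≈⟨ +-cong (*-cong (sym diff) mix-value) (*-congʳ _ (*-cong q q′)) ⟩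
                d * (sq (s + t) * sq (y * y′)) + ((s * y) * (t * y′)) * (y * y′)
                  ≈⟨ +-congˡ _ (trans (solve 4 (λ s t y z → ((s :* y) :* (t :* z)) :* (y :* z) := (s :* t) :* ((y :* z) :* (y :* z))) refl s t y y′)
                       (*-congʳ _ (𝕏-star i e j f (odd⇒≢O {i} {e} o) z n₊ n₋))) ⟩
                d * (sq (s + t) * sq (y * y′)) + ((𝕏 (i ℤ.+ j) (e ℤ.+ f) + d) * sq (s + t)) * sq (y * y′)
                  ≈⟨ solve 4 (λ d c m v → d :* (m :* v) :+ ((c :+ d) :* m) :* v := c :* (m :* v)) refl d (𝕏 (i ℤ.+ j) (e ℤ.+ f)) (sq (s + t)) (sq (y * y′)) ⟩
                𝕏 (i ℤ.+ j) (e ℤ.+ f) * (sq (s + t) * sq (y * y′)) ≈⟨ *-congˡ _ (sym mix-value) ⟩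
                𝕏 (i ℤ.+ j) (e ℤ.+ f) * mix x y x′ y′ ∎) ,
              reg-cong (sym mix-value) (reg-* (reg-* rs rs) (reg-* (reg-* r r′) (reg-* r r′)))
              where
                d = 𝕏 (i ℤ.- j) (e ℤ.- f)
                rs = reg-sum (O? j (f ℤ.- H))
                mix-value : mix x y x′ y′ ≈ sq (s + t) * sq (y * y′)
                mix-value = trans (sq-cong (+-cong (*-congʳ _ q) (*-congʳ _ q′)))
                  (solve 4 (λ s t y z → (s :* y :* z :+ t :* z :* y) :* (s :* y :* z :+ t :* z :* y) := ((s :+ t) :* (s :+ t)) :* ((y :* z) :* (y :* z))) refl s t y y′)

    private
      odd-rest : ∀ m → (odd m ≡ true × + 2 ∣ + m ℤ.- + 1) ⊎ (odd m ≡ false × + 2 ∣ + m)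
      odd-rest zero = inj₂ (P.refl , divides (+ 0) P.refl)
      odd-rest (suc m) = go (odd-rest m)
        where
          go : (odd m ≡ true × + 2 ∣ + m ℤ.- + 1) ⊎ (odd m ≡ false × + 2 ∣ + m) → _
          go (inj₁ (o , d)) = inj₂ (P.cong not o , dvd (ℤsolve 1 (λ m → (m ⊟ ℤcon (+ 1)) ⊞ ℤcon (+ 2) ≛ ℤcon (+ 1) ⊞ m) P.refl (+ m)) (∣m∣n⇒∣m+n d ℤD.∣-refl))
          go (inj₂ (o , d)) = inj₁ (P.cong not o , dvd (ℤsolve 1 (λ m → m ≛ (ℤcon (+ 1) ⊞ m) ⊟ ℤcon (+ 1)) P.refl (+ m)) d)

      odd-sum : ∀ m n → odd (m ℕ.+ n) ≡ odd m xor odd n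
      odd-sum zero n = P.refl
      odd-sum (suc m) n = P.trans (P.cong not (odd-sum m n)) (flip (odd m))
        where
          flip : ∀ a → not (a xor odd n) ≡ not a xor odd n
          flip true = BoolP.not-involutive (odd n)
          flip false = P.refl

    odd-multiple : ∀ m {e} → odd m ≡ true → Odd e → Odd (+ m ℤ.* e)
    odd-multiple m {e} om oe d = go (odd-rest m)
      where
        go : (odd m ≡ true × + 2 ∣ + m ℤ.- + 1) ⊎ (odd m ≡ false × + 2 ∣ + m) → ⊥
        go (inj₁ (_ , h)) = oe (dvd (ℤsolve 2 (λ m e → m ⊠ e ⊟ e ⊠ (m ⊟ ℤcon (+ 1)) ≛ e) P.refl (+ m) e) (∣m∣n⇒∣m-n d (∣n⇒∣m*n e h)))
        go (inj₂ (f , _)) with P.trans (P.sym om) f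
        ... | ()

    even-multiple : ∀ m e → odd m ≡ false → + 2 ∣ + m ℤ.* e
    even-multiple m e em = go (odd-rest m)
      where
        go : (odd m ≡ true × + 2 ∣ + m ℤ.- + 1) ⊎ (odd m ≡ false × + 2 ∣ + m) → _
        go (inj₂ (_ , h)) = dvd (ℤP.*-comm e (+ m)) (∣n⇒∣m*n e h)
        go (inj₁ (t , _)) with P.trans (P.sym em) t
        ... | ()

    -- The numerator is monic of degree m², and the denominator has coefficient m modulo 2 in degree
    -- m² - 1. The latter is recorded because in the sum of m and n of opposite parity it makes the
    -- cross term monic.
    record Rung (m : ℕ) : Set where
      field
        num den : ℕ → Carrier
        deg : ℕ
        deg≡ : suc deg ≡ m ℕ.* m
        num-top : Top (suc deg) 1# num
        den-top : Top deg (bit (odd m)) den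
      numQ : Q.Carrier
      numQ = num , suc deg , bound num-top
      denQ : Q.Carrier
      denQ = den , deg , bound den-top
      field
        kummer : ∀ i e → Odd e → Kummer (+ m ℤ.* i) (+ m ℤ.* e) (value (𝕏 i e) numQ) (value (𝕏 i e) denQ)

    private
      module SΛ = Series Λ

      𝕋 : ℕ → Carrier
      𝕋 1 = 1#
      𝕋 _ = 0#

      𝕋-top : Top 1 1# 𝕋
      𝕋-top = record { bound = λ { (suc zero) (s≤s ()) ; (suc (suc i)) _ → refl } ; top = refl ; coeffs∈ = λ { zero → R.nil ; (suc zero) → R.one ; (suc (suc _)) → R.nil } }

      const-top : ∀ {a} → R a → Top 0 a (SΛ.const a)
      const-top {a} h = record { bound = deg-const a ; top = refl ; coeffs∈ = λ { zero → h ; (suc _) → R.nil } }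

      𝕋Q AQ : Q.Carrier
      𝕋Q = 𝕋 , 1 , bound 𝕋-top
      AQ = SΛ.const A , 0 , deg-const A

      value-𝕋 : ∀ α → value α 𝕋Q ≈ α
      value-𝕋 α = solve 1 (λ a → O :+ a :* (I :+ a :* O) := a) refl α

      value-const : ∀ α {a} → value α (SΛ.const a , 0 , deg-const a) ≈ a
      value-const α = trans (+-congˡ _ (zeroʳ α)) (+-idʳ _)

      move : ∀ {i j e f x y} → i ≡ j → e ≡ f → Kummer i e x y → Kummer j f x y
      move P.refl P.refl k = k

    rung-1 : Rung 1
    rung-1 = record
      { num = 𝕋 ; den = SΛ.const 1# ; deg = 0 ; deg≡ = P.refl ; num-top = 𝕋-top ; den-top = const-top R.one
      ; kummer = λ i e o → move (P.sym (ℤP.*-identityˡ i)) (P.sym (ℤP.*-identityˡ e)) (kummer-cong (sym (value-𝕋 _)) (sym (value-const _)) (record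
          { origin = λ z → ⊥-elim (odd⇒≢O {i} {e} o z)
          ; affine = λ _ → sym (*-idʳ _) , reg-1 })) }

    rung-double : ∀ {m} → Rung m → Rung (m ℕ.+ m)
    rung-double {m} r = record
      { num = proj₁ N₂ ; den = proj₁ D₂ ; deg = d₂ ; deg≡ = deg-eq
      ; num-top = n-top ; den-top = d-top
      ; kummer = λ i e o → move (P.sym (ℤP.*-distribʳ-+ i (+ m) (+ m))) (P.sym (ℤP.*-distribʳ-+ e (+ m) (+ m)))
          (kummer-cong (sym (n-value (𝕏 i e))) (sym (d-value (𝕏 i e))) (kummer-double (Rung.kummer r i e o))) }
      where
        open Rung r
        N₂ D₂ : Q.Carrier
        N₂ = Q.fourth numQ Q.+ Q.fourth (AQ Q.* denQ)
        D₂ = Q.sq numQ Q.* Q.sq denQ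
        se = suc deg
        d₂ = suc (se ℕ.+ se ℕ.+ (deg ℕ.+ deg))
        four : suc d₂ ≡ se ℕ.+ se ℕ.+ (se ℕ.+ se)
        four = ℕsolve 1 (λ d → Nc 2 ⊹ ((Nc 1 ⊹ d) ⊹ (Nc 1 ⊹ d) ⊹ (d ⊹ d)) ≜ (Nc 1 ⊹ d) ⊹ (Nc 1 ⊹ d) ⊹ ((Nc 1 ⊹ d) ⊹ (Nc 1 ⊹ d))) P.refl deg
        deg-eq : suc d₂ ≡ (m ℕ.+ m) ℕ.* (m ℕ.+ m)
        deg-eq = P.trans four (P.trans (P.cong (λ z → z ℕ.+ z ℕ.+ (z ℕ.+ z)) deg≡) (ℕsolve 1 (λ m → m ⊛ m ⊹ m ⊛ m ⊹ (m ⊛ m ⊹ m ⊛ m) ≜ (m ⊹ m) ⊛ (m ⊹ m)) P.refl m))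
        even : odd (m ℕ.+ m) ≡ false
        even = P.trans (odd-sum m m) (BoolP.xor-same (odd m))
        n-top : Top (suc d₂) 1# (proj₁ N₂)
        n-top = recast (P.sym four) (solve 0 (I :* I :* (I :* I) :+ O := I) refl) (num⁴ ⊕ raise Aden⁴ (ℕP.+-mono-< (ℕP.+-mono-< ℕP.≤-refl ℕP.≤-refl) (ℕP.+-mono-< ℕP.≤-refl ℕP.≤-refl)))
          where
            num² = num-top ⊗ num-top
            num⁴ = num² ⊗ num²
            Aden = const-top A∈ ⊗ den-top
            Aden² = Aden ⊗ Aden
            Aden⁴ = Aden² ⊗ Aden²
        d-top : Top d₂ (bit (odd (m ℕ.+ m))) (proj₁ D₂)
        d-top = recast P.refl (reflexive (P.cong bit (P.sym even))) (raise num²den² ℕP.≤-refl)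
          where
            num² = num-top ⊗ num-top
            den² = den-top ⊗ den-top
            num²den² = num² ⊗ den²
        module _ (α : Carrier) where
          open Hom (evaluation α)
          v-* : ∀ {a b x y} → value α a ≈ x → value α b ≈ y → value α (a Q.* b) ≈ x * y
          v-* {a} {b} e f = trans (fun-* a b) (*-cong e f)
          n-value : value α (proj₁ N₂ , suc d₂ , bound n-top) ≈ fourth (value α numQ) + fourth (A * value α denQ)
          n-value = trans (fun-cong {proj₁ N₂ , suc d₂ , bound n-top} {N₂} (λ i → refl)) (trans (fun-+ (Q.fourth numQ) (Q.fourth (AQ Q.* denQ)))
            (+-cong (fourth-v numQ refl) (fourth-v (AQ Q.* denQ) (v-* {AQ} {denQ} (value-const α) refl))))
            where
              fourth-v : ∀ a {x} → value α a ≈ x → value α (Q.fourth a) ≈ fourth x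
              fourth-v a e = v-* {Q.sq a} {Q.sq a} (v-* {a} {a} e e) (v-* {a} {a} e e)
          d-value : value α (proj₁ D₂ , d₂ , bound d-top) ≈ sq (value α numQ) * sq (value α denQ)
          d-value = trans (fun-cong {proj₁ D₂ , d₂ , bound d-top} {D₂} (λ i → refl)) (v-* {Q.sq numQ} {Q.sq denQ} (v-* {numQ} {numQ} refl refl) (v-* {denQ} {denQ} refl refl))

    -- The condition on squares says (m - n)² = 1: the difference of the two multiples is ±P, so the
    -- coordinate required by `kummer-add` is the polynomial variable itself.
    rung-add : ∀ {m n} → odd m ≡ true → odd n ≡ false → m ℕ.* m ℕ.+ n ℕ.* n ℕ.+ (m ℕ.* m ℕ.+ n ℕ.* n) ≡ suc ((m ℕ.+ n) ℕ.* (m ℕ.+ n)) →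
               (∀ i e → Odd e → 𝕏 (+ m ℤ.* i ℤ.- + n ℤ.* i) (+ m ℤ.* e ℤ.- + n ℤ.* e) ≈ 𝕏 i e) → Rung m → Rung n → Rung (m ℕ.+ n)
    rung-add {m} {n} om en adjacent diff r r′ = record
      { num = proj₁ N₂ ; den = proj₁ D₂ ; deg = d₂ ; deg≡ = deg-eq
      ; num-top = n-top ; den-top = d-top
      ; kummer = λ i e o → move (P.sym (ℤP.*-distribʳ-+ i (+ m) (+ n))) (P.sym (ℤP.*-distribʳ-+ e (+ m) (+ n)))
          (kummer-cong (sym (n-value (𝕏 i e))) (sym (d-value (𝕏 i e)))
            (kummer-add (odd-multiple m om o) (even-multiple n e en) (Rung.kummer r i e o) (Rung.kummer r′ i e o) (diff i e o))) }
      where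
        module A = Rung r
        module B = Rung r′
        N₂ D₂ : Q.Carrier
        D₂ = Q.sq (A.numQ Q.* B.denQ Q.+ B.numQ Q.* A.denQ)
        N₂ = 𝕋Q Q.* D₂ Q.+ (A.numQ Q.* B.numQ) Q.* (A.denQ Q.* B.denQ)
        d = suc A.deg ℕ.+ B.deg
        d₂ = d ℕ.+ d
        deg-eq : suc d₂ ≡ (m ℕ.+ n) ℕ.* (m ℕ.+ n)
        deg-eq = ℕP.suc-injective (P.trans (ℕsolve 2 (λ a b → Nc 2 ⊹ ((Nc 1 ⊹ a) ⊹ b ⊹ ((Nc 1 ⊹ a) ⊹ b)) ≜ (Nc 1 ⊹ a) ⊹ (Nc 1 ⊹ b) ⊹ ((Nc 1 ⊹ a) ⊹ (Nc 1 ⊹ b))) P.refl A.deg B.deg)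
          (P.trans (P.cong₂ (λ x y → x ℕ.+ y ℕ.+ (x ℕ.+ y)) A.deg≡ B.deg≡) adjacent))
        opposite : odd (m ℕ.+ n) ≡ true
        opposite = P.trans (odd-sum m n) (P.cong₂ _xor_ om en)
        mixed : Top d 1# (proj₁ (A.numQ Q.* B.denQ Q.+ B.numQ Q.* A.denQ))
        mixed = recast P.refl (trans (+-cong {1# * bit (odd n)} {0#} {1# * bit (odd m)} {1#} (trans (*-idˡ _) (reflexive (P.cong bit en))) (trans (*-idˡ _) (reflexive (P.cong bit om)))) (+-idˡ 1#))
          (AB ⊕ recast (P.trans (ℕP.+-comm (suc B.deg) A.deg) (ℕP.+-suc A.deg B.deg)) refl BA)
          where
            AB = A.num-top ⊗ B.den-top
            BA = B.num-top ⊗ A.den-top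
        d-top : Top d₂ (bit (odd (m ℕ.+ n))) (proj₁ D₂)
        d-top = recast P.refl (trans (*-idˡ 1#) (reflexive (P.cong bit (P.sym opposite)))) (mixed ⊗ mixed)
        n-top : Top (suc d₂) 1# (proj₁ N₂)
        n-top = recast P.refl (trans (+-idʳ (1# * bit (odd (m ℕ.+ n)))) (trans (*-idˡ _) (reflexive (P.cong bit opposite))))
          (main ⊕ raise rest
            (s≤s (ℕP.≤-reflexive (ℕsolve 2 (λ a b → (Nc 1 ⊹ a) ⊹ (Nc 1 ⊹ b) ⊹ (a ⊹ b) ≜ (Nc 1 ⊹ a) ⊹ b ⊹ ((Nc 1 ⊹ a) ⊹ b)) P.refl A.deg B.deg))))
          where
            main = 𝕋-top ⊗ d-top
            nums = A.num-top ⊗ B.num-top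
            dens = A.den-top ⊗ B.den-top
            rest = nums ⊗ dens
        module _ (α : Carrier) where
          open Hom (evaluation α)
          v-* : ∀ {a b x y} → value α a ≈ x → value α b ≈ y → value α (a Q.* b) ≈ x * y
          v-* {a} {b} e f = trans (fun-* a b) (*-cong e f)
          D-value : value α D₂ ≈ mix (value α A.numQ) (value α A.denQ) (value α B.numQ) (value α B.denQ)
          D-value = v-* {M} {M} mv mv
            where
              M = A.numQ Q.* B.denQ Q.+ B.numQ Q.* A.denQ
              mv : value α M ≈ value α A.numQ * value α B.denQ + value α B.numQ * value α A.denQ
              mv = trans (fun-+ (A.numQ Q.* B.denQ) (B.numQ Q.* A.denQ)) (+-cong (fun-* A.numQ B.denQ) (fun-* B.numQ A.denQ))
          d-value : value α (proj₁ D₂ , d₂ , bound d-top) ≈ mix (value α A.numQ) (value α A.denQ) (value α B.numQ) (value α B.denQ)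
          d-value = trans (fun-cong {proj₁ D₂ , d₂ , bound d-top} {D₂} (λ i → refl)) D-value
          n-value : value α (proj₁ N₂ , suc d₂ , bound n-top) ≈ α * mix (value α A.numQ) (value α A.denQ) (value α B.numQ) (value α B.denQ)
                    + (value α A.numQ * value α B.numQ) * (value α A.denQ * value α B.denQ)
          n-value = trans (fun-cong {proj₁ N₂ , suc d₂ , bound n-top} {N₂} (λ i → refl)) (trans (fun-+ (𝕋Q Q.* D₂) ((A.numQ Q.* B.numQ) Q.* (A.denQ Q.* B.denQ)))
            (+-cong (v-* {𝕋Q} {D₂} (value-𝕋 α) D-value) (v-* {A.numQ Q.* B.numQ} {A.denQ Q.* B.denQ} (fun-* A.numQ B.numQ) (fun-* A.denQ B.denQ))))

    rung-next : ∀ {k} → Rung k → Rung (suc k) → Rung (k ℕ.+ suc k)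
    rung-next {k} r r′ = go (odd-rest k)
      where
        go : (odd k ≡ true × + 2 ∣ + k ℤ.- + 1) ⊎ (odd k ≡ false × + 2 ∣ + k) → Rung (k ℕ.+ suc k)
        go (inj₁ (o , _)) = rung-add o (P.cong not o)
          (ℕsolve 1 (λ k → k ⊛ k ⊹ (Nc 1 ⊹ k) ⊛ (Nc 1 ⊹ k) ⊹ (k ⊛ k ⊹ (Nc 1 ⊹ k) ⊛ (Nc 1 ⊹ k)) ≜ Nc 1 ⊹ (k ⊹ (Nc 1 ⊹ k)) ⊛ (k ⊹ (Nc 1 ⊹ k))) P.refl k)
          (λ i e oe → trans (reflexive (P.cong₂ 𝕏 (minus i) (minus e))) (𝕏-neg i e (odd⇒≢O {i} {e} oe))) r r′
          where
            minus : ∀ i → + k ℤ.* i ℤ.- + suc k ℤ.* i ≡ ℤ.- i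
            minus i = ℤsolve 2 (λ k i → k ⊠ i ⊟ (ℤcon (+ 1) ⊞ k) ⊠ i ≛ ⊟ i) P.refl (+ k) i
        go (inj₂ (o , _)) = P.subst Rung (ℕP.+-comm (suc k) k) (rung-add (P.cong not o) o
          (ℕsolve 1 (λ k → (Nc 1 ⊹ k) ⊛ (Nc 1 ⊹ k) ⊹ k ⊛ k ⊹ ((Nc 1 ⊹ k) ⊛ (Nc 1 ⊹ k) ⊹ k ⊛ k) ≜ Nc 1 ⊹ ((Nc 1 ⊹ k) ⊹ k) ⊛ ((Nc 1 ⊹ k) ⊹ k)) P.refl k)
          (λ i e oe → reflexive (P.cong₂ 𝕏 (plus i) (plus e))) r′ r)
          where
            plus : ∀ i → + suc k ℤ.* i ℤ.- + k ℤ.* i ≡ i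
            plus i = ℤsolve 2 (λ k i → (ℤcon (+ 1) ⊞ k) ⊠ i ⊟ k ⊠ i ≛ i) P.refl (+ k) i

    -- A binary ladder: 2k is reached from k by doubling, and 2k + 1 from the neighbours k and k +
    -- 1.
    rung : ∀ m → 0 < m → Rung m
    rung = <-rec _ step
      where
        halves : ∀ m → Σ ℕ λ k → (m ≡ k ℕ.+ k) ⊎ (m ≡ k ℕ.+ suc k)
        halves zero = 0 , inj₁ P.refl
        halves (suc m) = go (halves m)
          where
            go : (Σ ℕ λ k → (m ≡ k ℕ.+ k) ⊎ (m ≡ k ℕ.+ suc k)) → Σ ℕ λ k → (suc m ≡ k ℕ.+ k) ⊎ (suc m ≡ k ℕ.+ suc k)
            go (k , inj₁ e) = k , inj₂ (P.trans (P.cong suc e) (P.sym (ℕP.+-suc k k)))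
            go (k , inj₂ e) = suc k , inj₁ (P.cong suc e)
        step : ∀ m → (∀ {k} → k < m → 0 < k → Rung k) → 0 < m → Rung m
        step m ih m>0 = go (halves m)
          where
            go : (Σ ℕ λ k → (m ≡ k ℕ.+ k) ⊎ (m ≡ k ℕ.+ suc k)) → Rung m
            go (zero , inj₁ P.refl) = ⊥-elim (ℕP.<-irrefl P.refl m>0)
            go (suc k , inj₁ P.refl) = rung-double (ih (ℕP.m<m+n (suc k) (s≤s z≤n)) (s≤s z≤n))
            go (zero , inj₂ P.refl) = rung-1
            go (suc k , inj₂ P.refl) = rung-next (ih (ℕP.m<m+n (suc k) (s≤s z≤n)) (s≤s z≤n)) (ih (ℕP.m<n+m (suc (suc k)) (s≤s z≤n)) (s≤s z≤n))

-- Sums over cosets of the subgroups of order p.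

module TorsionSums where
  open import Defs
  open import Data.Integer.Divisibility.Signed as ℤD using (_∣_; _∣?_; divides; ∣m∣n⇒∣m+n; ∣m∣n⇒∣m-n; ∣m⇒∣-m; ∣⇒∣ᵤ; ∣ᵤ⇒∣; ∣n⇒∣m*n)
  open CharacteristicTwo
  open FormalSeries
  open Homomorphisms
  open BilateralSums
  open LambertSeries
  open EisensteinSeries
  open TwoDivision
  open DivisorSums
  open RootsOfUnity
  open Embedding

  module Reindex (p h : ℕ) (p≡ : p ≡ suc (h ℕ.+ h)) (pr : Prime p) (3∤p : ¬ (3 ℕD.∣ p)) (rs : RootSystem (3 ℕ.* p)) where
    open Level p h p≡ pr 3∤p rs public
    open ℤSolve using () renaming (_:=_ to _≛_; solve to ℤsolve; _:+_ to _⊞_; _:-_ to _⊟_; _:*_ to _⊠_; :-_ to ⊟_; con to ℤcon)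
    open Units RS.S using (IsUnit)
    private
      LL = + (p ℕ.+ p ℕ.+ (p ℕ.+ p))

      dvd : ∀ {m a b} → a ≡ b → m ∣ a → m ∣ b
      dvd P.refl d = d

    other-factor : ∀ {v x} → ¬ (+ p ∣ v) → + p ∣ v ℤ.* x → + p ∣ x
    other-factor {v} {x} ne d = go (prime-∣-* pr v x d)
      where
        go : (+ p ∣ v) ⊎ (+ p ∣ x) → + p ∣ x
        go (inj₁ h) = ⊥-elim (ne h)
        go (inj₂ h) = h

    affine : ℤ → ℤ → ℕ → ℤ
    affine u v t = u ℤ.+ v ℤ.* + t

    affine-hits : ∀ u v k → ¬ (+ p ∣ v) → Σ ℕ λ t → (t < p) × (+ p ∣ k ℤ.- affine u v t) × (∀ s → s < p → + p ∣ k ℤ.- affine u v s → s ≡ t)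
    affine-hits u v k ne = go (invert-mod {p} {v} pr ne)
      where
        go : Σ ℤ (λ w → + p ∣ w ℤ.* v ℤ.- + 1) → _
        go (w , dw) = t , ℤDM.n%ℕd<d x p , hit , λ s s<p d → unique s s<p (other-factor ne (dvd (ℤsolve 5 (λ k u v s t → (k ⊟ (u ⊞ v ⊠ t)) ⊟ (k ⊟ (u ⊞ v ⊠ s)) ≛ v ⊠ (s ⊟ t)) P.refl k u v (+ s) (+ t)) (∣m∣n⇒∣m-n hit d)))
          where
            x = w ℤ.* (k ℤ.- u)
            t = x ℤDM.%ℕ p
            q = x ℤDM./ℕ p
            x≡ : x ≡ + t ℤ.+ q ℤ.* + p
            x≡ = ℤDM.a≡a%ℕn+[a/ℕn]*n x p
            hit : + p ∣ k ℤ.- affine u v t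
            hit = dvd (P.trans (P.cong (λ z → v ℤ.* (q ℤ.* + p) ℤ.- (w ℤ.* v ℤ.- + 1) ℤ.* (k ℤ.- u) ℤ.+ v ℤ.* z) (P.sym (P.trans (P.cong (ℤ._- (+ t ℤ.+ q ℤ.* + p)) x≡) (ℤP.+-inverseʳ (+ t ℤ.+ q ℤ.* + p)))))
                (ℤsolve 6 (λ k u v w t y → v ⊠ y ⊟ (w ⊠ v ⊟ ℤcon (+ 1)) ⊠ (k ⊟ u) ⊞ v ⊠ (w ⊠ (k ⊟ u) ⊟ (t ⊞ y)) ≛ k ⊟ (u ⊞ v ⊠ t)) P.refl k u v w (+ t) (q ℤ.* + p)))
              (∣m∣n⇒∣m+n (∣m∣n⇒∣m-n (∣n⇒∣m*n v (divides q P.refl)) (dvd (ℤP.*-comm (k ℤ.- u) (w ℤ.* v ℤ.- + 1)) (∣n⇒∣m*n (k ℤ.- u) dw))) (dvd (P.sym (ℤP.*-zeroʳ v)) (divides (+ 0) P.refl)))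
            unique : ∀ s → s < p → + p ∣ + s ℤ.- + t → s ≡ t
            unique s s<p d = ℤP.+-injective (ℤP.i-j≡0⇒i≡j (+ s) (+ t) (small-multiple p (+ s ℤ.- + t) d (P.subst (_< p) (P.cong ∣_∣ (P.sym (ℤP.m-n≡m⊖n s t))) (ℕP.≤-<-trans (ℤP.∣m⊝n∣≤m⊔n s t) (ℕP.⊔-lub s<p (ℤDM.n%ℕd<d x p))))))

    root-^ : ∀ i d → root i S.^ d S.≈ root (+ d ℤ.* i)
    root-^ i zero = S.sym (root-per _ (divides (+ 0) P.refl))
    root-^ i (suc d) = S.trans (S.*-congˡ _ (root-^ i d)) (S.trans (S.sym (root-+ i (+ d ℤ.* i))) (S.reflexive (P.cong root (ℤsolve 2 (λ d i → i ⊞ d ⊠ i ≛ (ℤcon (+ 1) ⊞ d) ⊠ i) P.refl (+ d) i))))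

    triple : ∀ x → + p ∣ x → + N ∣ + 3 ℤ.* x
    triple x (divides q P.refl) = divides q (P.trans (ℤsolve 2 (λ q p → ℤcon (+ 3) ⊠ (q ⊠ p) ≛ q ⊠ (ℤcon (+ 3) ⊠ p)) P.refl q (+ p)) (P.cong (q ℤ.*_) (P.sym (ℤP.pos-* 3 p))))

    untriple : ∀ x → + N ∣ + 3 ℤ.* x → + p ∣ x
    untriple x (divides q e) = divides q (ℤP.*-cancelˡ-≡ (+ 3) x (q ℤ.* + p) (P.trans e (P.trans (P.cong (q ℤ.*_) (ℤP.pos-* 3 p)) (ℤsolve 2 (λ q p → q ⊠ (ℤcon (+ 3) ⊠ p) ≛ ℤcon (+ 3) ⊠ (q ⊠ p)) P.refl q (+ p)))))

    -- Multiplied by 1 + `root y` the sum telescopes to zero, and that factor is a unit.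
    geometric : ∀ y → ¬ (+ N ∣ y) → + N ∣ y ℤ.* + p → S.sum p (λ t → root (y ℤ.* + t)) S.≈ S.0#
    geometric y ny per = go (one-minus-unit y ny)
      where
        telescope : ∀ n → (S.1# S.+ root y) S.* S.sum n (λ t → root (y ℤ.* + t)) S.≈ S.1# S.+ root (y ℤ.* + n)
        telescope zero = S.trans (S.zeroʳ _) (S.sym (S.trans (S.+-congˡ _ (root-per _ (dvd (P.sym (ℤP.*-zeroʳ y)) (divides (+ 0) P.refl)))) (S.double _)))
        telescope (suc n) = S.trans (S.distribˡ _ _ _) (S.trans (S.+-cong (S.distribʳ _ _ _) (telescope n)) (S.trans
          (S.+-congʳ _ (S.+-congˡ _ (S.trans (S.sym (root-+ y (y ℤ.* + n))) (S.reflexive (P.cong root (ℤsolve 2 (λ y n → y ⊞ y ⊠ n ≛ y ⊠ (ℤcon (+ 1) ⊞ n)) P.refl y (+ n)))))))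
          (S.solve 2 (λ a b → (S.I S.:* a S.:+ b) S.:+ (S.I S.:+ a) S.:= S.I S.:+ b) S.refl _ _)))
        go : IsUnit (S.1# S.+ root y) → S.sum p (λ t → root (y ℤ.* + t)) S.≈ S.0#
        go (w , e) = S.trans (S.sym (S.*-idˡ _)) (S.trans (S.*-congʳ _ (S.sym (S.trans (S.*-comm _ _) e))) (S.trans (S.*-assoc _ _ _) (S.trans (S.*-congˡ w (S.trans (telescope p)
          (S.trans (S.+-congˡ _ (root-per _ per)) (S.double _)))) (S.zeroʳ w))))

    -- The factor 3 restricts to powers of ζ, and v prime to p lets the index run through all
    -- residues. For p ∣ d the p terms are 1, and they add up to 1 because p is odd.
    orthogonality : ∀ u v d → ¬ (+ p ∣ v) → S.sum p (λ t → root (+ 3 ℤ.* affine u v t) S.^ d) S.≈ S.bit (does (p ℕD.∣? d))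
    orthogonality u v d ne = go (p ℕD.∣? d)
      where
        go : (D : Dec (p ℕD.∣ d)) → S.sum p (λ t → root (+ 3 ℤ.* affine u v t) S.^ d) S.≈ S.bit (does D)
        go (yes y) = S.trans (S.sum-cong p (λ t → S.trans (root-^ _ d) (root-per _ (dvd (ℤsolve 2 (λ d x → ℤcon (+ 3) ⊠ (x ⊠ d) ≛ d ⊠ (ℤcon (+ 3) ⊠ x)) P.refl (+ d) (affine u v t))
            (triple _ (∣n⇒∣m*n (affine u v t) (∣ᵤ⇒∣ {+ p} {+ d} y)))))))
          (S.trans (ones p) (S.reflexive (P.cong S.bit odd-p)))
          where
            ones : ∀ n → S.sum n (λ _ → S.1#) S.≈ S.bit (odd n)
            ones zero = S.refl
            ones (suc n) = S.trans (S.+-congˡ _ (ones n)) (flip (odd n))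
              where
                flip : ∀ b → S.1# S.+ S.bit b S.≈ S.bit (not b)
                flip true = S.double _
                flip false = S.+-idʳ _
        go (no n) = S.trans (S.sum-cong p (λ t → S.trans (root-^ _ d) (S.trans (S.reflexive (P.cong root (ℤsolve 4 (λ u v d t → d ⊠ (ℤcon (+ 3) ⊠ (u ⊞ v ⊠ t)) ≛ (d ⊠ (ℤcon (+ 3) ⊠ u)) ⊞ (ℤcon (+ 3) ⊠ (v ⊠ d)) ⊠ t) P.refl u v (+ d) (+ t)))) (root-+ (+ d ℤ.* (+ 3 ℤ.* u)) ((+ 3 ℤ.* (v ℤ.* + d)) ℤ.* + t)))))
          (S.trans (S.sym (S.sum-*ˡ p _ _)) (S.trans (S.*-congˡ _ (geometric (+ 3 ℤ.* (v ℤ.* + d)) (λ x → n (∣⇒∣ᵤ (other-factor ne (untriple _ x))))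
            (dvd (ℤsolve 3 (λ v d p → ℤcon (+ 3) ⊠ ((v ⊠ d) ⊠ p) ≛ (ℤcon (+ 3) ⊠ (v ⊠ d)) ⊠ p) P.refl v (+ d) (+ p)) (triple _ (∣n⇒∣m*n (v ℤ.* + d) ℤD.∣-refl))))) (S.zeroʳ _)))

    -- Replaces x by the twist of y with index 3a. These p substitutions, together with
    -- `embed ⊙ inflate-p`, correspond to the p + 1 subgroups of order p.
    σ : ℤ → Hom (PowerSeries.series boolAlg) (PowerSeries.series RS.S)
    σ a = twist RS.S (root (+ 3 ℤ.* a)) ⊙ coeffs

    inflate-p : Hom (PowerSeries.series boolAlg) (PowerSeries.series boolAlg)
    inflate-p = 𝔹S.inflateHom p

    inflate-sum : ∀ m k (f : ℕ → Carrier) .{{_ : NonZero k}} n → S.sum m (λ t → inflate k (f t) n) S.≈ inflate k (λ d → S.sum m (λ t → f t d)) n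
    inflate-sum m k f n with k ℕD.∣? n
    ... | yes (ℕD.divides q _) = S.refl
    ... | no _ = S.sum-0 m (λ _ _ → S.refl)

    -- The points are y^p times all p-th roots of unity. Orthogonality keeps the d divisible by p in
    -- the kernel Σ c(d) v^d, and as c (d p) = c d this is the kernel at v^p: the value at x^p.
    sum-subgroup : ∀ c (z : ℕ → S.Carrier) u v → c 0 ≡ false → (∀ d → c (d ℕ.* p) ≡ c d) → ¬ (+ p ∣ v) →
                   sum p (λ t → ΣZ (fam c (z t) (⟨ + 3 ℤ.* affine u v t ⟩ at P₄))) ≈ Hom.fun (embed ⊙ inflate-p) (lam c)
    sum-subgroup c z u v c0 cp ne = trans (ΣZ-sum p (λ t → fam c (z t) (⟨ + 3 ℤ.* affine u v t ⟩ at P₄))) (trans (ΣZ-cong termwise) (trans (Eis-P₄ (𝔹S.inflate p c) (S.sum p z) (P.trans (𝔹S.inflate-∣ p c 0) c0))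
        (Hom.fun-cong embed (lam-inflate p c c0))))
      where
        termwise : ∀ k → sum p (λ t → fam c (z t) (⟨ + 3 ℤ.* affine u v t ⟩ at P₄) k) ≈ fam (𝔹S.inflate p c) (S.sum p z) (⟨ + 0 ⟩ at P₄) k
        termwise k n = S.trans (sum-at p _ n) (go (LL ∣? (k ℤ.- P₄)))
          where
            coefficient : ∀ u v → ¬ (+ p ∣ v) → ∀ d → S.sum p (λ t → S.bit (c d) S.* root (+ 3 ℤ.* affine u v t) S.^ d) S.≈ S.bit (𝔹S.inflate p c d) S.* root (+ 0) S.^ d
            coefficient u v ne d = S.trans (S.sym (S.sum-*ˡ p _ _)) (S.trans (S.*-congˡ _ (orthogonality u v d ne)) (S.trans (select (p ℕD.∣? d))
                (S.sym (S.trans (S.*-congˡ _ (S.trans (S.^-cong d (root-per (+ 0) (divides (+ 0) P.refl))) (S.^-1 d))) (S.*-idʳ _)))))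
              where
                select : (D : Dec (p ℕD.∣ d)) → S.bit (c d) S.* S.bit (does D) S.≈ S.bit (𝔹S.inflate p c d)
                select (yes (ℕD.divides q P.refl)) = S.trans (S.*-idʳ _) (S.reflexive (P.cong S.bit (P.trans (cp q) (P.sym (𝔹S.inflate-∣ p c q)))))
                select (no n) = S.trans (S.zeroʳ _) (S.reflexive (P.cong S.bit (P.sym (𝔹S.inflate-∤ p c d n))))
            negated : ∀ t → ℤ.- (+ 3 ℤ.* affine u v t) ≡ + 3 ℤ.* affine (ℤ.- u) (ℤ.- v) t
            negated t = ℤsolve 3 (λ u v t → ⊟ (ℤcon (+ 3) ⊠ (u ⊞ v ⊠ t)) ≛ ℤcon (+ 3) ⊠ ((⊟ u) ⊞ (⊟ v) ⊠ t)) P.refl u v (+ t)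
            summed : ∀ k → S.sum p (λ t → term c (z t) ⟨ + 3 ℤ.* affine u v t ⟩ k n) S.≈ term (𝔹S.inflate p c) (S.sum p z) ⟨ + 0 ⟩ k n
            summed (+ zero) = constant n
              where
                constant : ∀ n → S.sum p (λ t → const (z t) n) S.≈ const (S.sum p z) n
                constant zero = S.refl
                constant (suc n) = S.sum-0 p (λ _ _ → S.refl)
            summed (+ suc m) = S.trans (inflate-sum p (suc m) (λ t → pows c (root (+ 3 ℤ.* affine u v t))) n) (inflate-cong (suc m) (coefficient u v ne) n)
            summed -[1+ m ] = S.trans (inflate-sum p (suc m) (λ t → pows c (root (ℤ.- (+ 3 ℤ.* affine u v t)))) n) (inflate-cong (suc m) (λ d →
              S.trans (S.sum-cong p (λ t → S.*-congˡ _ (S.^-cong d (S.reflexive (P.cong root (negated t)))))) (coefficient (ℤ.- u) (ℤ.- v) (λ x → ne (dvd (ℤP.neg-involutive v) (∣m⇒∣-m x))) d)) n)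
            go : (D : Dec (LL ∣ k ℤ.- P₄)) → S.sum p (λ t → restrict D (term c (z t) ⟨ + 3 ℤ.* affine u v t ⟩ k) n) S.≈ restrict D (term (𝔹S.inflate p c) (S.sum p z) ⟨ + 0 ⟩ k) n
            go (no _) = S.sum-0 p (λ _ _ → S.refl)
            go (yes _) = summed k

    -- The points are powers of one twist of y whose exponents are congruent to p modulo 4 and run
    -- through all residues modulo p, so their classes modulo 4p fill the class of p modulo 4. By
    -- `signs` the sum is then the Lambert series in the twisted y.
    sum-diagonal : ∀ c (z : ℕ → S.Carrier) a u v → c 0 ≡ false → + 4 ∣ u ℤ.- + p → + 4 ∣ v → ¬ (+ p ∣ v) →
                   sum p (λ t → ΣZ (fam c (z t) (⟨ + 3 ℤ.* a ℤ.* affine u v t ⟩ at affine u v t))) ≈ Hom.fun (σ a) (lam c)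
    sum-diagonal c z a u v c0 4∣u 4∣v ne = trans (ΣZ-sum p f) value
      where
        ε : ℕ → ℤ
        ε = affine u v
        f : ℕ → ℤ → Carrier
        f t = fam c (z t) (⟨ + 3 ℤ.* a ℤ.* ε t ⟩ at ε t)
        ζ = root (+ 3 ℤ.* a)
        class : ∀ t k → + 4 ∣ k ℤ.- ε t → + 4 ∣ k ℤ.- + p
        class t k d = dvd (ℤsolve 5 (λ k u v t p → (k ⊟ (u ⊞ v ⊠ t)) ⊞ ((u ⊟ p) ⊞ t ⊠ v) ≛ k ⊟ p) P.refl k u v (+ t) (+ p)) (∣m∣n⇒∣m+n d (∣m∣n⇒∣m+n 4∣u (∣n⇒∣m*n (+ t) 4∣v)))
        class′ : ∀ t k → + 4 ∣ k ℤ.- + p → + 4 ∣ k ℤ.- ε t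
        class′ t k d = dvd (ℤsolve 5 (λ k u v t p → (k ⊟ p) ⊟ ((u ⊟ p) ⊞ t ⊠ v) ≛ k ⊟ (u ⊞ v ⊠ t)) P.refl k u v (+ t) (+ p)) (∣m∣n⇒∣m-n d (∣m∣n⇒∣m+n 4∣u (∣n⇒∣m*n (+ t) 4∣v)))
        missed : ∀ k n → ¬ (+ 4 ∣ k ℤ.- + p) → sum p (λ t → f t k) n S.≈ S.0#
        missed k n nd = S.trans (sum-at p _ n) (S.sum-0 p (λ t _ → restrict-no (LL ∣? (k ℤ.- ε t)) _ (λ d → nd (class t k (proj₁ (split-L _ d)))) n))
        hit : ∀ k n → + 4 ∣ k ℤ.- + p → (x : S.Carrier) → (∀ t → + p ∣ k ℤ.- ε t → term c (z t) ⟨ + 3 ℤ.* a ℤ.* ε t ⟩ k n S.≈ x) → sum p (λ t → f t k) n S.≈ x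
        hit k n d x val = S.trans (sum-at p _ n) (go (affine-hits u v k ne))
          where
            go : Σ ℕ (λ t → (t < p) × (+ p ∣ k ℤ.- affine u v t) × (∀ s → s < p → + p ∣ k ℤ.- affine u v s → s ≡ t)) → S.sum p (λ t → f t k n) S.≈ x
            go (t , t<p , dt , uniq) = S.trans (S.only p t t<p (λ s s<p s≢t → restrict-no (LL ∣? (k ℤ.- ε s)) _ (λ l → s≢t (uniq s s<p (proj₂ (split-L _ l)))) n))
              (S.trans (restrict-yes (LL ∣? (k ℤ.- ε t)) _ (join-L _ (class′ t k d) dt) n) (val t dt))
        congruent : ∀ x y → + p ∣ x ℤ.- y → root (+ 3 ℤ.* a ℤ.* y) S.≈ root (+ 3 ℤ.* a ℤ.* x)
        congruent x y d = root-cong _ _ (dvd (ℤsolve 3 (λ a x y → ⊟ (ℤcon (+ 3) ⊠ (a ⊠ (x ⊟ y))) ≛ ℤcon (+ 3) ⊠ a ⊠ y ⊟ ℤcon (+ 3) ⊠ a ⊠ x) P.refl a x y) (∣m⇒∣-m (triple _ (∣n⇒∣m*n a d))))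
        ζ-value : ∀ m n x → x S.≈ root (+ 3 ℤ.* a ℤ.* + m) → .{{_ : NonZero m}} → inflate m (pows c x) n S.≈ S.bit (𝔹S.inflate m c n) S.* ζ S.^ n
        ζ-value m n x ex = go (m ℕD.∣? n)
          where
            go : Dec (m ℕD.∣ n) → inflate m (pows c x) n S.≈ S.bit (𝔹S.inflate m c n) S.* ζ S.^ n
            go (no nd) = S.trans (inflate-∤ m _ n nd) (S.sym (S.trans (S.*-congʳ _ (S.reflexive (P.cong S.bit (𝔹S.inflate-∤ m c n nd)))) (S.zeroˡ _)))
            go (yes (ℕD.divides q P.refl)) = S.trans (inflate-∣ m _ q) (S.*-cong (S.reflexive (P.cong S.bit (P.sym (𝔹S.inflate-∣ m c q))))
              (S.trans (S.^-cong q ex) (S.trans (root-^ _ q) (S.trans (S.reflexive (P.cong root (P.trans (ℤsolve 3 (λ a m q → q ⊠ (ℤcon (+ 3) ⊠ a ⊠ m) ≛ (q ⊠ m) ⊠ (ℤcon (+ 3) ⊠ a)) P.refl a (+ m) (+ q)) (P.cong (ℤ._* (+ 3 ℤ.* a)) (P.sym (ℤP.pos-* q m)))))) (S.sym (root-^ _ (q ℕ.* m)))))))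
        pair : ∀ i n → sum p (λ t → f t (+ suc i)) n S.+ sum p (λ t → f t -[1+ i ]) n S.≈ S.bit (odd (suc i) ∧ 𝔹S.inflate (suc i) c n) S.* ζ S.^ n
        pair i n = go (signs m)
          where
            m = suc i
            x = S.bit (𝔹S.inflate m c n) S.* ζ S.^ n
            plus-value : ∀ t → + p ∣ + m ℤ.- ε t → term c (z t) ⟨ + 3 ℤ.* a ℤ.* ε t ⟩ (+ m) n S.≈ x
            plus-value t d = ζ-value m n _ (congruent (+ m) (ε t) d)
            minus-value : ∀ t → + p ∣ -[1+ i ] ℤ.- ε t → term c (z t) ⟨ + 3 ℤ.* a ℤ.* ε t ⟩ -[1+ i ] n S.≈ x
            minus-value t d = ζ-value m n _ (S.trans (S.reflexive (P.cong root (ℤsolve 2 (λ a y → ⊟ (ℤcon (+ 3) ⊠ a ⊠ y) ≛ ℤcon (+ 3) ⊠ a ⊠ (⊟ y)) P.refl a (ε t))))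
              (congruent (+ m) (ℤ.- ε t) (dvd (ℤsolve 2 (λ m y → ⊟ ((⊟ m) ⊟ y) ≛ m ⊟ (⊟ y)) P.refl (+ m) (ε t)) (∣m⇒∣-m d))))
            select : ∀ b → odd m ≡ b → S.bit b S.* x S.≈ S.bit (odd m ∧ 𝔹S.inflate m c n) S.* ζ S.^ n
            select b o = S.trans (S.sym (S.*-assoc _ _ _)) (S.*-congʳ _ (S.trans (S.sym (S.bit-* b _)) (S.reflexive (P.cong (λ w → S.bit (w ∧ 𝔹S.inflate m c n)) (P.sym o)))))
            go : Signs m → sum p (λ t → f t (+ m)) n S.+ sum p (λ t → f t -[1+ i ]) n S.≈ S.bit (odd m ∧ 𝔹S.inflate m c n) S.* ζ S.^ n
            go (plus o d nd) = S.trans (S.+-cong (hit (+ m) n d x plus-value) (missed -[1+ i ] n nd)) (S.trans (S.+-idʳ x) (S.trans (S.sym (S.*-idˡ x)) (select true o)))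
            go (minus o nd d) = S.trans (S.+-cong (missed (+ m) n nd) (hit -[1+ i ] n d x minus-value)) (S.trans (S.+-idˡ x) (S.trans (S.sym (S.*-idˡ x)) (select true o)))
            go (neither o nd nd′) = S.trans (S.+-cong (missed (+ m) n nd) (missed -[1+ i ] n nd′)) (S.trans (S.+-idˡ _) (S.trans (S.sym (S.zeroˡ x)) (select false o)))
        4∤-p : ¬ (+ 4 ∣ + 0 ℤ.- + p)
        4∤-p d = 2∤odd (ℤ.- + h ℤ.- + 1) (dvd (P.trans (P.cong (λ z → + 0 ℤ.- z) p-odd) (ℤsolve 1 (λ h → ℤcon (+ 0) ⊟ (h ⊞ h ⊞ ℤcon (+ 1)) ≛ (⊟ h ⊟ ℤcon (+ 1)) ⊞ (⊟ h ⊟ ℤcon (+ 1)) ⊞ ℤcon (+ 1)) P.refl (+ h)))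
          (ℤD.∣-trans (divides (+ 2) P.refl) d))
        value : ΣZ (λ k → sum p (λ t → f t k)) ≈ Hom.fun (σ a) (lam c)
        value n = S.trans (expandΣ (λ k → sum p (λ t → f t k)) n (missed (+ 0) n 4∤-p)) (S.trans (S.sum-cong n (λ i → pair i n)) (S.trans (S.sym (S.sum-*ʳ n _ _))
          (S.*-congʳ _ (sum-bit n (λ i → odd (suc i) ∧ 𝔹S.inflate (suc i) c n)))))

-- The p² points whose p-th multiple is ±P₄.

module TorsionPoints where
  open import Defs using (Poly; rS; 𝟏; _+ₚ_; _*ₚ_)
  import Defs
  open import Data.Integer.Divisibility.Signed as ℤD using (_∣_; _∣?_; divides; ∣m∣n⇒∣m+n; ∣m∣n⇒∣m-n; ∣⇒∣ᵤ; ∣n⇒∣m*n)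
  open CharacteristicTwo
  open FormalSeries
  open Homomorphisms
  open BilateralSums
  open LambertSeries
  open EisensteinSeries
  open TwoDivision
  open LevelThreeLaw
  open DivisorSums
  open RootsOfUnity
  open Embedding
  open TorsionSums
  open NewtonSums
  open BoundedTraces
  open MultiplicationPolynomials

  module Points (p h : ℕ) (p≡ : p ≡ suc (h ℕ.+ h)) (pr : Prime p) (3∤p : ¬ (3 ℕD.∣ p)) (rs : RootSystem (3 ℕ.* p)) where
    open Reindex p h p≡ pr 3∤p rs public
    open ℤSolve using () renaming (_:=_ to _≛_; solve to ℤsolve; _:+_ to _⊞_; _:-_ to _⊟_; _:*_ to _⊠_; :-_ to ⊟_; con to ℤcon)
    private
      Λ = PowerSeries.series RS.S
      LL = + (p ℕ.+ p ℕ.+ (p ℕ.+ p))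
      H = + (p ℕ.+ p)

      dvd : ∀ {m a b} → a ≡ b → m ∣ a → m ∣ b
      dvd P.refl d = d

      module E = Hom embed
      module Hr = Horner (PowerSeries.series boolAlg)

    R : Carrier → Set
    R a = Σ Poly λ g → a ≈ E (OddForms.ev g)

    R-subring : IsSubring Λ R
    R-subring = record
      { resp = λ { e (g , q) → g , trans (sym e) q }
      ; one = 𝟏 , trans (sym E.fun-1) (E.fun-cong (𝔹S.sym (𝔹S.trans (𝔹S.+-congˡ 𝔹S.1# (𝔹S.zeroʳ rS)) (𝔹S.+-idʳ 𝔹S.1#))))
      ; add = λ { (f , e) (g , q) → f +ₚ g , trans (+-cong e q) (trans (sym (E.fun-+ (OddForms.ev f) (OddForms.ev g))) (E.fun-cong (𝔹S.sym (Hr.horner-+ f g rS)))) }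
      ; mul = λ { (f , e) (g , q) → f *ₚ g , trans (*-cong e q) (trans (sym (E.fun-* (OddForms.ev f) (OddForms.ev g))) (E.fun-cong (𝔹S.sym (Hr.horner-* f g rS)))) } }

    private
      module R = IsSubring R-subring

    -- A nonzero polynomial in r has leading coefficient 1, hence is regular whatever zero divisors
    -- `S` has.
    R-zero? : ∀ {a} → R a → (a ≈ 0#) ⊎ Reg a
    R-zero? {a} (g , e) = go (OddForms.zero? g)
      where
        go : OddForms.Zero? g → (a ≈ 0#) ⊎ Reg a
        go (OddForms.is-zero _ z) = inj₁ (trans e (trans (E.fun-cong z) E.fun-0))
        go (OddForms.has-lead m (low , top)) = inj₂ (reg-cong (sym e) (reg-lead (m ℕ.* p) {S.1#} ((λ i l → below i l (p ℕD.∣? i)) , S.trans (inflate-∣ p _ m) (S.reflexive (P.cong S.bit top))) S.reg-1))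
          where
            below : ∀ i → i < m ℕ.* p → Dec (p ℕD.∣ i) → E (OddForms.ev g) i S.≈ S.0#
            below i l (no n) = inflate-∤ p _ i n
            below i l (yes (ℕD.divides q P.refl)) = S.trans (inflate-∣ p _ q) (S.reflexive (P.cong S.bit (low q (ℕP.*-cancelʳ-< p q m l))))

    r̂∈ : R r̂
    r̂∈ = Defs.X , trans r̂-embed (E.fun-cong (𝔹S.sym OddForms.ev-X))

    A∈ : R A
    A∈ = R.resp (sym A-value) (R.mul (R.mul r̂∈ 1+r̂) (R.mul 1+r̂ 1+r̂))
      where
        1+r̂ : R (1# + r̂)
        1+r̂ = R.add R.one r̂∈

    XQ∈ : R XQ
    XQ∈ = R.resp (sym XQ-value) (R.mul (R.mul 1+r̂ 1+r̂) (R.mul 1+r̂ 1+r̂))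
      where
        1+r̂ : R (1# + r̂)
        1+r̂ = R.add R.one r̂∈

    open Ladder RS.S N p p>0 RS.cyclic R R-subring A∈ public
      using (Odd; odd⇒≢O; odd⇒≢T; odd-multiple; Rung; rung; Kummer; origin)

    p∤1 : ¬ (+ p ∣ + 1)
    p∤1 d = ¬prime[1] (P.subst Prime (ℕD.∣1⇒≡1 (∣⇒∣ᵤ d)) pr)

    p-half : ∀ x → + p ∣ + 2 ℤ.* x → + p ∣ x
    p-half x d = dvd (P.trans (P.cong (λ z → x ℤ.* z ℤ.- + h ℤ.* (+ 2 ℤ.* x)) p-odd) (ℤsolve 2 (λ x h → x ⊠ (h ⊞ h ⊞ ℤcon (+ 1)) ⊟ h ⊠ (ℤcon (+ 2) ⊠ x) ≛ x) P.refl x (+ h)))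
      (∣m∣n⇒∣m-n (∣n⇒∣m*n x ℤD.∣-refl) (∣n⇒∣m*n (+ h) d))

    p-quarter : ∀ x → + p ∣ + 4 ℤ.* x → + p ∣ x
    p-quarter x d = p-half x (p-half (+ 2 ℤ.* x) (dvd (ℤsolve 1 (λ x → ℤcon (+ 4) ⊠ x ≛ ℤcon (+ 2) ⊠ (ℤcon (+ 2) ⊠ x)) P.refl x) d))

    p∤small : ∀ a → suc a < p → ¬ (+ p ∣ + suc a)
    p∤small a l d = ℕP.<⇒≱ l (ℕD.∣⇒≤ (∣⇒∣ᵤ d))

    odd-class : ∀ e → + 4 ∣ e ℤ.- + p → Odd e
    odd-class e d d2 = 2∤odd (ℤ.- + h ℤ.- + 1) (dvd (P.trans (P.cong (λ z → e ℤ.- z ℤ.- e) p-odd) (ℤsolve 2 (λ e h → (e ⊟ (h ⊞ h ⊞ ℤcon (+ 1))) ⊟ e ≛ (⊟ h ⊟ ℤcon (+ 1)) ⊞ (⊟ h ⊟ ℤcon (+ 1)) ⊞ ℤcon (+ 1)) P.refl e (+ h)))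
      (∣m∣n⇒∣m-n (ℤD.∣-trans (divides (+ 2) P.refl) d) d2))

    -- p · (3x, e) = ±P₄ on the curve, the sign being that of p mod 4.
    𝕏-p-multiple : ∀ x {i} e → i ≡ + 3 ℤ.* x → + 4 ∣ e ℤ.- + p → 𝕏 (+ p ℤ.* i) (+ p ℤ.* e) ≈ A
    𝕏-p-multiple x e P.refl d = go (parity (+ h))
      where
        index : + N ∣ + p ℤ.* (+ 3 ℤ.* x)
        index = dvd (ℤsolve 2 (λ x p → ℤcon (+ 3) ⊠ (x ⊠ p) ≛ p ⊠ (ℤcon (+ 3) ⊠ x)) P.refl x (+ p)) (triple _ (∣n⇒∣m*n x ℤD.∣-refl))
        base : LL ∣ + p ℤ.* (e ℤ.- + p)
        base = join-L _ (∣n⇒∣m*n (+ p) d) (dvd (ℤP.*-comm (e ℤ.- + p) (+ p)) (∣n⇒∣m*n (e ℤ.- + p) ℤD.∣-refl))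
        go : Σ ℤ (λ m → (+ h ≡ m ℤ.+ m) ⊎ (+ h ≡ m ℤ.+ m ℤ.+ + 1)) → 𝕏 (+ p ℤ.* (+ 3 ℤ.* x)) (+ p ℤ.* e) ≈ A
        go (m , inj₁ q) = 𝕏-near P₄ index (dvd (P.trans (P.cong (λ z → + p ℤ.* (e ℤ.- + p) ℤ.+ (+ p ℤ.* z ℤ.- + p)) (P.sym p≡4m+1)) (ℤsolve 2 (λ p e → p ⊠ (e ⊟ p) ⊞ (p ⊠ p ⊟ p) ≛ p ⊠ e ⊟ p) P.refl (+ p) e))
            (∣m∣n⇒∣m+n base (join-L _ (divides (+ p ℤ.* m) (ℤsolve 2 (λ p m → p ⊠ (ℤcon (+ 4) ⊠ m ⊞ ℤcon (+ 1)) ⊟ p ≛ (p ⊠ m) ⊠ ℤcon (+ 4)) P.refl (+ p) m))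
              (divides (+ 4 ℤ.* m) (ℤsolve 2 (λ p m → p ⊠ (ℤcon (+ 4) ⊠ m ⊞ ℤcon (+ 1)) ⊟ p ≛ (ℤcon (+ 4) ⊠ m) ⊠ p) P.refl (+ p) m))))) L∤P₄
          where
            p≡4m+1 : + p ≡ + 4 ℤ.* m ℤ.+ + 1
            p≡4m+1 = P.trans p-odd (P.trans (P.cong (λ z → z ℤ.+ z ℤ.+ + 1) q) (ℤsolve 1 (λ m → (m ⊞ m) ⊞ (m ⊞ m) ⊞ ℤcon (+ 1) ≛ ℤcon (+ 4) ⊠ m ⊞ ℤcon (+ 1)) P.refl m))
        go (m , inj₂ q) = trans (𝕏-near (ℤ.- P₄) index (dvd (P.trans (P.cong (λ z → + p ℤ.* (e ℤ.- + p) ℤ.+ (+ p ℤ.* z ℤ.+ + p)) (P.sym p≡4m+3)) (ℤsolve 2 (λ p e → p ⊠ (e ⊟ p) ⊞ (p ⊠ p ⊞ p) ≛ p ⊠ e ⊟ (⊟ p)) P.refl (+ p) e))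
            (∣m∣n⇒∣m+n base (join-L _ (divides (+ p ℤ.* m ℤ.+ + p) (ℤsolve 2 (λ p m → p ⊠ (ℤcon (+ 4) ⊠ m ⊞ ℤcon (+ 3)) ⊞ p ≛ (p ⊠ m ⊞ p) ⊠ ℤcon (+ 4)) P.refl (+ p) m))
              (divides (+ 4 ℤ.* m ℤ.+ + 4) (ℤsolve 2 (λ p m → p ⊠ (ℤcon (+ 4) ⊠ m ⊞ ℤcon (+ 3)) ⊞ p ≛ (ℤcon (+ 4) ⊠ m ⊞ ℤcon (+ 4)) ⊠ p) P.refl (+ p) m))))) L∤-P₄) A-neg
          where
            p≡4m+3 : + p ≡ + 4 ℤ.* m ℤ.+ + 3
            p≡4m+3 = P.trans p-odd (P.trans (P.cong (λ z → z ℤ.+ z ℤ.+ + 1) q) (ℤsolve 1 (λ m → (m ⊞ m ⊞ ℤcon (+ 1)) ⊞ (m ⊞ m ⊞ ℤcon (+ 1)) ⊞ ℤcon (+ 1) ≛ ℤcon (+ 4) ⊠ m ⊞ ℤcon (+ 3)) P.refl m))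

    -- The p² points with p-th multiple ±P₄: (a, j) stands for ζ^{a·scale j} y^{p+4j}. With scale j = p + 4j for j > 0 it is
    -- the (p+4j)-th power of ζ^a y, so that its multiples by 1 + 4t depend only on a.
    scale : ℕ → ℤ
    scale zero = + 1
    scale (suc j) = affine (+ p) (+ 4) (suc j)

    index : ℕ → ℕ → ℤ
    index a j = + 3 ℤ.* (+ a ℤ.* scale j)

    exponent : ℕ → ℤ
    exponent j = affine (+ p) (+ 4) j

    exponent-class : ∀ j → + 4 ∣ exponent j ℤ.- + p
    exponent-class j = divides (+ j) (ℤsolve 2 (λ p j → (p ⊞ ℤcon (+ 4) ⊠ j) ⊟ p ≛ j ⊠ ℤcon (+ 4)) P.refl (+ p) (+ j))

    p∤exponent : ∀ j → suc j < p → ¬ (+ p ∣ exponent (suc j))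
    p∤exponent j l d = p∤small j l (p-quarter _ (dvd (ℤsolve 2 (λ p x → (p ⊞ x) ⊟ p ≛ x) P.refl (+ p) (+ 4 ℤ.* + suc j)) (∣m∣n⇒∣m-n d ℤD.∣-refl)))

    p∤scale : ∀ j → j < p → ¬ (+ p ∣ scale j)
    p∤scale zero l = p∤1
    p∤scale (suc j) l = p∤exponent j l

    residue-unique : ∀ a b → a < p → b < p → + p ∣ + a ℤ.- + b → a ≡ b
    residue-unique a b a<p b<p d = ℤP.+-injective (ℤP.i-j≡0⇒i≡j (+ a) (+ b) (small-multiple p (+ a ℤ.- + b) d
      (P.subst (_< p) (P.cong ∣_∣ (P.sym (ℤP.m-n≡m⊖n a b))) (ℕP.≤-<-trans (ℤP.∣m⊝n∣≤m⊔n a b) (ℕP.⊔-lub a<p b<p)))))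

    exponent-odd : ∀ j → Odd (exponent j)
    exponent-odd j = odd-class _ (exponent-class j)

    -- The point must be excluded from P = ±Q. The exponents of P and Q add up to 2 modulo 4, so P =
    -- -Q is impossible; P = Q forces equal j, then equal a because `scale j` is prime to p. Fixing
    -- the exponent class modulo 4 thus picks one point from each pair ±P.
    points-distinct : ∀ a b j k → a < p → b < p → j < p → k < p → ¬ (a ≡ b × j ≡ k) → Reg (𝕏 (index a j) (exponent j) + 𝕏 (index b k) (exponent k))
    points-distinct a b j k a<p b<p j<p k<p ne = 𝕏-reg-+ (odd⇒≢O {index a j} (exponent-odd j)) (odd⇒≢T {index a j} (exponent-odd j)) (odd⇒≢O {index b k} (exponent-odd k)) (odd⇒≢T {index b k} (exponent-odd k))
        (λ { (_ , d) → p∤1 (p-half (+ 1) (dvd-two (proj₁ (split-L _ d)))) }) (λ { (c , d) → apart c (same-exponent d) })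
      where
        dvd-two : + 4 ∣ exponent j ℤ.+ exponent k → + p ∣ + 2 ℤ.* + 1
        dvd-two d = ⊥-elim (2∤odd (+ h) (P.subst (+ 2 ∣_) p-odd (4-to-2 (+ p) (dvd (ℤsolve 3 (λ p j k → (p ⊞ ℤcon (+ 4) ⊠ j) ⊞ (p ⊞ ℤcon (+ 4) ⊠ k) ⊟ (j ⊞ k) ⊠ ℤcon (+ 4) ≛ p ⊞ p) P.refl (+ p) (+ j) (+ k))
          (∣m∣n⇒∣m-n d (∣n⇒∣m*n (+ j ℤ.+ + k) ℤD.∣-refl))))))
        same-exponent : LL ∣ exponent j ℤ.- exponent k → j ≡ k
        same-exponent d = residue-unique j k j<p k<p (p-quarter _ (dvd (ℤsolve 3 (λ p j k → (p ⊞ ℤcon (+ 4) ⊠ j) ⊟ (p ⊞ ℤcon (+ 4) ⊠ k) ≛ ℤcon (+ 4) ⊠ (j ⊟ k)) P.refl (+ p) (+ j) (+ k)) (proj₂ (split-L _ d))))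
        apart : + N ∣ index a j ℤ.- index b k → j ≡ k → ⊥
        apart c P.refl = ne (residue-unique a b a<p b<p (other-factor (p∤scale j j<p) (untriple _ (dvd (ℤsolve 3 (λ a b s → ℤcon (+ 3) ⊠ (a ⊠ s) ⊟ ℤcon (+ 3) ⊠ (b ⊠ s) ≛ ℤcon (+ 3) ⊠ (s ⊠ (a ⊟ b))) P.refl (+ a) (+ b) (scale j)) c))) , P.refl)

    -- Being 1 modulo 4, these multipliers keep the exponent congruent to p modulo 4; as 4t runs
    -- through all residues modulo p, they sweep the coset of P under the subgroup generated by 4P.
    mult : ℕ → ℕ
    mult t = suc (4 ℕ.* t)

    mult-form : ∀ t → + mult t ≡ + 1 ℤ.+ + 4 ℤ.* + t
    mult-form t = P.cong (λ z → + 1 ℤ.+ z) (ℤP.pos-* 4 t)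

    mult-odd : ∀ t → odd (mult t) ≡ true
    mult-odd t = P.trans (P.cong not (P.trans (odd-* 4 t) P.refl)) P.refl

    mult-class : ∀ t e → + 4 ∣ e ℤ.- + p → + 4 ∣ + mult t ℤ.* e ℤ.- + p
    mult-class t e d = dvd (P.trans (ℤsolve 3 (λ t e p → (e ⊟ p) ⊞ (t ⊠ e) ⊠ ℤcon (+ 4) ≛ (ℤcon (+ 1) ⊞ ℤcon (+ 4) ⊠ t) ⊠ e ⊟ p) P.refl (+ t) e (+ p)) (P.cong (λ z → z ℤ.* e ℤ.- + p) (P.sym (mult-form t))))
      (∣m∣n⇒∣m+n d (divides (+ t ℤ.* e) P.refl))

    𝕊 : (ℕ → Bool) → (ℤ → S.Carrier) → ℤ → ℤ → Carrier
    𝕊 c z i e = ΣZ (fam c (z i) (⟨ i ⟩ at e))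

    𝕊-cong : ∀ c z {i j e f} → i ≡ j → ¬ (LL ∣ f) → LL ∣ e ℤ.- f → 𝕊 c z i e ≈ 𝕊 c z j f
    𝕊-cong c z {i} {_} {e} {f} P.refl nf d = ΣZ-cong (fam-cong c (z i) (z i) (⟨ i ⟩ at e) (⟨ i ⟩ at f) (same S.refl S.refl d) (λ _ _ _ _ → S.refl))

    -- The substitution for x that yields ϱ at the point (a, j): x itself at P₄, x^p at the other
    -- points of the row j = 0, and the twist of y belonging to a elsewhere, independently of j.
    fibre : ℕ → ℕ → Hom (PowerSeries.series boolAlg) Λ
    fibre zero zero = embed
    fibre zero (suc a) = embed ⊙ inflate-p
    fibre (suc j) a = σ (+ a)

    constant-sum : ∀ n x → sum n (λ _ → x) ≈ bit (odd n) * x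
    constant-sum zero x = sym (zeroˡ x)
    constant-sum (suc n) x = trans (+-congˡ x (constant-sum n x)) (flip (odd n))
      where
        flip : ∀ b → x + bit b * x ≈ bit (not b) * x
        flip true = solve 1 (λ x → x :+ I :* x := O :* x) refl x
        flip false = solve 1 (λ x → x :+ O :* x := I :* x) refl x

    sum-fibre : ∀ c z a j → c 0 ≡ false → (∀ d → c (d ℕ.* p) ≡ c d) → a < p → j < p →
                sum p (λ t → 𝕊 c z (+ mult t ℤ.* index a j) (+ mult t ℤ.* exponent j)) ≈ Hom.fun (fibre j a) (lam c)
    -- At P₄ all the multiples coincide, as 4P₄ is the origin; an odd number p of equal terms leaves
    -- one of them.
    sum-fibre c z zero zero c0 cp a<p j<p = begin
        sum p (λ t → 𝕊 c z (+ mult t ℤ.* index 0 0) (+ mult t ℤ.* exponent 0)) ≈⟨ sum-cong p (λ t → 𝕊-cong c z (vanishes t) L∤P₄ (stay t)) ⟩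
        sum p (λ _ → 𝕊 c z (+ 0) P₄) ≈⟨ trans (constant-sum p _) (trans (*-congʳ _ (reflexive (P.cong bit odd-p))) (*-idˡ _)) ⟩
        𝕊 c z (+ 0) P₄ ≈⟨ Eis-P₄ c (z (+ 0)) c0 ⟩
        E (lam c) ∎
      where
        vanishes : ∀ t → + mult t ℤ.* index 0 0 ≡ + 0
        vanishes t = ℤP.*-zeroʳ (+ mult t)
        stay : ∀ t → LL ∣ + mult t ℤ.* exponent 0 ℤ.- P₄
        stay t = join-L _ (mult-class t (exponent 0) (exponent-class 0)) (divides (+ mult t ℤ.- + 1) (ℤsolve 2 (λ m p → m ⊠ (p ⊞ ℤcon (+ 4) ⊠ ℤcon (+ 0)) ⊟ p ≛ (m ⊟ ℤcon (+ 1)) ⊠ p) P.refl (+ mult t) (+ p)))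
    sum-fibre c z (suc a) zero c0 cp a<p j<p =
        trans (sum-cong p (λ t → 𝕊-cong c z (P.trans (P.cong (ℤ._* index (suc a) 0) (mult-form t)) (ℤsolve 2 (λ t a → (ℤcon (+ 1) ⊞ ℤcon (+ 4) ⊠ t) ⊠ (ℤcon (+ 3) ⊠ (a ⊠ ℤcon (+ 1))) ≛ ℤcon (+ 3) ⊠ (a ⊞ (ℤcon (+ 4) ⊠ a) ⊠ t)) P.refl (+ t) (+ suc a))) L∤P₄ (stay t)))
          (sum-subgroup c (λ t → z (+ 3 ℤ.* affine (+ suc a) (+ 4 ℤ.* + suc a) t)) (+ suc a) (+ 4 ℤ.* + suc a) c0 cp (λ d → p∤small a a<p (p-quarter _ d)))
      where
        stay : ∀ t → LL ∣ + mult t ℤ.* exponent 0 ℤ.- P₄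
        stay t = join-L _ (mult-class t (exponent 0) (exponent-class 0)) (divides (+ mult t ℤ.- + 1) (ℤsolve 2 (λ m p → m ⊠ (p ⊞ ℤcon (+ 4) ⊠ ℤcon (+ 0)) ⊟ p ≛ (m ⊟ ℤcon (+ 1)) ⊠ p) P.refl (+ mult t) (+ p)))
    sum-fibre c z a (suc j) c0 cp a<p j<p = trans (sum-cong p (λ t → reflexive (P.cong₂ (𝕊 c z) (indices t) (exponents t))))
        (sum-diagonal c (λ t → z (+ 3 ℤ.* + a ℤ.* affine ε (+ 4 ℤ.* ε) t)) (+ a) ε (+ 4 ℤ.* ε) c0 (exponent-class (suc j)) (divides ε (ℤP.*-comm (+ 4) ε)) (λ d → p∤exponent j j<p (p-quarter _ d)))
      where
        ε = exponent (suc j)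
        exponents : ∀ t → + mult t ℤ.* ε ≡ affine ε (+ 4 ℤ.* ε) t
        exponents t = P.trans (P.cong (ℤ._* ε) (mult-form t)) (ℤsolve 2 (λ t e → (ℤcon (+ 1) ⊞ ℤcon (+ 4) ⊠ t) ⊠ e ≛ e ⊞ (ℤcon (+ 4) ⊠ e) ⊠ t) P.refl (+ t) ε)
        indices : ∀ t → + mult t ℤ.* index a (suc j) ≡ + 3 ℤ.* + a ℤ.* affine ε (+ 4 ℤ.* ε) t
        indices t = P.trans (ℤsolve 3 (λ m a e → m ⊠ (ℤcon (+ 3) ⊠ (a ⊠ e)) ≛ ℤcon (+ 3) ⊠ a ⊠ (m ⊠ e)) P.refl (+ mult t) (+ a) ε) (P.cong (λ w → + 3 ℤ.* + a ℤ.* w) (exponents t))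

-- The polynomial Ψ, its roots, and the weighted traces.

module ModularSums where
  open import Defs using (Series; rS)
  open import Data.Integer.Divisibility.Signed as ℤD using (_∣_; _∣?_; divides)
  open CharacteristicTwo
  open FormalSeries
  open Homomorphisms
  open LambertSeries
  open EisensteinSeries using (module ℤSolve)
  open DivisorSums
  open RootsOfUnity
  open NewtonSums
  open BoundedTraces
  open MultiplicationPolynomials
  open TorsionPoints

  module Modular (p h : ℕ) (p≡ : p ≡ suc (h ℕ.+ h)) (pr : Prime p) (3∤p : ¬ (3 ℕD.∣ p)) (rs : RootSystem (3 ℕ.* p))
                 (rungs : ∀ m → 0 < m → Points.Rung p h p≡ pr 3∤p rs m) where
    open Points p h p≡ pr 3∤p rs public
    open ℤSolve using () renaming (_:=_ to _≛_; solve to ℤsolve; _:+_ to _⊞_; _:-_ to _⊟_; _:*_ to _⊠_; :-_ to ⊟_; con to ℤcon)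
    private
      Λ = PowerSeries.series RS.S
      LL = + (p ℕ.+ p ℕ.+ (p ℕ.+ p))
      module E = Hom embed
      module R = IsSubring R-subring
      module SΛ = Series Λ
      module Q = Ring (Bounded.polynomials Λ)

      dvd : ∀ {m a b} → a ≡ b → m ∣ a → m ∣ b
      dvd P.refl d = d

    open CoefficientsIn Λ R R-subring
    open Evaluation Λ
    open Eval Λ using (evalP)
    open Kummer

    private
      𝓡 : Rung p
      𝓡 = rungs p p>0

      m = Rung.deg 𝓡

      p²≡ : suc m ≡ p ℕ.* p
      p²≡ = Rung.deg≡ 𝓡

      A-top : Top 0 A (SΛ.const A)
      A-top = record { bound = Bounded.deg-const Λ A ; top = refl ; coeffs∈ = λ { zero → A∈ ; (suc _) → R.nil } }

      AQ : Q.Carrier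
      AQ = SΛ.const A , 0 , bound A-top

      ΨQ : Q.Carrier
      ΨQ = Rung.numQ 𝓡 Q.+ AQ Q.* Rung.denQ 𝓡

      ψ : ℕ → Carrier
      ψ = proj₁ ΨQ

      ψ-top : Top (suc m) 1# ψ
      ψ-top = recast P.refl (+-idʳ 1#) (Rung.num-top 𝓡 ⊕ raise A-den ℕP.≤-refl)
        where
          A-den = A-top ⊗ Rung.den-top 𝓡

      value-const : ∀ α {a} d → value α (SΛ.const a , 0 , d) ≈ a
      value-const α d = trans (+-congˡ _ (zeroʳ α)) (+-idʳ _)

      ψ-value : ∀ α → evalP (suc (suc m)) ψ α ≈ value α (Rung.numQ 𝓡) + A * value α (Rung.denQ 𝓡)
      ψ-value α = trans (Hom.fun-cong (evaluation α) {ψ , suc m , bound ψ-top} {ΨQ} (λ i → refl)) (trans (Hom.fun-+ (evaluation α) (Rung.numQ 𝓡) (AQ Q.* Rung.denQ 𝓡))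
        (+-congˡ _ (trans (Hom.fun-* (evaluation α) AQ (Rung.denQ 𝓡)) (*-congʳ _ (value-const α (bound A-top))))))

    -- Ψ = N_p + A D_p vanishes where X(pP) = A.
    Ψ-root : ∀ x {i} e → i ≡ + 3 ℤ.* x → + 4 ∣ e ℤ.- + p → evalP (suc (suc m)) ψ (𝕏 i e) ≈ 0#
    Ψ-root x {i} e i≡ d = trans (ψ-value (𝕏 i e)) (≈⇒+≈0 (trans (proj₁ k) (*-congʳ _ (𝕏-p-multiple x e i≡ d))))
      where
        k = affine′ (Rung.kummer 𝓡 i e (odd-class e d)) (odd⇒≢O {+ p ℤ.* i} (odd-multiple p odd-p (odd-class e d)))
          where
            affine′ : ∀ {i e x y} → Kummer i e x y → ¬ IsO i e → (x ≈ 𝕏 i e * y) × Reg y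
            affine′ = Kummer.affine

    private
      a# j# : ℕ → ℕ
      a# i = i ℕDM.% p
      j# i = i ℕDM./ p

      a#< : ∀ i → a# i < p
      a#< i = ℕDM.m%n<n i p

      j#< : ∀ i → i < suc m → j# i < p
      j#< i l = ℕDM.m<n*o⇒m/o<n {i} {p} {p} (P.subst (i <_) p²≡ l)

      ι : ℕ → ℤ
      ι i = index (a# i) (j# i)

      ε : ℕ → ℤ
      ε i = exponent (j# i)

      ε-class : ∀ i → + 4 ∣ ε i ℤ.- + p
      ε-class i = exponent-class (j# i)

      ε-odd : ∀ i → Odd (ε i)
      ε-odd i = exponent-odd (j# i)

      α : ℕ → Carrier
      α i = 𝕏 (ι i) (ε i)

      α-root : ∀ i → i < suc m → evalP (suc (suc m)) ψ (α i) ≈ 0#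
      α-root i _ = Ψ-root (+ a# i ℤ.* scale (j# i)) (ε i) P.refl (ε-class i)

      α-distinct : ∀ i k → i < k → k < suc m → Reg (α i + α k)
      α-distinct i k i<k k<n = points-distinct (a# i) (a# k) (j# i) (j# k) (a#< i) (a#< k) (j#< i (ℕP.<-trans i<k k<n)) (j#< k k<n)
        (λ { (e , e′) → ℕP.<⇒≢ i<k (P.trans (ℕDM.m≡m%n+[m/n]*n i p) (P.trans (P.cong₂ (λ x y → x ℕ.+ y ℕ.* p) e e′) (P.sym (ℕDM.m≡m%n+[m/n]*n k p)))) })

    open Trace Λ R R-subring R-zero? m ψ (coeffs∈ ψ-top) (top ψ-top) α α-root α-distinct
      using (Λⁿ; Span; span; span-constant; span-α; Definable; fraction; definable-sum; F-sum; module Conjugates)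

    private
      n = suc m
      module F = Ring Λⁿ
      module Sp = IsSubring span

      constant∈ : ∀ {a} → R a → Span (λ _ → a)
      constant∈ {a} h = span-constant (a , h , F.refl)

      poly∈ : ∀ k f → (∀ l → R (f l)) → Span (λ i → evalP k f (α i))
      poly∈ zero f h = Sp.nil
      poly∈ (suc k) f h = Sp.add (constant∈ (h 0)) (Sp.mul span-α (poly∈ k (f ∘ suc) (h ∘ suc)))

      rungT : ∀ t → Rung (mult t)
      rungT t = rungs (mult t) (s≤s z≤n)

      𝕏t 𝕎t num den : ℕ → ℕ → Carrier
      𝕏t t i = 𝕏 (+ mult t ℤ.* ι i) (+ mult t ℤ.* ε i)
      𝕎t t i = 𝕎 (+ mult t ℤ.* ι i) (+ mult t ℤ.* ε i)
      num t i = value (α i) (Rung.numQ (rungT t))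
      den t i = value (α i) (Rung.denQ (rungT t))

      num∈ : ∀ t → Span (num t)
      num∈ t = poly∈ (suc (suc (Rung.deg (rungT t)))) (Rung.num (rungT t)) (coeffs∈ (Rung.num-top (rungT t)))

      den∈ : ∀ t → Span (den t)
      den∈ t = poly∈ (suc (Rung.deg (rungT t))) (Rung.den (rungT t)) (coeffs∈ (Rung.den-top (rungT t)))

      εt-odd : ∀ t i → Odd (+ mult t ℤ.* ε i)
      εt-odd t i = odd-multiple (mult t) (mult-odd t) (ε-odd i)

      kummer-t : ∀ t i → (num t i ≈ 𝕏t t i * den t i) × Reg (den t i)
      kummer-t t i = Kummer.affine (Rung.kummer (rungT t) (ι i) (ε i) (ε-odd i)) (odd⇒≢O {+ mult t ℤ.* ι i} (εt-odd t i))

      odd⇒∤ : ∀ {e} → Odd e → ¬ (LL ∣ e)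
      odd⇒∤ o d = o (ℤD.∣-trans (divides (+ 2) P.refl) (proj₁ (split-L _ d)))

      𝕏t-definable : ∀ t → Definable (𝕏t t)
      𝕏t-definable t = fraction (𝕏t t) (den t) (num t) (den∈ t) (λ i _ → proj₂ (kummer-t t i)) (num∈ t) (λ i _ → trans (*-comm _ _) (sym (proj₁ (kummer-t t i))))

      -- By `𝕎-law`, 𝕎 = 𝕏/(𝕏 + XQ), so with 𝕏 = num/den it is num/(num + XQ den), a fraction of
      -- elements of R[α].
      𝕎t-definable : ∀ t → Definable (𝕎t t)
      𝕎t-definable t = fraction (𝕎t t) (num t F.+ (λ _ → XQ) F.* den t) (num t) (Sp.add (num∈ t) (Sp.mul (constant∈ XQ∈) (den∈ t)))
          (λ i _ → reg-cong (sym (sum-form i)) (reg-* (𝕏+XQ-reg (+ mult t ℤ.* ι i) (+ mult t ℤ.* ε i) (odd⇒∤ (εt-odd t i))) (proj₂ (kummer-t t i)))) (num∈ t)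
          (λ i _ → begin
            (num t i + XQ * den t i) * 𝕎t t i ≈⟨ *-congʳ _ (sum-form i) ⟩
            ((𝕏t t i + XQ) * den t i) * 𝕎t t i ≈⟨ solve 3 (λ a d w → (a :* d) :* w := (w :* a) :* d) refl (𝕏t t i + XQ) (den t i) (𝕎t t i) ⟩
            (𝕎t t i * (𝕏t t i + XQ)) * den t i ≈⟨ *-congʳ _ (𝕎-law (+ mult t ℤ.* ι i) (+ mult t ℤ.* ε i) (odd⇒∤ (εt-odd t i))) ⟩
            𝕏t t i * den t i ≈⟨ sym (proj₁ (kummer-t t i)) ⟩
            num t i ∎)
        where
          sum-form : ∀ i → num t i + XQ * den t i ≈ (𝕏t t i + XQ) * den t i
          sum-form i = trans (+-congʳ _ (proj₁ (kummer-t t i))) (sym (distribʳ _ _ _))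

      -- The multiplier leaves the exponent class modulo 4 unchanged, so (1 + 4t)P is again a point
      -- with p-th multiple ±P₄.
      𝕏t-root : ∀ t i → i < n → evalP (suc (suc m)) ψ (𝕏t t i) ≈ 0#
      𝕏t-root t i _ = Ψ-root (+ mult t ℤ.* (+ a# i ℤ.* scale (j# i))) (+ mult t ℤ.* ε i)
        (ℤsolve 2 (λ m x → m ⊠ (ℤcon (+ 3) ⊠ x) ≛ ℤcon (+ 3) ⊠ (m ⊠ x)) P.refl (+ mult t) (+ a# i ℤ.* scale (j# i))) (mult-class t (ε i) (ε-class i))

      ϱF : F.Carrier
      ϱF = F.sum p 𝕎t

    ϱ : ℕ → ℕ → Carrier
    ϱ j a = Hom.fun (fibre j a) rS

    non3-p* : ∀ d → non3 (d ℕ.* p) ≡ non3 d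
    non3-p* d = P.trans (non3-∣ (d ℕ.* p)) (P.trans (P.cong (true xor_) (same-does (3 ℕD.∣? (d ℕ.* p)) (3 ℕD.∣? d))) (P.sym (non3-∣ d)))
      where
        open import Data.Nat.Primality using (euclidsLemma)
        same-does : (x : Dec (3 ℕD.∣ d ℕ.* p)) (y : Dec (3 ℕD.∣ d)) → does x ≡ does y
        same-does (yes _) (yes _) = P.refl
        same-does (no _) (no _) = P.refl
        same-does (no x) (yes y) = ⊥-elim (x (ℕD.∣-trans y (ℕD.m∣m*n p)))
        same-does (yes x) (no y) = ⊥-elim (neither-factor (euclidsLemma d p three-prime x))
          where
            neither-factor : (3 ℕD.∣ d) ⊎ (3 ℕD.∣ p) → ⊥
            neither-factor (inj₁ z) = y z
            neither-factor (inj₂ z) = 3∤p z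

    private
      odd-p* : ∀ d → odd (d ℕ.* p) ≡ odd d
      odd-p* d = P.trans (odd-* d p) (P.trans (P.cong (odd d ∧_) odd-p) (BoolP.∧-identityʳ (odd d)))
        where import Data.Bool.Properties as BoolP

      ϱF-value : ∀ i → i < n → ϱF i ≈ ϱ (j# i) (a# i)
      ϱF-value i l = trans (F-sum p 𝕎t i) (trans (sum-fibre non3 (λ _ → S.0#) (a# i) (j# i) P.refl non3-p* (a#< i) (j#< i l)) (Hom.fun-cong (fibre (j# i) (a# i)) (λ k → P.sym (rS-lam k))))

      𝕏-value : ∀ i → i < n → sum p (λ t → 𝕏t t i) ≈ Hom.fun (fibre (j# i) (a# i)) A₁
      𝕏-value i l = (sum-fibre odd RS.hyp (a# i) (j# i) P.refl odd-p* (a#< i) (j#< i l))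

      -- The sum of the 𝕏-values and ϱ are images of `A₁` and r under the same ring homomorphism,
      -- which transports A = F(r).
      quartic : ∀ i → i < n → sum p (λ t → 𝕏t t i) ≈ ϱF i * (1# + ϱF i) * sq (1# + ϱF i)
      quartic i l = trans (𝕏-value i l) (trans (hm.fun-cong OddForms.A₁-law) (trans (hm.fun-* (rS 𝔹S.* (𝔹S.1# 𝔹S.+ rS)) (𝔹S.sq (𝔹S.1# 𝔹S.+ rS)))
            (*-cong (trans (hm.fun-* rS (𝔹S.1# 𝔹S.+ rS)) (*-cong (sym (ϱF-value i l)) one+)) (trans (hm.fun-* (𝔹S.1# 𝔹S.+ rS) (𝔹S.1# 𝔹S.+ rS)) (*-cong one+ one+)))))
        where
          module hm = Hom (fibre (j# i) (a# i))
          one+ : hm.fun (𝔹S.1# 𝔹S.+ rS) ≈ 1# + ϱF i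
          one+ = trans (hm.fun-+ 𝔹S.1# rS) (+-cong hm.fun-1 (sym (ϱF-value i l)))

    -- The point with mult 0 = 1 gives 𝕎 itself.
    bounded-sums : Σ Carrier λ b → R b × Reg b × (∀ k → R (b * sum p (λ j → sum p (λ a → 𝕎 (index a j) (exponent j) * ϱ j a ^ k))))
    bounded-sums = go (Conjugates.quartic-traces 𝕏t 𝕏t-definable 𝕏t-root p ϱF (𝕎t 0) (definable-sum p (λ t _ → 𝕎t-definable t)) (𝕎t-definable 0) quartic)
      where
        w : ℕ → ℕ → Carrier
        w j a = 𝕎 (index a j) (exponent j)
        go : Σ Carrier (λ b → R b × Reg b × (∀ k → R (b * sum n (λ i → 𝕎t 0 i * ϱF i ^ k)))) → _
        go (b , b∈ , b-reg , h) = b , b∈ , b-reg , λ k → R.resp (*-congˡ b (regroup k)) (h k)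
          where
            regroup : ∀ k → sum n (λ i → 𝕎t 0 i * ϱF i ^ k) ≈ sum p (λ j → sum p (λ a → w j a * ϱ j a ^ k))
            regroup k = begin
              sum n (λ i → 𝕎t 0 i * ϱF i ^ k) ≈⟨ sum-cong< n (λ i l → *-cong (reflexive (P.cong₂ 𝕎 (ℤP.*-identityˡ (ι i)) (ℤP.*-identityˡ (ε i)))) (^-cong k (ϱF-value i l))) ⟩
              sum n g ≈⟨ reflexive (P.cong (λ N → sum N g) p²≡) ⟩
              sum (p ℕ.* p) g ≈⟨ sum-block p p g ⟩
              sum p (λ j → sum p (λ a → g (a ℕ.+ j ℕ.* p))) ≈⟨ sum-cong p (λ j → sum-cong< p (λ a a<p → reflexive (P.cong₂ (λ x y → w y x * ϱ y x ^ k) (residue j a a<p) (quotient# j a a<p)))) ⟩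
              sum p (λ j → sum p (λ a → w j a * ϱ j a ^ k)) ∎
              where
                g : ℕ → Carrier
                g i = w (j# i) (a# i) * ϱ (j# i) (a# i) ^ k
                residue : ∀ j a → a < p → a# (a ℕ.+ j ℕ.* p) ≡ a
                residue j a a<p = P.trans (ℕDM.[m+kn]%n≡m%n a j p) (ℕDM.m<n⇒m%n≡m a<p)
                quotient# : ∀ j a → a < p → j# (a ℕ.+ j ℕ.* p) ≡ j
                quotient# j a a<p = P.trans (ℕDM.+-distrib-/-∣ʳ a (ℕD.divides j P.refl)) (P.cong₂ ℕ._+_ (ℕDM.m<n⇒m/n≡0 a<p) (ℕDM.m*n/n≡m j p))

-- Hecke operators: the recursion for traces, and integrality.

module HeckeOperators where
  open import Defs
  open import Data.Integer.Divisibility.Signed as ℤD using (_∣_; _∣?_; divides; ∣n⇒∣m*n)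
  open CharacteristicTwo
  open FormalSeries
  open Homomorphisms
  open LambertSeries using (odd; non3)
  open EisensteinSeries using (module ℤSolve)
  open DivisorSums
  open RootsOfUnity
  open NewtonSums using (IsSubring)
  open TorsionPoints
  open ModularSums

  hecke : ℕ → Series → Series
  hecke p f = OddForms.U p f 𝔹S.+ 𝔹S.inflate p f

  module Integrality (p h : ℕ) (p≡ : p ≡ suc (h ℕ.+ h)) (pr : Prime p) (3∤p : ¬ (3 ℕD.∣ p)) (rs : RootSystem (3 ℕ.* p))
                     (rungs : ∀ m → 0 < m → Points.Rung p h p≡ pr 3∤p rs m) where
    open Modular p h p≡ pr 3∤p rs rungs
    open ℤSolve using () renaming (_:=_ to _≛_; solve to ℤsolve; _:+_ to _⊞_; _:-_ to _⊟_; _:*_ to _⊠_; :-_ to ⊟_; con to ℤcon)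
    private
      LL = + (p ℕ.+ p ℕ.+ (p ℕ.+ p))
      q = h ℕ.+ h
      module E = Hom embed
      module R = IsSubring R-subring

      d0 : ∀ {m} → m ∣ + 0
      d0 = divides (+ 0) P.refl

      dvd : ∀ {m a b} → a ≡ b → m ∣ a → m ∣ b
      dvd P.refl d = d

      front : ∀ g → sum p g ≈ g 0 + sum q (g ∘ suc)
      front g = trans (reflexive (P.cong (λ n → sum n g) p≡)) (sum-front q g)

      w : ℕ → ℕ → Carrier
      w j a = 𝕎 (index a j) (exponent j)

      r V : Carrier
      r = E rS
      V = E (𝔹S.inflate p rS)

      s : ℕ → Carrier
      s a = Hom.fun (σ (+ a)) rS

      exponent-0 : exponent 0 ≡ P₄
      exponent-0 = ℤP.+-identityʳ (+ p)

      w-00 : w 0 0 ≈ r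
      w-00 = trans (reflexive (P.cong (𝕎 (+ 0)) exponent-0)) r̂-embed

      -- The row j = 0 is the coset of P₄ under all p-th roots of unity, P₄ included; `row-rest`
      -- takes P₄ away again.
      row : sum p (w 0) ≈ V
      row = trans (sum-cong p (λ a → reflexive (P.cong₂ 𝕎 (ℤsolve 1 (λ a → ℤcon (+ 3) ⊠ (a ⊠ ℤcon (+ 1)) ≛ ℤcon (+ 3) ⊠ (ℤcon (+ 0) ⊞ ℤcon (+ 1) ⊠ a)) P.refl (+ a)) exponent-0)))
        (trans (sum-subgroup non3 (λ _ → S.0#) (+ 0) (+ 1) P.refl non3-p* p∤1) (Hom.fun-cong (embed ⊙ inflate-p) (λ k → P.sym (rS-lam k))))

      row-rest : sum q (w 0 ∘ suc) ≈ V + r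
      row-rest = trans (solve 2 (λ x y → y := (x :+ y) :+ x) refl (w 0 0) (sum q (w 0 ∘ suc))) (+-cong (trans (sym (front (w 0))) row) w-00)

      -- The powers of exponent p + 4j of one twisted y form a whole coset, with sum `s a`. Its
      -- member j = 0 is not `index a 0` but P₄ itself, the twist being trivial after the p-th
      -- power; removing it costs r.
      column-rest : ∀ a → sum q (λ j → w (suc j) a) ≈ s a + r
      column-rest a = trans (sum-cong q (λ j → reflexive (P.cong (λ i → 𝕎 i (exponent (suc j))) (P.sym (ℤP.*-assoc (+ 3) (+ a) (exponent (suc j)))))))
          (trans (solve 2 (λ x y → y := (x :+ y) :+ x) refl (g 0) (sum q (g ∘ suc))) (+-cong (trans (sym (front g)) column) g-0))
        where
          g : ℕ → Carrier
          g j = 𝕎 (+ 3 ℤ.* + a ℤ.* exponent j) (exponent j)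
          column : sum p g ≈ s a
          column = trans (sum-diagonal non3 (λ _ → S.0#) (+ a) (+ p) (+ 4) P.refl (dvd (P.sym (ℤP.+-inverseʳ (+ p))) d0) ℤD.∣-refl (λ d → p∤1 (p-quarter (+ 1) d)))
            (Hom.fun-cong (σ (+ a)) (λ k → P.sym (rS-lam k)))
          g-0 : g 0 ≈ r
          g-0 = trans (𝕎-cong {+ 3 ℤ.* + a ℤ.* exponent 0} {+ 0} {exponent 0} {P₄} (dvd (P.sym (P.trans (ℤP.+-identityʳ _) (ℤP.*-assoc (+ 3) (+ a) (exponent 0)))) (triple _ (∣n⇒∣m*n (+ a) (dvd (P.sym exponent-0) ℤD.∣-refl))))
            (dvd (P.sym (P.trans (P.cong (ℤ._- P₄) exponent-0) (ℤP.+-inverseʳ P₄))) d0)) r̂-embed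

      Tr : ℕ → Carrier
      Tr k = V ^ k + sum p (λ a → s a ^ k)

      -- P₄ contributes r · r^k, and each subgroup contributes (ϱ + r) ϱ^k with its constant value
      -- ϱ.
      total : ∀ k → sum p (λ j → sum p (λ a → w j a * ϱ j a ^ k)) ≈ r ^ suc k + (Tr (suc k) + r * Tr k)
      total k = begin
        sum p (λ j → sum p (λ a → w j a * ϱ j a ^ k)) ≈⟨ front _ ⟩
        sum p (λ a → w 0 a * ϱ 0 a ^ k) + sum q (λ j → sum p (λ a → w (suc j) a * s a ^ k))
          ≈⟨ +-cong (trans (front _) (+-cong (*-congʳ _ w-00) (trans (sym (sum-*ʳ q (V ^ k) (w 0 ∘ suc))) (*-congʳ _ row-rest))))
               (trans (sum-swap q p _) (sum-cong p (λ a → trans (sym (sum-*ʳ q _ _)) (*-congʳ _ (column-rest a))))) ⟩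
        (r * r ^ k + (V + r) * V ^ k) + sum p (λ a → (s a + r) * s a ^ k)
          ≈⟨ +-congˡ _ (trans (sum-cong p (λ a → distribʳ _ _ _)) (trans (sum-+ p _ _) (+-congˡ _ (sym (sum-*ˡ p r _))))) ⟩
        (r * r ^ k + (V + r) * V ^ k) + (sum p (λ a → s a ^ suc k) + r * sum p (λ a → s a ^ k))
          ≈⟨ solve 6 (λ r x v y a b → (r :* x :+ (v :+ r) :* y) :+ (a :+ r :* b) := r :* x :+ ((v :* y :+ a) :+ r :* (y :+ b))) refl r (r ^ k) V (V ^ k) (sum p (λ a → s a ^ suc k)) (sum p (λ a → s a ^ k)) ⟩
        r ^ suc k + (Tr (suc k) + r * Tr k) ∎

      r∈ : R r
      r∈ = R.resp r̂-embed r̂∈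

      -- `total` determines `Tr (suc k)` from `Tr k`, so the same b works for all k. The recursion
      -- starts from Tr 0 = p + 1 = 0, as p is odd.
      bounded : ∀ b → R b → (∀ k → R (b * sum p (λ j → sum p (λ a → w j a * ϱ j a ^ k)))) → ∀ k → R (b * Tr k)
      bounded b b∈ hyp zero = R.resp (sym (trans (*-congˡ b (trans (+-congˡ 1# (trans (constant-sum p 1#) (trans (*-congʳ 1# (reflexive (P.cong bit odd-p))) (*-idˡ 1#)))) (double 1#))) (zeroʳ b))) R.nil
      bounded b b∈ hyp (suc k) = R.resp (trans (+-congʳ _ (+-congʳ _ (*-congˡ b (total k))))
          (solve 5 (λ b x t r u → (b :* (x :+ (t :+ r :* u)) :+ b :* x) :+ r :* (b :* u) := b :* t) refl b (r ^ suc k) (Tr (suc k)) r (Tr k)))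
        (R.add (R.add (hyp k) (R.mul b∈ (R.pow (suc k) r∈))) (R.mul r∈ (bounded b b∈ hyp k)))

      σ-sum : ∀ f → sum p (λ a → Hom.fun (σ (+ a)) f) ≈ E (OddForms.U p f)
      σ-sum f n = S.trans (sum-at p _ n) (S.trans (S.sum-cong p (λ a → S.*-congˡ _ (S.^-cong n (S.reflexive (P.cong (λ x → root (+ 3 ℤ.* x)) (ℤsolve 1 (λ a → a ≛ ℤcon (+ 0) ⊞ ℤcon (+ 1) ⊠ a) P.refl (+ a)))))))
        (S.trans (S.sym (S.sum-*ˡ p _ _)) (S.trans (S.*-congˡ _ (orthogonality (+ 0) (+ 1) n p∤1)) (go (p ℕD.∣? n)))))
        where
          go : (D : Dec (p ℕD.∣ n)) → S.bit (f n) S.* S.bit (does D) S.≈ E (OddForms.U p f) n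
          go (yes (ℕD.divides d P.refl)) = S.trans (S.*-idʳ _) (S.trans (S.reflexive (P.cong (S.bit ∘ f) (ℕP.*-comm d p))) (S.sym (inflate-∣ p _ d)))
          go (no nd) = S.trans (S.zeroʳ _) (S.sym (inflate-∤ p _ n nd))

      -- Substitutions are ring homomorphisms, so powers may be taken before substituting. By
      -- orthogonality the p twists add up to the U-part, and V accounts for the part in x^p.
      Tr-hecke : ∀ k → Tr k ≈ E (hecke p (rS 𝔹S.^ k))
      Tr-hecke k = trans (+-cong (sym (Hom.fun-^ (embed ⊙ inflate-p) rS k)) (trans (sum-cong p (λ a → sym (Hom.fun-^ (σ (+ a)) rS k))) (σ-sum (rS 𝔹S.^ k))))
        (trans (+-comm _ _) (sym (E.fun-+ (OddForms.U p (rS 𝔹S.^ k)) (𝔹S.inflate p (rS 𝔹S.^ k)))))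

    powers-integral : Σ Poly λ B → ¬ (OddForms.ev B 𝔹S.≈ 𝔹S.0#) × (∀ k → OddForms.InR (OddForms.ev B 𝔹S.* hecke p (rS 𝔹S.^ k)))
    powers-integral = go bounded-sums
      where
        go : Σ Carrier (λ b → R b × Reg b × (∀ k → R (b * sum p (λ j → sum p (λ a → w j a * ϱ j a ^ k))))) → _
        go (b , (B , b≡) , reg , hyp) = B , (λ z → RS.nontrivial (reg 1# (trans (*-congʳ 1# (trans b≡ (trans (E.fun-cong z) E.fun-0))) (zeroˡ 1#)) 0)) , λ k → pull k (bounded b (B , b≡) hyp k)
          where
            pull : ∀ k → R (b * Tr k) → OddForms.InR (OddForms.ev B 𝔹S.* hecke p (rS 𝔹S.^ k))
            pull k (g , e) = g , E-injective (trans (sym e) (trans (*-cong b≡ (Tr-hecke k)) (sym (E.fun-* (OddForms.ev B) (hecke p (rS 𝔹S.^ k))))))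

  module _ (p : ℕ) .{{_ : NonZero p}} where
    open 𝔹S

    Tₚ-hecke : ∀ a n → Tₚ p a n ≡ hecke p a n
    Tₚ-hecke a n = P.cong (a (p ℕ.* n) xor_) (P.trans (xsum≡sum (suc n) f) (go (p ℕD.∣? n)))
      where
        f : ℕ → Bool
        f m = (p ℕ.* m ≡ᵇ n) ∧ a m
        go : Dec (p ℕD.∣ n) → 𝔹.sum (suc n) f ≡ inflate p a n
        go (no nd) = P.trans (𝔹.sum-0 (suc n) (λ m _ → P.cong (_∧ a m) (≡ᵇ-false (λ e → nd (ℕD.divides m (P.trans (P.sym e) (ℕP.*-comm p m))))))) (P.sym (inflate-∤ p a n nd))
        go (yes (ℕD.divides d P.refl)) = P.trans (𝔹.only (suc (d ℕ.* p)) d (s≤s (ℕP.m≤m*n d p)) (λ m _ ne → P.cong (_∧ a m) (≡ᵇ-false (λ e → ne (ℕP.*-cancelʳ-≡ m d p (P.trans (ℕP.*-comm m p) e))))))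
          (P.trans (P.cong (_∧ a d) (≡ᵇ-true (ℕP.*-comm p d))) (P.sym (inflate-∣ p a d)))

    hecke-cong : ∀ {a b} → a ≈ b → hecke p a ≈ hecke p b
    hecke-cong {a} {b} e = +-cong {OddForms.U p a} {OddForms.U p b} (λ n → e (p ℕ.* n)) (inflate-cong p e)

    hecke-+ : ∀ a b → hecke p (a + b) ≈ hecke p a + hecke p b
    hecke-+ a b = trans (+-cong {OddForms.U p (a + b)} {OddForms.U p a + OddForms.U p b} (OddForms.U-+ p a b) (inflate-+ p a b))
      (solve 4 (λ a b c d → (a :+ b) :+ (c :+ d) := (a :+ c) :+ (b :+ d)) refl (OddForms.U p a) (OddForms.U p b) (inflate p a) (inflate p b))

    hecke-0 : hecke p 0# ≈ 0#
    hecke-0 = trans (hecke-cong {0#} {0# + 0#} (sym (+-idˡ 0#))) (trans (hecke-+ 0# 0#) (double (hecke p 0#)))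

    hecke-sq : odd p ≡ true → ∀ a → hecke p (sq a) ≈ sq (hecke p a)
    hecke-sq o a = trans (+-cong {OddForms.U p (sq a)} {sq (OddForms.U p a)} (OddForms.U-sq p a o) (inflate-* p a a)) (sym (sq-+ (OddForms.U p a) (inflate p a)))

    U-inflate-comm : ∀ m → (∀ n → p ℕD.∣ m ℕ.* n → p ℕD.∣ n) → ∀ a → OddForms.U m (inflate p a) ≈ inflate p (OddForms.U m a)
    U-inflate-comm m coprime a n = go (p ℕD.∣? n)
      where
        go : Dec (p ℕD.∣ n) → inflate p a (m ℕ.* n) ≡ inflate p (OddForms.U m a) n
        go (no nd) = P.trans (inflate-∤ p a _ (λ d → nd (coprime n d))) (P.sym (inflate-∤ p (OddForms.U m a) n nd))
        go (yes (ℕD.divides d P.refl)) = P.trans (P.cong (inflate p a) (P.sym (ℕP.*-assoc m d p))) (P.trans (inflate-∣ p a (m ℕ.* d)) (P.sym (inflate-∣ p (OddForms.U m a) d)))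

    U-hecke : ∀ m → (∀ n → p ℕD.∣ m ℕ.* n → p ℕD.∣ n) → ∀ a → OddForms.U m (hecke p a) ≈ hecke p (OddForms.U m a)
    U-hecke m coprime a = +-cong {OddForms.U m (OddForms.U p a)} {OddForms.U p (OddForms.U m a)}
      (λ n → P.cong a (P.trans (P.sym (ℕP.*-assoc p m n)) (P.trans (P.cong (ℕ._* n) (ℕP.*-comm p m)) (ℕP.*-assoc m p n)))) (U-inflate-comm m coprime a)

    -- The operator commutes with squaring for odd p, so the Frobenius iterates of its value at f
    -- are its values at f^{2^j}. All of these become polynomials in r after multiplication by the
    -- one b, as `bounded-denominator` requires.
    integral : odd p ≡ true → (Σ Poly λ B → ¬ (OddForms.ev B ≈ 0#) × (∀ k → OddForms.InR (OddForms.ev B * hecke p (rS ^ k)))) → ∀ f → OddForms.InR (hecke p (OddForms.ev f))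
    integral o (B , nz , hyp) f = OddForms.bounded-denominator (length B) B (hecke p (OddForms.ev f)) ℕP.≤-refl nz (λ j → transport (iterate j) (linear (frob j) 0))
      where
        b = OddForms.ev B
        module Hr = Horner (PowerSeries.series boolAlg)
        transport : ∀ {x y} → x ≈ y → OddForms.InR (b * x) → OddForms.InR (b * y)
        transport {x} {y} e (g , q) = g , trans q (*-congˡ {x} {y} b e)
        plus : ∀ {x y} → OddForms.InR x → OddForms.InR y → OddForms.InR (x + y)
        plus {x} {y} (f , e) (g , q) = f +ₚ g , trans (Hr.horner-+ f g rS) (+-cong {OddForms.ev f} {x} e q)
        -- Linearity in the coefficients; the shifted exponent k makes the induction on f go through.
        linear : ∀ f k → OddForms.InR (b * hecke p (rS ^ k * OddForms.ev f))
        linear [] k = [] , sym (trans (*-congˡ {hecke p (rS ^ k * 0#)} {0#} b (trans (hecke-cong {rS ^ k * 0#} {0#} (zeroʳ (rS ^ k))) hecke-0)) (zeroʳ b))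
        linear (c ∷ f) k = split (lead c) (linear f (suc k))
          where
            lead : ∀ c → OddForms.InR (b * hecke p (rS ^ k * bit c))
            lead true = transport {hecke p (rS ^ k)} {hecke p (rS ^ k * 1#)} (hecke-cong {rS ^ k} {rS ^ k * 1#} (sym (*-idʳ (rS ^ k)))) (hyp k)
            lead false = linear [] k
            x y : Series
            x = rS ^ k * bit c
            y = rS ^ suc k * OddForms.ev f
            shape : rS ^ k * (bit c + rS * OddForms.ev f) ≈ x + y
            shape = solve 4 (λ a c r e → a :* (c :+ r :* e) := a :* c :+ (r :* a) :* e) refl (rS ^ k) (bit c) rS (OddForms.ev f)
            split : OddForms.InR (b * hecke p x) → OddForms.InR (b * hecke p y) → OddForms.InR (b * hecke p (rS ^ k * OddForms.ev (c ∷ f)))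
            split h₁ h₂ = joined (plus {b * hecke p x} {b * hecke p y} h₁ h₂)
              where
                joined : OddForms.InR (b * hecke p x + b * hecke p y) → OddForms.InR (b * hecke p (rS ^ k * OddForms.ev (c ∷ f)))
                joined (g , e) = g , trans e (trans (sym (distribˡ b (hecke p x) (hecke p y))) (*-congˡ {hecke p x + hecke p y} {hecke p (rS ^ k * OddForms.ev (c ∷ f))} b
                  (sym (trans (hecke-cong {rS ^ k * (bit c + rS * OddForms.ev f)} {x + y} shape) (hecke-+ x y)))))
        frob : ℕ → Poly
        frob zero = f
        frob (suc j) = frob j *ₚ frob j
        iterate : ∀ j → hecke p (rS ^ 0 * OddForms.ev (frob j)) ≈ OddForms.iterate-sq j (hecke p (OddForms.ev f))
        iterate zero = hecke-cong {1# * OddForms.ev f} {OddForms.ev f} (*-idˡ (OddForms.ev f))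
        iterate (suc j) = trans (hecke-cong {1# * OddForms.ev (frob (suc j))} {sq (1# * OddForms.ev (frob j))}
            (trans (*-idˡ (OddForms.ev (frob (suc j)))) (trans (Hr.horner-* (frob j) (frob j) rS) (sq-cong {OddForms.ev (frob j)} {1# * OddForms.ev (frob j)} (sym (*-idˡ (OddForms.ev (frob j))))))))
          (trans (hecke-sq o (1# * OddForms.ev (frob j))) (sq-cong {hecke p (1# * OddForms.ev (frob j))} {OddForms.iterate-sq j (hecke p (OddForms.ev f))} (iterate j)))

  hecke-preserves : ∀ p → Prime p → 3 < p → ∀ f → OddForms.InR (hecke p (OddForms.ev f))
  hecke-preserves p pr 3<p f = go (parity-ℕ p)
    where
      parity-ℕ : ∀ n → Σ ℕ λ h → (n ≡ h ℕ.+ h) ⊎ (n ≡ suc (h ℕ.+ h))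
      parity-ℕ zero = 0 , inj₁ P.refl
      parity-ℕ (suc n) = next (parity-ℕ n)
        where
          next : (Σ ℕ λ h → (n ≡ h ℕ.+ h) ⊎ (n ≡ suc (h ℕ.+ h))) → Σ ℕ λ h → (suc n ≡ h ℕ.+ h) ⊎ (suc n ≡ suc (h ℕ.+ h))
          next (h , inj₁ e) = h , inj₂ (P.cong suc e)
          next (h , inj₂ e) = suc h , inj₁ (P.trans (P.cong suc e) (P.cong suc (P.sym (ℕP.+-suc h h))))
      not-divisor : ∀ d → 1 < d → d < p → ¬ (d ℕD.∣ p)
      not-divisor d 1<d d<p x = which (prime⇒irreducible pr x)
        where
          which : (d ≡ 1) ⊎ (d ≡ p) → ⊥
          which (inj₁ P.refl) = ℕP.<-irrefl P.refl 1<d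
          which (inj₂ P.refl) = ℕP.<-irrefl P.refl d<p
      go : Σ ℕ (λ h → (p ≡ h ℕ.+ h) ⊎ (p ≡ suc (h ℕ.+ h))) → OddForms.InR (hecke p (OddForms.ev f))
      go (h , inj₁ e) = ⊥-elim (not-divisor 2 (s≤s (s≤s z≤n)) (ℕP.<-trans (s≤s (s≤s (s≤s z≤n))) 3<p)
        (ℕD.divides h (P.trans e (P.trans (P.cong (h ℕ.+_) (P.sym (ℕP.+-identityʳ h))) (ℕP.*-comm 2 h)))))
      go (h , inj₂ e) = with-roots (rootSystem p h e pr 3∤p)
        where
          3∤p = not-divisor 3 (s≤s (s≤s z≤n)) 3<p
          with-roots : RootSystem (3 ℕ.* p) → OddForms.InR (hecke p (OddForms.ev f))
          with-roots rs = integral p {{ℕ.>-nonZero (ℕP.<-trans (s≤s z≤n) 3<p)}} (Points.odd-p p h e pr 3∤p rs) (Integrality.powers-integral p h e pr 3∤p rs (Points.rung p h e pr 3∤p rs)) f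

  coprime-multiple : ∀ {p} → Prime p → ∀ m → 0 < m → m < p → ∀ n → p ℕD.∣ m ℕ.* n → p ℕD.∣ n
  coprime-multiple {p} pr (suc m) _ l n d = go (euclidsLemma (suc m) n pr d)
    where
      go : (p ℕD.∣ suc m) ⊎ (p ℕD.∣ n) → p ℕD.∣ n
      go (inj₁ x) = ⊥-elim (ℕP.<⇒≱ l (ℕD.∣⇒≤ x))
      go (inj₂ x) = x

-- The characterisation of K and its stability under the Hecke operators.

open import Defs
open DivisorSums using (module 𝔹S)
open HeckeOperators

theorem4p6 : ((f : Poly) →
                (InK f → ((∀ n → U₂ (evalS f) n ≡ false) × (∀ n → U₃ (evalS f) n ≡ evalS f n)))
                × (((∀ n → U₂ (evalS f) n ≡ false) × (∀ n → U₃ (evalS f) n ≡ evalS f n)) → InK f))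
             × ((p : ℕ) → Prime p → 3 < p → (f : Poly) → InK f →
                Σ Poly λ g → InK g × (∀ n → evalS g n ≡ Tₚ p (evalS f) n))
theorem4p6 = (λ f → OddForms.K⇒ f , λ { (u₂ , u₃) → OddForms.K⇐ f u₂ u₃ }) , stable
  where
    stable : (p : ℕ) → Prime p → 3 < p → (f : Poly) → InK f → Σ Poly λ g → InK g × (∀ n → evalS g n ≡ Tₚ p (evalS f) n)
    stable p pr 3<p f k = go (hecke-preserves p pr 3<p f) (OddForms.K⇒ f k)
      where
        instance
          nz : NonZero p
          nz = ℕ.>-nonZero (ℕP.<-trans (s≤s z≤n) 3<p)
        go : OddForms.InR (hecke p (OddForms.ev f)) → (∀ n → U₂ (evalS f) n ≡ false) × (∀ n → U₃ (evalS f) n ≡ evalS f n) → Σ Poly λ g → InK g × (∀ n → evalS g n ≡ Tₚ p (evalS f) n)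
        go (g , e) (u₂ , u₃) = g , OddForms.K⇐ g
            (λ n → P.trans (value (2 ℕ.* n)) (P.trans (U-hecke p 2 (coprime-multiple pr 2 (s≤s z≤n) (ℕP.<-trans (s≤s (s≤s (s≤s z≤n))) 3<p)) (evalS f) n)
              (P.trans (hecke-cong p {OddForms.U 2 (evalS f)} {𝔹S.0#} u₂ n) (hecke-0 p n))))
            (λ n → P.trans (value (3 ℕ.* n)) (P.trans (U-hecke p 3 (coprime-multiple pr 3 (s≤s z≤n) 3<p) (evalS f) n)
              (P.trans (hecke-cong p {OddForms.U 3 (evalS f)} {evalS f} u₃ n) (P.sym (value n))))) ,
            λ n → P.trans (value n) (P.sym (Tₚ-hecke p (evalS f) n))
          where
            value : ∀ n → evalS g n ≡ hecke p (evalS f) n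
            value n = P.trans (OddForms.evalS-horner g n) (P.trans (e n) (hecke-cong p {OddForms.ev f} {evalS f} (𝔹S.sym {evalS f} {OddForms.ev f} (OddForms.evalS-horner f)) n))
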